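{- Let $\mathcal X$ be a circulant sesquiclosed scheme on a finite cyclic group $G$. Assume that $\mathcal X$ is the $\mathfrak S$-wreath product of $\mathcal X_0=\mathcal X_{G/L}$ and $\mathcal X_1=\mathcal X_U$ for some section $\mathfrak S=U/L\in\mathfrak S_0(\mathcal X)$, and that (1) the section $\mathfrak S$ is subnormal in both $\mathcal X_0$ and $\mathcal X_1$, i.e., there is an $\mathcal X$-group $U'\ge U$ such that $\mathcal X_{U'/L}$ is normal and there is an $\mathcal X$-group $L'\le L$ such that $\mathcal X_{U/L'}$ is normal; (2) the schemes $\mathcal X_0$ and $\mathcal X_1$ are schurian and sesquiseparable. Then $\mathcal X$ is schurian and sesquiseparable.
   Context: A coherent configuration $\mathcal X=(\Omega,S)$ ($\Omega$ finite) is a partition $S$ of $\Omega^2$ with $1_\Omega$ a union of elements of $S$, closed under transposition $s\mapsto s^*$, with intersection numbers $c_{rs}^t=|\beta r\cap\gamma s^*|$ ($\beta r=\{\gamma:(\beta,\gamma)\in r\}$) independent of $(\beta,\gamma)\in t$; a scheme if $1_\Omega\in S$. Relations: unions of elements of $S$; fibers: $\Delta$ with $1_\Delta\in S$, $F(\mathcal X)$ their set; parabolics: relations that are equivalence relations. $\mathrm{Aut}(\mathcal X)$: permutations fixing each $s\in S$; schurian: $S$ is the set of $\mathrm{Aut}(\mathcal X)$-orbits on $\Omega^2$. An algebraic isomorphism $\varphi:\mathcal X\to\mathcal X'$ is a bijection $S\to S'$ preserving intersection numbers (extended by unions); $\mathrm{Iso}(\mathcal X,\mathcal X',\varphi)$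 is the set of bijections $f$ with $s^f=\varphi(s)$ for all $s$. The one-point extension $\mathcal X_\beta$ is the smallest coherent configuration whose relations include those of $\mathcal X$ with $\{(\beta,\beta)\}$ basic. A $(\beta,\beta')$-extension of $\varphi$ is an algebraic isomorphism $\mathcal X_\beta\to\mathcal X'_{\beta'}$ agreeing with $\varphi$ on $S$ and mapping $1_{\{\beta\}}$ to $1_{\{\beta'\}}$; $\varphi$ is sesquiclosed if such extensions exist whenever $\beta,\beta'$ lie in fibers $\Delta,\Delta'$ with $\varphi(1_\Delta)=1_{\Delta'}$. $\mathcal X$ is sesquiseparable if $\mathrm{Iso}(\mathcal X,\mathcal X',\varphi)\neq\emptyset$ for every sesquiclosed $\varphi$ from $\mathcal X$; $\mathcal X$ is sesquiclosed if for all $\beta$: $F(\mathcal X_\beta)=\{\beta s:s\in S,\beta s\ne\emptyset\}$ and the identity algebraic automorphism is sesquiclosed. For an equivalence relation $e$ and $s\subseteq\Omega^2$, $s_{\Omega/e}=\{(\Gamma,\Gamma'):s\cap(\Gamma\times\Gamma')\ne\emptyset\}$; $\mathrm{rad}(s)$ is the largest equivalence relation $e$ with $s=\bigcup_{(\Gamma,\Gamma')\in s_{\Omega/e}}\Gamma\times\Gamma'$. Circulant: a coherent configuration on a finite cyclic group $G$ such that all translations $x\mapsto xg$ are automorphisms; normal: the translation group is normal in $\mathrm{Aut}(\mathcal X)$. For $H\le G$, $e(H)$ has the cosets of $H$ as classes; $H$ is an $\mathcal X$-group if $e(H)$ is a parabolic. For $\mathcal X$-groups $L\le U$, $\mathcal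 X_{U/L}$ is the circulant scheme on the group $U/L$ with basis relations the nonempty $(s\cap U^2)_{U/e(L)}$; $\mathcal X_U=\mathcal X_{U/1}$, $\mathcal X_{G/L}$ as special cases; $\mathfrak S_0(\mathcal X)$ is the set of such $U/L$. $\mathcal X$ is the $U/L$-wreath product of $\mathcal X_{G/L}$ and $\mathcal X_U$ if for every $s\in S$ with $s\cap e(U)=\emptyset$ one has $e(L)\subseteq\mathrm{rad}(s)$. -}

module Defs where

open import Data.Nat using (ℕ; zero; suc; _+_; _*_; _∸_; _≤?_)
open import Data.Nat.DivMod using (_mod_)
open import Data.Nat.Divisibility using (_∣_; _∣?_)
open import Data.Fin using (Fin; toℕ) renaming (zero to fz; suc to fs)
open import Data.Bool using (Bool; true; false; _∧_; _∨_; if_then_else_)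
import Data.Bool.Properties as BoolP
open import Data.Vec using (Vec; tabulate)
open import Data.Vec.Properties using (≡-dec)
open import Data.Product using (Σ; ∃; ∃₂; _×_; _,_)
open import Function.Bundles using (_↔_; _⇔_; Inverse)
open import Relation.Binary using (IsEquivalence)
open import Relation.Binary.Definitions using (DecidableEquality)
open import Relation.Binary.PropositionalEquality using (_≡_)
open import Relation.Nullary using (¬_)
open import Relation.Nullary.Decidable using (⌊_⌋)

count : ∀ {n} → (Fin n → Bool) → ℕ
count {zero}  p = 0
count {suc n} p = (if p fz then 1 else 0) + count (λ x → p (fs x))

anyFin : ∀ {n} → (Fin n → Bool) → Bool
anyFin {zero}  p = false
anyFin {suc n} p = p fz ∨ anyFin (λ x → p (fs x))

-- A "configuration" on the point set Ω = Fin n: a partition S of Ω²,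
-- given as a colouring of Ω² by colours with decidable equality.
-- The basic relations are the nonempty colour classes.

record Config (n : ℕ) : Set₁ where
  constructor config
  field
    Col  : Set
    _≟ᶜ_ : DecidableEquality Col
    col  : Fin n → Fin n → Col

open Config public

inum : ∀ {n} (X : Config n) → Col X → Col X → Fin n → Fin n → ℕ
inum X r s β γ =
  count (λ δ → ⌊ _≟ᶜ_ X (col X β δ) r ⌋ ∧ ⌊ _≟ᶜ_ X (col X δ γ) s ⌋)

record IsCC {n} (X : Config n) : Set where
  field
    diagonal  : ∀ a b x → col X x x ≡ col X a b → a ≡ b
    transpose : ∀ a b a' b' → col X a b ≡ col X a' b' → col X b a ≡ col X b' a'
    intersect : ∀ a b a' b' → col X a b ≡ col X a' b' →
                ∀ r s → inum X r s a b ≡ inum X r s a' b'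

IsScheme : ∀ {n} → Config n → Set
IsScheme X = IsCC X × (∀ a b → col X a a ≡ col X b b)

Refines : ∀ {n} → Config n → Config n → Set
Refines Y X = ∀ a b a' b' → col Y a b ≡ col Y a' b' → col X a b ≡ col X a' b'

PointBasic : ∀ {n} → Config n → Fin n → Set
PointBasic Y β = ∀ a b → col Y a b ≡ col Y β β → (a ≡ β) × (b ≡ β)

record IsOnePointExt {n} (X : Config n) (β : Fin n) (Y : Config n) : Set₁ where
  field
    cc       : IsCC Y
    refines  : Refines Y X
    basic    : PointBasic Y β
    smallest : ∀ (Z : Config n) → IsCC Z → Refines Z X → PointBasic Z β → Refines Z Y

record IsAlgIso {n n'} (X : Config n) (X' : Config n') (φ : Col X → Col X') : Set where
  field
    into   : ∀ a b → ∃₂ λ a' b' → col X' a' b' ≡ φ (col X a b)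
    onto   : ∀ a' b' → ∃₂ λ a b → φ (col X a b) ≡ col X' a' b'
    inj    : ∀ a b a' b' → φ (col X a b) ≡ φ (col X a' b') → col X a b ≡ col X a' b'
    preserve : ∀ a b a' b' → col X' a' b' ≡ φ (col X a b) →
               ∀ p q r s → inum X (col X p q) (col X r s) a b
                         ≡ inum X' (φ (col X p q)) (φ (col X r s)) a' b'

Iso : ∀ {n n'} (X : Config n) (X' : Config n') (φ : Col X → Col X') → Set
Iso {n} {n'} X X' φ =
  Σ (Fin n ↔ Fin n') λ f → ∀ a b →
    col X' (Inverse.to f a) (Inverse.to f b) ≡ φ (col X a b)

-- ψ : Y → Y' is a (β,β')-extension of φ : X → X' (Y = X_β, Y' = X'_β')
IsExtension : ∀ {n n'} (X : Config n) (X' : Config n') (φ : Col X → Col X')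
              (β : Fin n) (β' : Fin n') (Y : Config n) (Y' : Config n')
              (ψ : Col Y → Col Y') → Set
IsExtension X X' φ β β' Y Y' ψ =
  IsAlgIso Y Y' ψ
  -- ψ agrees with φ on S (ψ extended to unions maps s to φ(s))
  × (∀ x y x' y' → col Y' x' y' ≡ ψ (col Y x y) → col X' x' y' ≡ φ (col X x y))
  × (ψ (col Y β β) ≡ col Y' β' β')

SesquiclosedMap : ∀ {n n'} (X : Config n) (X' : Config n') (φ : Col X → Col X') → Set₁
SesquiclosedMap {n} {n'} X X' φ =
  ∀ (β : Fin n) (β' : Fin n') → φ (col X β β) ≡ col X' β' β' →
  ∀ (Y : Config n) (Y' : Config n') → IsOnePointExt X β Y → IsOnePointExt X' β' Y' →
  Σ (Col Y → Col Y') λ ψ → IsExtension X X' φ β β' Y Y' ψ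

Sesquiseparable : ∀ {n} → Config n → Set₁
Sesquiseparable X =
  ∀ {n'} (X' : Config n') → IsCC X' → (φ : Col X → Col X') →
  IsAlgIso X X' φ → SesquiclosedMap X X' φ → Iso X X' φ

-- F(X_β) = { βs : s ∈ S, βs ≠ ∅ }  (equality of two sets of subsets of Ω)
FibersEq : ∀ {n} (X : Config n) (β : Fin n) (Y : Config n) → Set
FibersEq X β Y =
  (∀ δ → ∃ λ a → ∀ γ → (col Y γ γ ≡ col Y δ δ) ⇔ (col X β γ ≡ col X β a))
  × (∀ a → ∃ λ δ → ∀ γ → (col Y γ γ ≡ col Y δ δ) ⇔ (col X β γ ≡ col X β a))

Sesquiclosed : ∀ {n} → Config n → Set₁
Sesquiclosed {n} X =
  (∀ (β : Fin n) (Y : Config n) → IsOnePointExt X β Y → FibersEq X β Y)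
  × SesquiclosedMap X X (λ c → c)

IsAut : ∀ {n} (X : Config n) → (Fin n ↔ Fin n) → Set
IsAut X f = ∀ x y → col X (Inverse.to f x) (Inverse.to f y) ≡ col X x y

Schurian : ∀ {n} → Config n → Set
Schurian {n} X =
  ∀ a b a' b' → col X a b ≡ col X a' b' →
  Σ (Fin n ↔ Fin n) λ f → IsAut X f × (Inverse.to f a ≡ a') × (Inverse.to f b ≡ b')

_⊕_ : ∀ {n} → Fin n → Fin n → Fin n
_⊕_ {suc m} a b = (toℕ a + toℕ b) mod suc m

Circulant : ∀ {n} → Config n → Set
Circulant X = ∀ a b g → col X (a ⊕ g) (b ⊕ g) ≡ col X a b

-- normal: the translation group is normal in Aut(X)
-- (f τ_g f⁻¹ is a translation τ_h for every automorphism f)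
Normal : ∀ {n} → Config n → Set
Normal {n} X =
  ∀ (f : Fin n ↔ Fin n) → IsAut X f → ∀ (g : Fin n) →
  ∃ λ (h : Fin n) → ∀ y → Inverse.to f (y ⊕ g) ≡ Inverse.to f y ⊕ h

-- Subgroups of ℤ_n: for d ∣ n, H_d = { x : d ∣ x } (every subgroup is of
-- this form; H_d ≤ H_d' iff d' ∣ d).

SameCoset : ∀ {n} → ℕ → Fin n → Fin n → Set
SameCoset {n} d x y = Σ (Fin n) λ h → (d ∣ toℕ h) × (y ≡ x ⊕ h)

XGroup : ∀ {n} → Config n → ℕ → Set
XGroup {n} X d =
  (d ∣ n) × (∀ a b a' b' → col X a b ≡ col X a' b' →
             SameCoset d a b → SameCoset d a' b')

-- The scheme X_{U/L} for U = H_u, L = H_l with l = k * u, realised on the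
-- cyclic group ℤ_k ≅ U/L via i ↦ i·u + L.  The coset i·u + L is
-- { x : x ≡ i·u (mod l) } = { x : i·u ≤ x and l ∣ x - i·u }.
inCoset : ∀ {n k} (u : ℕ) → Fin k → Fin n → Bool
inCoset {n} {k} u i x =
  ⌊ toℕ i * u ≤? toℕ x ⌋ ∧ ⌊ (k * u) ∣? (toℕ x ∸ toℕ i * u) ⌋

-- colour of a pair of cosets (Γ_i,Γ_j): the union of all basic relations s
-- of X meeting Γ_i × Γ_j, as a characteristic vector on Ω²; hence two pairs
-- of cosets get the same colour iff they lie in the same basic relation
-- (s ∩ U²)_{U/e(L)}.
QCol : ℕ → Set
QCol n = Vec (Vec Bool n) n

Quot : ∀ {n} (X : Config n) (u k : ℕ) → Config k
Quot {n} X u k = config (QCol n) (≡-dec (≡-dec BoolP._≟_)) qcol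
  where
  qcol : Fin k → Fin k → QCol n
  qcol i j = tabulate λ x → tabulate λ y →
    anyFin λ x' → anyFin λ y' →
      inCoset {n} {k} u i x' ∧ inCoset {n} {k} u j y' ∧ ⌊ _≟ᶜ_ X (col X x' y') (col X x y) ⌋

RadProp : ∀ {n} → (Fin n → Fin n → Set) → (Fin n → Fin n → Set) → Set
RadProp e s = ∀ x y → s x y ⇔ (∃₂ λ x' y' → e x x' × e y y' × s x' y')

IsRad : ∀ {n} → (Fin n → Fin n → Set) → (Fin n → Fin n → Set) → Set₁
IsRad {n} r s =
  IsEquivalence r × RadProp r s ×
  (∀ (e : Fin n → Fin n → Set) → IsEquivalence e → RadProp e s → ∀ x y → e x y → r x y)

basicRel : ∀ {n} (X : Config n) → Fin n → Fin n → Fin n → Fin n → Set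
basicRel X a b x y = col X x y ≡ col X a b

IsWreath : ∀ {n} → Config n → ℕ → ℕ → Set₁
IsWreath {n} X u l =
  ∀ (a b : Fin n) → (∀ x y → basicRel X a b x y → ¬ SameCoset u x y) →
  ∀ (r : Fin n → Fin n → Set) → IsRad r (basicRel X a b) →
  ∀ x y → SameCoset l x y → r x y

{-# OPTIONS --safe #-}
module Submission where

-- Let φ : X → X' be sesquiclosed; for schurity take φ = id. Outside e(U) the colour of a pair
-- depends only on the L-cosets, so an isomorphism F of X_{G/L} inducing φ extends to X as soon as,
-- over every coset of U, the restriction of F is lifted to an isomorphism g of X_U. Both X_{G/L}
-- and X_U supply isomorphisms by sesquiseparability, and the automorphisms of X_U let us choose g
-- with prescribed values at two points 0 and u, where u generates U. That g then lies over F is read off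
-- from the (β,β')-extension at 0: a colour in it, seen from u, locates a point up to L' because
-- X_{U/L'} is normal, and up to L because X_{U'/L} is normal, so F and g agree modulo L on all of U.
--
-- The fact behind this is that a normal schurian circulant scheme becomes discrete once 0 and 1 are
-- distinguished. Such a scheme on ℤ/k consists of the orbits of a group K of multipliers and has no
-- non-affine automorphism, and the claim is reduced to the primary components of ℤ/k. For
-- a prime power, K cannot contain the multipliers 1 + ct for which x + q c x² would be an
-- automorphism, and this makes the differences with 0 and 1 decisive.
-- For a prime p and K a proper subgroup of the units, the functions f on ℤ/p with f(x) = f(x') for
-- indistinguishable x and x' include x^|K| and (x - 1)^|K| and are closed under the operator
-- f ↦ Σ_z (z - x)^e f(z), which lowers the degree; so they include one of degree 1, and x = x'.

-- The obstacle is that F and g come from two independent uses of sesquiseparability, and nothing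
-- ties them together. The link is a point v that both have to hit. Since the fibers of the
-- extension at β are the sets βs, every v that has the colour of u from β' lies in the fiber
-- corresponding to that of u. So v may be chosen inside the class F(u), g is corrected to pass
-- through it, and one extension judges both maps from v.
--
-- Schurity needs two prescribed values. If the points lie in different cosets of U, the lifts over
-- these two cosets are changed. If they lie in one coset, the lift there comes from an automorphism
-- of `X_U`, F comes from an automorphism of `X_{G/L}` with the same slope on the generator u, and
-- the two normal sections make both maps linear, hence compatible.
--
-- Modulo a prime p ≥ 5 the group K is proper because otherwise exchanging the residues 0 and 1
-- would be a non-affine automorphism; p = 2 and p = 3 are settled by inspection. A proper K has at
-- most (p - 1)/2 elements, which keeps every degree in the polynomial argument below p - 1.

-- Integer ring identities, mostly writing a number as a combination of known multiples of a
-- modulus.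

module Identities where

  open import Data.Integer using (+_; -_; _+_; _-_; _*_)
  open import Data.Integer.Tactic.RingSolver using (solve-∀)
  open import Relation.Binary.PropositionalEquality using (_≡_)

  r-[r+q*n]≡-q*n : ∀ r q n → r - (r + q * n) ≡ - q * n
  r-[r+q*n]≡-q*n = solve-∀

  s*[q*n]+t*[r*n]≡[s*q+t*r]*n : ∀ s q t r n → s * (q * n) + t * (r * n) ≡ (s * q + t * r) * n
  s*[q*n]+t*[r*n]≡[s*q+t*r]*n = solve-∀

  s*[q*n]+t*[r*n]+u*[v*n]≡[s*q+t*r+u*v]*n : ∀ s q t r u v n → s * (q * n) + t * (r * n) + u * (v * n) ≡ (s * q + t * r + u * v) * n
  s*[q*n]+t*[r*n]+u*[v*n]≡[s*q+t*r+u*v]*n = solve-∀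

  y-x≡-1*[x-y] : ∀ x y → y - x ≡ - + 1 * (x - y)
  y-x≡-1*[x-y] = solve-∀

  x-z≡1*[x-y]+1*[y-z] : ∀ x y z → x - z ≡ + 1 * (x - y) + + 1 * (y - z)
  x-z≡1*[x-y]+1*[y-z] = solve-∀

  [x+x']-[y+y']≡1*[x-y]+1*[x'-y'] : ∀ x y x' y' → (x + x') - (y + y') ≡ + 1 * (x - y) + + 1 * (x' - y')
  [x+x']-[y+y']≡1*[x-y]+1*[x'-y'] = solve-∀

  [x-x']-[y-y']≡1*[x-y]+-1*[x'-y'] : ∀ x y x' y' → (x - x') - (y - y') ≡ + 1 * (x - y) + - + 1 * (x' - y')
  [x-x']-[y-y']≡1*[x-y]+-1*[x'-y'] = solve-∀

  [x*x']-[y*y']≡x'*[x-y]+y*[x'-y'] : ∀ x y x' y' → (x * x') - (y * y') ≡ x' * (x - y) + y * (x' - y')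
  [x*x']-[y*y']≡x'*[x-y]+y*[x'-y'] = solve-∀

  x≡1*[x-0] : ∀ x → x ≡ + 1 * (x - + 0)
  x≡1*[x-0] = solve-∀

  x-0≡1*x : ∀ x → x - + 0 ≡ + 1 * x
  x-0≡1*x = solve-∀

  x≡v*[u*x]+-x*[u*v-1] : ∀ u v x → x ≡ v * (u * x) + - x * (u * v - + 1)
  x≡v*[u*x]+-x*[u*v-1] = solve-∀

  [1+y*n]+[-y*n]≡1 : ∀ y n → (+ 1 + y * n) + (- y * n) ≡ + 1
  [1+y*n]+[-y*n]≡1 = solve-∀

  [-x*m]+[1+x*m]≡1 : ∀ x m → (- x * m) + (+ 1 + x * m) ≡ + 1
  [-x*m]+[1+x*m]≡1 = solve-∀

  x*b-[a*p+b*x]≡-a*p : ∀ a p b x → x * b - (a * p + b * x) ≡ - a * p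
  x*b-[a*p+b*x]≡-a*p = solve-∀

  [-x]*[-b]-[a*p+b*x]≡-a*p : ∀ a p b x → (- x) * (- b) - (a * p + b * x) ≡ - a * p
  [-x]*[-b]-[a*p+b*x]≡-a*p = solve-∀

  x*[z+y-x*z*y]-1≡-[[x*y-1]*[x*z-1]] : ∀ x y z → x * (z + y - x * z * y) - + 1 ≡ - ((x * y - + 1) * (x * z - + 1))
  x*[z+y-x*z*y]-1≡-[[x*y-1]*[x*z-1]] = solve-∀

  -[[q*p]*[r*P]]≡-[q*r]*[p*P] : ∀ q p r P → - ((q * p) * (r * P)) ≡ - (q * r) * (p * P)
  -[[q*p]*[r*P]]≡-[q*r]*[p*P] = solve-∀

  H*[q*p]≡q*[p*H] : ∀ H q p → H * (q * p) ≡ q * (p * H)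
  H*[q*p]≡q*[p*H] = solve-∀

  j*t-u≡t*[j-s*u]+u*[t*s-1] : ∀ j t u s → j * t - u ≡ t * (j - s * u) + u * (t * s - + 1)
  j*t-u≡t*[j-s*u]+u*[t*s-1] = solve-∀

  [1+H*[j*t]]-[1+H*u]≡H*[j*t-u] : ∀ H j t u → (+ 1 + H * (j * t)) - (+ 1 + H * u) ≡ H * (j * t - u)
  [1+H*[j*t]]-[1+H*u]≡H*[j*t-u] = solve-∀

  [1+j*[p*h*t]+[p*h*t]*[p*h*t]*S]-[1+p*h*[j*t]]≡h*t*t*S*[p*[p*h]] : ∀ p h t j S → (+ 1 + j * (p * h * t) + (p * h * t) * (p * h * t) * S) - (+ 1 + p * h * (j * t)) ≡ h * t * t * S * (p * (p * h))
  [1+j*[p*h*t]+[p*h*t]*[p*h*t]*S]-[1+p*h*[j*t]]≡h*t*t*S*[p*[p*h]] = solve-∀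

  2*S≡1*[2*S-p*[p-1]]+[p-1]*p : ∀ S p → + 2 * S ≡ + 1 * (+ 2 * S - p * (p - + 1)) + (p - + 1) * p
  2*S≡1*[2*S-p*[p-1]]+[p-1]*p = solve-∀

  [t+Q*t*t*s]-t≡t*t*s*Q : ∀ t Q s → (t + Q * t * t * s) - t ≡ t * t * s * Q
  [t+Q*t*t*s]-t≡t*t*s*Q = solve-∀

  1+p*[Q*t]+Q*t*[Q*t]*[s*p]≡1+p*Q*[t+Q*t*t*s] : ∀ p Q t s → + 1 + p * (Q * t) + Q * t * (Q * t) * (s * p) ≡ + 1 + p * Q * (t + Q * t * t * s)
  1+p*[Q*t]+Q*t*[Q*t]*[s*p]≡1+p*Q*[t+Q*t*t*s] = solve-∀

  k≡1+[k-1] : ∀ k → k ≡ + 1 + (k - + 1)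
  k≡1+[k-1] = solve-∀

  [k'-k]*X-[k'-1]*H≡1*[X'-k*X]+-1*[[X'-H]-k'*[X-H]] : ∀ X X' k k' H → (k' - k) * X - (k' - + 1) * H ≡ + 1 * (X' - k * X) + - + 1 * ((X' - H) - k' * (X - H))
  [k'-k]*X-[k'-1]*H≡1*[X'-k*X]+-1*[[X'-H]-k'*[X-H]] = solve-∀

  k'-k≡Y*[[k'-k]*X-[k'-1]*H]+Y*[k'-1]*H+-[k'-k]*[X*Y-1] : ∀ X Y k k' H → k' - k ≡ Y * ((k' - k) * X - (k' - + 1) * H) + Y * (k' - + 1) * H + - (k' - k) * (X * Y - + 1)
  k'-k≡Y*[[k'-k]*X-[k'-1]*H]+Y*[k'-1]*H+-[k'-k]*[X*Y-1] = solve-∀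

  k'*k*-1≡k**[k'-k]+1*[k*k*-1] : ∀ k k' k* → k' * k* - + 1 ≡ k* * (k' - k) + + 1 * (k * k* - + 1)
  k'*k*-1≡k**[k'-k]+1*[k*k*-1] = solve-∀

  k'-k≡k*[k'*k*-1]+-k'*[k*k*-1] : ∀ k k' k* → k' - k ≡ k * (k' * k* - + 1) + - k' * (k * k* - + 1)
  k'-k≡k*[k'*k*-1]+-k'*[k*k*-1] = solve-∀

  H*[k-1]≡[X-H]*[k'-k]+-1*[[k'-k]*X-[k'-1]*H] : ∀ X k k' H → H * (k - + 1) ≡ (X - H) * (k' - k) + - + 1 * ((k' - k) * X - (k' - + 1) * H)
  H*[k-1]≡[X-H]*[k'-k]+-1*[[k'-k]*X-[k'-1]*H] = solve-∀

  X'-X≡1*[X'-k*X]+X*[k-1] : ∀ X X' k → X' - X ≡ + 1 * (X' - k * X) + X * (k - + 1)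
  X'-X≡1*[X'-k*X]+X*[k-1] = solve-∀

  k'-1≡-1*[[z-0]-k*[H-0]]+1*[[z-1]-k'*[H-1]]+[k'-k]*H : ∀ z k k' H → k' - + 1 ≡ - + 1 * ((z - + 0) - k * (H - + 0)) + + 1 * ((z - + 1) - k' * (H - + 1)) + (k' - k) * H
  k'-1≡-1*[[z-0]-k*[H-0]]+1*[[z-1]-k'*[H-1]]+[k'-k]*H = solve-∀

  z-H≡1*[[z-1]-k'*[H-1]]+[H-1]*[k'-1] : ∀ z k' H → z - H ≡ + 1 * ((z - + 1) - k' * (H - + 1)) + (H - + 1) * (k' - + 1)
  z-H≡1*[[z-1]-k'*[H-1]]+[H-1]*[k'-1] = solve-∀

  k'-1≡1*[[z-1]-k*[1+H-1]]+-1*[[z-0]-k'*[1+H-0]]+[k-k']*H : ∀ z k k' H → k' - + 1 ≡ + 1 * ((z - + 1) - k * (+ 1 + H - + 1)) + - + 1 * ((z - + 0) - k' * (+ 1 + H - + 0)) + (k - k') * H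
  k'-1≡1*[[z-1]-k*[1+H-1]]+-1*[[z-0]-k'*[1+H-0]]+[k-k']*H = solve-∀

  z-[1+H]≡1*[[z-0]-k'*[1+H-0]]+[1+H]*[k'-1] : ∀ z k' H → z - (+ 1 + H) ≡ + 1 * ((z - + 0) - k' * (+ 1 + H - + 0)) + (+ 1 + H) * (k' - + 1)
  z-[1+H]≡1*[[z-0]-k'*[1+H-0]]+[1+H]*[k'-1] = solve-∀

  [x'-s]-[x-s]≡x'-x : ∀ x x' s → (x' - s) - (x - s) ≡ x' - x
  [x'-s]-[x-s]≡x'-x = solve-∀

  [x'-[s+H]]-k'*[x-[s+H]]≡[x'-s-H]-k'*[x-s-H] : ∀ x x' s k' H → (x' - (s + H)) - k' * (x - (s + H)) ≡ (x' - s - H) - k' * (x - s - H)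
  [x'-[s+H]]-k'*[x-[s+H]]≡[x'-s-H]-k'*[x-s-H] = solve-∀

  t≡-1*[t'-t]+1*t' : ∀ t t' → t ≡ - + 1 * (t' - t) + + 1 * t'
  t≡-1*[t'-t]+1*t' = solve-∀

  q*[P*x]≡P*[q*x] : ∀ q P x → q * (P * x) ≡ P * (q * x)
  q*[P*x]≡P*[q*x] = solve-∀

  2≡2*[x-0]+-2*[x-1] : ∀ x → + 2 ≡ + 2 * (x - + 0) + - + 2 * (x - + 1)
  2≡2*[x-0]+-2*[x-1] = solve-∀

  1≡1+0*x+x*x*0 : ∀ x → + 1 ≡ + 1 + + 0 * x + x * x * + 0
  1≡1+0*x+x*x*0 = solve-∀

  [1+x]*[1+m*x+x*x*S]≡1+[1+m]*x+x*x*[m+S*[1+x]] : ∀ x m S → (+ 1 + x) * (+ 1 + m * x + x * x * S) ≡ + 1 + (+ 1 + m) * x + x * x * (m + S * (+ 1 + x))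
  [1+x]*[1+m*x+x*x*S]≡1+[1+m]*x+x*x*[m+S*[1+x]] = solve-∀

  2*[m+S*[1+x]]-[1+m]*[[1+m]-1]≡2*S*x+[2*S-m*[m-1]] : ∀ x m S → + 2 * (m + S * (+ 1 + x)) - (+ 1 + m) * ((+ 1 + m) - + 1) ≡ + 2 * S * x + (+ 2 * S - m * (m - + 1))
  2*[m+S*[1+x]]-[1+m]*[[1+m]-1]≡2*S*x+[2*S-m*[m-1]] = solve-∀

  2*S*x+q*x≡[2*S+q]*x : ∀ S x q → + 2 * S * x + q * x ≡ (+ 2 * S + q) * x
  2*S*x+q*x≡[2*S+q]*x = solve-∀

  [1+Q*t]-[1+Q*s]≡-[Q*[s-t]] : ∀ Q t s → (+ 1 + Q * t) - (+ 1 + Q * s) ≡ - (Q * (s - t))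
  [1+Q*t]-[1+Q*s]≡-[Q*[s-t]] = solve-∀

  -[Q*[u*2*2]]≡-u*[2*[2*Q]] : ∀ Q u → - (Q * (u * + 2 * + 2)) ≡ - u * (+ 2 * (+ 2 * Q))
  -[Q*[u*2*2]]≡-u*[2*[2*Q]] = solve-∀

  [1+Q*t]*[1+2*Q]-[1+Q*s]≡2*Q*[Q*t]+2*Q-Q*[s-t] : ∀ Q t s → (+ 1 + Q * t) * (+ 1 + + 2 * Q) - (+ 1 + Q * s) ≡ + 2 * Q * (Q * t) + + 2 * Q - Q * (s - t)
  [1+Q*t]*[1+2*Q]-[1+Q*s]≡2*Q*[Q*t]+2*Q-Q*[s-t] = solve-∀

  2*Q*[g*2*t]+2*Q-Q*[[1+u*2]*2]≡[g*t-u]*[2*[2*Q]] : ∀ Q t g u → + 2 * Q * (g * + 2 * t) + + 2 * Q - Q * ((+ 1 + u * + 2) * + 2) ≡ (g * t - u) * (+ 2 * (+ 2 * Q))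
  2*Q*[g*2*t]+2*Q-Q*[[1+u*2]*2]≡[g*t-u]*[2*[2*Q]] = solve-∀

  1≡1+Q*0 : ∀ Q → + 1 ≡ + 1 + Q * + 0
  1≡1+Q*0 = solve-∀

  s≡s-0 : ∀ s → s ≡ s - + 0
  s≡s-0 = solve-∀

  s-t≡1*[s-1]+-1*[t-1] : ∀ s t → s - t ≡ + 1 * (s - + 1) + - + 1 * (t - + 1)
  s-t≡1*[s-1]+-1*[t-1] = solve-∀

  X≡[X-2]+2 : ∀ X → X ≡ (X - + 2) + + 2
  X≡[X-2]+2 = solve-∀

  v*4+2≡2*[1+2*v] : ∀ v → v * + 4 + + 2 ≡ + 2 * (+ 1 + + 2 * v)
  v*4+2≡2*[1+2*v] = solve-∀

  1≡1*[1+2*v]+-v*2 : ∀ v → + 1 ≡ + 1 * (+ 1 + + 2 * v) + - v * + 2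
  1≡1*[1+2*v]+-v*2 = solve-∀

  [k-1]*[x-s]≡1*[x'-x]+-1*[[x'-s]-k*[x-s]] : ∀ x x' s k → (k - + 1) * (x - s) ≡ + 1 * (x' - x) + - + 1 * ((x' - s) - k * (x - s))
  [k-1]*[x-s]≡1*[x'-x]+-1*[[x'-s]-k*[x-s]] = solve-∀

  [k-1]*[2*y]≡2*1*[y*[k-1]] : ∀ k y → (k - + 1) * (+ 2 * y) ≡ + 2 * + 1 * (y * (k - + 1))
  [k-1]*[2*y]≡2*1*[y*[k-1]] = solve-∀

  [g*2*Q]*[2*y]≡g*y*[2*[2*Q]] : ∀ g Q y → (g * + 2 * Q) * (+ 2 * y) ≡ g * y * (+ 2 * (+ 2 * Q))
  [g*2*Q]*[2*y]≡g*y*[2*[2*Q]] = solve-∀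

  x'-x≡1*[[x'-s]-k*[x-s]]+1*[[k-1]*[x-s]] : ∀ x x' s k → x' - x ≡ + 1 * ((x' - s) - k * (x - s)) + + 1 * ((k - + 1) * (x - s))
  x'-x≡1*[[x'-s]-k*[x-s]]+1*[[k-1]*[x-s]] = solve-∀

  [1+H*t]-[1+H]≡H*[t-1] : ∀ H t → (+ 1 + H * t) - (+ 1 + H) ≡ H * (t - + 1)
  [1+H*t]-[1+H]≡H*[t-1] = solve-∀

  H*[q*2]≡q*[2*H] : ∀ H q → H * (q * + 2) ≡ q * (+ 2 * H)
  H*[q*2]≡q*[2*H] = solve-∀

  t+q*2*t*t-t≡q*t*t*2 : ∀ t q → t + q * + 2 * t * t - t ≡ q * t * t * + 2
  t+q*2*t*t-t≡q*t*t*2 = solve-∀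

  [1+2*q*t]*[[1+2*q*t]*1]≡1+2*[2*q]*[t+q*t*t] : ∀ t q → (+ 1 + + 2 * q * t) * ((+ 1 + + 2 * q * t) * + 1) ≡ + 1 + + 2 * (+ 2 * q) * (t + q * t * t)
  [1+2*q*t]*[[1+2*q*t]*1]≡1+2*[2*q]*[t+q*t*t] = solve-∀

  x'-x≡1*[[x'-0]-k*[x-0]]+[k-1]*x : ∀ x x' k → x' - x ≡ + 1 * ((x' - + 0) - k * (x - + 0)) + (k - + 1) * x
  x'-x≡1*[[x'-0]-k*[x-0]]+[k-1]*x = solve-∀

  x'-x≡1*[[x'-1]-k*[x-1]]+[k-1]*[x-1] : ∀ x x' k → x' - x ≡ + 1 * ((x' - + 1) - k * (x - + 1)) + (k - + 1) * (x - + 1)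
  x'-x≡1*[[x'-1]-k*[x-1]]+[k-1]*[x-1] = solve-∀

  1≡k'*[k-0]+-1*[k*k'-1] : ∀ k k' → + 1 ≡ k' * (k - + 0) + - + 1 * (k * k' - + 1)
  1≡k'*[k-0]+-1*[k*k'-1] = solve-∀

  1≡k'*[k-2]+-1*[k*k'-1]+k'*2 : ∀ k k' → + 1 ≡ k' * (k - + 2) + - + 1 * (k * k' - + 1) + k' * + 2
  1≡k'*[k-2]+-1*[k*k'-1]+k'*2 = solve-∀

  x'-x≡1*[[x'-0]-k*[x-0]]+x*[k-1] : ∀ x x' k → x' - x ≡ + 1 * ((x' - + 0) - k * (x - + 0)) + x * (k - + 1)
  x'-x≡1*[[x'-0]-k*[x-0]]+x*[k-1] = solve-∀

  x'-x≡1*[[x'-1]-k*[x-1]]+[x-1]*[k-1] : ∀ x x' k → x' - x ≡ + 1 * ((x' - + 1) - k * (x - + 1)) + (x - + 1) * (k - + 1)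
  x'-x≡1*[[x'-1]-k*[x-1]]+[x-1]*[k-1] = solve-∀

  k'*k*-1≡k**[k'-3]+-k**[k-3]+1*[k*k*-1] : ∀ k k' k* → k' * k* - + 1 ≡ k* * (k' - + 3) + - k* * (k - + 3) + + 1 * (k * k* - + 1)
  k'*k*-1≡k**[k'-3]+-k**[k-3]+1*[k*k*-1] = solve-∀

  k'-1≡x*[k'-k]+-1*[[x'-0]-k*[x-0]]+1*[[x'-1]-k'*[x-1]] : ∀ x x' k k' → k' - + 1 ≡ x * (k' - k) + - + 1 * ((x' - + 0) - k * (x - + 0)) + + 1 * ((x' - + 1) - k' * (x - + 1))
  k'-1≡x*[k'-k]+-1*[[x'-0]-k*[x-0]]+1*[[x'-1]-k'*[x-1]] = solve-∀

  2≡1*[k-1]+-1*[k-3] : ∀ k → + 2 ≡ + 1 * (k - + 1) + - + 1 * (k - + 3)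
  2≡1*[k-1]+-1*[k-3] = solve-∀

  u*[x-y]≡1*[[u*x+v]-[u*y+v]] : ∀ u v x y → u * (x - y) ≡ + 1 * ((u * x + v) - (u * y + v))
  u*[x-y]≡1*[[u*x+v]-[u*y+v]] = solve-∀

  g*[q-1]≡-1*[g-q*g] : ∀ g q → g * (q - + 1) ≡ - + 1 * (g - q * g)
  g*[q-1]≡-1*[g-q*g] = solve-∀

  k*x+0≡k*x : ∀ k x → k * x + + 0 ≡ k * x
  k*x+0≡k*x = solve-∀

  a+b+[c+d]≡a+c+[b+d] : ∀ a b c d → a + b + (c + d) ≡ a + c + (b + d)
  a+b+[c+d]≡a+c+[b+d] = solve-∀

  a*c*[b*d]≡[a*b]*[c*d] : ∀ a b c d → a * c * (b * d) ≡ (a * b) * (c * d)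
  a*c*[b*d]≡[a*b]*[c*d] = solve-∀

  k*g*[q*r]≡k*q*[g*r] : ∀ k g q r → k * g * (q * r) ≡ k * q * (g * r)
  k*g*[q*r]≡k*q*[g*r] = solve-∀

  1*g*[q*r]≡q*[g*r] : ∀ g q r → + 1 * g * (q * r) ≡ q * (g * r)
  1*g*[q*r]≡q*[g*r] = solve-∀

  [z'-x']-k*[z-x]≡-1*[[x'-z']-k*[x-z]] : ∀ x x' k z z' → (z' - x') - k * (z - x) ≡ - + 1 * ((x' - z') - k * (x - z))
  [z'-x']-k*[z-x]≡-1*[[x'-z']-k*[x-z]] = solve-∀

  a≡-1*-a : ∀ a → a ≡ - + 1 * - a
  a≡-1*-a = solve-∀

  a≡-1*[-1*a] : ∀ a → a ≡ - + 1 * (- + 1 * a)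
  a≡-1*[-1*a] = solve-∀

  x≡[x-0]*1 : ∀ x → x ≡ (x - + 0) * + 1
  x≡[x-0]*1 = solve-∀

  x≡1*[x*1]+0 : ∀ x → x ≡ + 1 * (x * + 1) + + 0
  x≡1*[x*1]+0 = solve-∀

  α*[x'-x]≡-1*[f-f']+1*[f-[α*[x*1]+β]]+-1*[f'-[α*[x'*1]+β]] : ∀ α β x x' f f' → α * (x' - x) ≡ - + 1 * (f - f') + + 1 * (f - (α * (x * + 1) + β)) + - + 1 * (f' - (α * (x' * + 1) + β))
  α*[x'-x]≡-1*[f-f']+1*[f-[α*[x*1]+β]]+-1*[f'-[α*[x'*1]+β]] = solve-∀

  [a+-b]-0≡1*[a-b] : ∀ a b → (a + - b) - + 0 ≡ + 1 * (a - b)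
  [a+-b]-0≡1*[a-b] = solve-∀

  x*[-0*y]≡-0*z : ∀ x y z → x * (- + 0 * y) ≡ - + 0 * z
  x*[-0*y]≡-0*z = solve-∀

  1≡k'*k+-1*[k*k'-1] : ∀ k k' → + 1 ≡ k' * k + - + 1 * (k * k' - + 1)
  1≡k'*k+-1*[k*k'-1] = solve-∀

  x≡1*[x-y]+1*y : ∀ x y → x ≡ + 1 * (x - y) + + 1 * y
  x≡1*[x-y]+1*y = solve-∀

  x+c≡1*[x*1]+c : ∀ x c → x + c ≡ + 1 * (x * + 1) + c
  x+c≡1*[x*1]+c = solve-∀

  0+x*[-1*y]≡-1*[x*y] : ∀ x y → + 0 + x * (- + 1 * y) ≡ - + 1 * (x * y)
  0+x*[-1*y]≡-1*[x*y] = solve-∀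

  -a*y+-b*y≡-[a+b]*y : ∀ a b y → - a * y + - b * y ≡ - (a + b) * y
  -a*y+-b*y≡-[a+b]*y = solve-∀

  x*[-b*y]≡-b*[x*y] : ∀ x b y → x * (- b * y) ≡ - b * (x * y)
  x*[-b*y]≡-b*[x*y] = solve-∀

  z+x-x≡z : ∀ z x → z + x - x ≡ z
  z+x-x≡z = solve-∀

  y*[α*f+g]≡α*[y*f]+y*g : ∀ y α f g → y * (α * f + g) ≡ α * (y * f) + y * g
  y*[α*f+g]≡α*[y*f]+y*g = solve-∀

  α≡α*1+0 : ∀ α → α ≡ α * + 1 + + 0
  α≡α*1+0 = solve-∀

  α*0+0≡0 : ∀ α → α * + 0 + + 0 ≡ + 0
  α*0+0≡0 = solve-∀

  α*[-c*1]+0≡-c*α : ∀ α c → α * (- c * + 1) + + 0 ≡ - c * α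
  α*[-c*1]+0≡-c*α = solve-∀

  α*[-c*y]≡-c*α*y : ∀ α c y → α * (- c * y) ≡ - c * α * y
  α*[-c*y]≡-c*α*y = solve-∀

  0*y+f≡f : ∀ y f → + 0 * y + f ≡ f
  0*y+f≡f = solve-∀

  α*y+f+[β*y+g]≡[α+β]*y+[f+g] : ∀ α β y f g → α * y + f + (β * y + g) ≡ (α + β) * y + (f + g)
  α*y+f+[β*y+g]≡[α+β]*y+[f+g] = solve-∀

  c*[α*y+f]≡c*α*y+c*f : ∀ c α y f → c * (α * y + f) ≡ c * α * y + c * f
  c*[α*y+f]≡c*α*y+c*f = solve-∀

  x*α≡α*[x*1]+0 : ∀ x α → x * α ≡ α * (x * + 1) + + 0
  x*α≡α*[x*1]+0 = solve-∀

  [α*y+f]*g≡α*[y*g]+f*g : ∀ α y f g → (α * y + f) * g ≡ α * (y * g) + f * g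
  [α*y+f]*g≡α*[y*g]+f*g = solve-∀

  1*y+0≡y : ∀ y → + 1 * y + + 0 ≡ y
  1*y+0≡y = solve-∀

  [x+c]*1-x*1≡c*1 : ∀ x c → (x + c) * + 1 - x * + 1 ≡ c * + 1
  [x+c]*1-x*1≡c*1 = solve-∀

  [x+c]*y-x*z≡[x+c]*[y-z]+c*z : ∀ x c y z → (x + c) * y - x * z ≡ (x + c) * (y - z) + c * z
  [x+c]*y-x*z≡[x+c]*[y-z]+c*z = solve-∀

  1*[c*n]+c*1≡c*[1+n] : ∀ c n → + 1 * (c * n) + c * + 1 ≡ c * (+ 1 + n)
  1*[c*n]+c*1≡c*[1+n] = solve-∀

  [a+g]-a≡1*[g-β*s]+β*s : ∀ a g β s → (a + g) - a ≡ + 1 * (g - β * s) + β * s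
  [a+g]-a≡1*[g-β*s]+β*s = solve-∀

  z*y-z*1≡[y-1]*z : ∀ z y → z * y - z * + 1 ≡ (y - + 1) * z
  z*y-z*1≡[y-1]*z = solve-∀

  [0+m]--1≡1*[1+m] : ∀ m → (+ 0 + m) - - + 1 ≡ + 1 * (+ 1 + m)
  [0+m]--1≡1*[1+m] = solve-∀

  z*y*[[z+x]*w]≡z*[z*y]*w+x*[z*y*w] : ∀ z y x w → z * y * ((z + x) * w) ≡ z * (z * y) * w + x * (z * y * w)
  z*y*[[z+x]*w]≡z*[z*y]*w+x*[z*y*w] = solve-∀

  k-1≡1*[[q*x'-[q*t'+1-q]]-k*[q*x-[q*t+1-q]]]+[-[x'-t'+1]+k*[x-t+1]]*q : ∀ x x' k q t t' → k - + 1 ≡ + 1 * ((q * x' - (q * t' + + 1 - q)) - k * (q * x - (q * t + + 1 - q))) + (- (x' - t' + + 1) + k * (x - t + + 1)) * q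
  k-1≡1*[[q*x'-[q*t'+1-q]]-k*[q*x-[q*t+1-q]]]+[-[x'-t'+1]+k*[x-t+1]]*q = solve-∀

  w≡d*[w*v]+-w*[d*v-1] : ∀ w v d → w ≡ d * (w * v) + - w * (d * v - + 1)
  w≡d*[w*v]+-w*[d*v-1] = solve-∀

  z-0≡1*[[z-0]-k*[q*x-0]]+k*x*q : ∀ z k q x → z - + 0 ≡ + 1 * ((z - + 0) - k * (q * x - + 0)) + k * x * q
  z-0≡1*[[z-0]-k*[q*x-0]]+k*x*q = solve-∀

  z-1≡1*[[z-1]-k*[q*t+1-q-1]]+k*[t-1]*q : ∀ z k q t → z - + 1 ≡ + 1 * ((z - + 1) - k * (q * t + + 1 - q - + 1)) + k * (t - + 1) * q
  z-1≡1*[[z-1]-k*[q*t+1-q-1]]+k*[t-1]*q = solve-∀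

  z-x'≡1*[q*x'+1-q-x']+-1*[q*x'+1-q-z-k*[q*x+1-q-q*x]]+k*[q-1] : ∀ x x' z k q → z - x' ≡ + 1 * (q * x' + + 1 - q - x') + - + 1 * (q * x' + + 1 - q - z - k * (q * x + + 1 - q - q * x)) + k * (q - + 1)
  z-x'≡1*[q*x'+1-q-x']+-1*[q*x'+1-q-z-k*[q*x+1-q-q*x]]+k*[q-1] = solve-∀

  z-1≡-1*[q*z-z]+1*[[q*z-1]-k*[q*1-1]]+k*[q-1] : ∀ z k q → z - + 1 ≡ - + 1 * (q * z - z) + + 1 * ((q * z - + 1) - k * (q * + 1 - + 1)) + k * (q - + 1)
  z-1≡-1*[q*z-z]+1*[[q*z-1]-k*[q*1-1]]+k*[q-1] = solve-∀

  1≡1*x+-1*[x-1] : ∀ x → + 1 ≡ + 1 * x + - + 1 * (x - + 1)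
  1≡1*x+-1*[x-1] = solve-∀

  y≡1*x+-1*[x-y] : ∀ x y → y ≡ + 1 * x + - + 1 * (x - y)
  y≡1*x+-1*[x-y] = solve-∀

  x≡1*y+1*[x-y] : ∀ x y → x ≡ + 1 * y + + 1 * (x - y)
  x≡1*y+1*[x-y] = solve-∀

  y-1≡1*[x-1]+-1*[x-y] : ∀ x y → y - + 1 ≡ + 1 * (x - + 1) + - + 1 * (x - y)
  y-1≡1*[x-1]+-1*[x-y] = solve-∀

  x-1≡1*[y-1]+1*[x-y] : ∀ x y → x - + 1 ≡ + 1 * (y - + 1) + + 1 * (x - y)
  x-1≡1*[y-1]+1*[x-y] = solve-∀

  x-y≡1*x+-1*y : ∀ x y → x - y ≡ + 1 * x + - + 1 * y
  x-y≡1*x+-1*y = solve-∀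

  x-y≡1*[x+0-[y+0]] : ∀ x y → x - y ≡ + 1 * (x + + 0 - (y + + 0))
  x-y≡1*[x+0-[y+0]] = solve-∀

  1≡1*[x+1-[y+-1]]+-1*x+1*[y-1] : ∀ x y → + 1 ≡ + 1 * (x + + 1 - (y + - + 1)) + - + 1 * x + + 1 * (y - + 1)
  1≡1*[x+1-[y+-1]]+-1*x+1*[y-1] = solve-∀

  1≡-1*[x+-1-[y+1]]+1*[x-1]+-1*y : ∀ x y → + 1 ≡ - + 1 * (x + - + 1 - (y + + 1)) + + 1 * (x - + 1) + - + 1 * y
  1≡-1*[x+-1-[y+1]]+1*[x-1]+-1*y = solve-∀

  y-1≡-1*[x+1-[y+0]]+1*x : ∀ x y → y - + 1 ≡ - + 1 * (x + + 1 - (y + + 0)) + + 1 * x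
  y-1≡-1*[x+1-[y+0]]+1*x = solve-∀

  y≡-1*[x+-1-[y+0]]+1*[x-1] : ∀ x y → y ≡ - + 1 * (x + - + 1 - (y + + 0)) + + 1 * (x - + 1)
  y≡-1*[x+-1-[y+0]]+1*[x-1] = solve-∀

  x-1≡1*[x+0-[y+1]]+1*y : ∀ x y → x - + 1 ≡ + 1 * (x + + 0 - (y + + 1)) + + 1 * y
  x-1≡1*[x+0-[y+1]]+1*y = solve-∀

  x≡1*[x+0-[y+-1]]+1*[y-1] : ∀ x y → x ≡ + 1 * (x + + 0 - (y + - + 1)) + + 1 * (y - + 1)
  x≡1*[x+0-[y+-1]]+1*[y-1] = solve-∀

  x+j-[y+j]≡1*[x-y] : ∀ x y j → x + j - (y + j) ≡ + 1 * (x - y)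
  x+j-[y+j]≡1*[x-y] = solve-∀

  [x+q*j-[y+q*j']]-s*[x-y]≡[j-j']*q+-[x-y]*[s-1] : ∀ x y j j' q s → (x + q * j - (y + q * j')) - s * (x - y) ≡ (j - j') * q + - (x - y) * (s - + 1)
  [x+q*j-[y+q*j']]-s*[x-y]≡[j-j']*q+-[x-y]*[s-1] = solve-∀

  2≡1*[[[3+q*0]-[2+q*0]]-[[1+q*-1]-[0+q*1]]]+-2*[q-1] : ∀ q → + 2 ≡ + 1 * (((+ 3 + q * + 0) - (+ 2 + q * + 0)) - ((+ 1 + q * - + 1) - (+ 0 + q * + 1))) + - + 2 * (q - + 1)
  2≡1*[[[3+q*0]-[2+q*0]]-[[1+q*-1]-[0+q*1]]]+-2*[q-1] = solve-∀

  t≡1*r+-1*[r-t] : ∀ t r → t ≡ + 1 * r + - + 1 * (r - t)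
  t≡1*r+-1*[r-t] = solve-∀

  x'-x≡1*[[x'-0]-k*[x-0]]+[1-k]*[0-x] : ∀ x x' k → x' - x ≡ + 1 * ((x' - + 0) - k * (x - + 0)) + (+ 1 - k) * (+ 0 - x)
  x'-x≡1*[[x'-0]-k*[x-0]]+[1-k]*[0-x] = solve-∀

  x'-x≡1*[[x'-1]-k*[x-1]]+[1-k]*[1-x] : ∀ x x' k → x' - x ≡ + 1 * ((x' - + 1) - k * (x - + 1)) + (+ 1 - k) * (+ 1 - x)
  x'-x≡1*[[x'-1]-k*[x-1]]+[1-k]*[1-x] = solve-∀

  k-0≡-k*[2-x]+1*[1*[0-x']+k*3]+1*[[x'-0]-k*[x-0]] : ∀ x x' k → k - + 0 ≡ - k * (+ 2 - x) + + 1 * (+ 1 * (+ 0 - x') + k * + 3) + + 1 * ((x' - + 0) - k * (x - + 0))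
  k-0≡-k*[2-x]+1*[1*[0-x']+k*3]+1*[[x'-0]-k*[x-0]] = solve-∀

  k-0≡k*[2-x]+-1*[1-x']+-1*[[x'-1]-k*[x-1]] : ∀ x x' k → k - + 0 ≡ k * (+ 2 - x) + - + 1 * (+ 1 - x') + - + 1 * ((x' - + 1) - k * (x - + 1))
  k-0≡k*[2-x]+-1*[1-x']+-1*[[x'-1]-k*[x-1]] = solve-∀

  q-[α*P+q]≡-α*P : ∀ α P q → q - (α * P + q) ≡ - α * P
  q-[α*P+q]≡-α*P = solve-∀

  [α*P+β*m]*z≡α*P*z+β*m*z : ∀ α P β m z → (α * P + β * m) * z ≡ α * P * z + β * m * z
  [α*P+β*m]*z≡α*P*z+β*m*z = solve-∀

  α*P*[t*m]+β*m*[s*P]≡[α*t+β*s]*[P*m] : ∀ α P β m t s → α * P * (t * m) + β * m * (s * P) ≡ (α * t + β * s) * (P * m)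
  α*P*[t*m]+β*m*[s*P]≡[α*t+β*s]*[P*m] = solve-∀

  q*x-x≡x*[q-1] : ∀ q x → q * x - x ≡ x * (q - + 1)
  q*x-x≡x*[q-1] = solve-∀

  q*x-0≡x*q : ∀ q x → q * x - + 0 ≡ x * q
  q*x-0≡x*q = solve-∀

  q*t+1-q-t≡[t-1]*[q-1] : ∀ q t → q * t + + 1 - q - t ≡ (t - + 1) * (q - + 1)
  q*t+1-q-t≡[t-1]*[q-1] = solve-∀

  q*t+1-q-1≡[t-1]*q : ∀ q t → q * t + + 1 - q - + 1 ≡ (t - + 1) * q
  q*t+1-q-1≡[t-1]*q = solve-∀

  y'-y≡1*[[y'-q*y]-k*[y-q*y]]+[y-k*y]*[q-1] : ∀ y y' k q → y' - y ≡ + 1 * ((y' - q * y) - k * (y - q * y)) + (y - k * y) * (q - + 1)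
  y'-y≡1*[[y'-q*y]-k*[y-q*y]]+[y-k*y]*[q-1] = solve-∀

  [x+q*c*[x*x]]-[y+q*c*[y*y]]≡[q*[1+c*[x+y]]+1-q]*[x-y] : ∀ q c x y → (x + q * c * (x * x)) - (y + q * c * (y * y)) ≡ (q * (+ 1 + c * (x + y)) + + 1 - q) * (x - y)
  [x+q*c*[x*x]]-[y+q*c*[y*y]]≡[q*[1+c*[x+y]]+1-q]*[x-y] = solve-∀

  2*c≡1*[[[1+1+q*c*[[1+1]*[1+1]]]-[1+q*c*[1*1]]]-[[0+1+q*c*[[0+1]*[0+1]]]-[0+q*c*[0*0]]]]+-[2*c]*[q-1] : ∀ c q → + 2 * c ≡ + 1 * (((+ 1 + + 1 + q * c * ((+ 1 + + 1) * (+ 1 + + 1))) - (+ 1 + q * c * (+ 1 * + 1))) - ((+ 0 + + 1 + q * c * ((+ 0 + + 1) * (+ 0 + + 1))) - (+ 0 + q * c * (+ 0 * + 0)))) + - (+ 2 * c) * (q - + 1)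
  2*c≡1*[[[1+1+q*c*[[1+1]*[1+1]]]-[1+q*c*[1*1]]]-[[0+1+q*c*[[0+1]*[0+1]]]-[0+q*c*[0*0]]]]+-[2*c]*[q-1] = solve-∀

  -s*P+y*m≡m*y-s*P : ∀ s P y m → - s * P + y * m ≡ m * y - s * P
  -s*P+y*m≡m*y-s*P = solve-∀

  m*y-[m*y-1]≡1 : ∀ m y → m * y - (m * y - + 1) ≡ + 1
  m*y-[m*y-1]≡1 = solve-∀

  a-c*[j+1]≡1*[[a-b]-[c-d]]+1*[b-c*j]+-1*[d-0] : ∀ a b c d j → a - c * (j + + 1) ≡ + 1 * ((a - b) - (c - d)) + + 1 * (b - c * j) + - + 1 * (d - + 0)
  a-c*[j+1]≡1*[[a-b]-[c-d]]+1*[b-c*j]+-1*[d-0] = solve-∀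

  m*[x-y]≡1*[m*x-m*y] : ∀ m x y → m * (x - y) ≡ + 1 * (m * x - m * y)
  m*[x-y]≡1*[m*x-m*y] = solve-∀

  u*[i-0]+l*t≡i*u+t*l : ∀ u i l t → u * (i - + 0) + l * t ≡ i * u + t * l
  u*[i-0]+l*t≡i*u+t*l = solve-∀

  x+l*t+l*s+l*r≡x+l*[t+s+r] : ∀ x l t s r → x + l * t + l * s + l * r ≡ x + l * (t + s + r)
  x+l*t+l*s+l*r≡x+l*[t+s+r] = solve-∀

  p-j*u≡1*[p-[u*j+s]]+1*s : ∀ p u j s → p - j * u ≡ + 1 * (p - (u * j + s)) + + 1 * s
  p-j*u≡1*[p-[u*j+s]]+1*s = solve-∀

  x-0≡x : ∀ x → x - + 0 ≡ x
  x-0≡x = solve-∀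

  y-x≡1*y+-1*x : ∀ x y → y - x ≡ + 1 * y + - + 1 * x
  y-x≡1*y+-1*x = solve-∀

  y≡1*[y-x]+1*x : ∀ x y → y ≡ + 1 * (y - x) + + 1 * x
  y≡1*[y-x]+1*x = solve-∀

  y-x≡1*[y-z]+-1*[x-z] : ∀ x y z → y - x ≡ + 1 * (y - z) + - + 1 * (x - z)
  y-x≡1*[y-z]+-1*[x-z] = solve-∀

  y-z≡1*[y-x]+1*[x-z] : ∀ x y z → y - z ≡ + 1 * (y - x) + + 1 * (x - z)
  y-z≡1*[y-x]+1*[x-z] = solve-∀

  x≡1*[x+l*t]+-t*l : ∀ x l t → x ≡ + 1 * (x + l * t) + - t * l
  x≡1*[x+l*t]+-t*l = solve-∀

  u*[q*k]+k*u*t≡[q+t]*[k*u] : ∀ u q k t → u * (q * k) + k * u * t ≡ (q + t) * (k * u)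
  u*[q*k]+k*u*t≡[q+t]*[k*u] = solve-∀

  u*z-u≡[z-1]*u : ∀ u z → u * z - u ≡ (z - + 1) * u
  u*z-u≡[z-1]*u = solve-∀

  -[d*z]≡-z*d : ∀ d z → - (d * z) ≡ - z * d
  -[d*z]≡-z*d = solve-∀

  s-[s-v]≡v : ∀ s v → s - (s - v) ≡ v
  s-[s-v]≡v = solve-∀

  w-q*d≡w+d*-q : ∀ w q d → w - q * d ≡ w + d * - q
  w-q*d≡w+d*-q = solve-∀

  -[-w+d*t]≡w+d*-t : ∀ w d t → - (- w + d * t) ≡ w + d * - t
  -[-w+d*t]≡w+d*-t = solve-∀

  r*u-u*z≡[r-z]*u : ∀ r u z → r * u - u * z ≡ (r - z) * u
  r*u-u*z≡[r-z]*u = solve-∀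

  p-r≡1*[p-z]+-1*[r-z] : ∀ p z r → p - r ≡ + 1 * (p - z) + - + 1 * (r - z)
  p-r≡1*[p-z]+-1*[r-z] = solve-∀

  x≡1*[x-y]+y : ∀ x y → x ≡ + 1 * (x - y) + y
  x≡1*[x-y]+y = solve-∀

  [i-j]*u≡-1*[x-i*u]+1*[x-j*u] : ∀ x i j u → (i - j) * u ≡ - + 1 * (x - i * u) + + 1 * (x - j * u)
  [i-j]*u≡-1*[x-i*u]+1*[x-j*u] = solve-∀

  y-x≡u*[j-i]+[1*[y-j*u]+-1*[x-i*u]] : ∀ x y i j u → y - x ≡ u * (j - i) + (+ 1 * (y - j * u) + - + 1 * (x - i * u))
  y-x≡u*[j-i]+[1*[y-j*u]+-1*[x-i*u]] = solve-∀

  x≡x+s-s : ∀ x s → x ≡ x + s - s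
  x≡x+s-s = solve-∀

  y+l*t-q*l≡y+l*[t-q] : ∀ y l t q → y + l * t - q * l ≡ y + l * (t - q)
  y+l*t-q*l≡y+l*[t-q] = solve-∀

  u*j-u*i≡u*[j-i] : ∀ u i j → u * j - u * i ≡ u * (j - i)
  u*j-u*i≡u*[j-i] = solve-∀

  u*[j-i]+s≡u*j+s-u*i : ∀ u i j s → u * (j - i) + s ≡ u * j + s - u * i
  u*[j-i]+s≡u*j+s-u*i = solve-∀

  x≡x+l*0 : ∀ x l → x ≡ x + l * + 0
  x≡x+l*0 = solve-∀

  x+l*t+l*-t≡x : ∀ x l t → x + l * t + l * - t ≡ x
  x+l*t+l*-t≡x = solve-∀

  u*z≡u*z'+u*[z-z'] : ∀ u z z' → u * z ≡ u * z' + u * (z - z')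
  u*z≡u*z'+u*[z-z'] = solve-∀

  u*[q*k]≡k*u*q : ∀ u q k → u * (q * k) ≡ k * u * q
  u*[q*k]≡k*u*q = solve-∀

  0-x≡-x : ∀ x → + 0 - x ≡ - x
  0-x≡-x = solve-∀

  x-x≡0 : ∀ x → x - x ≡ + 0
  x-x≡0 = solve-∀

  q*d*z≡z*q*d : ∀ q d z → q * d * z ≡ z * q * d
  q*d*z≡z*q*d = solve-∀

  y-x≡1*[y-[x+h]]+1*h : ∀ x h y → y - x ≡ + 1 * (y - (x + h)) + + 1 * h
  y-x≡1*[y-[x+h]]+1*h = solve-∀

  x+[y-x]≡y : ∀ x y → x + (y - x) ≡ y
  x+[y-x]≡y = solve-∀

  x-0≡1*[x-0+l*t]+-t*l : ∀ x l t → x - + 0 ≡ + 1 * (x - + 0 + l * t) + - t * l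
  x-0≡1*[x-0+l*t]+-t*l = solve-∀

  a≡1*[[a-b]+l*t]+1*b+-t*l : ∀ a b l t → a ≡ + 1 * ((a - b) + l * t) + + 1 * b + - t * l
  a≡1*[[a-b]+l*t]+1*b+-t*l = solve-∀

  Y+l*t+l*[s-t]≡Y+l*s : ∀ Y l t s → Y + l * t + l * (s - t) ≡ Y + l * s
  Y+l*t+l*[s-t]≡Y+l*s = solve-∀

  [a-b]+l*t≡1*[a-0]+-1*b+t*l : ∀ a b l t → (a - b) + l * t ≡ + 1 * (a - + 0) + - + 1 * b + t * l
  [a-b]+l*t≡1*[a-0]+-1*b+t*l = solve-∀

  j-0+l*t+l*s+l*r≡j+l*[t+s+r] : ∀ j l t s r → j - + 0 + l * t + l * s + l * r ≡ j + l * (t + s + r)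
  j-0+l*t+l*s+l*r≡j+l*[t+s+r] = solve-∀

  [z+b]-[z+a]≡b-a : ∀ z a b → (z + b) - (z + a) ≡ b - a
  [z+b]-[z+a]≡b-a = solve-∀

  x+l*t≡1*x+t*l : ∀ x l t → x + l * t ≡ + 1 * x + t * l
  x+l*t≡1*x+t*l = solve-∀

  u-0+l*t+l*s-u≡[t+s]*l : ∀ u l t s → u - + 0 + l * t + l * s - u ≡ (t + s) * l
  u-0+l*t+l*s-u≡[t+s]*l = solve-∀

  u*[j-i]≡[b+u*j]-[b+u*i] : ∀ b u i j → u * (j - i) ≡ (b + u * j) - (b + u * i)
  u*[j-i]≡[b+u*j]-[b+u*i] = solve-∀

  u*[z-y]≡u*z-u*y : ∀ u y z → u * (z - y) ≡ u * z - u * y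
  u*[z-y]≡u*z-u*y = solve-∀

  u*a-u*b≡u*[a-b] : ∀ u a b → u * a - u * b ≡ u * (a - b)
  u*a-u*b≡u*[a-b] = solve-∀

  u*[m*[q*i]]≡u*[m*q]*i : ∀ u m q i → u * (m * (q * i)) ≡ u * (m * q) * i
  u*[m*[q*i]]≡u*[m*q]*i = solve-∀

  u*[a-b]≡u*a-u*b : ∀ u a b → u * (a - b) ≡ u * a - u * b
  u*[a-b]≡u*a-u*b = solve-∀

  u*z+k*u*t≡u*[z+k*t] : ∀ u z k t → u * z + k * u * t ≡ u * (z + k * t)
  u*z+k*u*t≡u*[z+k*t] = solve-∀

  z+k*t-z≡t*k : ∀ z k t → z + k * t - z ≡ t * k
  z+k*t-z≡t*k = solve-∀

  u*[z'-z]-0≡-[u*[z-z']] : ∀ u z z' → u * (z' - z) - + 0 ≡ - (u * (z - z'))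
  u*[z'-z]-0≡-[u*[z-z']] = solve-∀

  -[u*[r*k]]≡-r*[k*u] : ∀ u r k → - (u * (r * k)) ≡ - r * (k * u)
  -[u*[r*k]]≡-r*[k*u] = solve-∀

  x≡b-[b-x] : ∀ x b → x ≡ b - (b - x)
  x≡b-[b-x] = solve-∀

  a-b-g≡1*[a-[c+g]]+-1*[b-d]+1*[c-d] : ∀ a b g c d → a - b - g ≡ + 1 * (a - (c + g)) + - + 1 * (b - d) + + 1 * (c - d)
  a-b-g≡1*[a-[c+g]]+-1*[b-d]+1*[c-d] = solve-∀

  a≡1*[a-[x-0]]+1*x : ∀ a x → a ≡ + 1 * (a - (x - + 0)) + + 1 * x
  a≡1*[a-[x-0]]+1*x = solve-∀

  y≡1*a+-1*[a-[y-0]] : ∀ a y → y ≡ + 1 * a + - + 1 * (a - (y - + 0))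
  y≡1*a+-1*[a-[y-0]] = solve-∀

  b-a≡1*[b-[w+s]]+-1*[a-w]+1*s : ∀ a b w s → b - a ≡ + 1 * (b - (w + s)) + - + 1 * (a - w) + + 1 * s
  b-a≡1*[b-[w+s]]+-1*[a-w]+1*s = solve-∀

  0+x≡x : ∀ x → + 0 + x ≡ x
  0+x≡x = solve-∀

  y-x+x≡y : ∀ x y → y - x + x ≡ y
  y-x+x≡y = solve-∀

  [a+u*y]-[a+u*x]≡u*[y-x] : ∀ a u x y → (a + u * y) - (a + u * x) ≡ u * (y - x)
  [a+u*y]-[a+u*x]≡u*[y-x] = solve-∀

  a+x-a≡x : ∀ a x → a + x - a ≡ x
  a+x-a≡x = solve-∀

  x-[a+h]≡1*[x-a-h] : ∀ x a h → x - (a + h) ≡ + 1 * (x - a - h)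
  x-[a+h]≡1*[x-a-h] = solve-∀

  u≡u*[1-0] : ∀ u → u ≡ u * (+ 1 - + 0)
  u≡u*[1-0] = solve-∀

-- Counting, and bijections obtained from equal counts.

module Matching where

  open import Defs using (count)
  open import Data.Nat using (ℕ; zero; suc; _+_; _≤_; _<_; z≤n; s≤s)
  import Data.Nat.Properties as ℕₚ
  open import Data.Fin using (Fin; punchIn; punchOut) renaming (zero to fz; suc to fs)
  import Data.Fin.Properties as Finₚ
  open import Data.Fin.Permutation using (permutation; insert; insert-punchIn)
  open import Data.Bool using (Bool; true; false; if_then_else_)
  open import Data.Product using (Σ; ∃; _,_; proj₁; proj₂)
  open import Data.Empty using (⊥-elim)
  open import Function using (_∘_)
  open import Function.Bundles using (_↔_; Inverse)
  open import Relation.Binary.Definitions using (DecidableEquality)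
  open import Relation.Binary.PropositionalEquality using (_≡_; _≢_; refl; sym; trans; cong; cong₂)
  open import Relation.Nullary using (¬_; Dec; yes; no)
  open import Relation.Nullary.Decidable using (⌊_⌋)
  open import Algebra.Properties.CommutativeMonoid.Sum ℕₚ.+-0-commutativeMonoid using (sum; sum-remove; sum-permute; sum-cong-≗)

  to : ∀ {m n} → Fin m ↔ Fin n → Fin m → Fin n
  to = Inverse.to

  from : ∀ {m n} → Fin m ↔ Fin n → Fin n → Fin m
  from = Inverse.from

  to-from : ∀ {m n} (σ : Fin m ↔ Fin n) x → to σ (from σ x) ≡ x
  to-from = Inverse.strictlyInverseˡ

  from-to : ∀ {m n} (σ : Fin m ↔ Fin n) x → from σ (to σ x) ≡ x
  from-to = Inverse.strictlyInverseʳ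

  ⌊⌋-true : {P : Set} (d : Dec P) → P → ⌊ d ⌋ ≡ true
  ⌊⌋-true (yes _) _ = refl
  ⌊⌋-true (no ¬p) p = ⊥-elim (¬p p)

  ⌊⌋-false : {P : Set} (d : Dec P) → ¬ P → ⌊ d ⌋ ≡ false
  ⌊⌋-false (yes p) ¬p = ⊥-elim (¬p p)
  ⌊⌋-false (no _)  _  = refl

  ⌊⌋-sound : {P : Set} (d : Dec P) → ⌊ d ⌋ ≡ true → P
  ⌊⌋-sound (yes p) _ = p

  ⌊⌋-cong : {P Q : Set} (d : Dec P) (e : Dec Q) → (P → Q) → (Q → P) → ⌊ d ⌋ ≡ ⌊ e ⌋
  ⌊⌋-cong (yes p) e f g = sym (⌊⌋-true e (f p))
  ⌊⌋-cong (no ¬p) e f g = sym (⌊⌋-false e (¬p ∘ g))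

  ind : Bool → ℕ
  ind b = if b then 1 else 0

  count≡sum : ∀ {n} (p : Fin n → Bool) → count p ≡ sum (ind ∘ p)
  count≡sum {zero}  p = refl
  count≡sum {suc n} p = cong (ind (p fz) +_) (count≡sum (p ∘ fs))

  count-permute : ∀ {m n} (σ : Fin m ↔ Fin n) (p : Fin m → Bool) (q : Fin n → Bool) →
                  (∀ x → p x ≡ q (to σ x)) → count p ≡ count q
  count-permute σ p q eq =
    trans (count≡sum p)
      (trans (sum-cong-≗ (λ x → cong ind (eq x)))
        (trans (sym (sum-permute (ind ∘ q) σ)) (sym (count≡sum q))))

  count-cong : ∀ {n} {p q : Fin n → Bool} → (∀ x → p x ≡ q x) → count p ≡ count q
  count-cong {zero}  eq = refl
  count-cong {suc n} eq = cong₂ _+_ (cong ind (eq fz)) (count-cong (eq ∘ fs))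

  count-remove : ∀ {n} (i : Fin (suc n)) (p : Fin (suc n) → Bool) →
                 count p ≡ ind (p i) + count (p ∘ punchIn i)
  count-remove i p =
    trans (count≡sum p)
      (trans (sum-remove {i = i} (ind ∘ p)) (cong (ind (p i) +_) (sym (count≡sum (p ∘ punchIn i)))))

  count-none : ∀ {n} (p : Fin n → Bool) → (∀ x → p x ≡ false) → count p ≡ 0
  count-none {zero}  p eq = refl
  count-none {suc n} p eq = cong₂ _+_ (cong ind (eq fz)) (count-none (p ∘ fs) (eq ∘ fs))

  count-some : ∀ {n} (p : Fin n → Bool) x → p x ≡ true → count p ≢ 0
  count-some {suc n} p x px c≡0 with trans (sym (count-remove x p)) c≡0
  ... | e rewrite px with () ← e

  count-mono : ∀ {n} (p q : Fin n → Bool) → (∀ x → p x ≡ true → q x ≡ true) → count p ≤ count q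
  count-mono {zero}  p q p⇒q = z≤n
  count-mono {suc n} p q p⇒q = ℕₚ.+-mono-≤ (at (p fz) (q fz) (p⇒q fz)) (count-mono (p ∘ fs) (q ∘ fs) (p⇒q ∘ fs))
    where
    at : ∀ a b → (a ≡ true → b ≡ true) → ind a ≤ ind b
    at false b     _ = z≤n
    at true  true  _ = s≤s z≤n
    at true  false h with () ← h refl

  count-mono-< : ∀ {n} (p q : Fin n → Bool) → (∀ x → p x ≡ true → q x ≡ true) →
                 ∀ i → p i ≡ false → q i ≡ true → count p < count q
  count-mono-< {suc n} p q p⇒q i pi qi rewrite count-remove i p | count-remove i q | pi | qi =
    s≤s (count-mono (p ∘ punchIn i) (q ∘ punchIn i) (p⇒q ∘ punchIn i))

  module _ {C : Set} (_≟_ : DecidableEquality C) where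

    -- Induction on the points: the first one is paired with any `y` of its colour, which exists
    -- because the class sizes agree, and cancelling this pair leaves the sizes equal.
    match : ∀ {m n} (f : Fin m → C) (g : Fin n → C) →
            (∀ c → count (λ x → ⌊ f x ≟ c ⌋) ≡ count (λ x → ⌊ g x ≟ c ⌋)) →
            Σ (Fin m ↔ Fin n) λ σ → ∀ x → f x ≡ g (to σ x)
    match {zero} {zero} f g eq = permutation (λ ()) (λ ()) (λ ()) (λ ()) , λ ()
    match {zero} {suc n} f g eq =
      ⊥-elim (count-some (λ x → ⌊ g x ≟ g fz ⌋) fz (⌊⌋-true (g fz ≟ g fz) refl) (sym (eq (g fz))))
    match {suc m} {n} f g eq with Finₚ.any? (λ y → g y ≟ f fz)
    ... | no none =
      ⊥-elim (count-some (λ x → ⌊ f x ≟ f fz ⌋) fz (⌊⌋-true (f fz ≟ f fz) refl)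
        (trans (eq (f fz)) (count-none _ (λ y → ⌊⌋-false (g y ≟ f fz) (λ e → none (y , e))))))
    match {suc m} {suc n} f g eq | yes (y , gy≡f0) = σ , ok
      where
      rec : Σ (Fin m ↔ Fin n) λ σ → ∀ x → f (fs x) ≡ g (punchIn y (to σ x))
      rec = match (f ∘ fs) (g ∘ punchIn y) λ c →
        ℕₚ.+-cancelˡ-≡ (ind ⌊ g y ≟ c ⌋) _ _
          (trans (cong (λ z → ind ⌊ z ≟ c ⌋ + count (λ x → ⌊ f (fs x) ≟ c ⌋)) gy≡f0)
            (trans (eq c) (count-remove y (λ x → ⌊ g x ≟ c ⌋))))
      σ : Fin (suc m) ↔ Fin (suc n)
      σ = insert fz y (proj₁ rec)
      ok : ∀ x → f x ≡ g (to σ x)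
      ok fz     = sym gy≡f0
      ok (fs x) = trans (proj₂ rec x) (cong g (sym (insert-punchIn fz y (proj₁ rec) x)))

  -- If `y` were missed, deleting it from the codomain would leave an injection of `m` points into
  -- fewer than `m`, against the pigeonhole principle.
  injective⇒surjective : ∀ {m n} → n ≤ m → (f : Fin m → Fin n) → (∀ x y → f x ≡ f y → x ≡ y) →
                         ∀ y → ∃ λ x → f x ≡ y
  injective⇒surjective {m} {suc n} n≤m f inj y with Finₚ.any? (λ x → f x Finₚ.≟ y)
  ... | yes hit = hit
  ... | no miss with Finₚ.pigeonhole n≤m (λ x → punchOut {i = y} {j = f x} (λ e → miss (x , sym e)))
  ...   | i , j , i<j , e =
    ⊥-elim (Finₚ.<⇒≢ i<j (inj i j (Finₚ.punchOut-injective (λ e → miss (i , sym e)) (λ e → miss (j , sym e)) e)))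

  injective⇒↔ : ∀ {m n} → n ≤ m → (f : Fin m → Fin n) → (∀ x y → f x ≡ f y → x ≡ y) →
                Σ (Fin m ↔ Fin n) λ σ → ∀ x → to σ x ≡ f x
  injective⇒↔ n≤m f inj =
    permutation f (λ y → proj₁ (sur y)) (λ y → proj₂ (sur y)) (λ x → inj _ _ (proj₂ (sur (f x)))) , λ x → refl
    where
    sur : ∀ y → ∃ λ x → f x ≡ y
    sur = injective⇒surjective n≤m f inj

-- Coherent families and algebraic isomorphisms.

module Coherence where

  open import Defs
  open Matching
  open import Data.Nat using (ℕ)
  open import Data.Fin using (Fin)
  import Data.Fin.Properties as Finₚ
  open import Data.Bool using (Bool; true; false; _∧_)
  open import Data.Product using (Σ; ∃; ∃₂; _×_; _,_; proj₁; proj₂)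
  open import Data.Product.Properties using (≡-dec)
  open import Data.Unit using (⊤; tt)
  open import Function using (_∘_)
  open import Function.Bundles using (_↔_)
  open import Function.Construct.Symmetry using (↔-sym)
  open import Relation.Binary.Definitions using (DecidableEquality)
  open import Relation.Binary.PropositionalEquality using (_≡_; refl; sym; trans; cong; cong₂)
  open import Relation.Nullary using (Dec; yes; no)
  open import Relation.Nullary.Decidable using (⌊_⌋)

  -- A family of colourings with a common set of colours which is coherent
  -- throughout the family: one colouring is a coherent configuration, two of them
  -- are a pair of coherent configurations with an algebraic isomorphism. The
  -- intersection numbers are replaced by a bijection that matches the triangles on
  -- two equally coloured arcs.
  record Coherent {I C : Set} (n : I → ℕ) (c : ∀ i → Fin (n i) → Fin (n i) → C) : Set where
    field
      diagonal  : ∀ i j x a b → c i x x ≡ c j a b → a ≡ b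
      transpose : ∀ i j a b a' b' → c i a b ≡ c j a' b' → c i b a ≡ c j b' a'
      matching  : ∀ i j a b a' b' → c i a b ≡ c j a' b' →
                  Σ (Fin (n i) ↔ Fin (n j)) λ σ →
                    ∀ δ → (c i a δ ≡ c j a' (to σ δ)) × (c i δ b ≡ c j (to σ δ) b')
      realised  : ∀ i j a b → ∃₂ λ a' b' → c i a b ≡ c j a' b'

    source : ∀ i j a b a' b' → c i a b ≡ c j a' b' → c i a a ≡ c j a' a'
    source i j a b a' b' e with matching i j a b a' b' e
    ... | σ , m = trans (proj₁ (m a)) (cong (c j a') (sym (diagonal i j a a' (to σ a) (proj₁ (m a)))))

    target : ∀ i j a b a' b' → c i a b ≡ c j a' b' → c i b b ≡ c j b' b'
    target i j a b a' b' e = source i j b a b' a' (transpose i j a b a' b' e)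

    triangle : ∀ i j a b a' b' → c i a b ≡ c j a' b' → ∀ δ →
               ∃ λ δ' → (c i a δ ≡ c j a' δ') × (c i δ b ≡ c j δ' b')
    triangle i j a b a' b' e δ = _ , proj₂ (matching i j a b a' b' e) δ

    arc : ∀ i j a a' → c i a a ≡ c j a' a' → ∀ δ → ∃ λ δ' → c i a δ ≡ c j a' δ'
    arc i j a a' e δ with triangle i j a a a' a' e δ
    ... | δ' , p , _ = δ' , p

  open Coherent public

  Coherent₁ : ∀ {n} {C : Set} → (Fin n → Fin n → C) → Set
  Coherent₁ {n} c = Coherent {⊤} (λ _ → n) (λ _ → c)

  two : {A : Set} → A → A → Bool → A
  two x y false = x
  two x y true  = y

  two-col : ∀ {n n'} {C : Set} → (Fin n → Fin n → C) → (Fin n' → Fin n' → C) →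
            ∀ i → Fin (two n n' i) → Fin (two n n' i) → C
  two-col c c' false = c
  two-col c c' true  = c'

  Coherent₂ : ∀ {n n'} {C : Set} → (Fin n → Fin n → C) → (Fin n' → Fin n' → C) → Set
  Coherent₂ {n} {n'} c c' = Coherent (two n n') (two-col c c')

  reindex : ∀ {I J C : Set} {n : I → ℕ} {c : ∀ i → Fin (n i) → Fin (n i) → C} (g : J → I) →
            Coherent n c → Coherent (n ∘ g) (λ j → c (g j))
  reindex g h = record
    { diagonal  = λ i j → diagonal h (g i) (g j)
    ; transpose = λ i j → transpose h (g i) (g j)
    ; matching  = λ i j → matching h (g i) (g j)
    ; realised  = λ i j → realised h (g i) (g j)
    }

  recolour : ∀ {I C E : Set} {n : I → ℕ} {c : ∀ i → Fin (n i) → Fin (n i) → C}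
             {d : ∀ i → Fin (n i) → Fin (n i) → E} →
             (∀ i j a b a' b' → c i a b ≡ c j a' b' → d i a b ≡ d j a' b') →
             (∀ i j a b a' b' → d i a b ≡ d j a' b' → c i a b ≡ c j a' b') →
             Coherent n c → Coherent n d
  recolour f g h = record
    { diagonal  = λ i j x a b e → diagonal h i j x a b (g i j x x a b e)
    ; transpose = λ i j a b a' b' e → f i j b a b' a' (transpose h i j a b a' b' (g i j a b a' b' e))
    ; matching  = λ i j a b a' b' e → let σ , m = matching h i j a b a' b' (g i j a b a' b' e) in
        σ , λ δ → f i j a δ a' _ (proj₁ (m δ)) , f i j δ b _ b' (proj₂ (m δ))
    ; realised  = λ i j a b → let a' , b' , e = realised h i j a b in a' , b' , f i j a b a' b' e
    }

  ⌊pair⌋ : {A B : Set} {x r : A} {y s : B} (dp : Dec ((x , y) ≡ (r , s))) (dx : Dec (x ≡ r)) (dy : Dec (y ≡ s)) →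
           ⌊ dp ⌋ ≡ ⌊ dx ⌋ ∧ ⌊ dy ⌋
  ⌊pair⌋ dp (yes refl) (yes refl) = ⌊⌋-true dp refl
  ⌊pair⌋ dp (yes _)    (no ¬q)    = ⌊⌋-false dp (λ { refl → ¬q refl })
  ⌊pair⌋ dp (no ¬p)    _          = ⌊⌋-false dp (λ { refl → ¬p refl })

  match₂ : ∀ {m n} {C : Set} (_≟_ : DecidableEquality C) (f₁ f₂ : Fin m → C) (g₁ g₂ : Fin n → C) →
           (∀ r s → count (λ x → ⌊ f₁ x ≟ r ⌋ ∧ ⌊ f₂ x ≟ s ⌋) ≡ count (λ x → ⌊ g₁ x ≟ r ⌋ ∧ ⌊ g₂ x ≟ s ⌋)) →
           Σ (Fin m ↔ Fin n) λ σ → ∀ x → (f₁ x ≡ g₁ (to σ x)) × (f₂ x ≡ g₂ (to σ x))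
  match₂ _≟_ f₁ f₂ g₁ g₂ eq
    with match (≡-dec _≟_ _≟_) (λ x → f₁ x , f₂ x) (λ x → g₁ x , g₂ x)
           (λ { (r , s) → trans (count-cong (λ x → ⌊pair⌋ (≡-dec _≟_ _≟_ (f₁ x , f₂ x) (r , s)) (f₁ x ≟ r) (f₂ x ≟ s)))
                  (trans (eq r s)
                    (count-cong (λ x → sym (⌊pair⌋ (≡-dec _≟_ _≟_ (g₁ x , g₂ x) (r , s)) (g₁ x ≟ r) (g₂ x ≟ s))))) })
  ... | σ , m = σ , λ x → cong proj₁ (m x) , cong proj₂ (m x)

  isCC⇒coherent : ∀ {n} (X : Config n) → IsCC X → Coherent₁ (col X)
  isCC⇒coherent X cc = record
    { diagonal  = λ _ _ x a b → IsCC.diagonal cc a b x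
    ; transpose = λ _ _ → IsCC.transpose cc
    ; matching  = λ _ _ a b a' b' e →
        match₂ (_≟ᶜ_ X) (col X a) (λ δ → col X δ b) (col X a') (λ δ → col X δ b') (IsCC.intersect cc a b a' b' e)
    ; realised  = λ _ _ a b → a , b , refl
    }

  coherent⇒isCC : ∀ {n} (X : Config n) → Coherent₁ (col X) → IsCC X
  coherent⇒isCC X h = record
    { diagonal  = λ a b x → diagonal h tt tt x a b
    ; transpose = transpose h tt tt
    ; intersect = λ a b a' b' e r s → let σ , m = matching h tt tt a b a' b' e in
        count-permute σ _ _ λ δ →
          cong₂ (λ x y → ⌊ _≟ᶜ_ X x r ⌋ ∧ ⌊ _≟ᶜ_ X y s ⌋) (proj₁ (m δ)) (proj₂ (m δ))
    }

  module _ {n n'} {C : Set} {c : Fin n → Fin n → C} {c' : Fin n' → Fin n' → C} where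

    -- Transposition and matching are asked for from left to right only; the other direction comes
    -- from inverting the matchings.
    glue : Coherent₁ c → Coherent₁ c' →
           (∀ x a b → c x x ≡ c' a b → a ≡ b) →
           (∀ x a b → c' x x ≡ c a b → a ≡ b) →
           (∀ a b a' b' → c a b ≡ c' a' b' → c b a ≡ c' b' a') →
           (∀ a b a' b' → c a b ≡ c' a' b' → Σ (Fin n ↔ Fin n') λ σ →
              ∀ δ → (c a δ ≡ c' a' (to σ δ)) × (c δ b ≡ c' (to σ δ) b')) →
           (∀ a b → ∃₂ λ a' b' → c a b ≡ c' a' b') →
           (∀ a' b' → ∃₂ λ a b → c a b ≡ c' a' b') →
           Coherent₂ c c'
    glue h h' dg dg' tp mt re re' = record
      { diagonal  = dia ; transpose = tra ; matching = mat ; realised = rea }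
      where
      dia : ∀ i j x a b → two-col c c' i x x ≡ two-col c c' j a b → a ≡ b
      dia false false = diagonal h tt tt
      dia false true  = dg
      dia true  false = dg'
      dia true  true  = diagonal h' tt tt
      tra : ∀ i j a b a' b' → two-col c c' i a b ≡ two-col c c' j a' b' → two-col c c' i b a ≡ two-col c c' j b' a'
      tra false false = transpose h tt tt
      tra false true  = tp
      tra true  false a b a' b' e = sym (tp a' b' a b (sym e))
      tra true  true  = transpose h' tt tt
      mat : ∀ i j a b a' b' → two-col c c' i a b ≡ two-col c c' j a' b' →
            Σ (Fin (two n n' i) ↔ Fin (two n n' j)) λ σ →
              ∀ δ → (two-col c c' i a δ ≡ two-col c c' j a' (to σ δ)) × (two-col c c' i δ b ≡ two-col c c' j (to σ δ) b')
      mat false false = matching h tt tt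
      mat false true  = mt
      mat true  false a b a' b' e with mt a' b' a b (sym e)
      ... | σ , m = ↔-sym σ , λ δ →
        trans (cong (c' a) (sym (to-from σ δ))) (sym (proj₁ (m (from σ δ)))) ,
        trans (cong (λ z → c' z b) (sym (to-from σ δ))) (sym (proj₂ (m (from σ δ))))
      mat true  true  = matching h' tt tt
      rea : ∀ i j a b → ∃₂ λ a' b' → two-col c c' i a b ≡ two-col c c' j a' b'
      rea false false a b = a , b , refl
      rea false true  = re
      rea true  false a b = let x , y , e = re' a b in x , y , sym e
      rea true  true  a b = a , b , refl

  module _ {n n'} (X : Config n) (X' : Config n') (φ : Col X → Col X') where

    private
      c : Fin n → Fin n → Col X'
      c a b = φ (col X a b)

    -- `IsAlgIso` speaks of intersection numbers alone. Counting turns them into matchings of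
    -- triangles, and respect for loops and transposition is then derived from triangles.
    algIso⇒coherent : IsCC X → IsCC X' → IsAlgIso X X' φ → Coherent₂ c (col X')
    algIso⇒coherent cc cc' iso =
      glue (recolour (λ _ _ a b a' b' → cong φ) (λ _ _ → inj) h) h' dg dg' tp mt
        (λ a b → let a' , b' , e = into a b in a' , b' , sym e) onto
      where
      open IsAlgIso iso
      h  = isCC⇒coherent X cc
      h' = isCC⇒coherent X' cc'
      preserved : ∀ a b a' b' → c a b ≡ col X' a' b' → ∀ r s →
                  count (λ δ → ⌊ _≟ᶜ_ X' (c a δ) r ⌋ ∧ ⌊ _≟ᶜ_ X' (c δ b) s ⌋) ≡ inum X' r s a' b'
      preserved a b a' b' e r s
        with Finₚ.any? (λ p → Finₚ.any? λ q → _≟ᶜ_ X' (c p q) r) | Finₚ.any? (λ p → Finₚ.any? λ q → _≟ᶜ_ X' (c p q) s)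
      ... | yes (p , q , refl) | yes (p' , q' , refl) =
        trans (count-cong λ δ → cong₂ _∧_
                (⌊⌋-cong (_≟ᶜ_ X' (c a δ) (c p q)) (_≟ᶜ_ X (col X a δ) (col X p q)) (inj a δ p q) (cong φ))
                (⌊⌋-cong (_≟ᶜ_ X' (c δ b) (c p' q')) (_≟ᶜ_ X (col X δ b) (col X p' q')) (inj δ b p' q') (cong φ)))
          (preserve a b a' b' (sym e) p q p' q')
      -- A colour outside the image of `φ` occurs on no arc of either side, because `φ` is onto the
      -- colours of `X'`.
      ... | no none | _ =
        trans (count-none _ λ δ → cong (_∧ _) (⌊⌋-false (_≟ᶜ_ X' (c a δ) r) (λ x → none (a , δ , x))))
          (sym (count-none _ λ δ → cong (_∧ _) (⌊⌋-false (_≟ᶜ_ X' (col X' a' δ) r)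
            (λ x → let p , q , y = onto a' δ in none (p , q , trans y x)))))
      ... | yes _ | no none =
        trans (count-none _ λ δ → trans (cong (_ ∧_) (⌊⌋-false (_≟ᶜ_ X' (c δ b) s) (λ x → none (δ , b , x)))) (∧-false _))
          (sym (count-none _ λ δ → trans (cong (_ ∧_) (⌊⌋-false (_≟ᶜ_ X' (col X' δ b') s)
            (λ x → let p , q , y = onto δ b' in none (p , q , trans y x)))) (∧-false _)))
        where
        ∧-false : ∀ x → x ∧ false ≡ false
        ∧-false false = refl
        ∧-false true  = refl
      mt : ∀ a b a' b' → c a b ≡ col X' a' b' → Σ (Fin n ↔ Fin n') λ σ →
           ∀ δ → (c a δ ≡ col X' a' (to σ δ)) × (c δ b ≡ col X' (to σ δ) b')
      mt a b a' b' e = match₂ (_≟ᶜ_ X') (c a) (λ δ → c δ b) (col X' a') (λ δ → col X' δ b') (preserved a b a' b' e)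
      -- Pull the loop at `a` back to an arc from `p` to `q` and place `b` over it as `δ`. The arc
      -- from `p` to `δ` has the colour of a loop, so `p` is `δ`, and the arc from `b` to `a` has
      -- the colour of the loop at `a`.
      dg : ∀ x a b → c x x ≡ col X' a b → a ≡ b
      dg x a b e with onto a a
      ... | p , q , pq with mt p q a a pq
      ...   | σ , m = sym (diagonal h' tt tt a b a (trans (sym pq) (trans (cong (λ z → c z q) p≡δ) at₂)))
        where
        δ = from σ b
        at₁ : c p δ ≡ col X' a b
        at₁ = trans (proj₁ (m δ)) (cong (col X' a) (to-from σ b))
        at₂ : c δ q ≡ col X' b a
        at₂ = trans (proj₂ (m δ)) (cong (λ z → col X' z a) (to-from σ b))
        p≡δ : p ≡ δ
        p≡δ = diagonal h tt tt x p δ (inj x x p δ (trans e (sym at₁)))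
      dia : ∀ a b a' b' → c a b ≡ col X' a' b' → c a a ≡ col X' a' a'
      dia a b a' b' e with mt a b a' b' e
      ... | σ , m = trans (proj₁ (m a)) (cong (col X' a') (sym (dg a a' (to σ a) (proj₁ (m a)))))
      -- The arc is read inside a triangle over the loop at `a`: the point `δ` matched with `b'` has
      -- the colour of `b` from `a`, and its return arc carries the transposed colour.
      tp : ∀ a b a' b' → c a b ≡ col X' a' b' → c b a ≡ col X' b' a'
      tp a b a' b' e with mt a a a' a' (dia a b a' b' e)
      ... | σ , m = trans (cong φ (transpose h tt tt a b a δ (inj a b a δ (trans e (sym at₁))))) at₂
        where
        δ = from σ b'
        at₁ : c a δ ≡ col X' a' b'
        at₁ = trans (proj₁ (m δ)) (cong (col X' a') (to-from σ b'))
        at₂ : c δ a ≡ col X' b' a'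
        at₂ = trans (proj₂ (m δ)) (cong (λ z → col X' z a') (to-from σ b'))
      dg' : ∀ x a b → col X' x x ≡ c a b → a ≡ b
      dg' x a b e = diagonal h tt tt a a b (inj a a a b (trans (dia a b x x (sym e)) e))

    coherent⇒algIso : (∀ a b a' b' → c a b ≡ c a' b' → col X a b ≡ col X a' b') →
                      Coherent₂ c (col X') → IsAlgIso X X' φ
    coherent⇒algIso inj h = record
      { into = λ a b → let a' , b' , e = realised h false true a b in a' , b' , sym e
      ; onto = λ a b → let a' , b' , e = realised h true false a b in a' , b' , sym e
      ; inj  = inj
      ; preserve = λ a b a' b' e p q r s → let σ , m = matching h false true a b a' b' (sym e) in
          count-permute σ _ _ λ δ → cong₂ _∧_
            (⌊⌋-cong (_≟ᶜ_ X (col X a δ) (col X p q)) (_≟ᶜ_ X' (col X' a' (to σ δ)) (c p q))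
              (λ x → trans (sym (proj₁ (m δ))) (cong φ x)) (λ x → inj a δ p q (trans (proj₁ (m δ)) x)))
            (⌊⌋-cong (_≟ᶜ_ X (col X δ b) (col X r s)) (_≟ᶜ_ X' (col X' (to σ δ) b') (c r s))
              (λ x → trans (sym (proj₂ (m δ))) (cong φ x)) (λ x → inj δ b r s (trans (proj₂ (m δ)) x)))
      }

-- Existence of one-point extensions.

module OnePointExtension where

  open import Defs
  open Matching
  open Coherence
  open import Data.Nat using (ℕ; _*_; _<_)
  import Data.Nat.Properties as ℕₚ
  open import Data.Nat.Induction using (<-wellFounded)
  open import Induction.WellFounded using (Acc; acc)
  open import Data.Fin using (Fin; remQuot; combine)
  import Data.Fin.Properties as Finₚ
  open import Data.Bool using (Bool; true; false; _∧_)
  import Data.Bool.Properties as Boolₚ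
  open import Data.Vec using (Vec; tabulate; lookup)
  open import Data.Vec.Properties using (lookup∘tabulate; tabulate-cong) renaming (≡-dec to ≡-decᵛ)
  open import Data.Product using (Σ; _×_; _,_; proj₁; proj₂)
  open import Data.Product.Properties using (≡-dec)
  open import Data.Unit using (tt)
  open import Function using (_∘_; id)
  open import Function.Bundles using (_↔_)
  open import Relation.Binary.PropositionalEquality using (_≡_; refl; sym; trans; cong; cong₂)
  open import Relation.Nullary using (¬_; yes; no)
  open import Relation.Nullary.Decidable using (⌊_⌋; _×-dec_; ¬?; decidable-stable)

  module _ {n : ℕ} where

    -- The four indices name two arcs, whose colours stand for the two arguments of an intersection
    -- number: `Col` is an arbitrary type that cannot be enumerated, while arcs can. A vector keeps
    -- equality decidable.
    Table : Set
    Table = Vec (Vec (Vec (Vec ℕ n) n) n) n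

    table : (Fin n → Fin n → Fin n → Fin n → ℕ) → Table
    table f = tabulate λ p → tabulate λ q → tabulate λ r → tabulate λ s → f p q r s

    entry : Table → Fin n → Fin n → Fin n → Fin n → ℕ
    entry t p q r s = lookup (lookup (lookup (lookup t p) q) r) s

    entry-table : ∀ f p q r s → entry (table f) p q r s ≡ f p q r s
    entry-table f p q r s
      rewrite lookup∘tabulate (λ p → tabulate λ q → tabulate λ r → tabulate λ s → f p q r s) p
            | lookup∘tabulate (λ q → tabulate λ r → tabulate λ s → f p q r s) q
            | lookup∘tabulate (λ r → tabulate λ s → f p q r s) r
            = lookup∘tabulate (λ s → f p q r s) s

    table-cong : ∀ {f g} → (∀ p q r s → f p q r s ≡ g p q r s) → table f ≡ table g
    table-cong eq = tabulate-cong λ p → tabulate-cong λ q → tabulate-cong λ r → tabulate-cong λ s → eq p q r s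

    -- One round of the 2-dimensional Weisfeiler–Leman refinement.
    refine : Config n → Config n
    refine A = config (Col A × Col A × Table)
      (≡-dec (_≟ᶜ_ A) (≡-dec (_≟ᶜ_ A) (≡-decᵛ (≡-decᵛ (≡-decᵛ (≡-decᵛ ℕₚ._≟_))))))
      λ a b → col A a b , col A b a , table λ p q r s → inum A (col A p q) (col A r s) a b

    refine-match : ∀ A a b a' b' → col (refine A) a b ≡ col (refine A) a' b' →
                   Σ (Fin n ↔ Fin n) λ σ → ∀ δ → (col A a δ ≡ col A a' (to σ δ)) × (col A δ b ≡ col A (to σ δ) b')
    refine-match A a b a' b' e = match₂ (_≟ᶜ_ A) (col A a) (λ δ → col A δ b) (col A a') (λ δ → col A δ b') same
      where
      known : ∀ p q r s → inum A (col A p q) (col A r s) a b ≡ inum A (col A p q) (col A r s) a' b'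
      known p q r s = trans (sym (entry-table (λ p q r s → inum A (col A p q) (col A r s) a b) p q r s))
        (trans (cong (λ t → entry t p q r s) (cong (proj₂ ∘ proj₂) e)) (entry-table (λ p q r s → inum A (col A p q) (col A r s) a' b') p q r s))
      ∧-false : ∀ x → x ∧ false ≡ false
      ∧-false false = refl
      ∧-false true  = refl
      same : ∀ r s → inum A r s a b ≡ inum A r s a' b'
      same r s with Finₚ.any? (λ p → Finₚ.any? λ q → _≟ᶜ_ A (col A p q) r) | Finₚ.any? (λ p → Finₚ.any? λ q → _≟ᶜ_ A (col A p q) s)
      ... | yes (p , q , refl) | yes (p' , q' , refl) = known p q p' q'
      ... | no none | _ = trans (zero a b) (sym (zero a' b'))
        where
        zero : ∀ a b → inum A r s a b ≡ 0
        zero a b = count-none _ λ δ → cong (_∧ _) (⌊⌋-false (_≟ᶜ_ A (col A a δ) r) (λ x → none (a , δ , x)))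
      ... | yes _ | no none = trans (zero a b) (sym (zero a' b'))
        where
        zero : ∀ a b → inum A r s a b ≡ 0
        zero a b = count-none _ λ δ →
          trans (cong (_ ∧_) (⌊⌋-false (_≟ᶜ_ A (col A δ b) s) (λ x → none (δ , b , x)))) (∧-false _)

    -- In a coherent `Z` equally coloured arcs have matching triangles, hence equal counts for every
    -- coarser colouring. So refinement never passes below a coherent configuration that is finer
    -- than the start.
    coherent-refines : ∀ Z A → IsCC Z → Refines Z A → Refines Z (refine A)
    coherent-refines Z A cc ZA a b a' b' e =
      cong₂ _,_ (ZA a b a' b' e) (cong₂ _,_ (ZA b a b' a' (IsCC.transpose cc a b a' b' e)) (table-cong counts))
      where
      counts : ∀ p q r s → inum A (col A p q) (col A r s) a b ≡ inum A (col A p q) (col A r s) a' b'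
      counts p q r s with matching (isCC⇒coherent Z cc) tt tt a b a' b' e
      ... | σ , m = count-permute σ _ _ λ δ →
        cong₂ (λ x y → ⌊ _≟ᶜ_ A x (col A p q) ⌋ ∧ ⌊ _≟ᶜ_ A y (col A r s) ⌋)
          (ZA _ _ _ _ (proj₁ (m δ))) (ZA _ _ _ _ (proj₂ (m δ)))

    Quad : Set
    Quad = (Fin n × Fin n) × (Fin n × Fin n)

    split : Fin (n * n) × Fin (n * n) → Quad
    split (x , y) = remQuot {n} n x , remQuot {n} n y

    decode : Fin ((n * n) * (n * n)) → Quad
    decode i = split (remQuot {n * n} (n * n) i)

    encode : Quad → Fin ((n * n) * (n * n))
    encode ((a , b) , (a' , b')) = combine (combine a b) (combine a' b')

    decode-encode : ∀ q → decode (encode q) ≡ q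
    decode-encode ((a , b) , (a' , b')) =
      trans (cong split (Finₚ.remQuot-combine (combine a b) (combine a' b')))
        (cong₂ _,_ (Finₚ.remQuot-combine a b) (Finₚ.remQuot-combine a' b'))

    same? : (A : Config n) → Quad → Bool
    same? A ((a , b) , (a' , b')) = ⌊ _≟ᶜ_ A (col A a b) (col A a' b') ⌋

    -- The termination measure: a refinement that splits a class has fewer pairs of equally coloured
    -- arcs.
    coincidences : Config n → ℕ
    coincidences A = count λ i → same? A (decode i)

    fewer : ∀ A B → Refines B A → ∀ a b a' b' → col A a b ≡ col A a' b' → ¬ col B a b ≡ col B a' b' →
            coincidences B < coincidences A
    fewer A B BA a b a' b' e ¬e = count-mono-< _ _
      (λ i x → let (p , q) , (p' , q') = decode i in
         ⌊⌋-true (_≟ᶜ_ A (col A p q) (col A p' q')) (BA p q p' q' (⌊⌋-sound (_≟ᶜ_ B (col B p q) (col B p' q')) x)))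
      (encode ((a , b) , (a' , b')))
      (trans (cong (same? B) (decode-encode _)) (⌊⌋-false (_≟ᶜ_ B _ _) ¬e))
      (trans (cong (same? A) (decode-encode _)) (⌊⌋-true (_≟ᶜ_ A _ _) e))

    record StableRefinement (A : Config n) : Set₁ where
      field
        Y       : Config n
        finer   : Refines Y A
        stable  : Refines Y (refine Y)
        minimal : ∀ Z → IsCC Z → Refines Z A → Refines Z Y

    stabilise : ∀ A → Acc _<_ (coincidences A) → StableRefinement A
    stabilise A (acc rec)
      with Finₚ.any? (λ a → Finₚ.any? λ b → Finₚ.any? λ a' → Finₚ.any? λ b' →
             _≟ᶜ_ A (col A a b) (col A a' b') ×-dec ¬? (_≟ᶜ_ (refine A) (col (refine A) a b) (col (refine A) a' b')))
    ... | no none = record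
      { Y = A ; finer = λ _ _ _ _ → id
      ; stable = λ a b a' b' e → decidable-stable (_≟ᶜ_ (refine A) _ _) (λ ¬e → none (a , b , a' , b' , e , ¬e))
      ; minimal = λ _ _ → id }
    ... | yes (a , b , a' , b' , e , ¬e) = record
      { Y = Y ; finer = λ a b a' b' → cong proj₁ ∘ finer a b a' b'
      ; stable = stable
      ; minimal = λ Z cc ZA → minimal Z cc (coherent-refines Z A cc ZA) }
      where
      open StableRefinement (stabilise (refine A) (rec (fewer A (refine A) (λ _ _ _ _ → cong proj₁) a b a' b' e ¬e)))

    -- The first flag separates the diagonal from the other arcs; the last two make the loop at `β`
    -- a class of its own.
    marked : Config n → Fin n → Config n
    marked X β = config (Col X × Bool × Bool × Bool)
      (≡-dec (_≟ᶜ_ X) (≡-dec Boolₚ._≟_ (≡-dec Boolₚ._≟_ Boolₚ._≟_)))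
      λ a b → col X a b , ⌊ a Finₚ.≟ b ⌋ , ⌊ a Finₚ.≟ β ⌋ , ⌊ b Finₚ.≟ β ⌋

    -- `SesquiclosedMap` is a statement about given one-point extensions and yields nothing until
    -- some are exhibited.
    onePointExt : ∀ X β → Σ (Config n) (IsOnePointExt X β)
    onePointExt X β = Y , record { cc = cc ; refines = λ a b a' b' → cong proj₁ ∘ finer a b a' b' ; basic = basic ; smallest = smallest }
      where
      open StableRefinement (stabilise (marked X β) (<-wellFounded _))
      flag : {a b a' b' : Fin n} → ⌊ a Finₚ.≟ b ⌋ ≡ ⌊ a' Finₚ.≟ b' ⌋ → a ≡ b → a' ≡ b'
      flag {a} {b} {a'} {b'} e a≡b = ⌊⌋-sound (a' Finₚ.≟ b') (trans (sym e) (⌊⌋-true (a Finₚ.≟ b) a≡b))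
      cc : IsCC Y
      cc = coherent⇒isCC Y record
        { diagonal = λ _ _ x a b e → flag (cong (proj₁ ∘ proj₂) (finer x x a b e)) refl
        ; transpose = λ _ _ a b a' b' e → cong (proj₁ ∘ proj₂) (stable a b a' b' e)
        ; matching = λ _ _ a b a' b' e → refine-match Y a b a' b' (stable a b a' b' e)
        ; realised = λ _ _ a b → a , b , refl }
      basic : PointBasic Y β
      basic a b e = flag (cong (proj₁ ∘ proj₂ ∘ proj₂) f) refl , flag (cong (proj₂ ∘ proj₂ ∘ proj₂) f) refl
        where f = sym (finer a b β β e)
      smallest : ∀ Z → IsCC Z → Refines Z X → PointBasic Z β → Refines Z Y
      smallest Z cz ZX bz = minimal Z cz λ a b a' b' e →
        cong₂ _,_ (ZX a b a' b' e)
          (cong₂ _,_ (⌊⌋-cong (a Finₚ.≟ b) (a' Finₚ.≟ b') (on-diagonal e) (on-diagonal (sym e)))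
            (cong₂ _,_ (⌊⌋-cong (a Finₚ.≟ β) (a' Finₚ.≟ β) (at-source e) (at-source (sym e)))
              (⌊⌋-cong (b Finₚ.≟ β) (b' Finₚ.≟ β) (at-target e) (at-target (sym e)))))
        where
        h = isCC⇒coherent Z cz
        on-diagonal : ∀ {a b a' b'} → col Z a b ≡ col Z a' b' → a ≡ b → a' ≡ b'
        on-diagonal {a} {b} {a'} {b'} e refl = diagonal h tt tt a a' b' e
        at-source : ∀ {a b a' b'} → col Z a b ≡ col Z a' b' → a ≡ β → a' ≡ β
        at-source {a} {b} {a'} {b'} e refl = proj₁ (bz a' a' (sym (source h tt tt a b a' b' e)))
        at-target : ∀ {a b a' b'} → col Z a b ≡ col Z a' b' → b ≡ β → b' ≡ β
        at-target {a} {b} {a'} {b'} e refl = proj₁ (bz b' b' (sym (target h tt tt a b a' b' e)))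

-- Sesquiseparability restated for joint colourings.

module Separability where

  open import Defs
  open Matching
  open Coherence
  open OnePointExtension
  open import Data.Nat using (ℕ)
  open import Data.Fin using (Fin)
  import Data.Fin.Properties as Finₚ
  open import Data.Bool using (true; false)
  open import Data.Product using (Σ; ∃₂; _×_; _,_; proj₁; proj₂)
  open import Data.Unit using (tt)
  open import Data.Empty using (⊥-elim)
  open import Function using (id)
  open import Function.Bundles using (_↔_; Equivalence)
  open import Function.Construct.Composition using (_↔-∘_)
  open import Relation.Binary.Definitions using (DecidableEquality)
  open import Relation.Binary.PropositionalEquality using (_≡_; refl; sym; trans; cong)
  open import Relation.Nullary using (yes; no)

  module _ {n} (A : Config n) {E : Set} (default : E) (c : Fin n → Fin n → E) where

    -- A colour that occurs on no arc inherits no value, so it receives `default`.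
    induced : Col A → E
    induced x with Finₚ.any? (λ a → Finₚ.any? λ b → _≟ᶜ_ A (col A a b) x)
    ... | yes (a , b , _) = c a b
    ... | no _            = default

    induced-col : (∀ a b a' b' → col A a b ≡ col A a' b' → c a b ≡ c a' b') →
                  ∀ a b → induced (col A a b) ≡ c a b
    induced-col resp a b with Finₚ.any? (λ p → Finₚ.any? λ q → _≟ᶜ_ A (col A p q) (col A a b))
    ... | yes (p , q , e) = resp p q a b e
    ... | no none         = ⊥-elim (none (a , b , refl))

  -- A coarsening y of the o-th member of a coherent family is carried to all members.
  module Coarsen {I E K : Set} {n : I → ℕ} {w : ∀ i → Fin (n i) → Fin (n i) → E} (h : Coherent n w) (o : I)
    (y : Fin (n o) → Fin (n o) → K) (hy : Coherent₁ y)
    (wy : ∀ a b a' b' → w o a b ≡ w o a' b' → y a b ≡ y a' b') where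

    z : ∀ i → Fin (n i) → Fin (n i) → K
    z i a b = let p , q , _ = realised h i o a b in y p q

    z-val : ∀ i a b p q → w i a b ≡ w o p q → z i a b ≡ y p q
    z-val i a b p q e = let p' , q' , e' = realised h i o a b in wy p' q' p q (trans (sym e') e)

    -- Arcs of two members are compared by a detour through the member `o`: a matching of the fine
    -- family, one of `y`, and again one of the fine family are composed.
    coarse : Coherent n z
    coarse = record { diagonal = dia ; transpose = tra ; matching = mat ; realised = rea }
      where
      dia : ∀ i j x a b → z i x x ≡ z j a b → a ≡ b
      dia i j x a b e with realised h i o x x | realised h j o a b
      ... | p , q , e₁ | p' , q' , e₂ with diagonal h i o x p q e₁
      ...   | refl with diagonal hy tt tt p p' q' e
      ...     | refl = diagonal h o j p' a b (sym e₂)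
      tra : ∀ i j a b a' b' → z i a b ≡ z j a' b' → z i b a ≡ z j b' a'
      tra i j a b a' b' e with realised h i o a b | realised h j o a' b'
      ... | p , q , e₁ | p' , q' , e₂ =
        trans (z-val i b a q p (transpose h i o a b p q e₁))
          (trans (transpose hy tt tt p q p' q' e) (sym (z-val j b' a' q' p' (transpose h j o a' b' p' q' e₂))))
      mat : ∀ i j a b a' b' → z i a b ≡ z j a' b' →
            Σ (Fin (n i) ↔ Fin (n j)) λ σ → ∀ δ → (z i a δ ≡ z j a' (to σ δ)) × (z i δ b ≡ z j (to σ δ) b')
      mat i j a b a' b' e with realised h i o a b | realised h j o a' b'
      ... | p , q , e₁ | p' , q' , e₂
        with matching h i o a b p q e₁ | matching hy tt tt p q p' q' e | matching h o j p' q' a' b' (sym e₂)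
      ... | σ₁ , m₁ | σ₂ , m₂ | σ₃ , m₃ = σ₃ ↔-∘ (σ₂ ↔-∘ σ₁) , λ δ →
        let δ₁ = to σ₁ δ ; δ₂ = to σ₂ δ₁ ; δ₃ = to σ₃ δ₂ in
        trans (z-val i a δ p δ₁ (proj₁ (m₁ δ)))
          (trans (proj₁ (m₂ δ₁)) (sym (z-val j a' δ₃ p' δ₂ (sym (proj₁ (m₃ δ₂)))))) ,
        trans (z-val i δ b δ₁ q (proj₂ (m₁ δ)))
          (trans (proj₂ (m₂ δ₁)) (sym (z-val j δ₃ b' δ₂ q' (sym (proj₂ (m₃ δ₂))))))
      rea : ∀ i j a b → ∃₂ λ a' b' → z i a b ≡ z j a' b'
      rea i j a b with realised h i o a b
      ... | p , q , e with realised h o j p q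
      ...   | a' , b' , e' = a' , b' , sym (z-val j a' b' p q (sym e'))

  Basic : ∀ {n} {E : Set} → (Fin n → Fin n → E) → Fin n → Set
  Basic w β = ∀ a b → w a b ≡ w β β → (a ≡ β) × (b ≡ β)

  -- A (β,β')-extension, with corresponding relations of both sides given the same colour.
  record Extension {n n'} {C : Set} (c : Fin n → Fin n → C) (c' : Fin n' → Fin n' → C) (β : Fin n) (β' : Fin n') : Set₁ where
    field
      E      : Set
      _≟_    : DecidableEquality E
      w      : Fin n → Fin n → E
      w'     : Fin n' → Fin n' → E
      joint  : Coherent₂ w w'
      finer  : ∀ i j a b a' b' → two-col w w' i a b ≡ two-col w w' j a' b' → two-col c c' i a b ≡ two-col c c' j a' b'
      base   : w β β ≡ w' β' β'
      basic  : Basic w β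
      basic' : Basic w' β'

  module _ {n n'} (X : Config n) (X' : Config n') (φ : Col X → Col X') where

    -- The second component preserves what the condition on fibers provides: points of equal colour
    -- from `β` lie in one fiber of the extension.
    sesquiclosed⇒extension : IsAlgIso X X' φ → SesquiclosedMap X X' φ → (∀ β Y → IsOnePointExt X β Y → FibersEq X β Y) →
      ∀ β β' → φ (col X β β) ≡ col X' β' β' →
      Σ (Extension (λ a b → φ (col X a b)) (col X') β β') λ ext →
        ∀ γ δ → φ (col X β γ) ≡ φ (col X β δ) → Extension.w ext γ γ ≡ Extension.w ext δ δ
    sesquiclosed⇒extension iso sc fibres β β' e = build (onePointExt X β) (onePointExt X' β')
      where
      Result : Set₁
      Result = Σ (Extension (λ a b → φ (col X a b)) (col X') β β') λ ext →
        ∀ γ δ → φ (col X β γ) ≡ φ (col X β δ) → Extension.w ext γ γ ≡ Extension.w ext δ δ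
      extend : ∀ Y Y' → IsOnePointExt X β Y → IsOnePointExt X' β' Y' →
               Σ (Col Y → Col Y') (IsExtension X X' φ β β' Y Y') → Result
      extend Y Y' y y' (ψ , iso' , agree , fixed) = record
        { _≟_ = _≟ᶜ_ Y' ; w = λ a b → ψ (col Y a b) ; w' = col Y'
        ; joint = algIso⇒coherent Y Y' ψ (IsOnePointExt.cc y) (IsOnePointExt.cc y') iso'
        ; finer = fine ; base = fixed
        ; basic = λ a b x → IsOnePointExt.basic y a b (IsAlgIso.inj iso' a b β β x)
        ; basic' = IsOnePointExt.basic y' } ,
        λ γ δ x → let a , q = proj₁ (fibres β Y y) δ in
          cong ψ (Equivalence.from (q γ) (trans (IsAlgIso.inj iso β γ β δ x) (Equivalence.to (q δ) refl)))
        where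
        fine : ∀ i j a b a' b' → two-col (λ a b → ψ (col Y a b)) (col Y') i a b ≡ two-col (λ a b → ψ (col Y a b)) (col Y') j a' b' →
               two-col (λ a b → φ (col X a b)) (col X') i a b ≡ two-col (λ a b → φ (col X a b)) (col X') j a' b'
        fine false false a b a' b' x = cong φ (IsOnePointExt.refines y a b a' b' (IsAlgIso.inj iso' a b a' b' x))
        fine false true  a b a' b' x = sym (agree a b a' b' (sym x))
        fine true  false a b a' b' x = agree a' b' a b x
        fine true  true  a b a' b' x = IsOnePointExt.refines y' a b a' b' x
      build : Σ (Config n) (IsOnePointExt X β) → Σ (Config n') (IsOnePointExt X' β') → Result
      build (Y , y) (Y' , y') = extend Y Y' y y' (sc β β' e Y Y' y y')

  module _ {I C E : Set} {n : I → ℕ} {c : ∀ i → Fin (n i) → Fin (n i) → C} {w : ∀ i → Fin (n i) → Fin (n i) → E}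
    (h : Coherent n w) (fine : ∀ i j a b a' b' → w i a b ≡ w j a' b' → c i a b ≡ c j a' b') where

    -- Minimality of Y' forces it below the transport of Y.
    transported : ∀ o i (β : Fin (n o)) (β' : Fin (n i)) → w o β β ≡ w i β' β' → Basic (w i) β' → Basic (w o) β →
      (A : Config (n o)) (A' : Config (n i)) →
      (∀ a b a' b' → col A a b ≡ col A a' b' → c o a b ≡ c o a' b') →
      (∀ a b a' b' → c o a b ≡ c o a' b' → col A a b ≡ col A a' b') →
      (∀ a b a' b' → c i a b ≡ c i a' b' → col A' a b ≡ col A' a' b') →
      DecidableEquality E →
      (Y : Config (n o)) (Y' : Config (n i)) → IsOnePointExt A β Y → IsOnePointExt A' β' Y' →
      ∀ p q p' q' a b a' b' → w o p q ≡ w i a b → w o p' q' ≡ w i a' b' →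
      col Y p q ≡ col Y p' q' → col Y' a b ≡ col Y' a' b'
    transported o i β β' base basic' basicₒ A A' Ac cA cA' _≟_ Y Y' y y' p q p' q' a b a' b' e e' s =
      IsOnePointExt.smallest y' Z Zcc ZA' Zbasic a b a' b'
        (trans (z-val i a b p q (sym e)) (trans s (sym (z-val i a' b' p' q' (sym e')))))
      where
      W : Config (n o)
      W = config E _≟_ (w o)
      hW : IsCC W
      hW = coherent⇒isCC W (reindex (λ _ → o) h)
      WY : Refines W Y
      WY = IsOnePointExt.smallest y W hW (λ a b a' b' x → cA a b a' b' (fine o o a b a' b' x)) basicₒ
      open Coarsen h o (col Y) (isCC⇒coherent Y (IsOnePointExt.cc y)) WY
      Z : Config (n i)
      Z = config (Col Y) (_≟ᶜ_ Y) (z i)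
      Zcc : IsCC Z
      Zcc = coherent⇒isCC Z (reindex (λ _ → i) coarse)
      ZA' : Refines Z A'
      ZA' a b a' b' x with realised h i o a b | realised h i o a' b'
      ... | p , q , e₁ | p' , q' , e₂ = cA' a b a' b'
        (trans (fine i o a b p q e₁)
          (trans (Ac p q p' q' (IsOnePointExt.refines y p q p' q' x)) (sym (fine i o a' b' p' q' e₂))))
      Zbasic : PointBasic Z β'
      Zbasic a b x with trans x (z-val i β' β' β β (sym base))
      ... | x' with realised h i o a b
      ...   | p , q , e₁ with IsOnePointExt.basic y p q x'
      ...     | refl , refl = basic' a b (trans e₁ base)

  module _ {n n'} (A : Config n) (i₀ : Fin n) (sep : Sesquiseparable A) {C : Set} (_≟_ : DecidableEquality C)
    (c : Fin n → Fin n → C) (c' : Fin n' → Fin n' → C)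
    (Ac : ∀ a b a' b' → col A a b ≡ col A a' b' → c a b ≡ c a' b')
    (cA : ∀ a b a' b' → c a b ≡ c a' b' → col A a b ≡ col A a' b')
    (h : Coherent₂ c c') (ext : ∀ β β' → c β β ≡ c' β' β' → Extension c c' β β') where

    private
      A' : Config n'
      A' = config C _≟_ c'

      φ : Col A → C
      φ = induced A (c i₀ i₀) c

      φ-col : ∀ a b → φ (col A a b) ≡ c a b
      φ-col = induced-col A (c i₀ i₀) c Ac

      same : ∀ i a b → two-col c c' i a b ≡ two-col (λ a b → φ (col A a b)) c' i a b
      same false a b = sym (φ-col a b)
      same true  a b = refl

      iso : IsAlgIso A A' φ
      iso = coherent⇒algIso A A' φ
        (λ a b a' b' e → cA a b a' b' (trans (sym (φ-col a b)) (trans e (φ-col a' b'))))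
        (recolour (λ i j a b a' b' e → trans (sym (same i a b)) (trans e (same j a' b')))
                  (λ i j a b a' b' e → trans (same i a b) (trans e (sym (same j a' b')))) h)

      -- The extension at hand may be finer than `Y`. Minimality of `Y'` shows that equal colours of
      -- `Y` go to equal colours of `Y'`, which defines `ψ`; minimality of `Y` gives the converse,
      -- hence injectivity.
      closed : SesquiclosedMap A A' φ
      closed β β' e Y Y' y y' = ψ , isoψ , agree , ψ-val β β β' β' base
        where
        open Extension (ext β β' (trans (sym (φ-col β β)) e)) renaming (_≟_ to _≟ᴱ_)
        fwd : ∀ p q p' q' a b a' b' → w p q ≡ w' a b → w p' q' ≡ w' a' b' → col Y p q ≡ col Y p' q' → col Y' a b ≡ col Y' a' b'
        fwd = transported joint finer false true β β' base basic' basic A A' Ac cA (λ _ _ _ _ → id) _≟ᴱ_ Y Y' y y'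
        bwd : ∀ p q p' q' a b a' b' → w' p q ≡ w a b → w' p' q' ≡ w a' b' → col Y' p q ≡ col Y' p' q' → col Y a b ≡ col Y a' b'
        bwd = transported joint finer true false β' β (sym base) basic basic' A' A (λ _ _ _ _ → id) (λ _ _ _ _ → id) cA _≟ᴱ_ Y' Y y' y
        W'Y' : ∀ a b a' b' → w' a b ≡ w' a' b' → col Y' a b ≡ col Y' a' b'
        W'Y' a b a' b' x = let p , q , e = realised joint true false a b in
          fwd p q p q a b a' b' (sym e) (trans (sym e) x) refl
        open Coarsen joint true (col Y') (isCC⇒coherent Y' (IsOnePointExt.cc y')) W'Y'
        resp : ∀ a b a' b' → col Y a b ≡ col Y a' b' → z false a b ≡ z false a' b'
        resp a b a' b' x = let p , q , e = realised joint false true a b ; p' , q' , e' = realised joint false true a' b' in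
          fwd a b a' b' p q p' q' e e' x
        ψ : Col Y → Col Y'
        ψ = induced Y (col Y' β' β') (z false)
        ψ-col : ∀ a b → ψ (col Y a b) ≡ z false a b
        ψ-col = induced-col Y (col Y' β' β') (z false) resp
        ψ-val : ∀ a b a' b' → w a b ≡ w' a' b' → ψ (col Y a b) ≡ col Y' a' b'
        ψ-val a b a' b' x = trans (ψ-col a b) (z-val false a b a' b' x)
        z≡ : ∀ i a b → z i a b ≡ two-col (λ a b → ψ (col Y a b)) (col Y') i a b
        z≡ false a b = sym (ψ-col a b)
        z≡ true  a b = z-val true a b a b refl
        isoψ : IsAlgIso Y Y' ψ
        isoψ = coherent⇒algIso Y Y' ψ
          (λ a b a' b' x → let p , q , e = realised joint false true a b ; p' , q' , e' = realised joint false true a' b' in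
             bwd p q p' q' a b a' b' (sym e) (sym e') (trans (sym (ψ-val a b p q e)) (trans x (ψ-val a' b' p' q' e'))))
          (recolour (λ i j a b a' b' e → trans (sym (z≡ i a b)) (trans e (z≡ j a' b')))
                    (λ i j a b a' b' e → trans (z≡ i a b) (trans e (sym (z≡ j a' b')))) coarse)
        agree : ∀ x y x' y' → col Y' x' y' ≡ ψ (col Y x y) → c' x' y' ≡ φ (col A x y)
        agree x y x' y'' e = let p , q , f = realised joint false true x y in
          trans (IsOnePointExt.refines y' x' y'' p q (trans e (ψ-val x y p q f)))
            (trans (sym (finer false true x y p q f)) (sym (φ-col x y)))

    -- The colours of `A` matter only up to renaming, so `A` may be a `Quot` while `c` is the
    -- quotient colouring of a different family.
    separate : Σ (Fin n ↔ Fin n') λ f → ∀ a b → c' (to f a) (to f b) ≡ c a b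
    separate = let f , e = sep A' (coherent⇒isCC A' (reindex (λ _ → true) h)) φ iso closed in f , λ a b → trans (e a b) (φ-col a b)

-- Quotients of coherent families by parabolics.

module Quotient where

  open import Defs
  open Matching
  open Coherence
  open import Data.Nat using (ℕ; zero; suc; _+_; _*_)
  import Data.Nat.Properties as ℕₚ
  open import Data.Fin using (Fin) renaming (zero to fz; suc to fs)
  import Data.Fin.Properties as Finₚ
  open import Data.Bool using (Bool; true; false; _∧_; _∨_)
  import Data.Bool.Properties as Boolₚ
  open import Data.Vec using (tabulate; lookup)
  open import Data.Vec.Properties using (lookup∘tabulate; tabulate-cong) renaming (≡-dec to ≡-decᵛ)
  open import Data.Product using (Σ; ∃; ∃₂; _×_; _,_; proj₁; proj₂)
  open import Data.Empty using (⊥-elim)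
  open import Function using (_∘_)
  open import Function.Bundles using (_↔_)
  open import Relation.Binary.Definitions using (DecidableEquality)
  open import Relation.Binary.PropositionalEquality using (_≡_; _≢_; refl; sym; trans; cong; cong₂)
  open import Relation.Nullary using (yes; no)
  open import Relation.Nullary.Decidable using (⌊_⌋)

  ∧-true : ∀ {a b} → a ∧ b ≡ true → (a ≡ true) × (b ≡ true)
  ∧-true {true} {true} _ = refl , refl

  ∧-intro : ∀ {a b} → a ≡ true → b ≡ true → a ∧ b ≡ true
  ∧-intro refl refl = refl

  bool-cong : ∀ a b → (a ≡ true → b ≡ true) → (b ≡ true → a ≡ true) → a ≡ b
  bool-cong true  b     f g = sym (f refl)
  bool-cong false true  f g = g refl
  bool-cong false false f g = refl

  anyFin-intro : ∀ {n} (p : Fin n → Bool) x → p x ≡ true → anyFin p ≡ true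
  anyFin-intro p fz px rewrite px = refl
  anyFin-intro p (fs x) px = trans (cong (p fz ∨_) (anyFin-intro (p ∘ fs) x px)) (Boolₚ.∨-zeroʳ (p fz))

  anyFin-elim : ∀ {n} (p : Fin n → Bool) → anyFin p ≡ true → ∃ λ x → p x ≡ true
  anyFin-elim {suc n} p e with p fz in eq
  ... | true  = fz , eq
  ... | false = let x , px = anyFin-elim (p ∘ fs) e in fs x , px

  count-∨ : ∀ {n} (p q : Fin n → Bool) → (∀ x → p x ≡ true → q x ≡ true → false ≡ true) →
            count (λ x → p x ∨ q x) ≡ count p + count q
  count-∨ {zero}  p q dis = refl
  count-∨ {suc n} p q dis with p fz | q fz | dis fz | count-∨ (p ∘ fs) (q ∘ fs) (dis ∘ fs)
  ... | true  | true  | d | ih with () ← d refl refl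
  ... | true  | false | d | ih = cong suc ih
  ... | false | true  | d | ih = trans (cong suc ih) (sym (ℕₚ.+-suc (count (p ∘ fs)) (count (q ∘ fs))))
  ... | false | false | d | ih = ih

  -- Allows blocks to be counted through their points once all selected blocks have the same size.
  count-union : ∀ {m n} (mem : Fin m → Fin n → Bool) (t : Fin m → Bool) s →
                (∀ k k' x → mem k x ≡ true → mem k' x ≡ true → k ≡ k') →
                (∀ k → t k ≡ true → count (mem k) ≡ s) →
                count (λ x → anyFin λ k → mem k x ∧ t k) ≡ count t * s
  count-union {zero} {n} mem t s dis size = count-none {n} (λ _ → false) λ _ → refl
  count-union {suc m} mem t s dis size =
    trans (count-∨ (λ x → mem fz x ∧ t fz) (λ x → anyFin λ k → mem (fs k) x ∧ t (fs k)) apart)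
      (trans (cong₂ _+_ first (count-union (mem ∘ fs) (t ∘ fs) s (λ k k' x a b → Finₚ.suc-injective (dis (fs k) (fs k') x a b)) (size ∘ fs)))
        (sym (ℕₚ.*-distribʳ-+ s (ind (t fz)) (count (t ∘ fs)))))
    where
    apart : ∀ x → mem fz x ∧ t fz ≡ true → anyFin (λ k → mem (fs k) x ∧ t (fs k)) ≡ true → false ≡ true
    apart x a b with anyFin-elim (λ k → mem (fs k) x ∧ t (fs k)) b
    ... | k , c with () ← dis fz (fs k) x (proj₁ (∧-true a)) (proj₁ (∧-true c))
    first : count (λ x → mem fz x ∧ t fz) ≡ ind (t fz) * s
    first with t fz | size fz
    ... | true  | sz = trans (count-cong λ x → Boolₚ.∧-identityʳ (mem fz x)) (trans (sz refl) (sym (ℕₚ.*-identityˡ s)))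
    ... | false | _  = count-none _ λ x → Boolₚ.∧-zeroʳ (mem fz x)

  -- The blocks are the classes of a parabolic inside a class of a larger one; both
  -- parabolics have to correspond under the family.
  record Section {I E : Set} {n : I → ℕ} (w : ∀ i → Fin (n i) → Fin (n i) → E)
                 (m : I → ℕ) (mem : ∀ i → Fin (m i) → Fin (n i) → Bool) : Set where
    field
      inhabited : ∀ i k → ∃ λ x → mem i k x ≡ true
      disjoint  : ∀ i k k' x → mem i k x ≡ true → mem i k' x ≡ true → k ≡ k'
      block     : ∀ i j k k' x x' y y' → mem i k x ≡ true → mem j k' x' ≡ true →
                  w i x y ≡ w j x' y' → mem i k y ≡ true → mem j k' y' ≡ true
      support   : ∀ i j k k' l x x' y y' → mem i k x ≡ true → mem j k' x' ≡ true →
                  w i x y ≡ w j x' y' → mem i l y ≡ true → ∃ λ l' → mem j l' y' ≡ true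
      meets     : ∀ i j k x → mem i k x ≡ true → ∃₂ λ k' x' → (mem j k' x' ≡ true) × (w i x x ≡ w j x' x')

  module QuotientFamily {I E : Set} (_≟_ : DecidableEquality E) {n : I → ℕ} {w : ∀ i → Fin (n i) → Fin (n i) → E}
    (h : Coherent n w) (o : I) {m : I → ℕ} {mem : ∀ i → Fin (m i) → Fin (n i) → Bool} (sec : Section w m mem) where

    open Section sec

    -- Colours of all members are recorded as sets of arcs of the one member `o`, which makes them
    -- comparable between members. For a single colouring this is the encoding of `Quot`.
    qcol : ∀ i → Fin (m i) → Fin (m i) → QCol (n o)
    qcol i k l = tabulate λ x → tabulate λ y →
      anyFin λ x' → anyFin λ y' → mem i k x' ∧ mem i l y' ∧ ⌊ w i x' y' ≟ w o x y ⌋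

    Q : ∀ i j → Fin (m i) → Fin (m i) → Fin (m j) → Fin (m j) → Set
    Q i j k l k' l' = ∃₂ λ x y → ∃₂ λ x' y' →
      ((mem i k x ≡ true) × (mem i l y ≡ true)) × ((mem j k' x' ≡ true) × (mem j l' y' ≡ true)) × (w i x y ≡ w j x' y')

    -- One coincidence of arcs spreads to all representatives: a triangle first replaces `x₀` by
    -- `x`, a second one replaces `y₀` by `y`, and the new points stay in their blocks.
    Q-lift : ∀ i j k l k' l' → Q i j k l k' l' → ∀ x y → mem i k x ≡ true → mem i l y ≡ true →
             ∃₂ λ x' y' → ((mem j k' x' ≡ true) × (mem j l' y' ≡ true)) × (w i x y ≡ w j x' y')
    Q-lift i j k l k' l' (x₀ , y₀ , x₀' , y₀' , (a , b) , (a' , b') , e) x y kx ly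
      with triangle h i j x₀ y₀ x₀' y₀' e x
    ... | x' , e₁ , e₂ with triangle h i j x y₀ x' y₀' e₂ y
    ...   | y' , e₃ , e₄ = x' , y' ,
      (block i j k k' x₀ x₀' x x' a a' e₁ kx , block i j l l' y₀ y₀' y y' b b' (transpose h i j y y₀ y' y₀' e₄) ly) , e₃

    bit : ∀ i k l x y → lookup (lookup (qcol i k l) x) y ≡
          anyFin λ x' → anyFin λ y' → mem i k x' ∧ mem i l y' ∧ ⌊ w i x' y' ≟ w o x y ⌋
    bit i k l x y
      rewrite lookup∘tabulate (λ x → tabulate λ y → anyFin λ x' → anyFin λ y' → mem i k x' ∧ mem i l y' ∧ ⌊ w i x' y' ≟ w o x y ⌋) x
      = lookup∘tabulate (λ y → anyFin λ x' → anyFin λ y' → mem i k x' ∧ mem i l y' ∧ ⌊ w i x' y' ≟ w o x y ⌋) y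

    bit-intro : ∀ i k l x y x' y' → mem i k x' ≡ true → mem i l y' ≡ true → w i x' y' ≡ w o x y →
                (anyFin λ x' → anyFin λ y' → mem i k x' ∧ mem i l y' ∧ ⌊ w i x' y' ≟ w o x y ⌋) ≡ true
    bit-intro i k l x y x' y' a b e =
      anyFin-intro _ x' (anyFin-intro (λ y' → mem i k x' ∧ mem i l y' ∧ ⌊ w i x' y' ≟ w o x y ⌋) y'
        (∧-intro a (∧-intro b (⌊⌋-true (w i x' y' ≟ w o x y) e))))

    bit-elim : ∀ i k l x y → (anyFin λ x' → anyFin λ y' → mem i k x' ∧ mem i l y' ∧ ⌊ w i x' y' ≟ w o x y ⌋) ≡ true →
               ∃₂ λ x' y' → (mem i k x' ≡ true) × (mem i l y' ≡ true) × (w i x' y' ≡ w o x y)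
    bit-elim i k l x y e with anyFin-elim _ e
    ... | x' , e' with anyFin-elim (λ y' → mem i k x' ∧ mem i l y' ∧ ⌊ w i x' y' ≟ w o x y ⌋) e'
    ...   | y' , e'' with ∧-true e''
    ...     | a , bc with ∧-true bc
    ...       | b , c = x' , y' , a , b , ⌊⌋-sound (w i x' y' ≟ w o x y) c

    qcol⇒Q : ∀ i j k l k' l' → qcol i k l ≡ qcol j k' l' → Q i j k l k' l'
    qcol⇒Q i j k l k' l' e with inhabited i k | inhabited i l
    ... | x , kx | y , ly with realised h i o x y
    ...   | p , q , f with bit-elim j k' l' p q
                             (trans (sym (bit j k' l' p q))
                               (trans (cong (λ v → lookup (lookup v p) q) (sym e))
                                 (trans (bit i k l p q) (bit-intro i k l p q x y kx ly f))))
    ...     | x' , y' , a , b , g = x , y , x' , y' , (kx , ly) , (a , b) , trans f (sym g)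

    Q-sym : ∀ i j k l k' l' → Q i j k l k' l' → Q j i k' l' k l
    Q-sym i j k l k' l' (x , y , x' , y' , a , b , e) = x' , y' , x , y , b , a , sym e

    Q⇒qcol : ∀ i j k l k' l' → Q i j k l k' l' → qcol i k l ≡ qcol j k' l'
    Q⇒qcol i j k l k' l' r = tabulate-cong λ x → tabulate-cong λ y → bool-cong _ _ (half i j k l k' l' r x y) (half j i k' l' k l (Q-sym i j k l k' l' r) x y)
      where
      half : ∀ i j k l k' l' → Q i j k l k' l' → ∀ x y →
        (anyFin λ x' → anyFin λ y' → mem i k x' ∧ mem i l y' ∧ ⌊ w i x' y' ≟ w o x y ⌋) ≡ true →
        (anyFin λ x' → anyFin λ y' → mem j k' x' ∧ mem j l' y' ∧ ⌊ w j x' y' ≟ w o x y ⌋) ≡ true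
      half i j k l k' l' r x y e with bit-elim i k l x y e
      ... | x' , y' , a , b , f with Q-lift i j k l k' l' r x' y' a b
      ...   | x'' , y'' , (a' , b') , g = bit-intro j k' l' x y x'' y'' a' b' (trans (sym g) f)

    Q-target : ∀ i j k l k' l' → Q i j k l k' l' → Q i j l l l' l'
    Q-target i j k l k' l' (x , y , x' , y' , (a , b) , (a' , b') , e) =
      y , y , y' , y' , (b , b) , (b' , b') , target h i j x y x' y' e

    -- A loop of blocks lifts to a loop of points, and the matching over that loop carries block to
    -- block.
    size-≡ : ∀ i j k k' → Q i j k k k' k' → count (mem i k) ≡ count (mem j k')
    size-≡ i j k k' r with inhabited i k
    ... | x , kx with Q-lift i j k k k' k' r x x kx kx
    ...   | x' , y' , (a , b) , e with diagonal h i j x x' y' e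
    ...     | refl with matching h i j x x x' x' e
    ...       | σ , mt = count-permute σ (mem i k) (mem j k') λ z → bool-cong _ _
      (block i j k k' x x' z (to σ z) kx a (proj₁ (mt z))) (block j i k' k x' x (to σ z) z a kx (sym (proj₁ (mt z))))

    -- Triangles of blocks are matched by counting. The matching of points shows that the selected
    -- blocks cover equally many points on both sides, and dividing by the common block size gives
    -- equally many blocks.
    quotient : Coherent m qcol
    quotient = record { diagonal = dia ; transpose = tra ; matching = mat ; realised = rea }
      where
      dia : ∀ i j x a b → qcol i x x ≡ qcol j a b → a ≡ b
      dia i j k a b e = pick (inhabited i k)
        where
        same-block : ∀ {x'} y' → x' ≡ y' → mem j a x' ≡ true → mem j b y' ≡ true → a ≡ b
        same-block {x'} y' refl p q = disjoint j a b x' p q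
        pick : (∃ λ x → mem i k x ≡ true) → a ≡ b
        pick (x , kx) = located (Q-lift i j k k a b (qcol⇒Q i j k k a b e) x x kx kx)
          where
          located : (∃₂ λ x' y' → ((mem j a x' ≡ true) × (mem j b y' ≡ true)) × (w i x x ≡ w j x' y')) → a ≡ b
          located (x' , y' , (p , q) , f) = same-block y' (diagonal h i j x x' y' f) p q
      tra : ∀ i j a b a' b' → qcol i a b ≡ qcol j a' b' → qcol i b a ≡ qcol j b' a'
      tra i j a b a' b' e with qcol⇒Q i j a b a' b' e
      ... | x , y , x' , y' , (p , q) , (p' , q') , f =
        Q⇒qcol i j b a b' a' (y , x , y' , x' , (q , p) , (q' , p') , transpose h i j x y x' y' f)
      rea : ∀ i j a b → ∃₂ λ a' b' → qcol i a b ≡ qcol j a' b'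
      rea i j a b with inhabited i a | inhabited i b
      ... | x , ax | y , by with meets i j a x ax
      ...   | a' , x' , ax' , e with arc h i j x x' e y
      ...     | y' , f with support i j a a' b x x' y y' ax ax' f by
      ...       | b' , by' = a' , b' , Q⇒qcol i j a b a' b' (x , y , x' , y' , (ax , by) , (ax' , by') , f)
      _≟ᵠ_ : DecidableEquality (QCol (n o))
      _≟ᵠ_ = ≡-decᵛ (≡-decᵛ Boolₚ._≟_)
      mat : ∀ i j a b a' b' → qcol i a b ≡ qcol j a' b' → Σ (Fin (m i) ↔ Fin (m j)) λ σ →
            ∀ δ → (qcol i a δ ≡ qcol j a' (to σ δ)) × (qcol i δ b ≡ qcol j (to σ δ) b')
      mat i j a b a' b' e with qcol⇒Q i j a b a' b' e
      ... | x , y , x' , y' , (ax , by) , (ax' , by') , f with matching h i j x y x' y' f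
      ...   | σ , mt = match₂ _≟ᵠ_ (qcol i a) (λ δ → qcol i δ b) (qcol j a') (λ δ → qcol j δ b') same
        where
        T : QCol (n o) → QCol (n o) → ∀ i → Fin (m i) → Fin (m i) → Fin (m i) → Bool
        T r s i a b δ = ⌊ qcol i a δ ≟ᵠ r ⌋ ∧ ⌊ qcol i δ b ≟ᵠ s ⌋
        T-sound : ∀ r s i a b δ → T r s i a b δ ≡ true → (qcol i a δ ≡ r) × (qcol i δ b ≡ s)
        T-sound r s i a b δ t = let p , q = ∧-true t in ⌊⌋-sound (qcol i a δ ≟ᵠ r) p , ⌊⌋-sound (qcol i δ b ≟ᵠ s) q
        T-true : ∀ r s i a b δ → qcol i a δ ≡ r → qcol i δ b ≡ s → T r s i a b δ ≡ true
        T-true r s i a b δ p q = ∧-intro (⌊⌋-true (qcol i a δ ≟ᵠ r) p) (⌊⌋-true (qcol i δ b ≟ᵠ s) q)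
        half : ∀ r s i j a b a' b' x y x' y' z z' → mem i a x ≡ true → mem i b y ≡ true → mem j a' x' ≡ true → mem j b' y' ≡ true →
               w i x z ≡ w j x' z' → w i z y ≡ w j z' y' →
               anyFin (λ δ → mem i δ z ∧ T r s i a b δ) ≡ true → anyFin (λ δ → mem j δ z' ∧ T r s j a' b' δ) ≡ true
        half r s i j a b a' b' x y x' y' z z' ax by ax' by' f g t with anyFin-elim (λ δ → mem i δ z ∧ T r s i a b δ) t
        ... | δ , dt with ∧-true dt
        ...   | dz , t' with support i j a a' δ x x' z z' ax ax' f dz | T-sound r s i a b δ t'
        ...     | δ' , dz' | p , q = anyFin-intro (λ δ → mem j δ z' ∧ T r s j a' b' δ) δ' (∧-intro dz' (T-true r s j a' b' δ'
          (trans (sym (Q⇒qcol i j a δ a' δ' (x , z , x' , z' , (ax , dz) , (ax' , dz') , f))) p)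
          (trans (sym (Q⇒qcol i j δ b δ' b' (z , y , z' , y' , (dz , by) , (dz' , by') , g))) q)))
        points : ∀ r s → count (λ z → anyFin λ δ → mem i δ z ∧ T r s i a b δ) ≡ count (λ z → anyFin λ δ → mem j δ z ∧ T r s j a' b' δ)
        points r s = count-permute σ _ _ λ z → bool-cong _ _
          (half r s i j a b a' b' x y x' y' z (to σ z) ax by ax' by' (proj₁ (mt z)) (proj₂ (mt z)))
          (half r s j i a' b' a b x' y' x y (to σ z) z ax' by' ax by (sym (proj₁ (mt z))) (sym (proj₂ (mt z))))
        -- All blocks with labels r and s have the same size, left and right.
        conclude : ∀ r s v → v ≢ 0 → (∀ δ → T r s i a b δ ≡ true → count (mem i δ) ≡ v) →
                   (∀ δ → T r s j a' b' δ ≡ true → count (mem j δ) ≡ v) →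
                   count (T r s i a b) ≡ count (T r s j a' b')
        conclude r s zero v≢0 _ _ = ⊥-elim (v≢0 refl)
        conclude r s v@(suc _) _ sz sz' = ℕₚ.*-cancelʳ-≡ _ _ v
          (trans (sym (count-union (mem i) (T r s i a b) v (disjoint i) sz))
            (trans (points r s) (count-union (mem j) (T r s j a' b') v (disjoint j) sz')))
        same-size : ∀ r s i a b δ j a' b' δ' → T r s i a b δ ≡ true → T r s j a' b' δ' ≡ true → count (mem i δ) ≡ count (mem j δ')
        same-size r s i a b δ j a' b' δ' t t' = size-≡ i j δ δ' (Q-target i j a δ a' δ' (qcol⇒Q i j a δ a' δ'
          (trans (proj₁ (T-sound r s i a b δ t)) (sym (proj₁ (T-sound r s j a' b' δ' t'))))))
        nonempty : ∀ i δ → count (mem i δ) ≢ 0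
        nonempty i δ = let z , dz = inhabited i δ in count-some (mem i δ) z dz
        same : ∀ r s → count (T r s i a b) ≡ count (T r s j a' b')
        same r s with Finₚ.any? (λ δ → T r s i a b δ Boolₚ.≟ true)
        ... | yes (δ , t) = conclude r s _ (nonempty i δ)
          (λ δ' t' → same-size r s i a b δ' i a b δ t' t) (λ δ' t' → same-size r s j a' b' δ' i a b δ t' t)
        ... | no none with Finₚ.any? (λ δ → T r s j a' b' δ Boolₚ.≟ true)
        ...   | yes (δ , t) = conclude r s _ (nonempty j δ)
          (λ δ' t' → same-size r s i a b δ' j a' b' δ t' t) (λ δ' t' → same-size r s j a' b' δ' j a' b' δ t' t)
        ...   | no none' = trans (count-none _ λ δ → Boolₚ.¬-not (λ t → none (δ , t)))
                             (sym (count-none _ λ δ → Boolₚ.¬-not (λ t → none' (δ , t))))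

-- Congruences, residues and units.

module Congruence where

  open Identities
  open import Data.Nat as ℕ using (ℕ; zero; suc; NonZero)
  import Data.Nat.Properties as ℕₚ
  import Data.Nat.Divisibility as ℕᵈ
  open import Data.Nat.Coprimality using (Coprime; coprime-Bézout)
  open import Data.Nat.GCD using (module Bézout)
  open import Data.Nat.Primality using (Prime; prime⇒irreducible)
  open import Data.Integer using (ℤ; +_; -_; _+_; _-_; _*_; _^_; ∣_∣)
  import Data.Integer.Properties as ℤₚ
  open import Data.Integer.Divisibility.Signed using (_∣_; divides; ∣⇒∣ᵤ; ∣ᵤ⇒∣; ∣-trans)
  open import Data.Integer.DivMod using (_%ℕ_; _/ℕ_; n%ℕd<d; a≡a%ℕn+[a/ℕn]*n)
  open import Data.Fin using (Fin; toℕ; fromℕ<)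
  import Data.Fin.Properties as Finₚ
  open import Data.Product using (∃; ∃₂; _,_)
  open import Data.Sum using (inj₁; inj₂)
  open import Data.Empty using (⊥-elim)
  open import Relation.Binary.PropositionalEquality using (_≡_; refl; sym; trans; cong; cong₂; subst)
  open import Relation.Nullary using (¬_)

  infix 4 _≈_[_]

  record _≈_[_] (x y n : ℤ) : Set where
    constructor mod
    field div : n ∣ (x - y)

  open _≈_[_] public

  lin₁ : ∀ {n a z} → n ∣ a → ∀ s → z ≡ s * a → n ∣ z
  lin₁ {n} {a} {z} (divides q e) s f = divides (s * q) (trans f (trans (cong (s *_) e) (sym (ℤₚ.*-assoc s q n))))

  lin₂ : ∀ {n a b z} → n ∣ a → n ∣ b → ∀ s t → z ≡ s * a + t * b → n ∣ z
  lin₂ {n} (divides q refl) (divides r refl) s t f = divides (s * q + t * r) (trans f (s*[q*n]+t*[r*n]≡[s*q+t*r]*n s q t r n))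

  lin₃ : ∀ {n a b c z} → n ∣ a → n ∣ b → n ∣ c → ∀ s t u → z ≡ s * a + t * b + u * c → n ∣ z
  lin₃ {n} (divides q refl) (divides r refl) (divides v refl) s t u f =
    divides (s * q + t * r + u * v) (trans f (s*[q*n]+t*[r*n]+u*[v*n]≡[s*q+t*r+u*v]*n s q t r u v n))

  ≈-refl : ∀ {n} x → x ≈ x [ n ]
  ≈-refl {n} x = mod (divides (+ 0) (trans (ℤₚ.+-inverseʳ x) (sym (ℤₚ.*-zeroˡ n))))

  ≈-reflexive : ∀ {n x y} → x ≡ y → x ≈ y [ n ]
  ≈-reflexive {x = x} refl = ≈-refl x

  ≈-sym : ∀ {n x y} → x ≈ y [ n ] → y ≈ x [ n ]
  ≈-sym {x = x} {y} (mod e) = mod (lin₁ e (- + 1) (y-x≡-1*[x-y] x y))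

  ≈-trans : ∀ {n x y z} → x ≈ y [ n ] → y ≈ z [ n ] → x ≈ z [ n ]
  ≈-trans {x = x} {y} {z} (mod e) (mod f) = mod (lin₂ e f (+ 1) (+ 1) (x-z≡1*[x-y]+1*[y-z] x y z))

  ≈-+ : ∀ {n x y x' y'} → x ≈ y [ n ] → x' ≈ y' [ n ] → x + x' ≈ y + y' [ n ]
  ≈-+ {x = x} {y} {x'} {y'} (mod e) (mod f) = mod (lin₂ e f (+ 1) (+ 1) ([x+x']-[y+y']≡1*[x-y]+1*[x'-y'] x y x' y'))

  ≈-- : ∀ {n x y x' y'} → x ≈ y [ n ] → x' ≈ y' [ n ] → x - x' ≈ y - y' [ n ]
  ≈-- {x = x} {y} {x'} {y'} (mod e) (mod f) = mod (lin₂ e f (+ 1) (- + 1) ([x-x']-[y-y']≡1*[x-y]+-1*[x'-y'] x y x' y'))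

  ≈-* : ∀ {n x y x' y'} → x ≈ y [ n ] → x' ≈ y' [ n ] → x * x' ≈ y * y' [ n ]
  ≈-* {x = x} {y} {x'} {y'} (mod e) (mod f) = mod (lin₂ e f x' y ([x*x']-[y*y']≡x'*[x-y]+y*[x'-y'] x y x' y'))

  ≈-*ˡ : ∀ {n x y} c → x ≈ y [ n ] → c * x ≈ c * y [ n ]
  ≈-*ˡ c e = ≈-* (≈-refl c) e

  ≈-^ : ∀ {n x y} e → x ≈ y [ n ] → x ^ e ≈ y ^ e [ n ]
  ≈-^ zero    f = ≈-refl (+ 1)
  ≈-^ (suc e) f = ≈-* f (≈-^ e f)

  ∣⇒≈0 : ∀ {n x} → n ∣ x → x ≈ + 0 [ n ]
  ∣⇒≈0 {x = x} e = mod (lin₁ e (+ 1) (x-0≡1*x x))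

  ≈0⇒∣ : ∀ {n x} → x ≈ + 0 [ n ] → n ∣ x
  ≈0⇒∣ {x = x} (mod e) = lin₁ e (+ 1) (x≡1*[x-0] x)

  ≈-weaken : ∀ {m n x y} → m ∣ n → x ≈ y [ n ] → x ≈ y [ m ]
  ≈-weaken m∣n (mod e) = mod (∣-trans m∣n e)

  ι : ∀ {n} → Fin n → ℤ
  ι x = + toℕ x

  abstract
    -- Everything about `resid` follows from `ι-resid`; hiding the definition keeps division from
    -- unfolding.
    resid : ∀ n → .{{NonZero n}} → ℤ → Fin n
    resid n z = fromℕ< (n%ℕd<d z n)

    ι-resid : ∀ n .{{_ : NonZero n}} z → ι (resid n z) ≈ z [ + n ]
    ι-resid n z = mod (divides (- (z /ℕ n))
      (trans (cong₂ _-_ (cong +_ (Finₚ.toℕ-fromℕ< (n%ℕd<d z n))) (a≡a%ℕn+[a/ℕn]*n z n)) (r-[r+q*n]≡-q*n (+ (z %ℕ n)) (z /ℕ n) (+ n))))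

  ∣-small : ∀ {n r} → + n ∣ r → ∣ r ∣ ℕ.< n → r ≡ + 0
  ∣-small {n} {r} d small with ∣ r ∣ in eq | ∣⇒∣ᵤ d
  ... | zero  | _ = ℤₚ.∣i∣≡0⇒i≡0 eq
  ... | suc m | e = ⊥-elim (ℕᵈ.>⇒∤ small e)

  small-difference : ∀ {n a b} → a ℕ.< n → b ℕ.< n → ∣ + a - + b ∣ ℕ.< n
  small-difference {n} {a} {b} a<n b<n =
    subst (ℕ._< n) (cong ∣_∣ (sym (ℤₚ.[+m]-[+n]≡m⊖n a b))) (ℕₚ.≤-<-trans (ℤₚ.∣m⊝n∣≤m⊔n a b) (ℕₚ.⊔-pres-<m a<n b<n))

  ι-injective : ∀ {n} {x y : Fin n} → ι x ≈ ι y [ + n ] → x ≡ y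
  ι-injective {n} {x} {y} e =
    Finₚ.toℕ-injective (ℤₚ.+-injective (ℤₚ.i-j≡0⇒i≡j (ι x) (ι y) (∣-small (div e) (small-difference (Finₚ.toℕ<n x) (Finₚ.toℕ<n y)))))

  resid-cong : ∀ n .{{_ : NonZero n}} {x y} → x ≈ y [ + n ] → resid n x ≡ resid n y
  resid-cong n {x} {y} e = ι-injective (≈-trans (ι-resid n x) (≈-trans e (≈-sym (ι-resid n y))))

  resid-≈ : ∀ n .{{_ : NonZero n}} {x y} → resid n x ≡ resid n y → x ≈ y [ + n ]
  resid-≈ n {x} {y} e = ≈-trans (≈-sym (ι-resid n x)) (≈-trans (≈-reflexive (cong ι e)) (ι-resid n y))

  resid-ι : ∀ {n} .{{_ : NonZero n}} (x : Fin n) → resid n (ι x) ≡ x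
  resid-ι {n} x = ι-injective (ι-resid n (ι x))

  Unit : ℤ → ℤ → Set
  Unit n x = ∃ λ y → x * y ≈ + 1 [ n ]

  unit-cancel : ∀ {n u x} → Unit n u → n ∣ u * x → n ∣ x
  unit-cancel {n} {u} {x} (v , mod e) d = lin₂ d e v (- x) (x≡v*[u*x]+-x*[u*v-1] u v x)

  coprime⇒bezout : ∀ {m n} → Coprime m n → ∃₂ λ a b → a * + m + b * + n ≡ + 1
  coprime⇒bezout {m} {n} c with coprime-Bézout c
  ... | Bézout.+- x y eq = + x , - + y , (trans (cong₂ _+_ (sym (ℤₚ.pos-* x m)) refl) (trans (cong (_+ (- + y * + n)) e) ([1+y*n]+[-y*n]≡1 (+ y) (+ n))))
    where
    e : + (x ℕ.* m) ≡ + 1 + + y * + n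
    e = trans (cong +_ (sym eq)) (trans (ℤₚ.pos-+ 1 (y ℕ.* n)) (cong (λ z → + 1 + z) (ℤₚ.pos-* y n)))
  ... | Bézout.-+ x y eq = - + x , + y , trans (cong (λ z → (- + x * + m) + z) e) ([-x*m]+[1+x*m]≡1 (+ x) (+ m))
    where
    e : + y * + n ≡ + 1 + + x * + m
    e = trans (sym (ℤₚ.pos-* y n)) (trans (cong +_ (sym eq)) (trans (ℤₚ.pos-+ 1 (x ℕ.* m)) (cong (λ z → + 1 + z) (ℤₚ.pos-* x m))))

  prime-coprime : ∀ {p m} → Prime p → ¬ (p ℕᵈ.∣ m) → Coprime p m
  prime-coprime {p} {m} pr p∤m {d} (d∣p , d∣m) with prime⇒irreducible pr d∣p
  ... | inj₁ d≡1  = d≡1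
  ... | inj₂ refl = ⊥-elim (p∤m d∣m)

  prime-unit : ∀ {p} → Prime p → ∀ x → ¬ (+ p ∣ x) → Unit (+ p) x
  prime-unit {p} pr x p∤x with coprime⇒bezout (prime-coprime {m = ∣ x ∣} pr (λ d → p∤x (∣ᵤ⇒∣ d)))
  ... | a , b , e with ℤₚ.+∣i∣≡i⊎+∣i∣≡-i x
  ...   | inj₁ f = b , mod (divides (- a) (trans (cong (_- + 1) (cong (_* b) (sym f))) (trans (cong (_-_ (+ ∣ x ∣ * b)) (sym e)) (x*b-[a*p+b*x]≡-a*p a (+ p) b (+ ∣ x ∣)))))
  ...   | inj₂ f = - b , mod (divides (- a) (trans (cong (λ z → z * (- b) - + 1) x≡) (trans (cong (_-_ (- (+ ∣ x ∣) * - b)) (sym e)) ([-x]*[-b]-[a*p+b*x]≡-a*p a (+ p) b (+ ∣ x ∣)))))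
    where
    x≡ : x ≡ - (+ ∣ x ∣)
    x≡ = trans (sym (ℤₚ.neg-involutive x)) (cong -_ (sym f))

  unit-^ : ∀ {p x} a → Unit p x → Unit (p ^ suc a) x
  unit-^ {p} {x} zero (y , e) = y , subst (λ z → x * y ≈ + 1 [ z ]) (sym (ℤₚ.*-identityʳ p)) e
  unit-^ {p} {x} (suc a) (y , mod (divides q e)) with unit-^ {p} {x} a (y , mod (divides q e))
  -- The errors of two approximate inverses multiply: the witness `w` satisfies
  -- `1 - x * w = (1 - x * y) * (1 - x * z)`, which gains one factor `p`.
  ... | z , mod (divides r f) = z + y - x * z * y ,
    mod (divides (- (q * r)) (trans (x*[z+y-x*z*y]-1≡-[[x*y-1]*[x*z-1]] x y z) (trans (cong₂ (λ s t → - (s * t)) e f) (-[[q*p]*[r*P]]≡-[q*r]*[p*P] q p r (p ^ suc a)))))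

-- Multiplier groups, and rigidity modulo odd prime powers.

module Multipliers where

  open Matching
  open Congruence
  open Identities
  open import Data.Nat as ℕ using (ℕ; zero; suc; NonZero)
  import Data.Nat.Properties as ℕₚ
  open import Data.Nat.Primality using (Prime; prime⇒nonZero)
  open import Data.Integer using (ℤ; +_; -_; _+_; _-_; _*_; _^_; ∣_∣)
  import Data.Integer.Properties as ℤₚ
  open import Data.Integer.Divisibility.Signed using (_∣_; divides; _∣?_; ∣-trans; ∣-refl)
  open import Data.Fin using (Fin; toℕ)
  open import Data.Product using (Σ; ∃; _×_; _,_)
  open import Data.Empty using (⊥-elim)
  open import Function.Bundles using (_↔_)
  open import Relation.Binary.PropositionalEquality using (_≡_; refl; sym; trans; cong; subst)
  open import Relation.Nullary using (¬_; Dec; yes; no)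

  record MultiplierGroup (n : ℤ) (K : ℤ → Set) : Set where
    field
      dec  : ∀ k → Dec (K k)
      resp : ∀ {k k'} → k ≈ k' [ n ] → K k → K k'
      one  : K (+ 1)
      mul  : ∀ {k k'} → K k → K k' → K (k * k')
      inv  : ∀ {k} → K k → ∃ λ k' → K k' × (k * k' ≈ + 1 [ n ])

    pow : ∀ {k} j → K k → K (k ^ j)
    pow zero    c = one
    pow (suc j) c = mul c (pow j c)

  -- The points that the refinement has already individualised.
  Single : ℤ → (ℤ → ℤ → Set) → ℤ → Set
  Single n R s = ∀ {z} → R s z → z ≈ s [ n ]

  -- A relation R between two copies of ℤ/n that fixes 0 and 1 and is compatible with
  -- the cyclotomic scheme of K in the sense of colour refinement.
  record Equitable (n : ℕ) (K : ℤ → Set) (R : ℤ → ℤ → Set) : Set where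
    field
      step  : ∀ {y y'} → R y y' → Σ (Fin n ↔ Fin n) λ σ → ∀ z →
              R (ι z) (ι (to σ z)) × ∃ λ k → K k × (y' - ι (to σ z) ≈ k * (y - ι z) [ + n ])
      resp  : ∀ {x x' y y'} → x ≈ x' [ + n ] → y ≈ y' [ + n ] → R x y → R x' y'
      zero₁ : Single (+ n) R (+ 0)
      one₁  : Single (+ n) R (+ 1)

    -- `step` accepts every point as a third vertex. A fixed point `s` has to stay in place there,
    -- so the difference from `s` changes by a multiplier.
    compare : .{{_ : NonZero n}} → ∀ {s y y'} → Single (+ n) R s → R y y' → ∃ λ k → K k × (y' - s ≈ k * (y - s) [ + n ])
    compare {s} {y} {y'} single r with step r
    ... | σ , m with m (resid n s)
    ...   | r' , k , Kk , e = k , Kk , ≈-trans (≈-- (≈-refl y') (≈-sym fixed)) (≈-trans e (≈-*ˡ k (≈-- (≈-refl y) (ι-resid n s))))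
      where
      fixed : ι (to σ (resid n s)) ≈ s [ + n ]
      fixed = single (resp (ι-resid n s) (≈-refl _) r')

  -- Two-term expansion of (1 + x)^m with control of the second coefficient.
  expand : ∀ x m → ∃ λ S → ((+ 1 + x) ^ m ≡ + 1 + + m * x + x * x * S) × (+ 2 * S ≈ + m * (+ m - + 1) [ x ])
  expand x zero = + 0 , 1≡1+0*x+x*x*0 x , ≈-reflexive refl
  expand x (suc m) with expand x m
  ... | S , e , mod (divides q f) = + m + S * (+ 1 + x) ,
    trans (cong ((+ 1 + x) *_) e) (trans ([1+x]*[1+m*x+x*x*S]≡1+[1+m]*x+x*x*[m+S*[1+x]] x (+ m) S) (cong (λ z → + 1 + z * x + x * x * (+ m + S * (+ 1 + x))) (sym (ℤₚ.pos-+ 1 m)))) ,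
    mod (divides (+ 2 * S + q) (trans (cong (λ z → + 2 * (+ m + S * (+ 1 + x)) - z * (z - + 1)) (ℤₚ.pos-+ 1 m))
      (trans (2*[m+S*[1+x]]-[1+m]*[[1+m]-1]≡2*S*x+[2*S-m*[m-1]] x (+ m) S) (trans (cong (λ z → + 2 * S * x + z) f) (2*S*x+q*x≡[2*S+q]*x S x q)))))

  module Descent {n : ℤ} {C : ℤ → Set} (mult : MultiplierGroup n C) (p : ℤ) (q e₀ : ℕ)
    (lift : ∀ d t → ∃ λ t' → (t' ≈ t [ p ]) × ((+ 1 + p ^ (d ℕ.+ e₀) * t) ^ q ≡ + 1 + p ^ (suc d ℕ.+ e₀) * t')) where

    open MultiplierGroup mult

    -- Each `q`-th power moves the deviation from 1 up by one factor `p` and keeps `t` modulo `p`,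
    -- until the level is reached at which divisibility of `t` is known.
    raise : ∀ g d t → C (+ 1 + p ^ (d ℕ.+ e₀) * t) →
            (∀ t → C (+ 1 + p ^ ((g ℕ.+ d) ℕ.+ e₀) * t) → p ∣ t) → p ∣ t
    raise zero    d t c top = top t c
    raise (suc g) d t c top with lift d t
    ... | t' , mod e , f = lin₂ e (raise g (suc d) t' (subst C f (pow q c)) (λ u cu → top u (subst (λ z → C (+ 1 + p ^ (z ℕ.+ e₀) * u)) (ℕₚ.+-suc g d) cu)))
                            (- + 1) (+ 1) (t≡-1*[t'-t]+1*t' t t')

    -- If 1 + p^T t ∈ C only for p ∣ t, then an element of C that is 1 modulo p^e₀ is 1 modulo p^(T+1).
    descend : ∀ T → (∀ t → C (+ 1 + p ^ (T ℕ.+ e₀) * t) → p ∣ t) → ∀ {k} → C k → k ≈ + 1 [ p ^ e₀ ] →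
              ∀ d → d ℕ.≤ suc T → k ≈ + 1 [ p ^ (d ℕ.+ e₀) ]
    descend T top c e zero    _  = e
    descend T top {k} c e (suc d) d≤T with descend T top c e d (ℕₚ.≤-trans (ℕₚ.n≤1+n d) d≤T)
    ... | mod (divides t f) with raise (T ℕ.∸ d) d t (subst C (trans (k≡1+[k-1] k) (cong (λ z → + 1 + z) (trans f (ℤₚ.*-comm t (p ^ (d ℕ.+ e₀)))))) c)
                             (λ u cu → top u (subst (λ z → C (+ 1 + p ^ (z ℕ.+ e₀) * u)) (ℕₚ.m∸n+n≡m (ℕ.s≤s⁻¹ d≤T)) cu))
    ...   | divides s refl = mod (divides s (trans f (ℤₚ.*-assoc s p (p ^ (d ℕ.+ e₀)))))

  module _ (p : ℕ) (pr : Prime p) where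

    private instance
      p≢0 : NonZero p
      p≢0 = prime⇒nonZero pr

    pow-cancel : ∀ e {x y} → (+ p) ^ e * x ≡ (+ p) ^ e * y → x ≡ y
    pow-cancel zero    {x} {y} f = trans (sym (ℤₚ.*-identityˡ x)) (trans f (ℤₚ.*-identityˡ y))
    pow-cancel (suc e) {x} {y} f = pow-cancel e (ℤₚ.*-cancelˡ-≡ (+ p) _ _
      (trans (sym (ℤₚ.*-assoc (+ p) ((+ p) ^ e) x)) (trans f (ℤₚ.*-assoc (+ p) ((+ p) ^ e) y))))

    pow-cancel-∣ : ∀ e {x y} → (+ p) ^ e * x ∣ (+ p) ^ e * y → x ∣ y
    pow-cancel-∣ e {x} {y} (divides q f) = divides q (pow-cancel e (trans f (q*[P*x]≡P*[q*x] q ((+ p) ^ e) x)))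

  -- p odd, modulus P = p² p^b, H = P / p.
  module OddPrimePower (p : ℕ) (pr : Prime p) (odd : ¬ (+ p ∣ + 2)) (b : ℕ) {C : ℤ → Set} {R : ℤ → ℤ → Set}
    (mult : MultiplierGroup ((+ p) ^ suc (suc b)) C)
    (quad : ∀ c → (∀ t → C (+ 1 + c * t)) → (+ p) ^ suc (suc b) ∣ + 2 * c)
    (zero₁ : Single ((+ p) ^ suc (suc b)) R (+ 0)) (one₁ : Single ((+ p) ^ suc (suc b)) R (+ 1))
    (compare : ∀ {s x x'} → Single ((+ p) ^ suc (suc b)) R s → R x x' → ∃ λ k → C k × (x' - s ≈ k * (x - s) [ (+ p) ^ suc (suc b) ])) where

    open MultiplierGroup mult

    private
      instance
        p≢0 : NonZero p
        p≢0 = prime⇒nonZero pr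

      H P : ℤ
      H = (+ p) ^ suc b
      P = (+ p) ^ suc (suc b)

      H∣P : H ∣ P
      H∣P = divides (+ p) refl

      -- `H * H` vanishes modulo `P`, so powers of `1 + H * t` are linear in the exponent.
      power : ∀ t j → (+ 1 + H * t) ^ j ≈ + 1 + H * (+ j * t) [ P ]
      power t j with expand (H * t) j
      ... | S , e , _ = mod (divides ((+ p) ^ b * t * t * S) (trans (cong (_- (+ 1 + H * (+ j * t))) e) ([1+j*[p*h*t]+[p*h*t]*[p*h*t]*S]-[1+p*h*[j*t]]≡h*t*t*S*[p*[p*h]] (+ p) ((+ p) ^ b) t (+ j) S)))

      -- The second coefficient `S` of the expansion is divisible by `p`: twice it is congruent to
      -- `p * (p - 1)` modulo `Q * t`, and `p` is odd.
      lift : ∀ d t → ∃ λ t' → (t' ≈ t [ + p ]) × ((+ 1 + (+ p) ^ (d ℕ.+ 1) * t) ^ p ≡ + 1 + (+ p) ^ (suc d ℕ.+ 1) * t')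
      lift d t with expand ((+ p) ^ (d ℕ.+ 1) * t) p
      ... | S , e , mod f = t + Q * t * t * s , mod (lin₁ p∣Q (t * t * s) ([t+Q*t*t*s]-t≡t*t*s*Q t Q s)) , trans e (trans (cong (λ z → + 1 + + p * (Q * t) + Q * t * (Q * t) * z) S≡) (1+p*[Q*t]+Q*t*[Q*t]*[s*p]≡1+p*Q*[t+Q*t*t*s] (+ p) Q t s))
        where
        Q = (+ p) ^ (d ℕ.+ 1)
        p∣Q : + p ∣ Q
        p∣Q = subst (λ z → + p ∣ (+ p) ^ z) (sym (ℕₚ.+-comm d 1)) (divides ((+ p) ^ d) (ℤₚ.*-comm (+ p) ((+ p) ^ d)))
        p∣S : + p ∣ S
        p∣S = unit-cancel {u = + 2} (prime-unit pr (+ 2) odd) (lin₂ (∣-trans (lin₁ p∣Q t (ℤₚ.*-comm Q t)) f) ∣-refl (+ 1) (+ p - + 1) (2*S≡1*[2*S-p*[p-1]]+[p-1]*p S (+ p)))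
        s = _∣_.quotient p∣S
        S≡ : S ≡ s * + p
        S≡ = _∣_.equality p∣S

      -- For `t` prime to `p` the powers of `1 + H * t` run through all `1 + H * u`. Then `quad`
      -- would make `P` divide `2 * H`, which is impossible for odd `p`.
      notC : ∀ t → C (+ 1 + H * t) → + p ∣ t
      notC t c with + p ∣? t
      ... | yes d = d
      ... | no ¬d with prime-unit pr t ¬d
      ...   | s , mod ts = ⊥-elim (odd (pow-cancel-∣ p pr (suc b) (subst (_∣ (H * + 2)) (ℤₚ.*-comm (+ p) H) (subst (P ∣_) (ℤₚ.*-comm (+ 2) H) (quad H all)))))
        where
        all : ∀ u → C (+ 1 + H * u)
        all u = resp (≈-trans (power t j) (mod (lin-H ([1+H*[j*t]]-[1+H*u]≡H*[j*t-u] H (+ j) t u) jt))) (pow j c)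
          where
          j = toℕ (resid p (s * u))
          jt : + p ∣ (+ j * t - u)
          jt = lin₂ (div (ι-resid p (s * u))) ts t u (j*t-u≡t*[j-s*u]+u*[t*s-1] (+ j) t u s)
          lin-H : ∀ {z v} → z ≡ H * v → + p ∣ v → P ∣ z
          lin-H {z} f (divides q refl) = divides q (trans f (H*[q*p]≡q*[p*H] H q (+ p)))

      near-one : ∀ {k} → C k → k ≈ + 1 [ H ] → k ≈ + 1 [ P ]
      near-one {k} c (mod (divides t f)) with notC t (subst C (trans (k≡1+[k-1] k) (cong (λ z → + 1 + z) (trans f (ℤₚ.*-comm t H)))) c)
      ... | divides s refl = mod (divides s (trans f (ℤₚ.*-assoc s (+ p) H)))

      open Descent mult (+ p) p 1 lift

      one-mod-p : ∀ {k} → C k → k ≈ + 1 [ + p ] → k ≈ + 1 [ P ]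
      one-mod-p {k} c e = subst (λ z → k ≈ + 1 [ (+ p) ^ z ]) (ℕₚ.+-comm (suc b) 1)
        (descend b (λ t c → notC t (subst (λ z → C (+ 1 + (+ p) ^ z * t)) (ℕₚ.+-comm b 1) c)) c
          (subst (λ z → k ≈ + 1 [ z ]) (sym (ℤₚ.*-identityʳ (+ p))) e) (suc b) ℕₚ.≤-refl)

      -- Subtracting the two congruences gives `k' = k` modulo `H`, hence modulo `P` by `near-one`.
      -- What is left is `H * (k - 1) = 0`, so `k` is 1 modulo `p` and therefore modulo `P`.
      separate : ∀ {X X' k k'} → C k → C k' → X' ≈ k * X [ P ] → X' - H ≈ k' * (X - H) [ P ] → Unit P X → X' ≈ X [ P ]
      separate {X} {X'} {k} {k'} c c' (mod e) (mod e') (Y , mod u) with inv c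
      ... | k* , c* , mod i = mod (lin₂ e (div k≈1) (+ 1) X (X'-X≡1*[X'-k*X]+X*[k-1] X X' k))
        where
        r = k' * k*
        main : P ∣ ((k' - k) * X - (k' - + 1) * H)
        main = lin₂ e e' (+ 1) (- + 1) ([k'-k]*X-[k'-1]*H≡1*[X'-k*X]+-1*[[X'-H]-k'*[X-H]] X X' k k' H)
        k'≈k-H : H ∣ (k' - k)
        k'≈k-H = lin₃ (∣-trans H∣P main) ∣-refl (∣-trans H∣P u) Y (Y * (k' - + 1)) (- (k' - k)) (k'-k≡Y*[[k'-k]*X-[k'-1]*H]+Y*[k'-1]*H+-[k'-k]*[X*Y-1] X Y k k' H)
        r≈1 : r ≈ + 1 [ P ]
        r≈1 = near-one (mul c' c*) (mod (lin₂ k'≈k-H (∣-trans H∣P i) k* (+ 1) (k'*k*-1≡k**[k'-k]+1*[k*k*-1] k k' k*)))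
        k'≈k : P ∣ (k' - k)
        k'≈k = lin₂ (div r≈1) i k (- k') (k'-k≡k*[k'*k*-1]+-k'*[k*k*-1] k k' k*)
        k≈1 : k ≈ + 1 [ P ]
        k≈1 = one-mod-p c (mod (pow-cancel-∣ p pr (suc b) (subst (_∣ (H * (k - + 1))) (ℤₚ.*-comm (+ p) H)
          (lin₂ k'≈k main (X - H) (- + 1) (H*[k-1]≡[X-H]*[k'-k]+-1*[[k'-k]*X-[k'-1]*H] X k k' H)))))

      -- Comparison with 0 shows that `H` divides `z`; then the multiplier in the comparison with 1
      -- is 1 modulo `H`, hence modulo `P`.
      H-single : Single P R H
      H-single {z} r with compare zero₁ r | compare one₁ r
      ... | k , c , mod e | k' , c' , mod e' = mod (lin₂ e' (div (near-one c' (mod (lin₃ (∣-trans H∣P e) (∣-trans H∣P e') ∣-refl (- + 1) (+ 1) (k' - k) (k'-1≡-1*[[z-0]-k*[H-0]]+1*[[z-1]-k'*[H-1]]+[k'-k]*H z k k' H))))) (+ 1) (H - + 1) (z-H≡1*[[z-1]-k'*[H-1]]+[H-1]*[k'-1] z k' H))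

      1+H-single : Single P R (+ 1 + H)
      1+H-single {z} r with compare zero₁ r | compare one₁ r
      ... | k' , c' , mod e' | k , c , mod e = mod (lin₂ e' (div (near-one c' (mod (lin₃ (∣-trans H∣P e) (∣-trans H∣P e') ∣-refl (+ 1) (- + 1) (k - k') (k'-1≡1*[[z-1]-k*[1+H-1]]+-1*[[z-0]-k'*[1+H-0]]+[k-k']*H z k k' H))))) (+ 1) (+ 1 + H) (z-[1+H]≡1*[[z-0]-k'*[1+H-0]]+[1+H]*[k'-1] z k' H))

      around : ∀ s {x x'} → Single P R s → Single P R (s + H) → R x x' → ¬ (+ p ∣ (x - s)) → x' ≈ x [ P ]
      around s {x} {x'} ss sH r ¬d with compare ss r | compare sH r
      ... | k , c , e | k' , c' , mod e' =
        mod (subst (P ∣_) ([x'-s]-[x-s]≡x'-x x x' s) (div (separate {x - s} {x' - s} c c' e (mod (subst (P ∣_) ([x'-[s+H]]-k'*[x-[s+H]]≡[x'-s-H]-k'*[x-s-H] x x' s k' H) e')) (unit-^ {x = x - s} (suc b) (prime-unit pr (x - s) ¬d)))))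

    -- One of `x` and `x - 1` is prime to `p`, so one of the pairs 0, `H` and 1, `1 + H` of fixed
    -- points determines `x`.
    discrete : ∀ {x x'} → R x x' → x' ≈ x [ P ]
    discrete {x} {x'} r with + p ∣? (x - + 0)
    ... | no ¬d = around (+ 0) zero₁ (subst (Single P R) (sym (ℤₚ.+-identityˡ H)) H-single) r ¬d
    ... | yes d = around (+ 1) one₁ 1+H-single r λ d' → odd (lin₂ d d' (+ 2) (- + 2) (2≡2*[x-0]+-2*[x-1] x))

-- Rigidity modulo powers of two.

module PowersOfTwo where

  open Congruence
  open Multipliers
  open Identities
  open import Data.Nat as ℕ using (ℕ; zero; suc)
  import Data.Nat.Properties as ℕₚ
  open import Data.Nat.Primality using (Prime; prime?)
  open import Data.Integer using (ℤ; +_; -_; _+_; _-_; _*_; _^_; ∣_∣)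
  import Data.Integer.Properties as ℤₚ
  open import Data.Integer.Divisibility.Signed using (_∣_; divides; _∣?_; ∣-trans; ∣-refl)
  open import Data.Fin using () renaming (zero to fz; suc to fs)
  open import Data.Product using (∃; _×_; _,_)
  open import Data.Sum using (_⊎_; inj₁; inj₂)
  open import Data.Empty using (⊥-elim)
  open import Relation.Binary.PropositionalEquality using (_≡_; refl; sym; trans; cong; cong₂; subst)
  open import Relation.Nullary using (¬_; yes; no)
  open import Relation.Nullary.Decidable using (from-no; from-yes)

  data Mod4 (x : ℤ) : Set where
    is0 : x ≈ + 0 [ + 4 ] → Mod4 x
    is1 : x ≈ + 1 [ + 4 ] → Mod4 x
    is2 : x ≈ + 2 [ + 4 ] → Mod4 x
    is3 : x ≈ + 3 [ + 4 ] → Mod4 x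

  mod4 : ∀ x → Mod4 x
  mod4 x with resid 4 x | ι-resid 4 x
  ... | fz                | e = is0 (≈-sym e)
  ... | fs fz             | e = is1 (≈-sym e)
  ... | fs (fs fz)        | e = is2 (≈-sym e)
  ... | fs (fs (fs fz))   | e = is3 (≈-sym e)

  parity : ∀ x → (+ 2 ∣ x) ⊎ (+ 2 ∣ (x - + 1))
  parity x with resid 2 x | ι-resid 2 x
  ... | fz    | e = inj₁ (≈0⇒∣ (≈-sym e))
  ... | fs fz | e = inj₂ (div (≈-sym e))

  2∤1 : ¬ (+ 2 ∣ + 1)
  2∤1 = from-no (+ 2 ∣? + 1)

  prime-2 : Prime 2
  prime-2 = from-yes (prime? 2)

  2∣4 : + 2 ∣ + 4
  2∣4 = divides (+ 2) refl

  module PowerOfTwo {P : ℤ} {C : ℤ → Set} {R : ℤ → ℤ → Set} (mult : MultiplierGroup P C)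
    (zero₁ : Single P R (+ 0)) (one₁ : Single P R (+ 1))
    (compare : ∀ {s x x'} → Single P R s → R x x' → ∃ λ k → C k × (x' - s ≈ k * (x - s) [ P ])) where

    open MultiplierGroup mult

    -- Whichever of `x` and `x - 1` is even absorbs the unknown multiplier.
    modulo-2 : + 2 ∣ P → ∀ {x x'} → R x x' → x' ≈ x [ + 2 ]
    modulo-2 2∣P {x} {x'} r with compare zero₁ r | compare one₁ r
    ... | k , c , mod e | k' , c' , mod e' with parity x
    ...   | inj₁ d = mod (lin₂ (∣-trans 2∣P e) d (+ 1) (k - + 1) (x'-x≡1*[[x'-0]-k*[x-0]]+[k-1]*x x x' k))
    ...   | inj₂ d = mod (lin₂ (∣-trans 2∣P e') d (+ 1) (k' - + 1) (x'-x≡1*[[x'-1]-k*[x-1]]+[k-1]*[x-1] x x' k'))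

    sign : + 2 ∣ P → ∀ {k} → C k → (k ≈ + 1 [ + 4 ]) ⊎ (k ≈ + 3 [ + 4 ])
    sign 2∣P {k} c with inv c | mod4 k
    ... | _ | is1 e = inj₁ e
    ... | _ | is3 e = inj₂ e
    ... | k' , _ , mod i | is0 (mod e) = ⊥-elim (2∤1 (lin₂ (∣-trans 2∣4 e) (∣-trans 2∣P i) k' (- + 1) (1≡k'*[k-0]+-1*[k*k'-1] k k')))
    ... | k' , _ , mod i | is2 (mod e) = ⊥-elim (2∤1 (lin₃ (∣-trans 2∣4 e) (∣-trans 2∣P i) ∣-refl k' (- + 1) k' (1≡k'*[k-2]+-1*[k*k'-1]+k'*2 k k')))

    -- If C is {±1} modulo B then comparing with 0 and 1 settles everything modulo B.
    modulo : ∀ B → + 4 ∣ B → B ∣ P → (∀ {k} → C k → k ≈ + 1 [ + 4 ] → k ≈ + 1 [ B ]) → ∀ {x x'} → R x x' → x' ≈ x [ B ]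
    modulo B 4∣B B∣P G {x} {x'} r with compare zero₁ r | compare one₁ r
    ... | k , c , mod e | k' , c' , mod e' with sign (∣-trans 2∣4 (∣-trans 4∣B B∣P)) c | sign (∣-trans 2∣4 (∣-trans 4∣B B∣P)) c'
    ...   | inj₁ k≈1 | _ = mod (lin₂ (∣-trans B∣P e) (div (G c k≈1)) (+ 1) x (x'-x≡1*[[x'-0]-k*[x-0]]+x*[k-1] x x' k))
    ...   | inj₂ _ | inj₁ k'≈1 = mod (lin₂ (∣-trans B∣P e') (div (G c' k'≈1)) (+ 1) (x - + 1) (x'-x≡1*[[x'-1]-k*[x-1]]+[x-1]*[k-1] x x' k'))
    -- Both multipliers are 3 modulo 4, so their quotient is 1 modulo 4 and hence modulo `B`. With
    -- equal multipliers the two comparisons subtract to `k' = 1`, a contradiction.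
    ...   | inj₂ (mod k≈3) | inj₂ (mod k'≈3) with inv c
    ...     | k* , c* , mod i = ⊥-elim (from-no (+ 4 ∣? + 2) (lin₂ (∣-trans 4∣B k'≈1) k'≈3 (+ 1) (- + 1) (2≡1*[k-1]+-1*[k-3] k')))
      where
      r≈1 : (k' * k*) ≈ + 1 [ B ]
      r≈1 = G (mul c' c*) (mod (lin₃ k'≈3 k≈3 (∣-trans (∣-trans 4∣B B∣P) i) k* (- k*) (+ 1) (k'*k*-1≡k**[k'-3]+-k**[k-3]+1*[k*k*-1] k k' k*)))
      k'≈k : B ∣ (k' - k)
      k'≈k = lin₂ (div r≈1) (∣-trans B∣P i) k (- k') (k'-k≡k*[k'*k*-1]+-k'*[k*k*-1] k k' k*)
      k'≈1 : B ∣ (k' - + 1)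
      k'≈1 = lin₃ k'≈k (∣-trans B∣P e) (∣-trans B∣P e') x (- + 1) (+ 1) (k'-1≡x*[k'-k]+-1*[[x'-0]-k*[x-0]]+1*[[x'-1]-k'*[x-1]] x x' k k')

    modulo-4 : P ≡ + 4 → ∀ {x x'} → R x x' → x' ≈ x [ + 4 ]
    modulo-4 refl = modulo (+ 4) ∣-refl ∣-refl (λ _ e → e)

  -- This is 2 to the power `b + 1`. The case split gives the exponent the shape `_ + 2` that
  -- `Descent` produces.
  quarter : ℕ → ℤ
  quarter zero    = + 2
  quarter (suc b) = (+ 2) ^ (b ℕ.+ 2)

  -- P = 2^(b+3) with half H and quarter Q.
  module HigherPowerOfTwo (b : ℕ) {C : ℤ → Set} {R : ℤ → ℤ → Set} (mult : MultiplierGroup ((+ 2) ^ (suc b ℕ.+ 2)) C)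
    (quad : ∀ c → (∀ t → C (+ 1 + c * t)) → (+ 2) ^ (suc b ℕ.+ 2) ∣ + 2 * c)
    (zero₁ : Single ((+ 2) ^ (suc b ℕ.+ 2)) R (+ 0)) (one₁ : Single ((+ 2) ^ (suc b ℕ.+ 2)) R (+ 1))
    (compare : ∀ {s x x'} → Single ((+ 2) ^ (suc b ℕ.+ 2)) R s → R x x' → ∃ λ k → C k × (x' - s ≈ k * (x - s) [ (+ 2) ^ (suc b ℕ.+ 2) ])) where

    open MultiplierGroup mult
    open PowerOfTwo mult zero₁ one₁ compare

    private
      P H Q : ℤ
      P = (+ 2) ^ (suc b ℕ.+ 2)
      H = (+ 2) ^ (b ℕ.+ 2)
      Q = quarter b

      half : ∀ b → (+ 2) ^ (b ℕ.+ 2) ≡ + 2 * quarter b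
      half zero    = refl
      half (suc b) = refl

      4∣ : ∀ b → + 4 ∣ (+ 2) ^ (b ℕ.+ 2)
      4∣ zero    = ∣-refl
      4∣ (suc b) = ∣-trans (4∣ b) (divides (+ 2) refl)

      2∣Q : ∀ b → + 2 ∣ quarter b
      2∣Q zero    = ∣-refl
      2∣Q (suc b) = ∣-trans 2∣4 (4∣ b)

      H∣P : H ∣ P
      H∣P = divides (+ 2) refl

      lift : ∀ d t → ∃ λ t' → (t' ≈ t [ + 2 ]) × ((+ 1 + (+ 2) ^ (d ℕ.+ 2) * t) ^ 2 ≡ + 1 + (+ 2) ^ (suc d ℕ.+ 2) * t')
      lift d t with half d | 2∣Q d
      ... | h | divides q e = t + quarter d * t * t , mod (divides (q * t * t) (trans (cong (λ z → t + z * t * t - t) e) (t+q*2*t*t-t≡q*t*t*2 t q))) ,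
          trans (cong (λ z → (+ 1 + z * t) ^ 2) h) (trans ([1+2*q*t]*[[1+2*q*t]*1]≡1+2*[2*q]*[t+q*t*t] t (quarter d)) (cong (λ z → + 1 + + 2 * z * (t + quarter d * t * t)) (sym h)))

      open Descent mult (+ 2) 2 2 lift

      module Generic (¬half : ¬ C (+ 1 + H)) where
        -- For odd `t` the multiplier is `1 + H` modulo `P`.
        notC : ∀ t → C (+ 1 + H * t) → + 2 ∣ t
        notC t c with parity t
        ... | inj₁ d = d
        ... | inj₂ (divides q e) = ⊥-elim (¬half (resp (mod (divides q (trans ([1+H*t]-[1+H]≡H*[t-1] H t) (trans (cong (H *_) e) (H*[q*2]≡q*[2*H] H q))))) c))

        result : ∀ {x x'} → R x x' → x' ≈ x [ P ]
        result = modulo P (∣-trans (4∣ b) H∣P) ∣-refl (λ c e → descend b notC c e (suc b) ℕₚ.≤-refl)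

      module Special (has-half : C (+ 1 + H)) where

        -- The factor `1 + H = 1 + 2 * Q` raises the parameter by 2 modulo 4. From one odd `t` it
        -- reaches all odd parameters, from 1 all even ones; then `quad` would make `P` divide
        -- `2 * Q = H`.
        notC : ∀ t → C (+ 1 + Q * t) → + 2 ∣ t
        notC t c with parity t
        ... | inj₁ d = d
        ... | inj₂ t-odd = ⊥-elim (2∤1 (pow-cancel-∣ 2 prime-2 (b ℕ.+ 2)
                (subst (_∣ (H * + 1)) (ℤₚ.*-comm (+ 2) H) (subst (P ∣_) (trans (sym (half b)) (sym (ℤₚ.*-identityʳ H))) (quad Q all)))))
          where
          same-parity : ∀ t₀ → C (+ 1 + Q * t₀) → ∀ s → + 2 ∣ (s - t₀) → C (+ 1 + Q * s)
          same-parity t₀ c₀ s (divides v e) with parity v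
          ... | inj₁ (divides u f) = resp (mod (divides (- u) (trans ([1+Q*t]-[1+Q*s]≡-[Q*[s-t]] Q t₀ s) (trans (cong (λ z → - (Q * z)) (trans e (cong (_* + 2) f))) (trans (-[Q*[u*2*2]]≡-u*[2*[2*Q]] Q u) (cong (λ z → - u * (+ 2 * z)) (sym (half b)))))))) c₀
          ... | inj₂ (divides u f) with 2∣Q b
          ...   | divides g h = resp (mod (divides (g * t₀ - u) (trans (cong (λ z → (+ 1 + Q * t₀) * (+ 1 + z) - (+ 1 + Q * s)) (half b))
                    (trans ([1+Q*t]*[1+2*Q]-[1+Q*s]≡2*Q*[Q*t]+2*Q-Q*[s-t] Q t₀ s) (trans (cong (λ z → + 2 * Q * (Q * t₀) + + 2 * Q - Q * z) e)
                      (trans (cong (λ z → + 2 * Q * (Q * t₀) + + 2 * Q - Q * (z * + 2)) (trans (k≡1+[k-1] v) (cong (λ z → + 1 + z) f)))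
                        (trans (cong (λ z → + 2 * Q * (z * t₀) + + 2 * Q - Q * ((+ 1 + u * + 2) * + 2)) h) (trans (2*Q*[g*2*t]+2*Q-Q*[[1+u*2]*2]≡[g*t-u]*[2*[2*Q]] Q t₀ g u) (cong (λ z → (g * t₀ - u) * (+ 2 * z)) (sym (half b))))))))))) (mul c₀ has-half)
          all : ∀ s → C (+ 1 + Q * s)
          all s with parity s
          ... | inj₁ d = same-parity (+ 0) (subst C (1≡1+Q*0 Q) one) s (subst (+ 2 ∣_) (s≡s-0 s) d)
          ... | inj₂ d = same-parity t c s (lin₂ d t-odd (+ 1) (- + 1) (s-t≡1*[s-1]+-1*[t-1] s t))

        -- For `b = 0` the modulus `H` is 4 itself. Otherwise the top level of the descent is `Q`,
        -- one below that of the generic case.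
        near-one : ∀ b' → b' ≡ b → ∀ {k} → C k → k ≈ + 1 [ + 4 ] → k ≈ + 1 [ (+ 2) ^ (b' ℕ.+ 2) ]
        near-one zero     _    c e = e
        near-one (suc b') refl c e = descend b' notC c e (suc b') ℕₚ.≤-refl

        modulo-half : ∀ {x x'} → R x x' → x' ≈ x [ H ]
        modulo-half = modulo H (4∣ b) H∣P (near-one b refl)

        -- Here `x - s` is `2 * y` with `y` odd. As `x` is already known modulo `H`, the multiplier
        -- is 1 modulo `Q`, and by `notC` modulo `2 * Q`; the factor 2 of `x - s` supplies the rest
        -- of `P`.
        separate : ∀ {s x x'} → Single P R s → x - s ≈ + 2 [ + 4 ] → R x x' → x' ≈ x [ P ]
        separate {s} {x} {x'} single (mod (divides v f)) r = conclude (compare single r) (modulo-half r)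
          where
          y = + 1 + + 2 * v
          X≡ : x - s ≡ + 2 * y
          X≡ = trans (X≡[X-2]+2 (x - s)) (trans (cong (λ z → z + + 2) f) (v*4+2≡2*[1+2*v] v))
          y-odd : ¬ (+ 2 ∣ y)
          y-odd d = 2∤1 (lin₂ d ∣-refl (+ 1) (- v) (1≡1*[1+2*v]+-v*2 v))
          y-unit : Unit Q y
          y-unit = let y' , u = unit-^ {x = y} (b ℕ.+ 2) (prime-unit prime-2 y y-odd) in
            y' , ≈-weaken (∣-trans (divides (+ 2) (half b)) H∣P) u
          conclude : (∃ λ k → C k × (x' - s ≈ k * (x - s) [ P ])) → x' ≈ x [ H ] → x' ≈ x [ P ]
          conclude (k , c , mod e) (mod e') = mod (lin₂ e P∣ (+ 1) (+ 1) (x'-x≡1*[[x'-s]-k*[x-s]]+1*[[k-1]*[x-s]] x x' s k))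
            where
            Q∣k-1 : Q ∣ (k - + 1)
            Q∣k-1 = unit-cancel {u = y} y-unit (pow-cancel-∣ 2 prime-2 1
              (subst (_∣ ((+ 2) ^ 1 * (y * (k - + 1)))) (half b)
                (subst (H ∣_) (trans (cong ((k - + 1) *_) X≡) ([k-1]*[2*y]≡2*1*[y*[k-1]] k y))
                  (lin₂ e' (∣-trans H∣P e) (+ 1) (- + 1) ([k-1]*[x-s]≡1*[x'-x]+-1*[[x'-s]-k*[x-s]] x x' s k)))))
            g = _∣_.quotient Q∣k-1
            2∣g : + 2 ∣ g
            2∣g = notC g (subst C (trans (k≡1+[k-1] k) (cong (λ z → + 1 + z) (trans (_∣_.equality Q∣k-1) (ℤₚ.*-comm g Q)))) c)
            P∣ : P ∣ ((k - + 1) * (x - s))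
            P∣ = divides (_∣_.quotient 2∣g * y)
              (trans (cong₂ _*_ (trans (_∣_.equality Q∣k-1) (cong (_* Q) (_∣_.equality 2∣g))) X≡)
                (trans ([g*2*Q]*[2*y]≡g*y*[2*[2*Q]] (_∣_.quotient 2∣g) Q y) (cong (λ z → _∣_.quotient 2∣g * y * (+ 2 * z)) (sym (half b)))))

        result : ∀ {x x'} → R x x' → x' ≈ x [ P ]
        result {x} {x'} r with mod4 x
        ... | is2 e = separate zero₁ (≈-- e (≈-refl (+ 0))) r
        ... | is3 e = separate one₁ (≈-- e (≈-refl (+ 1))) r
        -- 2 and 3 are fixed by the two previous cases, being at distance 2 from 0 and 1; they serve
        -- the remaining residues modulo 4.
        ... | is0 e = separate {+ 2} (separate zero₁ (≈-refl (+ 2))) (≈-trans (≈-- e (≈-refl (+ 2))) (mod (divides (- + 1) refl))) r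
        ... | is1 e = separate {+ 3} (separate one₁ (≈-refl (+ 2))) (≈-trans (≈-- e (≈-refl (+ 3))) (mod (divides (- + 1) refl))) r

    discrete : ∀ {x x'} → R x x' → x' ≈ x [ P ]
    discrete with dec (+ 1 + H)
    ... | yes c = Special.result c
    ... | no ¬c = Generic.result ¬c

-- Binomial coefficients, and sums and products over residues.

module FiniteSums where

  open Matching
  open Congruence
  open Identities
  open import Data.Nat as ℕ using (ℕ; zero; suc; NonZero)
  import Data.Nat.Properties as ℕₚ
  import Data.Nat.Divisibility as ℕᵈ
  open import Data.Nat.Primality using (Prime; euclidsLemma)
  open import Data.Nat.Combinatorics using (_C_; nCk+nC[k+1]≡[n+1]C[k+1]; k>n⇒nCk≡0)
  open import Data.Integer using (ℤ; +_; -_; _+_; _-_; _*_; _^_; ∣_∣)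
  import Data.Integer.Properties as ℤₚ
  open import Data.Integer.Divisibility.Signed using (_∣_)
  open import Data.Integer.Tactic.RingSolver using (solve-∀)
  import Data.Nat.Tactic.RingSolver as ℕSolver
  open import Data.Fin using (Fin) renaming (zero to fz; suc to fs)
  open import Data.Bool using (Bool; true; false; if_then_else_)
  open import Data.Product using (Σ; _,_)
  open import Data.Sum using (inj₁; inj₂)
  open import Data.Empty using (⊥-elim)
  open import Function using (_∘_)
  open import Function.Bundles using (_↔_)
  open import Relation.Binary.PropositionalEquality using (_≡_; refl; sym; trans; cong; cong₂; subst)
  open import Relation.Nullary using (¬_; Dec; yes; no)
  open import Relation.Nullary.Decidable using (⌊_⌋)
  open import Defs using (count)
  open import Algebra.Properties.CommutativeMonoid.Sum ℤₚ.+-0-commutativeMonoid using (sum) renaming (sum-permute to sum-permuteᶻ)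
  open import Algebra.Properties.CommutativeMonoid.Sum ℤₚ.*-1-commutativeMonoid using () renaming (sum to product; sum-permute to product-permute)

  -- Pascal's triangle modulo a prime

  C-absorb : ∀ n k → suc k ℕ.* (suc n C suc k) ≡ suc n ℕ.* (n C k)
  C-absorb zero zero = refl
  C-absorb zero (suc k) = trans (cong (suc (suc k) ℕ.*_) (k>n⇒nCk≡0 {1} {suc (suc k)} (ℕ.s≤s (ℕ.s≤s ℕ.z≤n)))) (ℕₚ.*-zeroʳ (suc (suc k)))
  C-absorb (suc n) zero = trans (cong (1 ℕ.*_) (sym (nCk+nC[k+1]≡[n+1]C[k+1] (suc n) 0)))
    (trans (identity (suc n C 1)) (trans (cong suc (C-absorb n 0)) (identity' n)))
    where
    identity : ∀ c → 1 ℕ.* (1 ℕ.+ c) ≡ suc (1 ℕ.* c)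
    identity = ℕSolver.solve-∀
    identity' : ∀ n → suc (suc n ℕ.* 1) ≡ suc (suc n) ℕ.* 1
    identity' = ℕSolver.solve-∀
  C-absorb (suc n) (suc k) =
    trans (cong (suc (suc k) ℕ.*_) (sym (nCk+nC[k+1]≡[n+1]C[k+1] (suc n) (suc k))))
      (trans (identity k (suc n C suc k) (suc n C suc (suc k)))
        (trans (cong₂ (λ a b → a ℕ.+ (suc n C suc k) ℕ.+ b) (C-absorb n k) (C-absorb n (suc k)))
          (trans (identity' n (n C k) (n C suc k) (suc n C suc k))
            (trans (cong (λ z → suc n ℕ.* z ℕ.+ (suc n C suc k)) (nCk+nC[k+1]≡[n+1]C[k+1] n k)) (identity'' n (suc n C suc k))))))
    where
    identity : ∀ k a b → suc (suc k) ℕ.* (a ℕ.+ b) ≡ suc k ℕ.* a ℕ.+ a ℕ.+ suc (suc k) ℕ.* b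
    identity = ℕSolver.solve-∀
    identity' : ∀ n x y a → suc n ℕ.* x ℕ.+ a ℕ.+ suc n ℕ.* y ≡ suc n ℕ.* (x ℕ.+ y) ℕ.+ a
    identity' = ℕSolver.solve-∀
    identity'' : ∀ n a → suc n ℕ.* a ℕ.+ a ≡ suc (suc n) ℕ.* a
    identity'' = ℕSolver.solve-∀

  -- Absorption turns `suc k` times the coefficient into `suc n` times a smaller one, and `suc n` is
  -- below `p`.
  prime∤C : ∀ {p} → Prime p → ∀ n k → k ℕ.≤ n → n ℕ.< p → ¬ (p ℕᵈ.∣ n C k)
  prime∤C {p} pr n zero _ n<p d with ℕᵈ.∣1⇒≡1 d
  ... | refl with () ← pr
  prime∤C {p} pr (suc n) (suc k) (ℕ.s≤s k≤n) n<p d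
    with euclidsLemma (suc n) (n C k) pr (subst (p ℕᵈ.∣_) (C-absorb n k) (ℕᵈ.∣n⇒∣m*n (suc k) d))
  ... | inj₁ d' = ℕᵈ.>⇒∤ n<p d'
  ... | inj₂ d' = prime∤C pr n k k≤n (ℕₚ.<-trans (ℕₚ.n<1+n n) n<p) d'

  sum-≈ : ∀ {n m} {f g : Fin m → ℤ} → (∀ z → f z ≈ g z [ n ]) → sum f ≈ sum g [ n ]
  sum-≈ {m = zero}  e = ≈-refl (+ 0)
  sum-≈ {m = suc m} e = ≈-+ (e fz) (sum-≈ (e ∘ fs))

  sum-+ : ∀ {m} (f g : Fin m → ℤ) → sum (λ z → f z + g z) ≡ sum f + sum g
  sum-+ {zero}  f g = refl
  sum-+ {suc m} f g = trans (cong (λ s → f fz + g fz + s) (sum-+ (f ∘ fs) (g ∘ fs))) (a+b+[c+d]≡a+c+[b+d] (f fz) (g fz) (sum (f ∘ fs)) (sum (g ∘ fs)))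

  sum-* : ∀ {m} a (f : Fin m → ℤ) → sum (λ z → a * f z) ≡ a * sum f
  sum-* {zero}  a f = sym (ℤₚ.*-zeroʳ a)
  sum-* {suc m} a f = trans (cong (λ s → a * f fz + s) (sum-* a (f ∘ fs))) (sym (ℤₚ.*-distribˡ-+ a (f fz) (sum (f ∘ fs))))

  sum-neg : ∀ {m} (f : Fin m → ℤ) → sum (λ z → - f z) ≡ - sum f
  sum-neg {zero}  f = refl
  sum-neg {suc m} f = trans (cong (λ s → - f fz + s) (sum-neg (f ∘ fs))) (sym (ℤₚ.neg-distrib-+ (f fz) (sum (f ∘ fs))))

  sum-one : ∀ m → sum {m} (λ _ → + 1) ≡ + m
  sum-one zero    = refl
  sum-one (suc m) = trans (cong (λ s → + 1 + s) (sum-one m)) (sym (ℤₚ.pos-+ 1 m))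

  product-≈ : ∀ {n m} {f g : Fin m → ℤ} → (∀ z → f z ≈ g z [ n ]) → product f ≈ product g [ n ]
  product-≈ {m = zero}  e = ≈-refl (+ 1)
  product-≈ {m = suc m} e = ≈-* (e fz) (product-≈ (e ∘ fs))

  product-unit : ∀ {n m} {f : Fin m → ℤ} → (∀ z → Unit n (f z)) → Unit n (product f)
  product-unit {m = zero}  u = + 1 , ≈-refl (+ 1)
  product-unit {n} {suc m} {f} u with u fz | product-unit {n} {m} {f ∘ fs} (u ∘ fs)
  ... | y , e | y' , e' = y * y' , ≈-trans (≈-reflexive (a*c*[b*d]≡[a*b]*[c*d] (f fz) y (product (f ∘ fs)) y')) (≈-* e e')

  product-if : ∀ {m} k (s : Fin m → Bool) (g : Fin m → ℤ) →
               product (λ z → (if s z then k else + 1) * g z) ≡ k ^ count s * product g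
  product-if {zero}  k s g = refl
  product-if {suc m} k s g with s fz | product-if k (s ∘ fs) (g ∘ fs)
  ... | true  | e = trans (cong (λ z → k * g fz * z) e) (k*g*[q*r]≡k*q*[g*r] k (g fz) (k ^ count (s ∘ fs)) (product (g ∘ fs)))
  ... | false | e = trans (cong (λ z → + 1 * g fz * z) e) (1*g*[q*r]≡q*[g*r] (g fz) (k ^ count (s ∘ fs)) (product (g ∘ fs)))

  module Affine (n : ℕ) .{{_ : NonZero n}} where

    affine : ∀ u v → Unit (+ n) u → Σ (Fin n ↔ Fin n) λ σ → ∀ z → ι (to σ z) ≈ u * ι z + v [ + n ]
    affine u v unit = let σ , e = injective⇒↔ ℕₚ.≤-refl f inj in
      σ , λ z → ≈-trans (≈-reflexive (cong ι (e z))) (ι-resid n (u * ι z + v))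
      where
      f : Fin n → Fin n
      f z = resid n (u * ι z + v)
      inj : ∀ x y → f x ≡ f y → x ≡ y
      inj x y e = ι-injective (mod (unit-cancel {u = u} unit (lin₁ (div (resid-≈ n {u * ι x + v} {u * ι y + v} e)) (+ 1) (u*[x-y]≡1*[[u*x+v]-[u*y+v]] u v (ι x) (ι y)))))

    sum-affine : ∀ (f : ℤ → ℤ) → (∀ {x y} → x ≈ y [ + n ] → f x ≈ f y [ + n ]) → ∀ v →
                 sum (λ (z : Fin n) → f (ι z + v)) ≈ sum (λ (z : Fin n) → f (ι z)) [ + n ]
    sum-affine f per v = let σ , e = affine (+ 1) v (+ 1 , ≈-refl (+ 1)) in
      ≈-trans (sum-≈ (λ z → per (≈-sym (≈-trans (e z) (≈-reflexive (cong (_+ v) (ℤₚ.*-identityˡ (ι z))))))))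
        (≈-reflexive (sym (sum-permuteᶻ (λ z → f (ι z)) σ)))

    -- Lagrange: multiplication by k permutes S, hence multiplies its product by k^|S|.
    orbit-power : (S : ℤ → Set) (S? : ∀ x → Dec (S x)) → (∀ {x y} → x ≈ y [ + n ] → S x → S y) →
                  (∀ {x} → S x → Unit (+ n) x) → ∀ k → Unit (+ n) k →
                  (∀ {x} → S x → S (k * x)) → (∀ {x} → S (k * x) → S x) →
                  k ^ count (λ (z : Fin n) → ⌊ S? (ι z) ⌋) ≈ + 1 [ + n ]
    orbit-power S S? S-resp S-unit k k-unit fwd bwd =
      let σ , e = affine k (+ 0) k-unit in
      mod (unit-cancel {u = product g} (product-unit g-unit) (lin₁ (div (≈-trans (≈-reflexive (product-permute g σ)) (≈-trans (product-≈ (λ z → point z (to σ z) (e z)))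
        (≈-reflexive (product-if k s g))))) (- + 1) (g*[q-1]≡-1*[g-q*g] (product g) (k ^ count s))))
      where
      s : Fin n → Bool
      s z = ⌊ S? (ι z) ⌋
      g : Fin n → ℤ
      g z = if s z then ι z else + 1
      g-unit : ∀ z → Unit (+ n) (g z)
      g-unit z with S? (ι z)
      ... | yes q = S-unit q
      ... | no _  = + 1 , ≈-refl (+ 1)
      point : ∀ z z' → ι z' ≈ k * ι z + + 0 [ + n ] → g z' ≈ (if s z then k else + 1) * g z [ + n ]
      point z z' e with S? (ι z) | S? (ι z')
      ... | yes _ | yes _ = ≈-trans e (≈-reflexive (k*x+0≡k*x k (ι z)))
      ... | yes q | no ¬q = ⊥-elim (¬q (S-resp (≈-sym (≈-trans e (≈-reflexive (k*x+0≡k*x k (ι z))))) (fwd q)))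
      ... | no ¬q | yes q = ⊥-elim (¬q (bwd (S-resp (≈-trans e (≈-reflexive (k*x+0≡k*x k (ι z)))) q)))
      ... | no _  | no _  = ≈-refl (+ 1)

-- Proper multiplier groups modulo a prime: the polynomial method.

module PrimeDegree where

  open Matching
  open Congruence
  open Multipliers
  open FiniteSums
  open Quotient using (count-∨)
  open import Defs using (count)
  open Identities
  open import Data.Nat as ℕ using (ℕ; zero; suc)
  import Data.Nat.Properties as ℕₚ
  import Data.Nat.Divisibility as ℕᵈ
  open import Data.Nat.Primality using (Prime)
  open import Data.Nat.Combinatorics using (_C_; nCk+nC[k+1]≡[n+1]C[k+1]; k>n⇒nCk≡0)
  open import Data.Integer using (ℤ; +_; -_; _+_; _-_; _*_; _^_; ∣_∣)
  import Data.Integer.Properties as ℤₚ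
  open import Data.Integer.Divisibility.Signed using (_∣_; divides; _∣?_; ∣⇒∣ᵤ)
  open import Data.Fin using (Fin; toℕ) renaming (zero to fz; suc to fs)
  open import Data.Bool using (true; false; _∨_)
  open import Data.Product using (∃₂; _×_; _,_; proj₁; proj₂)
  open import Data.Sum using (_⊎_; inj₁; inj₂)
  open import Data.Empty using (⊥; ⊥-elim)
  open import Function using (_∘_)
  open import Relation.Binary.PropositionalEquality using (_≡_; refl; sym; trans; cong; cong₂; subst)
  open import Relation.Nullary using (¬_; Dec; yes; no)
  open import Relation.Nullary.Decidable using (⌊_⌋; ¬?)
  open import Algebra.Properties.CommutativeMonoid.Sum ℤₚ.+-0-commutativeMonoid using (sum; sum-cong-≗) renaming (sum-permute to sum-permuteᶻ)

  module ModPrime (m : ℕ) (pr : Prime (suc m)) where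

    private
      p : ℤ
      p = + suc m

    open Affine (suc m)

    unit? : ∀ x → Dec (¬ (p ∣ x))
    unit? x = ¬? (p ∣? x)

    small∤ : ∀ j → j ℕ.< suc m → 0 ℕ.< j → ¬ (p ∣ + j)
    small∤ (suc j) j<p _ d = ℕᵈ.>⇒∤ j<p (∣⇒∣ᵤ d)

    ∤-* : ∀ {a b} → ¬ (p ∣ a) → ¬ (p ∣ b) → ¬ (p ∣ a * b)
    ∤-* {a} ¬a ¬b d = ¬b (unit-cancel {u = a} (prime-unit pr a ¬a) d)

    count-units : count (λ (z : Fin (suc m)) → ⌊ unit? (ι z) ⌋) ≡ m
    count-units = trans (cong₂ ℕ._+_ (cong ind (⌊⌋-false (unit? (+ 0)) (λ u → u (divides (+ 0) refl))))
                          (all m (λ z → unit? (ι {suc m} (fs z))) (λ z → small∤ (suc (toℕ z)) (ℕ.s≤s (toℕ<n z)) (ℕ.s≤s ℕ.z≤n)))) refl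
      where
      open import Data.Fin.Properties using (toℕ<n)
      all : ∀ n {Q : Fin n → Set} (Q? : ∀ z → Dec (Q z)) → (∀ z → Q z) → count (λ z → ⌊ Q? z ⌋) ≡ n
      all zero    Q? q = refl
      all (suc n) Q? q = cong₂ ℕ._+_ (cong ind (⌊⌋-true (Q? fz) (q fz))) (all n (Q? ∘ fs) (q ∘ fs))

    fermat : ∀ k → ¬ (p ∣ k) → k ^ m ≈ + 1 [ p ]
    fermat k ¬k = subst (λ c → k ^ c ≈ + 1 [ p ]) count-units
      (orbit-power (λ x → ¬ (p ∣ x)) unit? resp (λ {x} → prime-unit pr x) k (prime-unit pr k ¬k) (∤-* ¬k) (λ ¬kx d → ¬kx (lin₁ d k refl)))
      where
      resp : ∀ {x y} → x ≈ y [ p ] → ¬ (p ∣ x) → ¬ (p ∣ y)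
      resp {x} {y} (mod e) ¬x d = ¬x (lin₂ e d (+ 1) (+ 1) (x≡1*[x-y]+1*y x y))

    -- f is congruent to a polynomial of degree at most D whose D-th coefficient is α.
    data Poly : ℕ → ℤ → (ℤ → ℤ) → Set where
      constant : ∀ {α f} → (∀ x → f x ≈ α [ p ]) → Poly zero α f
      leading  : ∀ {D α f} g β → Poly D β g → (∀ x → f x ≈ α * x ^ suc D + g x [ p ]) → Poly (suc D) α f

    poly-ext : ∀ D {α f f'} → (∀ x → f' x ≈ f x [ p ]) → Poly D α f → Poly D α f'
    poly-ext _ e (constant q) = constant λ x → ≈-trans (e x) (q x)
    poly-ext _ e (leading g β q h) = leading g β q λ x → ≈-trans (e x) (h x)

    poly-raise : ∀ D {α f} → Poly D α f → Poly (suc D) (+ 0) f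
    poly-raise D {α} {f} q = leading f α q λ x → ≈-reflexive (sym (0*y+f≡f (x ^ suc D) (f x)))

    poly-+ : ∀ D {α β f g} → Poly D α f → Poly D β g → Poly D (α + β) (λ x → f x + g x)
    poly-+ zero (constant q) (constant r) = constant λ x → ≈-+ (q x) (r x)
    poly-+ (suc D) {α} {β} (leading f α' q h) (leading g β' r h') = leading (λ x → f x + g x) (α' + β') (poly-+ D q r)
      λ x → ≈-trans (≈-+ (h x) (h' x)) (≈-reflexive (α*y+f+[β*y+g]≡[α+β]*y+[f+g] α β (x ^ suc D) (f x) (g x)))

    poly-scale : ∀ D c {α f} → Poly D α f → Poly D (c * α) (λ x → c * f x)
    poly-scale zero    c (constant q) = constant λ x → ≈-*ˡ c (q x)
    poly-scale (suc D) c {α} (leading f α' q h) = leading (λ x → c * f x) (c * α') (poly-scale D c q)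
      λ x → ≈-trans (≈-*ˡ c (h x)) (≈-reflexive (c*[α*y+f]≡c*α*y+c*f c α (x ^ suc D) (f x)))

    poly-x : ∀ D {α f} → Poly D α f → Poly (suc D) α (λ x → x * f x)
    poly-x zero    {α} (constant q) = leading (λ _ → + 0) (+ 0) (constant λ x → ≈-refl (+ 0)) λ x → ≈-trans (≈-*ˡ x (q x)) (≈-reflexive (x*α≡α*[x*1]+0 x α))
    poly-x (suc D) {α} (leading f α' q h) = leading (λ x → x * f x) α' (poly-x D q)
      λ x → ≈-trans (≈-*ˡ x (h x)) (≈-reflexive (y*[α*f+g]≡α*[y*f]+y*g x α (x ^ suc D) (f x)))

    poly-x^ : ∀ j D {α f} → Poly D α f → Poly (j ℕ.+ D) α (λ x → x ^ j * f x)
    poly-x^ zero    D {f = f} q = poly-ext D (λ x → ≈-reflexive (ℤₚ.*-identityˡ (f x))) q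
    poly-x^ (suc j) D {f = f} q = poly-ext (suc j ℕ.+ D) (λ x → ≈-reflexive (ℤₚ.*-assoc x (x ^ j) (f x))) (poly-x (j ℕ.+ D) (poly-x^ j D q))

    poly-* : ∀ D E {α β f g} → Poly D α f → Poly E β g → Poly (D ℕ.+ E) (α * β) (λ x → f x * g x)
    poly-* zero E {α} {g = g} (constant q) r = poly-ext E (λ x → ≈-* (q x) (≈-refl (g x))) (poly-scale E α r)
    poly-* (suc D) E {α} {β} {f} {g} (leading f' α' q h) r = subst (λ c → Poly (suc D ℕ.+ E) c (λ x → f x * g x)) (ℤₚ.+-identityʳ (α * β))
      (poly-ext (suc D ℕ.+ E) (λ x → ≈-trans (≈-* (h x) (≈-refl (g x))) (≈-reflexive ([α*y+f]*g≡α*[y*g]+f*g α (x ^ suc D) (f' x) (g x))))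
        (poly-+ (suc D ℕ.+ E) (poly-scale (suc D ℕ.+ E) α (poly-x^ (suc D) E r)) (poly-raise (D ℕ.+ E) (poly-* D E q r))))

    monomial : ∀ D → Poly D (+ 1) (λ x → x ^ D)
    monomial zero    = constant λ x → ≈-refl (+ 1)
    monomial (suc D) = leading (λ _ → + 0) (+ 0) (zero-poly D) λ x → ≈-reflexive (sym (1*y+0≡y (x ^ suc D)))
      where
      zero-poly : ∀ D → Poly D (+ 0) (λ _ → + 0)
      zero-poly zero    = constant λ x → ≈-refl (+ 0)
      zero-poly (suc D) = poly-raise D (zero-poly D)

    -- In the induction `(x + c) * y - x * z = (x + c) * (y - z) + c * z`, so each degree adds `c`
    -- to the leading coefficient.
    difference : ∀ c D → Poly D (c * + suc D) (λ x → (x + c) ^ suc D - x ^ suc D)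
    difference c zero = constant λ x → ≈-reflexive ([x+c]*1-x*1≡c*1 x c)
    difference c (suc D) = subst (λ a → Poly (suc D) a (λ x → (x + c) ^ suc (suc D) - x ^ suc (suc D))) coefficient
      (poly-ext (suc D) (λ x → ≈-reflexive ([x+c]*y-x*z≡[x+c]*[y-z]+c*z x c ((x + c) ^ suc D) (x ^ suc D)))
        (poly-+ (suc D) (poly-* 1 D linear (difference c D)) (poly-scale (suc D) c (monomial (suc D)))))
      where
      linear : Poly 1 (+ 1) (λ x → x + c)
      linear = leading (λ _ → c) c (constant λ _ → ≈-refl c) λ x → ≈-reflexive (x+c≡1*[x*1]+c x c)
      coefficient : + 1 * (c * + suc D) + c * + 1 ≡ c * + suc (suc D)
      coefficient = trans (1*[c*n]+c*1≡c*[1+n] c (+ suc D)) (cong (c *_) (sym (ℤₚ.pos-+ 1 (suc D))))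

    Σ' : (ℤ → ℤ) → ℤ
    Σ' f = sum (λ (z : Fin (suc m)) → f (ι z))

    powerSum : ℕ → ℤ
    powerSum j = Σ' (_^ j)

    sum-poly : ∀ D → (∀ j → j ℕ.< D → p ∣ powerSum j) → ∀ {α f} → Poly D α f → Σ' f ≈ α * powerSum D [ p ]
    sum-poly zero    _ {α} {f} (constant q) = ≈-trans (sum-≈ {f = λ (z : Fin (suc m)) → f (ι z)} {g = λ _ → α * + 1} (λ z → ≈-trans (q (ι z)) (≈-reflexive (sym (ℤₚ.*-identityʳ α)))))
      (≈-reflexive (sum-* {suc m} α (λ _ → + 1)))
    sum-poly (suc D) low {α} {f} (leading g β q h) =
      ≈-trans (sum-≈ (λ (z : Fin (suc m)) → h (ι z)))
        (≈-trans (≈-reflexive (trans (sum-+ (λ (z : Fin (suc m)) → α * ι z ^ suc D) (λ z → g (ι z))) (cong (_+ Σ' g) (sum-* α (λ (z : Fin (suc m)) → ι z ^ suc D)))))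
          (mod (lin₂ (div (sum-poly D (λ j j<D → low j (ℕₚ.<-trans j<D (ℕₚ.n<1+n D))) q)) (low D (ℕₚ.n<1+n D)) (+ 1) β ([a+g]-a≡1*[g-β*s]+β*s (α * powerSum (suc D)) (Σ' g) β (powerSum D)))))

    -- The differences `(z + 1) ^ suc j - z ^ suc j` sum to zero over the residues. They form a
    -- polynomial of degree `j` whose leading coefficient `suc j` is a unit, and by induction its
    -- lower terms contribute nothing.
    powerSum-zero : ∀ j → j ℕ.< m → p ∣ powerSum j
    powerSum-zero j j<m = below (suc j) j<m j (ℕₚ.n<1+n j)
      where
      at : ∀ j → j ℕ.< m → (∀ i → i ℕ.< j → p ∣ powerSum i) → p ∣ powerSum j
      at j j<m low = unit-cancel {u = + 1 * + suc j} (prime-unit pr (+ 1 * + suc j) (subst (λ z → ¬ (p ∣ z)) (sym (ℤₚ.*-identityˡ (+ suc j))) (small∤ (suc j) (ℕ.s≤s j<m) (ℕ.s≤s ℕ.z≤n))))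
        (≈0⇒∣ (≈-trans (≈-sym (sum-poly j low (difference (+ 1) j))) telescopes))
        where
        telescopes : Σ' (λ x → (x + + 1) ^ suc j - x ^ suc j) ≈ + 0 [ p ]
        telescopes = ≈-trans (≈-reflexive (trans (sum-+ (λ (z : Fin (suc m)) → (ι z + + 1) ^ suc j) (λ z → - (ι z ^ suc j)))
                       (cong (λ s → Σ' (λ x → (x + + 1) ^ suc j) + s) (sum-neg (λ (z : Fin (suc m)) → ι z ^ suc j)))))
                     (mod (lin₁ (div (sum-affine (_^ suc j) (≈-^ (suc j)) (+ 1))) (+ 1) ([a+-b]-0≡1*[a-b] (Σ' (λ x → (x + + 1) ^ suc j)) (powerSum (suc j)))))
      below : ∀ n → n ℕ.≤ m → ∀ j → j ℕ.< n → p ∣ powerSum j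
      below (suc n) n<m j j<n with ℕₚ.m≤n⇒m<n∨m≡n (ℕ.s≤s⁻¹ j<n)
      ... | inj₁ j<n' = below n (ℕₚ.≤-trans (ℕₚ.n≤1+n n) n<m) j j<n'
      ... | inj₂ refl = at j n<m (below j (ℕₚ.≤-trans (ℕₚ.n≤1+n j) n<m))

    pow-wrap : 1 ℕ.≤ m → ∀ z → z ^ suc m ≈ z ^ 1 [ p ]
    pow-wrap _ z with p ∣? z
    ... | no ¬d = ≈-*ˡ z (fermat z ¬d)
    ... | yes d = mod (lin₁ d (z ^ m - + 1) (z*y-z*1≡[y-1]*z z (z ^ m)))

    powerSum-top : 1 ℕ.≤ m → powerSum m ≈ - + 1 [ p ]
    powerSum-top (ℕ.s≤s {n = m'} _) =
      ≈-trans (≈-+ (≈-refl (+ 0)) (sum-≈ {g = λ _ → + 1} (λ (z : Fin m) → fermat (ι {suc m} (fs z)) (small∤ (suc (toℕ z)) (ℕ.s≤s (toℕ<n z)) (ℕ.s≤s ℕ.z≤n)))))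
        (≈-trans (≈-reflexive (cong (λ s → + 0 + s) (sum-one m))) (mod (divides (+ 1) (trans ([0+m]--1≡1*[1+m] (+ m)) (cong (+ 1 *_) (sym (ℤₚ.pos-+ 1 m)))))))
      where
      open import Data.Fin.Properties using (toℕ<n)

    moment : ℕ → ℕ → ℤ → ℤ
    moment i e x = Σ' (λ z → z ^ e * (z + x) ^ i)

    -- Only the z^(p-1) term of z^e (z + x)^i survives the summation over z.
    moment-value : ∀ i → i ℕ.< m → ∀ δ e → suc e ℕ.+ δ ≡ m → ∀ x →
                   moment i (suc e) x ≈ - + (i C δ) * x ^ (i ℕ.∸ δ) [ p ]
    moment-value zero i<m δ e eq x = ≈-trans (sum-≈ (λ z → ≈-reflexive (ℤₚ.*-identityʳ (ι {suc m} z ^ suc e)))) (base δ eq)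
      where
      base : ∀ δ → suc e ℕ.+ δ ≡ m → powerSum (suc e) ≈ - + (0 C δ) * x ^ (0 ℕ.∸ δ) [ p ]
      base zero eq = subst (λ u → powerSum u ≈ - + 1 [ p ]) (sym (trans (sym (ℕₚ.+-identityʳ (suc e))) eq)) (powerSum-top i<m)
      base (suc δ) eq = ∣⇒≈0 (powerSum-zero (suc e) (subst (suc e ℕ.<_) eq (subst (suc e ℕ.<_) (sym (ℕₚ.+-suc (suc e) δ)) (ℕ.s≤s (ℕₚ.m≤m+n (suc e) δ)))))
    moment-value (suc i) i<m δ e eq x = ≈-trans recurrence (pascal δ eq)
      where
      i<m' : i ℕ.< m
      i<m' = ℕₚ.<-trans (ℕₚ.n<1+n i) i<m
      recurrence : moment (suc i) (suc e) x ≈ moment i (suc (suc e)) x + x * moment i (suc e) x [ p ]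
      recurrence = ≈-trans (sum-≈ (λ (z : Fin (suc m)) → ≈-reflexive (z*y*[[z+x]*w]≡z*[z*y]*w+x*[z*y*w] (ι z) (ι z ^ e) x ((ι z + x) ^ i))))
        (≈-reflexive (trans (sum-+ (λ (z : Fin (suc m)) → ι z ^ suc (suc e) * (ι z + x) ^ i) (λ z → x * (ι z ^ suc e * (ι z + x) ^ i)))
          (cong (λ s → moment i (suc (suc e)) x + s) (sum-* x (λ (z : Fin (suc m)) → ι z ^ suc e * (ι z + x) ^ i)))))
      pascal : ∀ δ → suc e ℕ.+ δ ≡ m → moment i (suc (suc e)) x + x * moment i (suc e) x ≈ - + (suc i C δ) * x ^ (suc i ℕ.∸ δ) [ p ]
      -- For `δ = 0` the raised exponent is `p`, which Fermat wraps round to 1, and that moment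
      -- vanishes.
      pascal zero eq = ≈-trans (≈-+ wrapped (≈-*ˡ x (moment-value i i<m' 0 e eq x))) (≈-reflexive (0+x*[-1*y]≡-1*[x*y] x (x ^ i)))
        where
        e+1≡m : suc e ≡ m
        e+1≡m = trans (sym (ℕₚ.+-identityʳ (suc e))) eq
        vanish : ∀ e' → suc e' ≡ m → moment i 1 x ≈ + 0 [ p ]
        vanish e' f = ≈-trans (moment-value i i<m' e' 0 f x) (≈-reflexive (trans (cong (λ c → - + c * x ^ (i ℕ.∸ e')) (k>n⇒nCk≡0 {i} {e'} (ℕ.s≤s⁻¹ (subst (suc i ℕ.<_) (sym f) i<m)))) (ℤₚ.*-zeroˡ (x ^ (i ℕ.∸ e')))))
        wrapped : moment i (suc (suc e)) x ≈ + 0 [ p ]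
        wrapped = ≈-trans (sum-≈ (λ (z : Fin (suc m)) → ≈-* (subst (λ u → ι z ^ suc u ≈ ι z ^ 1 [ p ]) (sym e+1≡m) (pow-wrap (ℕₚ.≤-trans (ℕ.s≤s ℕ.z≤n) i<m) (ι z))) (≈-refl ((ι z + x) ^ i)))) (vanish e e+1≡m)
      pascal (suc δ) eq = ≈-trans (≈-+ (moment-value i i<m' δ (suc e) (trans (sym (ℕₚ.+-suc (suc e) δ)) eq) x) (≈-*ˡ x (moment-value i i<m' (suc δ) e eq x)))
        (≈-reflexive (trans (cong (λ s → - + (i C δ) * x ^ (i ℕ.∸ δ) + s) (shifted (ℕₚ.<-≤-connex δ i))) (trans (-a*y+-b*y≡-[a+b]*y (+ (i C δ)) (+ (i C suc δ)) (x ^ (i ℕ.∸ δ)))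
          (cong (λ c → - c * x ^ (i ℕ.∸ δ)) (trans (sym (ℤₚ.pos-+ (i C δ) (i C suc δ))) (cong +_ (nCk+nC[k+1]≡[n+1]C[k+1] i δ)))))))
        where
        shifted : (δ ℕ.< i) ⊎ (i ℕ.≤ δ) → x * (- + (i C suc δ) * x ^ (i ℕ.∸ suc δ)) ≡ - + (i C suc δ) * x ^ (i ℕ.∸ δ)
        shifted (inj₁ δ<i) = trans (x*[-b*y]≡-b*[x*y] x (+ (i C suc δ)) (x ^ (i ℕ.∸ suc δ))) (cong (λ u → - + (i C suc δ) * x ^ u) (sym (ℕₚ.+-∸-assoc 1 δ<i)))
        shifted (inj₂ i≤δ) rewrite k>n⇒nCk≡0 {i} {suc δ} (ℕ.s≤s i≤δ) = x*[-0*y]≡-0*z x (x ^ (i ℕ.∸ suc δ)) (x ^ (i ℕ.∸ δ))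

    -- The operator f ↦ Σ_z (z - x)^e f(z) lowers the degree by d = p - 1 - e.
    module Lowering (d e : ℕ) (e+d : suc e ℕ.+ suc d ≡ m) where

      T : (ℤ → ℤ) → ℤ → ℤ
      T f x = Σ' (λ z → (z - x) ^ suc e * f z)

      -- Shifting the summation variable by `x` turns the sum into a moment.
      T-monomial : ∀ i → i ℕ.< m → ∀ x → T (_^ i) x ≈ - + (i C suc d) * x ^ (i ℕ.∸ suc d) [ p ]
      T-monomial i i<m x = ≈-trans (≈-sym (sum-affine (λ z → (z - x) ^ suc e * z ^ i) (λ f → ≈-* (≈-^ (suc e) (≈-- f (≈-refl x))) (≈-^ i f)) x))
        (≈-trans (sum-≈ (λ (z : Fin (suc m)) → ≈-reflexive (cong (λ y → y ^ suc e * (ι z + x) ^ i) (z+x-x≡z (ι z) x)))) (moment-value i i<m (suc d) e e+d x))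

      T-cong : ∀ {f g} → (∀ x → f x ≈ g x [ p ]) → ∀ x → T f x ≈ T g x [ p ]
      T-cong h x = sum-≈ (λ (z : Fin (suc m)) → ≈-*ˡ ((ι z - x) ^ suc e) (h (ι z)))

      T-linear : ∀ α f g x → T (λ z → α * f z + g z) x ≡ α * T f x + T g x
      T-linear α f g x = trans (sum-cong-≗ (λ (z : Fin (suc m)) → y*[α*f+g]≡α*[y*f]+y*g ((ι z - x) ^ suc e) α (f (ι z)) (g (ι z))))
        (trans (sum-+ (λ (z : Fin (suc m)) → α * ((ι z - x) ^ suc e * f (ι z))) (λ z → (ι z - x) ^ suc e * g (ι z)))
          (cong (_+ T g x) (sum-* α (λ (z : Fin (suc m)) → (ι z - x) ^ suc e * f (ι z)))))

      T-leading : ∀ D α f g → D ℕ.< m → (∀ x → f x ≈ α * x ^ D + g x [ p ]) → ∀ x →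
                  T f x ≈ α * (- + (D C suc d) * x ^ (D ℕ.∸ suc d)) + T g x [ p ]
      T-leading D α f g D<m h x = ≈-trans (T-cong h x) (≈-trans (≈-reflexive (T-linear α (_^ D) g x))
        (≈-+ (≈-*ˡ α (T-monomial D D<m x)) (≈-refl (T g x))))

      vanish : ∀ D x → D ℕ.≤ d → - + (D C suc d) * x ^ (D ℕ.∸ suc d) ≡ + 0
      vanish D x D≤d = trans (cong (λ c → - + c * x ^ (D ℕ.∸ suc d)) (k>n⇒nCk≡0 {D} {suc d} (ℕ.s≤s D≤d))) (ℤₚ.*-zeroˡ (x ^ (D ℕ.∸ suc d)))

      d<m : d ℕ.< m
      d<m = subst (suc d ℕ.≤_) e+d (ℕₚ.m≤n+m (suc d) (suc e))

      T-low : ∀ D {α f} → D ℕ.≤ d → Poly D α f → ∀ x → T f x ≈ + 0 [ p ]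
      T-low zero {α} {f} _ (constant q) x = ≈-trans (T-leading 0 α f (λ _ → + 0) (ℕₚ.≤-<-trans ℕ.z≤n d<m) (λ x → ≈-trans (q x) (≈-reflexive (α≡α*1+0 α))) x)
        (≈-trans (≈-+ (≈-*ˡ α (≈-reflexive (vanish 0 x ℕ.z≤n))) (≈-reflexive zero-sum)) (≈-reflexive (α*0+0≡0 α)))
        where
        zero-sum : T (λ _ → + 0) x ≡ + 0
        zero-sum = trans (sum-cong-≗ (λ (z : Fin (suc m)) → ℤₚ.*-comm ((ι z - x) ^ suc e) (+ 0))) (sum-* {suc m} (+ 0) (λ z → (ι z - x) ^ suc e))
      T-low (suc D) {α} {f} D≤d (leading g β q h) x = ≈-trans (T-leading (suc D) α f g (ℕₚ.≤-<-trans D≤d d<m) h x)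
        (≈-trans (≈-+ (≈-*ˡ α (≈-reflexive (vanish (suc D) x D≤d))) (T-low D (ℕₚ.≤-trans (ℕₚ.n≤1+n D) D≤d) q x)) (≈-reflexive (α*0+0≡0 α)))

      -- The binomial factor is prime to `p` in the degrees allowed, so that the degree drops by
      -- exactly `suc d`.
      T-poly : ∀ r → suc d ℕ.+ r ℕ.< m → ∀ {α f} → Poly (suc d ℕ.+ r) α f → Poly r (- + ((suc d ℕ.+ r) C suc d) * α) (T f)
      T-poly zero r<m {α} {f} (leading g β q h) = constant λ x →
        ≈-trans (T-leading (suc d ℕ.+ 0) α f g r<m h x)
          (≈-trans (≈-+ (≈-reflexive (cong (λ u → α * (- + ((suc d ℕ.+ 0) C suc d) * x ^ u)) (ℕₚ.m+n∸m≡n (suc d) 0))) (T-low (d ℕ.+ 0) (ℕₚ.≤-reflexive (ℕₚ.+-identityʳ d)) q x))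
            (≈-reflexive (α*[-c*1]+0≡-c*α α (+ ((suc d ℕ.+ 0) C suc d)))))
      T-poly (suc r) r<m {α} {f} (leading g β q h) =
        leading (T g) _ (T-poly r (ℕₚ.<-trans (subst (ℕ._< suc d ℕ.+ suc r) refl (ℕₚ.+-monoʳ-< (suc d) (ℕₚ.n<1+n r))) r<m) (subst (λ D → Poly D β g) (ℕₚ.+-suc d r) q)) λ x →
          ≈-trans (T-leading (suc d ℕ.+ suc r) α f g r<m h x)
            (≈-+ (≈-reflexive (trans (cong (λ u → α * (- + ((suc d ℕ.+ suc r) C suc d) * x ^ u)) (ℕₚ.m+n∸m≡n (suc d) (suc r))) (α*[-c*y]≡-c*α*y α (+ ((suc d ℕ.+ suc r) C suc d)) (x ^ suc r)))) (≈-refl (T g x)))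

    module Proper {C' : ℤ → Set} {R : ℤ → ℤ → Set} (mult : MultiplierGroup p C') (eqt : Equitable (suc m) C' R)
      (t₀ : ℤ) (t₀-unit : ¬ (p ∣ t₀)) (t₀∉ : ¬ C' t₀) where

      open MultiplierGroup mult
      open Equitable eqt using (step; zero₁; one₁; compare)

      private
        unit : ∀ {k} → C' k → Unit p k
        unit c = let k' , _ , e = inv c in k' , e

        cancel : ∀ {k x} → C' k → C' (x * k) → C' x
        cancel {k} {x} c cx = let k' , c' , e = inv c in
          resp (≈-trans (≈-reflexive (ℤₚ.*-assoc x k k')) (≈-trans (≈-*ˡ x e) (≈-reflexive (ℤₚ.*-identityʳ x)))) (mul cx c')

        order : ℕ
        order = count (λ (z : Fin (suc m)) → ⌊ dec (ι z) ⌋)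

        lagrange : ∀ {k} → C' k → k ^ order ≈ + 1 [ p ]
        lagrange {k} c = orbit-power C' dec resp unit k (unit c) (mul c) (λ {x} cx → cancel c (subst C' (ℤₚ.*-comm k x) cx))

        order-coset : count (λ (z : Fin (suc m)) → ⌊ dec (t₀ * ι z) ⌋) ≡ order
        order-coset = let σ , e = affine t₀ (+ 0) (prime-unit pr t₀ t₀-unit) in
          count-permute σ (λ (z : Fin (suc m)) → ⌊ dec (t₀ * ι z) ⌋) (λ (z : Fin (suc m)) → ⌊ dec (ι z) ⌋) λ z → ⌊⌋-cong (dec (t₀ * ι z)) (dec (ι (to σ z)))
            (resp (≈-sym (≈-trans (e z) (≈-reflexive (ℤₚ.+-identityʳ (t₀ * ι z)))))) (resp (≈-trans (e z) (≈-reflexive (ℤₚ.+-identityʳ (t₀ * ι z)))))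

        ∤ : ∀ {k} → C' k → ¬ (p ∣ k)
        ∤ {k} c d = let k' , _ , mod e = inv c in small∤ 1 (ℕ.s≤s (ℕₚ.≤-trans (ℕ.s≤s ℕ.z≤n) m≥1)) (ℕ.s≤s ℕ.z≤n) (lin₂ d e k' (- + 1) (1≡k'*k+-1*[k*k'-1] k k'))
          where
          m≥1 : 1 ℕ.≤ m
          m≥1 = ℕ.s≤s⁻¹ (nonTrivial⇒n>1 (suc m) {{prime⇒nonTrivial pr}})
            where
            open import Data.Nat.Base using (nonTrivial⇒n>1)
            open import Data.Nat.Primality using (prime⇒nonTrivial)

        -- `C'` and its coset by the inverse of `t₀` are disjoint sets of units of the same size.
        2*order≤m : order ℕ.+ order ℕ.≤ m
        2*order≤m = ℕₚ.≤-trans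
          (ℕₚ.≤-reflexive (trans (cong (order ℕ.+_) (sym order-coset))
            (sym (count-∨ (λ (z : Fin (suc m)) → ⌊ dec (ι z) ⌋) (λ z → ⌊ dec (t₀ * ι z) ⌋)
              (λ z a b → ⊥-elim (t₀∉ (cancel (⌊⌋-sound (dec (ι z)) a) (⌊⌋-sound (dec (t₀ * ι z)) b))))))))
          (ℕₚ.≤-trans (count-mono _ _ (λ z e → ⌊⌋-true (unit? (ι z)) (nonzero z (⌊ dec (ι z) ⌋) refl e))) (ℕₚ.≤-reflexive count-units))
          where
          nonzero : ∀ (z : Fin (suc m)) b → b ≡ ⌊ dec (ι z) ⌋ → b ∨ ⌊ dec (t₀ * ι z) ⌋ ≡ true → ¬ (p ∣ ι z)
          nonzero z true  f e = ∤ (⌊⌋-sound (dec (ι z)) (sym f))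
          nonzero z false f e = λ d → ∤ (⌊⌋-sound (dec (t₀ * ι z)) e) (lin₁ d t₀ refl)

        order≢0 : order ≡ 0 → ⊥
        order≢0 = count-some (λ (z : Fin (suc m)) → ⌊ dec (ι z) ⌋) (resid (suc m) (+ 1)) (⌊⌋-true (dec _) (resp (≈-sym (ι-resid (suc m) (+ 1))) one))

        -- The functions that cannot tell related points apart; products and differences stay among
        -- them.
        InV : (ℤ → ℤ) → Set
        InV f = ∀ {x x'} → R x x' → f x ≈ f x' [ p ]

        module Bounded (d : ℕ) (d≡ : order ≡ suc d) where

          bound : suc d ℕ.+ suc d ℕ.≤ m
          bound = subst (λ o → o ℕ.+ o ℕ.≤ m) d≡ 2*order≤m

          e : ℕ
          e = m ℕ.∸ suc (suc d)

          e+d : suc e ℕ.+ suc d ≡ m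
          e+d = trans (sym (ℕₚ.+-suc e (suc d))) (ℕₚ.m∸n+n≡m (ℕₚ.≤-trans (ℕ.s≤s (ℕₚ.m≤n+m (suc d) d)) bound))

          open Lowering d e e+d

          root : ∀ {k} → C' k → k ^ suc d ≈ + 1 [ p ]
          root {k} c = subst (λ o → k ^ o ≈ + 1 [ p ]) d≡ (lagrange c)

          -- Both `k ^ m` and `k ^ suc d` are 1, hence so is the power with the complementary
          -- exponent. This is the reason for the exponent `suc e` in `T`.
          root' : ∀ {k} → C' k → k ^ suc e ≈ + 1 [ p ]
          root' {k} c = ≈-trans (≈-reflexive (sym (ℤₚ.*-identityʳ (k ^ suc e))))
            (≈-trans (≈-*ˡ (k ^ suc e) (≈-sym (root c)))
              (≈-trans (≈-reflexive (trans (sym (ℤₚ.^-distribˡ-+-* k (suc e) (suc d))) (cong (k ^_) e+d))) (fermat k (∤ c))))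

          *-^ : ∀ a b j → (a * b) ^ j ≡ a ^ j * b ^ j
          *-^ a b zero    = refl
          *-^ a b (suc j) = trans (cong (a * b *_) (*-^ a b j)) (k*g*[q*r]≡k*q*[g*r] a b (a ^ j) (b ^ j))

          inV-power : ∀ s → Single p R s → InV (λ x → (x - s) ^ suc d)
          inV-power s single {x} {x'} r = let k , c , f = compare single r in
            ≈-sym (≈-trans (≈-^ {x = x' - s} {k * (x - s)} (suc d) f) (≈-trans (≈-reflexive (*-^ k (x - s) (suc d)))
              (≈-trans (≈-* (root c) (≈-refl ((x - s) ^ suc d))) (≈-reflexive (ℤₚ.*-identityˡ ((x - s) ^ suc d))))))

          -- The permutation of `step` reorders the sum, and each factor `(z - x) ^ suc e` changes
          -- by a power of a multiplier that `root'` makes 1.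
          inV-T : ∀ {f} → InV f → InV (T f)
          inV-T {f} v {x} {x'} r with step r
          ... | σ , st = ≈-trans (sum-≈ (λ (z : Fin (suc m)) → ≈-* (term z) (v (proj₁ (st z))))) (≈-reflexive (sym (sum-permuteᶻ (λ (z : Fin (suc m)) → (ι z - x') ^ suc e * f (ι z)) σ)))
            where
            term : ∀ z → (ι z - x) ^ suc e ≈ (ι (to σ z) - x') ^ suc e [ p ]
            term z with st z
            ... | _ , k , c , mod g = ≈-sym (≈-trans (≈-^ {x = ι (to σ z) - x'} {k * (ι z - x)} (suc e) (mod (lin₁ g (- + 1) ([z'-x']-k*[z-x]≡-1*[[x'-z']-k*[x-z]] x x' k (ι z) (ι (to σ z))))))
                (≈-trans (≈-reflexive (*-^ k (ι z - x) (suc e))) (≈-trans (≈-* (root' c) (≈-refl ((ι z - x) ^ suc e))) (≈-reflexive (ℤₚ.*-identityˡ ((ι z - x) ^ suc e))))))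

          Invariant : ℕ → Set
          Invariant r = ∃₂ λ f α → InV f × Poly r α f × ¬ (p ∣ α)

          h₁ : ℤ → ℤ
          h₁ x = (x + - + 1) ^ suc d - x ^ suc d

          h₁-poly : Poly d (- + 1 * + suc d) h₁
          h₁-poly = difference (- + 1) d

          h₁-inV : InV h₁
          h₁-inV {x} {x'} r = ≈-- (inV-power (+ 1) one₁ r)
            (≈-trans (≈-reflexive (cong (_^ suc d) (s≡s-0 x))) (≈-trans (inV-power (+ 0) zero₁ r) (≈-reflexive (cong (_^ suc d) (sym (s≡s-0 x'))))))

          neg∤ : ∀ {a} → ¬ (p ∣ a) → ¬ (p ∣ - a)
          neg∤ {a} ¬a q = ¬a (lin₁ q (- + 1) (a≡-1*-a a))

          top : Invariant d
          top = h₁ , _ , h₁-inV , h₁-poly , λ q → small∤ (suc d) (ℕ.s≤s (ℕₚ.≤-trans (ℕₚ.m≤m+n (suc d) (suc d)) bound)) (ℕ.s≤s ℕ.z≤n)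
            (lin₁ q (- + 1) (a≡-1*[-1*a] (+ suc d)))

          -- h₁ has degree |C| - 1 and the operator T lowers by |C|.
          lower : ∀ r → suc r ℕ.≤ d → Invariant (suc r) → Invariant r
          lower r r<d (f , α , v , q , ¬α) = T (λ x → h₁ x * f x) , _ ,
            inV-T (λ ρ → ≈-* (h₁-inV ρ) (v ρ)) ,
            T-poly r small (subst (λ D → Poly D (- + 1 * + suc d * α) (λ x → h₁ x * f x)) (ℕₚ.+-suc d r) (poly-* d (suc r) h₁-poly q)) ,
            ∤-* { - + ((suc d ℕ.+ r) C suc d)} { - + 1 * + suc d * α} (neg∤ {+ ((suc d ℕ.+ r) C suc d)} (λ b → prime∤C pr (suc d ℕ.+ r) (suc d) (ℕₚ.m≤m+n (suc d) r) (ℕₚ.<-trans small (ℕₚ.n<1+n m)) (∣⇒∣ᵤ b)))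
              (∤-* { - + 1 * + suc d} {α} (proj₂ (proj₂ (proj₂ (proj₂ top)))) ¬α)
            where
            small : suc d ℕ.+ r ℕ.< m
            small = ℕₚ.≤-trans (ℕ.s≤s (ℕₚ.+-monoʳ-≤ (suc d) (ℕₚ.≤-trans (ℕₚ.n≤1+n r) r<d))) (ℕₚ.≤-trans (ℕₚ.≤-reflexive (sym (ℕₚ.+-suc (suc d) d))) bound)

          descend : ∀ j r → j ℕ.+ suc r ≡ d → Invariant (suc r)
          descend zero    r refl = top
          descend (suc j) r eq = lower (suc r) (subst (suc (suc r) ℕ.≤_) (trans (ℕₚ.+-suc j (suc r)) eq) (ℕₚ.m≤n+m (suc (suc r)) j)) (descend j (suc r) (trans (ℕₚ.+-suc j (suc r)) eq))

          -- For `d = 0` the group is trivial and `x` itself is invariant. The copy `d'` exists to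
          -- be matched on.
          linear : ∀ d' → d' ≡ d → Invariant 1
          linear zero d-eq = (λ x → x) , + 1 ,
            (λ {x} {x'} r → ≈-trans (≈-reflexive (x≡[x-0]*1 x))
              (≈-trans (subst (λ q → (x - + 0) ^ suc q ≈ (x' - + 0) ^ suc q [ p ]) (sym d-eq) (inV-power (+ 0) zero₁ r)) (≈-reflexive (sym (x≡[x-0]*1 x'))))) ,
            leading (λ _ → + 0) (+ 0) (constant λ _ → ≈-refl (+ 0)) (λ x → ≈-reflexive (x≡1*[x*1]+0 x)) , λ q → ∤ one q
          linear (suc d') d-eq = descend d' 0 (trans (ℕₚ.+-comm d' 1) d-eq)

          result : ∀ {x x'} → R x x' → x' ≈ x [ p ]
          result {x} {x'} r with linear d refl
          ... | f , α , v , leading g β (constant q) h , ¬α = mod (unit-cancel {u = α} (prime-unit pr α ¬α)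
            (lin₃ (div (v r)) (div (≈-trans (h x) (≈-+ (≈-refl (α * (x * + 1))) (q x)))) (div (≈-trans (h x') (≈-+ (≈-refl (α * (x' * + 1))) (q x')))) (- + 1) (+ 1) (- + 1) (α*[x'-x]≡-1*[f-f']+1*[f-[α*[x*1]+β]]+-1*[f'-[α*[x'*1]+β]] α β x x' (f x) (f x'))))

      discrete : ∀ {x x'} → R x x' → x' ≈ x [ p ]
      discrete with order in eq
      ... | zero  = ⊥-elim (order≢0 eq)
      ... | suc d = Bounded.result d eq

-- Rigidity modulo n, by reduction to prime powers.

module Rigidity where

  open Matching
  open Congruence
  open Multipliers
  open PowersOfTwo
  open PrimeDegree
  open Identities
  open import Data.Nat as ℕ using (ℕ; zero; suc; NonZero)
  import Data.Nat.Properties as ℕₚ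
  import Data.Nat.Divisibility as ℕᵈ
  open import Data.Nat.Primality using (Prime; prime⇒nonZero; prime⇒nonTrivial)
  open import Data.Nat.Primality.Factorisation using (factorise)
  open import Data.Nat.GCD using (gcd; gcd[m,n]∣m; gcd[m,n]∣n; gcd-greatest)
  open import Data.Nat.Induction using (<-wellFounded)
  open import Induction.WellFounded using (Acc; acc)
  open import Data.List using ([]; _∷_)
  open import Data.List.Relation.Unary.All using ([]; _∷_)
  open import Data.Nat.ListAction using (product)
  open import Data.Integer using (ℤ; +_; -_; _+_; _-_; _*_; _^_; ∣_∣)
  import Data.Integer.Properties as ℤₚ
  open import Data.Integer.Divisibility.Signed using (_∣_; divides; _∣?_; ∣-trans; ∣-refl; ∣⇒∣ᵤ; ∣ᵤ⇒∣)
  open import Data.Integer.Tactic.RingSolver using (solve-∀)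
  open import Data.Fin using (Fin)
  import Data.Fin.Properties as Finₚ
  open import Data.Product using (Σ; ∃; ∃₂; _×_; _,_; proj₁; proj₂)
  open import Data.Empty using (⊥; ⊥-elim)
  open import Function using (_∘_)
  open import Function.Bundles using (_↔_)
  open import Relation.Binary.PropositionalEquality using (_≡_; _≢_; refl; sym; trans; cong; cong₂; subst)
  open import Relation.Nullary using (¬_; Dec; yes; no)
  open import Relation.Nullary.Decidable using (¬?; _×-dec_; decidable-stable; from-yes; from-no)

  -- The modulus is an integer variable so that `+ (p ^ a)` can be traded for `(+ p) ^ a` by
  -- matching on an equation.
  record Setting (Z : ℤ) (C : ℤ → Set) (R : ℤ → ℤ → Set) : Set where
    field
      group      : MultiplierGroup Z C
      quadraticᶻ : ∀ c → (∀ t → C (+ 1 + c * t)) → Z ∣ + 2 * c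
      zeroᶻ      : Single Z R (+ 0)
      oneᶻ       : Single Z R (+ 1)
      compareᶻ   : ∀ {s x x'} → Single Z R s → R x x' → ∃ λ k → C k × (x' - s ≈ k * (x - s) [ Z ])

  module Discreteness (n : ℕ) .{{_ : NonZero n}} {K : ℤ → Set} {R : ℤ → ℤ → Set}
    (mult : MultiplierGroup (+ n) K) (eqt : Equitable n K R)
    (affine : ∀ (f : ℤ → ℤ) → (∀ x y → ∃ λ k → K k × (f x - f y ≈ k * (x - y) [ + n ])) →
              ∀ x y → f (x + + 1) - f x ≈ f (y + + 1) - f y [ + n ]) where

    open MultiplierGroup mult
    open Equitable eqt renaming (resp to R-resp)

    module Component (P m : ℕ) .{{_ : NonZero P}} (n≡ : n ≡ P ℕ.* m) (α β : ℤ) (bezout : α * + P + β * + m ≡ + 1) where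

      private
        N≡ : + n ≡ + P * + m
        N≡ = trans (cong +_ n≡) (ℤₚ.pos-* P m)

        P∣n : + P ∣ + n
        P∣n = divides (+ m) (trans N≡ (ℤₚ.*-comm (+ P) (+ m)))

        m∣n : + m ∣ + n
        m∣n = divides (+ P) N≡

      -- The idempotent of the component: 1 modulo `P` and 0 modulo `m`.
      q : ℤ
      q = β * + m

      q≈1 : + P ∣ (q - + 1)
      q≈1 = divides (- α) (trans (cong (_-_ q) (sym bezout)) (q-[α*P+q]≡-α*P α (+ P) q))

      q≈0 : + m ∣ q
      q≈0 = divides β refl

      both : ∀ {z} → + P ∣ z → + m ∣ z → + n ∣ z
      both {z} (divides s e) (divides t f) = divides (α * t + β * s) (trans (trans (sym (ℤₚ.*-identityˡ z)) (trans (cong (_* z) (sym bezout)) (trans ([α*P+β*m]*z≡α*P*z+β*m*z α (+ P) β (+ m) z) (cong₂ (λ a b → α * + P * a + β * + m * b) f e)))) (trans (α*P*[t*m]+β*m*[s*P]≡[α*t+β*s]*[P*m] α (+ P) β (+ m) t s) (cong ((α * t + β * s) *_) (sym N≡))))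

      crt : ∀ {x y} → x ≈ y [ + P ] → x ≈ y [ + m ] → x ≈ y [ + n ]
      crt (mod e) (mod f) = mod (both e f)

      modP : ∀ {x y} → x ≈ y [ + n ] → x ≈ y [ + P ]
      modP = ≈-weaken P∣n

      modm : ∀ {x y} → x ≈ y [ + n ] → x ≈ y [ + m ]
      modm = ≈-weaken m∣n

      qP : ∀ x → q * x ≈ x [ + P ]
      qP x = mod (lin₁ q≈1 x (q*x-x≡x*[q-1] q x))

      qm : ∀ x → q * x ≈ + 0 [ + m ]
      qm x = mod (lin₁ q≈0 x (q*x-0≡x*q q x))

      -- A second copy of ℤ/P, at the residue 1 modulo `m`, beside the copy formed by the multiples
      -- of `q`. Differences between the two copies are 1 or -1 modulo `m`, and this forces
      -- multipliers between them to be 1 modulo `m`.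
      slice : ℤ → ℤ
      slice t = q * t + + 1 - q

      sliceP : ∀ t → slice t ≈ t [ + P ]
      sliceP t = mod (lin₁ q≈1 (t - + 1) (q*t+1-q-t≡[t-1]*[q-1] q t))

      slicem : ∀ t → slice t ≈ + 1 [ + m ]
      slicem t = mod (lin₁ q≈0 (t - + 1) (q*t+1-q-1≡[t-1]*q q t))

      onto-slice : ∀ {x} → x ≈ + 1 [ + m ] → x ≈ slice x [ + n ]
      onto-slice {x} e = crt (≈-sym (sliceP x)) (≈-trans e (≈-sym (slicem x)))

      slice-cong : ∀ {t t'} → t ≈ t' [ + P ] → slice t ≈ slice t' [ + n ]
      slice-cong {t} {t'} e = crt (≈-trans (sliceP t) (≈-trans e (≈-sym (sliceP t')))) (≈-trans (slicem t) (≈-sym (slicem t')))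

      q-cong : ∀ {t t'} → t ≈ t' [ + P ] → q * t ≈ q * t' [ + n ]
      q-cong {t} {t'} e = crt (≈-trans (qP t) (≈-trans e (≈-sym (qP t')))) (≈-trans (qm t) (≈-sym (qm t')))

      C : ℤ → Set
      C t = K (slice t)

      C-intro : ∀ {k} → k ≈ + 1 [ + m ] → K k → C k
      C-intro e c = resp (onto-slice e) c

      R' : ℤ → ℤ → Set
      R' x x' = R (q * x) (q * x')

      multC : MultiplierGroup (+ P) C
      multC = record
        { dec  = λ t → dec (slice t)
        ; resp = λ e c → resp (slice-cong e) c
        ; one  = resp (onto-slice (≈-refl (+ 1))) one
        ; mul  = λ {k} {k'} c c' → resp (crt (≈-trans (≈-* (sliceP k) (sliceP k')) (≈-sym (sliceP (k * k')))) (≈-trans (≈-* (slicem k) (slicem k')) (≈-sym (slicem (k * k'))))) (mul c c')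
        ; inv  = λ {k} c → let k' , c' , e = inv c in
            k' , C-intro (≈-trans (≈-reflexive (sym (ℤₚ.*-identityˡ k'))) (≈-trans (≈-* (≈-sym (slicem k)) (≈-refl k')) (modm e))) c' ,
            ≈-trans (≈-* (≈-sym (sliceP k)) (≈-refl k')) (modP e)
        }

      private
        vanishes-mod-m : ∀ {x z} → R (q * x) z → z ≈ + 0 [ + m ]
        vanishes-mod-m {x} {z} r = from-comparison (compare zero₁ r)
          where
          from-comparison : (∃ λ k → K k × (z - + 0 ≈ k * (q * x - + 0) [ + n ])) → z ≈ + 0 [ + m ]
          from-comparison (k , _ , mod f) = mod (lin₂ (∣-trans m∣n f) q≈0 (+ 1) (k * x) (z-0≡1*[[z-0]-k*[q*x-0]]+k*x*q z k q x))

        one-mod-m : ∀ {x z} → R (slice x) z → z ≈ + 1 [ + m ]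
        one-mod-m {x} {z} r = from-comparison (compare one₁ r)
          where
          from-comparison : (∃ λ k → K k × (z - + 1 ≈ k * (slice x - + 1) [ + n ])) → z ≈ + 1 [ + m ]
          from-comparison (k , _ , mod e) = mod (lin₂ (∣-trans m∣n e) q≈0 (+ 1) (k * (x - + 1)) (z-1≡1*[[z-1]-k*[q*t+1-q-1]]+k*[t-1]*q z k q x))

        value-mod-P : ∀ {x x' y z k} → y ≈ q * x [ + n ] → slice x' - z ≈ k * (slice x - y) [ + n ] → z ≈ x' [ + P ]
        value-mod-P {x} {x'} {y} {z} {k} f e = mod (lin₃ (div (sliceP x')) (∣-trans P∣n (div e')) q≈1 (+ 1) (- + 1) k (z-x'≡1*[q*x'+1-q-x']+-1*[q*x'+1-q-z-k*[q*x+1-q-q*x]]+k*[q-1] x x' z k q))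
          where
          e' : slice x' - z ≈ k * (slice x - q * x) [ + n ]
          e' = ≈-trans e (≈-*ˡ k (≈-- (≈-refl (slice x)) f))

      -- Look from `slice x` at `q * x` in the other copy: their difference vanishes modulo `P`, so
      -- the image of `q * x` has the residue `x'`.
      slice⇒R' : ∀ {x x'} → R (slice x) (slice x') → R' x x'
      slice⇒R' {x} {x'} r = conclude (proj₁ (step r)) (proj₂ (step r) (resid n (q * x)))
        where
        conclude : ∀ (σ : Fin n ↔ Fin n) → R (ι (resid n (q * x))) (ι (to σ (resid n (q * x)))) ×
          (∃ λ k → K k × (slice x' - ι (to σ (resid n (q * x))) ≈ k * (slice x - ι (resid n (q * x))) [ + n ])) → R' x x'
        conclude σ (r' , k , _ , e) = R-resp (≈-refl (q * x)) (crt (≈-trans (value-mod-P {k = k} (ι-resid n (q * x)) e) (≈-sym (qP x'))) (≈-trans (vanishes-mod-m r'') (≈-sym (qm x')))) r''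
          where
          r'' : R (q * x) (ι (to σ (resid n (q * x))))
          r'' = R-resp (ι-resid n (q * x)) (≈-refl _) r'

      -- Points are compared inside the copy of multiples of `q`, while third vertices are taken
      -- from `slice`. The images of the latter are again in `slice`, so reducing them modulo `P`
      -- gives an injective map.
      eqtC : Equitable P C R'
      eqtC = record { step = step' ; resp = λ e f → R-resp (q-cong e) (q-cong f) ; zero₁ = zero' ; one₁ = one' }
        where
        zero' : Single (+ P) R' (+ 0)
        zero' {z} r = ≈-trans (≈-sym (qP z)) (modP (zero₁ (R-resp (≈-reflexive (ℤₚ.*-zeroʳ q)) (≈-refl (q * z)) r)))
        one' : Single (+ P) R' (+ 1)
        -- `q` and 1 agree modulo `P`, so comparison with the fixed point 1 leaves no freedom there.
        one' {z} r = from-comparison (compare one₁ r)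
          where
          from-comparison : (∃ λ k → K k × (q * z - + 1 ≈ k * (q * + 1 - + 1) [ + n ])) → z ≈ + 1 [ + P ]
          from-comparison (k , _ , mod f) = mod (lin₃ (div (qP z)) (∣-trans P∣n f) q≈1 (- + 1) (+ 1) k (z-1≡-1*[q*z-z]+1*[[q*z-1]-k*[q*1-1]]+k*[q-1] z k q))
        step' : ∀ {x x'} → R' x x' → Σ (Fin P ↔ Fin P) λ τ → ∀ t →
                R' (ι t) (ι (to τ t)) × ∃ λ k → C k × (x' - ι (to τ t) ≈ k * (x - ι t) [ + P ])
        step' {x} {x'} r = let τ , τ≡ = injective⇒↔ ℕₚ.≤-refl f f-inj in τ , λ t → subst (Good t) (sym (τ≡ t)) (good t (proj₂ (st (src t))))
          where
          σ = proj₁ (step r)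
          st = proj₂ (step r)
          Good : Fin P → Fin P → Set
          Good t t' = R' (ι t) (ι t') × ∃ λ k → C k × (x' - ι t' ≈ k * (x - ι t) [ + P ])
          src : Fin P → Fin n
          src t = resid n (slice (ι t))
          img : Fin P → ℤ
          img t = ι (to σ (src t))
          f : Fin P → Fin P
          f t = resid P (img t)
          r₁ : ∀ t → R (slice (ι t)) (img t)
          r₁ t = R-resp (ι-resid n (slice (ι t))) (≈-refl (img t)) (proj₁ (st (src t)))
          img-m : ∀ t → img t ≈ + 1 [ + m ]
          img-m t = one-mod-m (r₁ t)
          img≈ : ∀ t → img t ≈ slice (ι (f t)) [ + n ]
          img≈ t = ≈-trans (onto-slice (img-m t)) (slice-cong (≈-sym (ι-resid P (img t))))
          f-inj : ∀ s t → f s ≡ f t → s ≡ t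
          f-inj s t e = ι-injective (≈-trans (≈-sym (sliceP (ι s))) (≈-trans (modP (resid-≈ n {slice (ι s)} {slice (ι t)}
            (trans (sym (from-to σ (src s))) (trans (cong (from σ) (ι-injective (≈-trans (img≈ s) (≈-trans (≈-reflexive (cong (slice ∘ ι) e)) (≈-sym (img≈ t)))))) (from-to σ (src t)))))) (sliceP (ι t))))
          good : ∀ t → (∃ λ k → K k × (q * x' - img t ≈ k * (q * x - ι (src t)) [ + n ])) → Good t (f t)
          good t (k , c , e) = slice⇒R' (R-resp (≈-refl (slice (ι t))) (img≈ t) (r₁ t)) , k , C-intro k-m c , k-P
            where
            e' : q * x' - slice (ι (f t)) ≈ k * (q * x - slice (ι t)) [ + n ]
            e' = ≈-trans (≈-- (≈-refl (q * x')) (≈-sym (img≈ t))) (≈-trans e (≈-*ˡ k (≈-- (≈-refl (q * x)) (ι-resid n (slice (ι t))))))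
            k-m : k ≈ + 1 [ + m ]
            k-m = mod (lin₂ (∣-trans m∣n (div e')) q≈0 (+ 1) (- (x' - ι (f t) + + 1) + k * (x - ι t + + 1)) (k-1≡1*[[q*x'-[q*t'+1-q]]-k*[q*x-[q*t+1-q]]]+[-[x'-t'+1]+k*[x-t+1]]*q x x' k q (ι t) (ι (f t))))
            k-P : x' - ι (f t) ≈ k * (x - ι t) [ + P ]
            k-P = ≈-trans (≈-- (≈-sym (qP x')) (≈-sym (sliceP (ι (f t))))) (≈-trans (modP e') (≈-*ˡ k (≈-- (qP x) (sliceP (ι t)))))

      -- Rigidity of the component fixes `q * y`. Since `y` agrees with it modulo `P`, comparison
      -- shows that `y'` does too.
      combine : (∀ {x x'} → R' x x' → x' ≈ x [ + P ]) → ∀ {y y'} → R y y' → y' ≈ y [ + P ]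
      combine discrete {y} {y'} r = from-comparison (compare single r)
        where
        single : Single (+ n) R (q * y)
        single {z} ρ = ≈-trans z≈qz (q-cong (discrete (R-resp (≈-refl (q * y)) z≈qz ρ)))
          where
          z≈qz : z ≈ q * z [ + n ]
          z≈qz = crt (≈-sym (qP z)) (≈-trans (vanishes-mod-m ρ) (≈-sym (qm z)))
        from-comparison : (∃ λ k → K k × (y' - q * y ≈ k * (y - q * y) [ + n ])) → y' ≈ y [ + P ]
        from-comparison (k , _ , mod e) = mod (lin₂ (∣-trans P∣n e) q≈1 (+ 1) (y - k * y) (y'-y≡1*[[y'-q*y]-k*[y-q*y]]+[y-k*y]*[q-1] y y' k q))

      -- x + qc x² is an automorphism as soon as all 1 + ct are multipliers.
      quadratic : ∀ c → (∀ t → C (+ 1 + c * t)) → + P ∣ + 2 * c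
      quadratic c all = lin₂ (∣-trans P∣n (div (affine f preserved (+ 1) (+ 0)))) q≈1 (+ 1) (- (+ 2 * c)) (2*c≡1*[[[1+1+q*c*[[1+1]*[1+1]]]-[1+q*c*[1*1]]]-[[0+1+q*c*[[0+1]*[0+1]]]-[0+q*c*[0*0]]]]+-[2*c]*[q-1] c q)
        where
        f : ℤ → ℤ
        f x = x + q * c * (x * x)
        preserved : ∀ x y → ∃ λ k → K k × (f x - f y ≈ k * (x - y) [ + n ])
        preserved x y = slice (+ 1 + c * (x + y)) , all (x + y) , ≈-reflexive ([x+q*c*[x*x]]-[y+q*c*[y*y]]≡[q*[1+c*[x+y]]+1-q]*[x-y] q c x y)

      -- If all units modulo the prime P are multipliers, the residues 0 and 1 modulo P can be swapped.
      swapping : Prime P → 5 ℕ.≤ P → ¬ (∀ t → ¬ (+ P ∣ t) → C t)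
      -- 2 and 3 avoid the residues 0 and 1. The step from 2 to 3 is kept while the step from 0 to 1
      -- is reversed, so constant increments would make `P` divide 2.
      swapping pr 5≤P all = ∤small 2 (ℕₚ.≤-trans (from-yes (3 ℕₚ.≤? 5)) 5≤P) (ℕ.s≤s ℕ.z≤n)
        (claim (f (+ 3)) (f (+ 2)) (f (+ 1)) (f (+ 0)) f₃ f₂ f₁ f₀ (div (affine f preserved (+ 2) (+ 0))))
        where
        ∤small : ∀ j → j ℕ.< P → 0 ℕ.< j → ¬ (+ P ∣ + j)
        ∤small (suc j) j<p _ d = ℕᵈ.>⇒∤ j<p (∣⇒∣ᵤ d)
        data Place (x : ℤ) : Set where
          at0 : + P ∣ x → Place x
          at1 : + P ∣ (x - + 1) → Place x
          off : ¬ (+ P ∣ x) → ¬ (+ P ∣ (x - + 1)) → Place x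
        place : ∀ x → Place x
        place x with + P ∣? x | + P ∣? (x - + 1)
        ... | yes d | _     = at0 d
        ... | no _  | yes d = at1 d
        ... | no ¬d | no ¬e = off ¬d ¬e
        jump : ∀ {x} → Place x → ℤ
        jump (at0 _)   = + 1
        jump (at1 _)   = - + 1
        jump (off _ _) = + 0
        f : ℤ → ℤ
        f x = x + q * jump (place x)
        not-both : ∀ {x} → + P ∣ x → + P ∣ (x - + 1) → ⊥
        not-both {x} d e = ∤small 1 (ℕₚ.≤-trans (from-yes (2 ℕₚ.≤? 5)) 5≤P) (ℕ.s≤s ℕ.z≤n) (lin₂ d e (+ 1) (- + 1) (1≡1*x+-1*[x-1] x))
        same : ∀ {x y} (a : Place x) (b : Place y) → + P ∣ (x - y) → jump a ≡ jump b
        same (at0 _) (at0 _) d = refl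
        same (at1 _) (at1 _) d = refl
        same (off _ _) (off _ _) d = refl
        same {x} {y} (at0 a) (at1 b) d = ⊥-elim (not-both {y} (lin₂ a d (+ 1) (- + 1) (y≡1*x+-1*[x-y] x y)) b)
        same {x} {y} (at1 a) (at0 b) d = ⊥-elim (not-both {x} (lin₂ b d (+ 1) (+ 1) (x≡1*y+1*[x-y] x y)) a)
        same {x} {y} (at0 a) (off b _) d = ⊥-elim (b (lin₂ a d (+ 1) (- + 1) (y≡1*x+-1*[x-y] x y)))
        same {x} {y} (at1 a) (off _ b) d = ⊥-elim (b (lin₂ a d (+ 1) (- + 1) (y-1≡1*[x-1]+-1*[x-y] x y)))
        same {x} {y} (off a _) (at0 b) d = ⊥-elim (a (lin₂ b d (+ 1) (+ 1) (x≡1*y+1*[x-y] x y)))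
        same {x} {y} (off _ a) (at1 b) d = ⊥-elim (a (lin₂ b d (+ 1) (+ 1) (x-1≡1*[y-1]+1*[x-y] x y)))
        apart : ∀ {x y} (a : Place x) (b : Place y) → ¬ (+ P ∣ (x - y)) → ¬ (+ P ∣ (x + jump a - (y + jump b)))
        apart {x} {y} (at0 a) (at0 b) ¬d _ = ¬d (lin₂ a b (+ 1) (- + 1) (x-y≡1*x+-1*y x y))
        apart {x} {y} (at1 a) (at1 b) ¬d _ = ¬d (lin₂ a b (+ 1) (- + 1) (s-t≡1*[s-1]+-1*[t-1] x y))
        apart {x} {y} (off _ _) (off _ _) ¬d d = ¬d (lin₁ d (+ 1) (x-y≡1*[x+0-[y+0]] x y))
        apart {x} {y} (at0 a) (at1 b) ¬d d = ∤small 1 (ℕₚ.≤-trans (from-yes (2 ℕₚ.≤? 5)) 5≤P) (ℕ.s≤s ℕ.z≤n) (lin₃ d a b (+ 1) (- + 1) (+ 1) (1≡1*[x+1-[y+-1]]+-1*x+1*[y-1] x y))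
        apart {x} {y} (at1 a) (at0 b) ¬d d = ∤small 1 (ℕₚ.≤-trans (from-yes (2 ℕₚ.≤? 5)) 5≤P) (ℕ.s≤s ℕ.z≤n) (lin₃ d a b (- + 1) (+ 1) (- + 1) (1≡-1*[x+-1-[y+1]]+1*[x-1]+-1*y x y))
        apart {x} {y} (at0 a) (off _ b) ¬d d = b (lin₂ d a (- + 1) (+ 1) (y-1≡-1*[x+1-[y+0]]+1*x x y))
        apart {x} {y} (at1 a) (off b _) ¬d d = b (lin₂ d a (- + 1) (+ 1) (y≡-1*[x+-1-[y+0]]+1*[x-1] x y))
        apart {x} {y} (off _ a) (at0 b) ¬d d = a (lin₂ d b (+ 1) (+ 1) (x-1≡1*[x+0-[y+1]]+1*y x y))
        apart {x} {y} (off a _) (at1 b) ¬d d = a (lin₂ d b (+ 1) (+ 1) (x≡1*[x+0-[y+-1]]+1*[y-1] x y))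
        preserved : ∀ x y → ∃ λ k → K k × (f x - f y ≈ k * (x - y) [ + n ])
        preserved x y with + P ∣? (x - y)
        ... | yes d = + 1 , one , ≈-reflexive (trans (cong (λ j → x + q * j - f y) (same (place x) (place y) d)) (x+j-[y+j]≡1*[x-y] x y (q * jump (place y))))
        ... | no ¬d with prime-unit pr (x - y) ¬d
        -- `t` is the quotient of the new difference by the old one modulo `P`, a unit because the
        -- swap is injective.
        ...   | v , mod u = slice t , all t t-unit , crt
                  (mod (lin₃ q≈1 (div (sliceP t)) u (jump (place x) - jump (place y)) (- (x - y)) (- (x - y + (jump (place x) - jump (place y)))) (identity₁ x y v (jump (place x)) (jump (place y)) q)))
                  (mod (lin₂ q≈0 (div (slicem t)) (jump (place x) - jump (place y)) (- (x - y)) ([x+q*j-[y+q*j']]-s*[x-y]≡[j-j']*q+-[x-y]*[s-1] x y (jump (place x)) (jump (place y)) q (slice t))))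
          where
          t = (x + jump (place x) - (y + jump (place y))) * v
          t-unit : ¬ (+ P ∣ t)
          t-unit d = apart (place x) (place y) ¬d (lin₂ d u (x - y) (- (x + jump (place x) - (y + jump (place y)))) (w≡d*[w*v]+-w*[d*v-1] (x + jump (place x) - (y + jump (place y))) v (x - y)))
          identity₁ : ∀ x y v j j' q → (x + q * j - (y + q * j')) - (q * ((x + j - (y + j')) * v) + + 1 - q) * (x - y)
            ≡ (j - j') * (q - + 1) + - (x - y) * (q * ((x + j - (y + j')) * v) + + 1 - q - (x + j - (y + j')) * v) + - (x - y + (j - j')) * ((x - y) * v - + 1)
          identity₁ = solve-∀
        place-off : ∀ x (a : Place x) → ¬ (+ P ∣ x) → ¬ (+ P ∣ (x - + 1)) → jump a ≡ + 0
        place-off x (at0 d)   ¬a ¬b = ⊥-elim (¬a d)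
        place-off x (at1 d)   ¬a ¬b = ⊥-elim (¬b d)
        place-off x (off _ _) ¬a ¬b = refl
        place-0 : ∀ (a : Place (+ 0)) → jump a ≡ + 1
        place-0 (at0 _)    = refl
        place-0 (at1 d)    = ⊥-elim (not-both {+ 0} (divides (+ 0) refl) d)
        place-0 (off ¬d _) = ⊥-elim (¬d (divides (+ 0) refl))
        place-1 : ∀ (a : Place (+ 1)) → jump a ≡ - + 1
        place-1 (at0 d)    = ⊥-elim (not-both {+ 1} d (divides (+ 0) refl))
        place-1 (at1 d)    = refl
        place-1 (off _ ¬d) = ⊥-elim (¬d (divides (+ 0) refl))
        f₃ : f (+ 3) ≡ + 3 + q * + 0
        f₃ = cong (λ j → + 3 + q * j) (place-off (+ 3) (place (+ 3))
          (∤small 3 (ℕₚ.≤-trans (from-yes (4 ℕₚ.≤? 5)) 5≤P) (ℕ.s≤s ℕ.z≤n)) (∤small 2 (ℕₚ.≤-trans (from-yes (3 ℕₚ.≤? 5)) 5≤P) (ℕ.s≤s ℕ.z≤n)))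
        f₂ : f (+ 2) ≡ + 2 + q * + 0
        f₂ = cong (λ j → + 2 + q * j) (place-off (+ 2) (place (+ 2))
          (∤small 2 (ℕₚ.≤-trans (from-yes (3 ℕₚ.≤? 5)) 5≤P) (ℕ.s≤s ℕ.z≤n)) (∤small 1 (ℕₚ.≤-trans (from-yes (2 ℕₚ.≤? 5)) 5≤P) (ℕ.s≤s ℕ.z≤n)))
        f₁ : f (+ 1) ≡ + 1 + q * - + 1
        f₁ = cong (λ j → + 1 + q * j) (place-1 (place (+ 1)))
        f₀ : f (+ 0) ≡ + 0 + q * + 1
        f₀ = cong (λ j → + 0 + q * j) (place-0 (place (+ 0)))
        claim : ∀ a b c d → a ≡ + 3 + q * + 0 → b ≡ + 2 + q * + 0 → c ≡ + 1 + q * - + 1 → d ≡ + 0 + q * + 1 →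
                + n ∣ ((a - b) - (c - d)) → + P ∣ + 2
        claim _ _ _ _ refl refl refl refl e = lin₂ (∣-trans P∣n e) q≈1 (+ 1) (- + 2) (2≡1*[[[3+q*0]-[2+q*0]]-[[1+q*-1]-[0+q*1]]]+-2*[q-1] q)

      setting : Setting (+ P) C R'
      setting = record
        { group = multC ; quadraticᶻ = quadratic ; zeroᶻ = Equitable.zero₁ eqtC ; oneᶻ = Equitable.one₁ eqtC ; compareᶻ = Equitable.compare eqtC }

      finish : ∀ Z → + P ≡ Z → (Setting Z C R' → ∀ {x x'} → R' x x' → x' ≈ x [ Z ]) → ∀ {y y'} → R y y' → y' ≈ y [ + P ]
      finish _ refl h = combine (h setting)

      finish-prime : Prime P → 5 ℕ.≤ P →
        (∀ t → ¬ (+ P ∣ t) → ¬ C t → MultiplierGroup (+ P) C → Equitable P C R' → ∀ {x x'} → R' x x' → x' ≈ x [ + P ]) →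
        ∀ {y y'} → R y y' → y' ≈ y [ + P ]
      finish-prime pr 5≤P h = combine (result (Finₚ.any? λ (t : Fin P) → ¬? (+ P ∣? ι t) ×-dec ¬? (dec (slice (ι t)))))
        where
        result : Dec (∃ λ (t : Fin P) → ¬ (+ P ∣ ι t) × ¬ C (ι t)) → ∀ {x x'} → R' x x' → x' ≈ x [ + P ]
        result (yes (t , t-unit , t∉)) = h (ι t) t-unit t∉ multC eqtC
        result (no none) = ⊥-elim (swapping pr 5≤P λ t ¬t →
          resp (slice-cong (ι-resid P t)) (decidable-stable (dec (slice (ι (resid P t))))
            λ ¬c → none (resid P t , (λ d → ¬t (lin₂ d (div (ι-resid P t)) (+ 1) (- + 1) (t≡1*r+-1*[r-t] t (ι (resid P t))))) , ¬c)))

      -- 0 and 1 are fixed, and a related point cannot leave the one remaining residue, since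
      -- multipliers are nonzero.
      modulo-3 : P ≡ 3 → ∀ {x x'} → R' x x' → x' ≈ x [ + P ]
      modulo-3 refl {x} {x'} r = cases (ι-resid 3 x) (ι-resid 3 x') (Equitable.compare eqtC (Equitable.zero₁ eqtC) r) (Equitable.compare eqtC (Equitable.one₁ eqtC) r)
        where
        not-zero : ∀ {k} → C k → ¬ (k ≈ + 0 [ + 3 ])
        not-zero {k} c (mod e) = let k' , _ , mod f = MultiplierGroup.inv multC c in from-no (+ 3 ∣? + 1) (lin₂ e f k' (- + 1) (1≡k'*[k-0]+-1*[k*k'-1] k k'))
        cases : ∀ {i j : Fin 3} → ι i ≈ x [ + 3 ] → ι j ≈ x' [ + 3 ] →
                (∃ λ k → C k × (x' - + 0 ≈ k * (x - + 0) [ + 3 ])) → (∃ λ k → C k × (x' - + 1 ≈ k * (x - + 1) [ + 3 ])) → x' ≈ x [ + 3 ]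
        cases {Fin.zero} (mod i) _ (k , _ , mod e) _ = mod (lin₂ e i (+ 1) (+ 1 - k) (x'-x≡1*[[x'-0]-k*[x-0]]+[1-k]*[0-x] x x' k))
        cases {Fin.suc Fin.zero} (mod i) _ _ (k , _ , mod e) = mod (lin₂ e i (+ 1) (+ 1 - k) (x'-x≡1*[[x'-1]-k*[x-1]]+[1-k]*[1-x] x x' k))
        cases {Fin.suc (Fin.suc Fin.zero)} {Fin.zero} (mod i) (mod j) (k , c , mod e) _ = ⊥-elim (not-zero c (mod (lin₃ i (lin₂ j ∣-refl (+ 1) k refl) e (- k) (+ 1) (+ 1) (k-0≡-k*[2-x]+1*[1*[0-x']+k*3]+1*[[x'-0]-k*[x-0]] x x' k))))
        cases {Fin.suc (Fin.suc Fin.zero)} {Fin.suc Fin.zero} (mod i) (mod j) _ (k , c , mod e) = ⊥-elim (not-zero c (mod (lin₃ i j e k (- + 1) (- + 1) (k-0≡k*[2-x]+-1*[1-x']+-1*[[x'-1]-k*[x-1]] x x' k))))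
        cases {Fin.suc (Fin.suc Fin.zero)} {Fin.suc (Fin.suc Fin.zero)} i j _ _ = ≈-trans (≈-sym j) i

    prime-modulus : ∀ p m → Prime p → p ≢ 2 → n ≡ p ℕ.* m → ∀ α β → α * + p + β * + m ≡ + 1 → ∀ {y y'} → R y y' → y' ≈ y [ + p ]
    prime-modulus 2 m pr p≢2 n≡ α β b = ⊥-elim (p≢2 refl)
    prime-modulus 3 m pr _ n≡ α β b = Component.combine 3 m n≡ α β b (Component.modulo-3 3 m n≡ α β b refl)
    prime-modulus (suc (suc (suc (suc zero)))) m pr _ n≡ α β b = ⊥-elim (from-no (Data.Nat.Primality.prime? 4) pr)
      where import Data.Nat.Primality
    prime-modulus p@(suc m'@(suc (suc (suc (suc _))))) m pr _ n≡ α β b =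
      Component.finish-prime p m n≡ α β b pr (ℕ.s≤s (ℕ.s≤s (ℕ.s≤s (ℕ.s≤s (ℕ.s≤s ℕ.z≤n)))))
        λ t t-unit t∉ mult eqt → ModPrime.Proper.discrete m' pr mult eqt t t-unit t∉

    pos-^ : ∀ p a → + (p ℕ.^ a) ≡ (+ p) ^ a
    pos-^ p zero    = refl
    pos-^ p (suc a) = trans (ℤₚ.pos-* p (p ℕ.^ a)) (cong (+ p *_) (pos-^ p a))

    unit⇒bezout : ∀ {Z P m} → Z ≡ P → Unit P m → ∃₂ λ α β → α * Z + β * m ≡ + 1
    unit⇒bezout {P = P} {m} refl (y , mod (divides s e)) = - s , y , trans (-s*P+y*m≡m*y-s*P s P y m) (trans (cong (λ z → m * y - z) (sym e)) (m*y-[m*y-1]≡1 m y))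

    prime-power : ∀ p a m → Prime p → n ≡ p ℕ.^ suc a ℕ.* m → ¬ (p ℕᵈ.∣ m) → ∀ {y y'} → R y y' → y' ≈ y [ + (p ℕ.^ suc a) ]
    prime-power p a m pr n≡ p∤m = go a (p ℕₚ.≟ 2) n≡ bezout
      where
      instance
        p≢0 : NonZero p
        p≢0 = prime⇒nonZero pr
      bezout : ∃₂ λ α β → α * + (p ℕ.^ suc a) + β * + m ≡ + 1
      bezout = unit⇒bezout (pos-^ p (suc a)) (unit-^ {+ p} {+ m} a (prime-unit pr (+ m) (λ d → p∤m (∣⇒∣ᵤ d))))
      go : ∀ a → Dec (p ≡ 2) → n ≡ p ℕ.^ suc a ℕ.* m → (∃₂ λ α β → α * + (p ℕ.^ suc a) + β * + m ≡ + 1) →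
           ∀ {y y'} → R y y' → y' ≈ y [ + (p ℕ.^ suc a) ]
      go zero (yes refl) n≡ (α , β , b) = Component.finish 2 m n≡ α β b (+ 2) refl λ s →
        let open Setting s in PowerOfTwo.modulo-2 group zeroᶻ oneᶻ compareᶻ ∣-refl
      go (suc zero) (yes refl) n≡ (α , β , b) = Component.finish 4 m n≡ α β b (+ 4) refl λ s →
        let open Setting s in PowerOfTwo.modulo-4 group zeroᶻ oneᶻ compareᶻ refl
      go (suc (suc a)) (yes refl) n≡ (α , β , b) =
        Component.finish (2 ℕ.^ suc (suc (suc a))) m {{ℕₚ.m^n≢0 2 (suc (suc (suc a)))}} n≡ α β b ((+ 2) ^ (suc a ℕ.+ 2)) shape λ s →
          let open Setting s in HigherPowerOfTwo.discrete a group quadraticᶻ zeroᶻ oneᶻ compareᶻ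
        where
        shape : + (2 ℕ.^ suc (suc (suc a))) ≡ (+ 2) ^ (suc a ℕ.+ 2)
        shape = trans (pos-^ 2 (suc (suc (suc a)))) (cong (λ e → (+ 2) ^ suc e) (ℕₚ.+-comm 2 a))
      go zero (no p≢2) n≡ (α , β , b) {y} {y'} r = subst (λ z → y' ≈ y [ + z ]) (sym (ℕₚ.*-identityʳ p))
        (prime-modulus p m pr p≢2 (trans n≡ (cong (ℕ._* m) (ℕₚ.*-identityʳ p))) α β (subst (λ z → α * + z + β * + m ≡ + 1) (ℕₚ.*-identityʳ p) b) r)
      go (suc a) (no p≢2) n≡ (α , β , b) =
        Component.finish (p ℕ.^ suc (suc a)) m {{ℕₚ.m^n≢0 p (suc (suc a))}} n≡ α β b ((+ p) ^ suc (suc a)) (pos-^ p (suc (suc a))) λ s →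
          let open Setting s in OddPrimePower.discrete p pr odd a group quadraticᶻ zeroᶻ oneᶻ compareᶻ
        where
        odd : ¬ (+ p ∣ + 2)
        odd d = p≢2 (ℕₚ.≤-antisym (ℕᵈ.∣⇒≤ (∣⇒∣ᵤ d)) (nonTrivial⇒n>1 p {{prime⇒nonTrivial pr}}))
          where open import Data.Nat.Base using (nonTrivial⇒n>1)

    private
      valuation : ∀ p → Prime p → ∀ k → k ≢ 0 → Acc ℕ._<_ k → ∃₂ λ a m → (k ≡ p ℕ.^ a ℕ.* m) × ¬ (p ℕᵈ.∣ m)
      valuation p pr k k≢0 (acc rec) with p ℕᵈ.∣? k
      ... | no p∤k = 0 , k , sym (ℕₚ.+-identityʳ k) , p∤k
      ... | yes (ℕᵈ.divides k' refl) with valuation p pr k' (λ { refl → k≢0 refl }) (rec smaller)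
        where
        open import Data.Nat.Base using (nonTrivial⇒n>1; ≢-nonZero)
        instance
          k'≢0 : NonZero k'
          k'≢0 = ≢-nonZero (λ { refl → k≢0 refl })
        smaller : k' ℕ.< k' ℕ.* p
        smaller = ℕₚ.m<m*n k' p (nonTrivial⇒n>1 p {{prime⇒nonTrivial pr}})
      ...   | a , m , refl , p∤m = suc a , m , identity p (p ℕ.^ a) m , p∤m
        where
        identity : ∀ p P m → P ℕ.* m ℕ.* p ≡ p ℕ.* P ℕ.* m
        identity = ℕSolve.solve-∀
          where import Data.Nat.Tactic.RingSolver as ℕSolve

      prime-factor : ∀ h → h ≢ 0 → h ≢ 1 → ∃ λ p → Prime p × (p ℕᵈ.∣ h)
      prime-factor h h≢0 h≢1 with factorise h {{≢-nonZero h≢0}}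
        where open import Data.Nat.Base using (≢-nonZero)
      ... | record { factors = []     ; isFactorisation = e } = ⊥-elim (h≢1 e)
      ... | record { factors = p ∷ ps ; isFactorisation = e ; factorsPrime = pr ∷ _ } = p , pr , ℕᵈ.divides (product ps) (trans e (ℕₚ.*-comm p (product ps)))

    -- For a prime p dividing n / gcd(n , D) the full p-part of n would divide D, hence the gcd.
    discrete : ∀ {y y'} → R y y' → y' ≈ y [ + n ]
    discrete {y} {y'} r with gcd[m,n]∣m n ∣ y' - y ∣
    ... | ℕᵈ.divides h n≡ = conclude (h ℕₚ.≟ 1)
      where
      open import Data.Nat.Base using (≢-nonZero; ≢-nonZero⁻¹)
      g = gcd n ∣ y' - y ∣
      n≢0 : n ≢ 0
      n≢0 = ≢-nonZero⁻¹ n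
      conclude : Dec (h ≡ 1) → y' ≈ y [ + n ]
      conclude (yes refl) = mod (∣ᵤ⇒∣ (subst (ℕᵈ._∣ ∣ y' - y ∣) (trans (sym (ℕₚ.+-identityʳ g)) (sym n≡)) (gcd[m,n]∣n n ∣ y' - y ∣)))
      conclude (no h≢1) with prime-factor h (λ { refl → n≢0 n≡ }) h≢1
      ... | p , pr , p∣h with valuation p pr n n≢0 (<-wellFounded n)
      ...   | zero , m , e , p∤m = ⊥-elim (p∤m (subst (p ℕᵈ.∣_) (trans e (ℕₚ.+-identityʳ m)) (ℕᵈ.∣-trans p∣h (ℕᵈ.divides g (trans n≡ (ℕₚ.*-comm h g))))))
      ...   | suc a , m , e , p∤m = ⊥-elim (p∤m (ℕᵈ.*-cancelˡ-∣ (p ℕ.^ suc a) {{ℕₚ.m^n≢0 p (suc a) {{prime⇒nonZero pr}}}}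
          (subst (p ℕ.^ suc a ℕ.* p ℕᵈ.∣_) (trans (ℕₚ.*-comm g h) (trans (sym n≡) e)) (ℕᵈ.*-pres-∣ P∣g p∣h))))
        where
        P∣g : p ℕ.^ suc a ℕᵈ.∣ g
        P∣g = gcd-greatest (ℕᵈ.divides m (trans e (ℕₚ.*-comm (p ℕ.^ suc a) m))) (∣⇒∣ᵤ (div (prime-power p a m pr e p∤m r)))

-- A circulant scheme paired with an arbitrary configuration; rigidity of normal sections.

module CirculantPair where

  open import Defs
  open Matching
  open Coherence
  open Quotient
  open Congruence
  open Multipliers
  open Rigidity
  open Separability using (Extension)
  open Identities
  open import Data.Nat as ℕ using (ℕ; zero; suc; NonZero)
  import Data.Nat.Properties as ℕₚ
  import Data.Nat.Divisibility as ℕᵈ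
  import Data.Nat.DivMod as ℕᵐ
  open import Data.Integer using (ℤ; +_; -_; _+_; _-_; _*_; ∣_∣)
  import Data.Integer.Properties as ℤₚ
  open import Data.Integer.Divisibility.Signed using (_∣_; divides; _∣?_; ∣-trans; ∣-refl; ∣⇒∣ᵤ; ∣ᵤ⇒∣)
  open import Data.Fin using (Fin; toℕ)
  import Data.Fin.Properties as Finₚ
  open import Data.Bool using (Bool; true; false)
  open import Data.Product using (Σ; ∃; ∃₂; _×_; _,_; proj₁; proj₂)
  open import Data.Unit using (⊤; tt)
  open import Function.Bundles using (_↔_)
  open import Relation.Binary.Definitions using (DecidableEquality)
  open import Relation.Binary.PropositionalEquality using (_≡_; refl; sym; trans; cong; subst)
  open import Relation.Nullary using (Dec)
  open import Relation.Nullary.Decidable using (⌊_⌋; map′; decidable-stable)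

  %-≈ : ∀ s n .{{_ : NonZero n}} → + (s ℕᵐ.% n) ≈ + s [ + n ]
  %-≈ s n = mod (divides (- + (s ℕᵐ./ n))
    (trans (cong (λ z → + (s ℕᵐ.% n) - z) split) (r-[r+q*n]≡-q*n (+ (s ℕᵐ.% n)) (+ (s ℕᵐ./ n)) (+ n))))
    where
    split : + s ≡ + (s ℕᵐ.% n) + + (s ℕᵐ./ n) * + n
    split = trans (cong +_ (ℕᵐ.m≡m%n+[m/n]*n s n)) (trans (ℤₚ.pos-+ (s ℕᵐ.% n) (s ℕᵐ./ n ℕ.* n)) (cong (λ z → + (s ℕᵐ.% n) + z) (ℤₚ.pos-* (s ℕᵐ./ n) n)))

  ι-⊕ : ∀ {n} (a b : Fin n) → ι (a ⊕ b) ≈ ι a + ι b [ + n ]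
  ι-⊕ {suc m} a b = ≈-trans (≈-reflexive (cong +_ (Finₚ.toℕ-fromℕ< (ℕᵐ.m%n<n (toℕ a ℕ.+ toℕ b) (suc m)))))
    (≈-trans (%-≈ (toℕ a ℕ.+ toℕ b) (suc m)) (≈-reflexive (ℤₚ.pos-+ (toℕ a) (toℕ b))))

  ℕ∣⇒∣ : ∀ {d z} → d ℕᵈ.∣ z → + d ∣ + z
  ℕ∣⇒∣ {d} {z} e = ∣ᵤ⇒∣ {+ d} {+ z} e

  sameCoset⇒∣ : ∀ {n d} → d ℕᵈ.∣ n → {x y : Fin n} → SameCoset d x y → + d ∣ (ι y - ι x)
  sameCoset⇒∣ {n} {d} d∣n {x} {y} (h , d∣h , e) =
    lin₂ (∣-trans (ℕ∣⇒∣ d∣n) (div (≈-trans (≈-reflexive (cong ι e)) (ι-⊕ x h)))) (ℕ∣⇒∣ d∣h) (+ 1) (+ 1) (y-x≡1*[y-[x+h]]+1*h (ι x) (ι h) (ι y))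

  ∣⇒sameCoset : ∀ {n d} .{{_ : NonZero n}} → d ℕᵈ.∣ n → {x y : Fin n} → + d ∣ (ι y - ι x) → SameCoset d x y
  ∣⇒sameCoset {n} {d} d∣n {x} {y} e = resid n (ι y - ι x) ,
    ∣⇒∣ᵤ (lin₂ (∣-trans (ℕ∣⇒∣ d∣n) (div r)) e (+ 1) (+ 1) (x≡1*[x-y]+1*y (ι (resid n (ι y - ι x))) (ι y - ι x))) ,
    ι-injective (≈-sym (≈-trans (ι-⊕ x (resid n (ι y - ι x))) (≈-trans (≈-+ (≈-refl (ι x)) r) (≈-reflexive (x+[y-x]≡y (ι x) (ι y))))))
    where
    r : ι (resid n (ι y - ι x)) ≈ ι y - ι x [ + n ]
    r = ι-resid n (ι y - ι x)

  -- Membership in the coset i u + L, l = k u, is congruence modulo l.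
  module _ {n k : ℕ} (u : ℕ) where

    private
      l : ℕ
      l = k ℕ.* u

    inCoset⇒∣ : ∀ (i : Fin k) (x : Fin n) → inCoset {n} {k} u i x ≡ true → + l ∣ (ι x - ι i * + u)
    inCoset⇒∣ i x e =
      let a , b = ∧-true e
          iu≤x = ⌊⌋-sound (toℕ i ℕ.* u ℕ.≤? toℕ x) a
          d = ⌊⌋-sound (l ℕᵈ.∣? (toℕ x ℕ.∸ toℕ i ℕ.* u)) b in
      subst (+ l ∣_) (trans (sym (ℤₚ.⊖-≥ iu≤x)) (trans (sym (ℤₚ.[+m]-[+n]≡m⊖n (toℕ x) (toℕ i ℕ.* u))) (cong (_-_ (ι x)) (ℤₚ.pos-* (toℕ i) u)))) (ℕ∣⇒∣ d)

    ∣⇒inCoset : .{{_ : NonZero u}} → ∀ (i : Fin k) (x : Fin n) → + l ∣ (ι x - ι i * + u) → inCoset {n} {k} u i x ≡ true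
    ∣⇒inCoset i x d = ∧-intro (⌊⌋-true (toℕ i ℕ.* u ℕ.≤? toℕ x) iu≤x) (⌊⌋-true (l ℕᵈ.∣? (toℕ x ℕ.∸ toℕ i ℕ.* u)) (∣⇒∣ᵤ d'))
      where
      iu = toℕ i ℕ.* u
      iu<l : iu ℕ.< l
      iu<l = ℕₚ.*-monoˡ-< u (Finₚ.toℕ<n i)
      d₁ : + l ∣ (+ toℕ x - + iu)
      d₁ = subst (λ z → + l ∣ (ι x - z)) (sym (ℤₚ.pos-* (toℕ i) u)) d
      iu≤x : iu ℕ.≤ toℕ x
      iu≤x = decidable-stable (iu ℕ.≤? toℕ x) λ ¬p → ¬p (ℕₚ.≤-reflexive (sym (ℤₚ.+-injective (ℤₚ.i-j≡0⇒i≡j (+ toℕ x) (+ iu) (∣-small d₁ (small-difference (ℕₚ.<-trans (ℕₚ.≰⇒> ¬p) iu<l) iu<l))))))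
      d' : + l ∣ + (toℕ x ℕ.∸ iu)
      d' = subst (+ l ∣_) (trans (ℤₚ.[+m]-[+n]≡m⊖n (toℕ x) iu) (ℤₚ.⊖-≥ iu≤x)) d₁

  module Pair (n : ℕ) .{{_ : NonZero n}} {n' : ℕ} {C : Set} (_≟_ : DecidableEquality C)
    (c : Fin n → Fin n → C) (c' : Fin n' → Fin n' → C) (joint : Coherent₂ c c')
    (circulant : ∀ x y → c x y ≡ c (resid n (+ 0)) (resid n (ι y - ι x))) where

    pt : ℤ → Fin n
    pt = resid n

    -- All colours on Ω' have this form as well, although Ω' carries no group structure; differences
    -- are therefore available there only up to equality of `D`.
    D : ℤ → C
    D z = c (pt (+ 0)) (pt z)

    pt-≈ : ∀ z → ι (pt z) ≈ z [ + n ]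
    pt-≈ = ι-resid n

    D-cong : ∀ {x y} → x ≈ y [ + n ] → D x ≡ D y
    D-cong e = cong (c (pt (+ 0))) (resid-cong n e)

    c-D : ∀ x y → c x y ≡ D (ι y - ι x)
    c-D = circulant

    c-pt : ∀ x y → c (pt x) (pt y) ≡ D (y - x)
    c-pt x y = trans (c-D (pt x) (pt y)) (D-cong (≈-- (pt-≈ y) (pt-≈ x)))

    D-triangle : ∀ {x y} → D x ≡ D y → ∀ s → ∃ λ r → (D s ≡ D r) × (D (x - s) ≡ D (y - r))
    D-triangle {x} {y} e s = let δ , f , g = triangle joint false false (pt (+ 0)) (pt x) (pt (+ 0)) (pt y) e (pt s) in
      ι δ , trans f (cong (c (pt (+ 0))) (sym (resid-ι δ))) ,
      trans (sym (c-pt s x)) (trans g (trans (c-D δ (pt y)) (D-cong (≈-- (pt-≈ y) (≈-refl (ι δ))))))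

    c'-diag : ∀ a → c' a a ≡ D (+ 0)
    c'-diag a with realised joint true false a a
    ... | x , y , e with diagonal joint true false a x y e
    ...   | refl = trans e (trans (c-D x x) (cong D (x-x≡0 (ι x))))

    c'-D : ∀ a b → ∃ λ w → c' a b ≡ D w
    c'-D a b = let x , y , e = realised joint true false a b in ι y - ι x , trans e (c-D x y)

    c'-neg : ∀ {a b w} → c' a b ≡ D w → c' b a ≡ D (- w)
    c'-neg {a} {b} {w} e = trans (transpose joint true false a b (pt (+ 0)) (pt w) e) (trans (c-pt w (+ 0)) (cong D (0-x≡-x w)))

    c'-split : ∀ {a b w} → c' a b ≡ D w → ∀ x → ∃ λ s → (c' a x ≡ D s) × (c' x b ≡ D (w - s))
    c'-split {a} {b} {w} e x = let δ , f , g = triangle joint true false a b (pt (+ 0)) (pt w) e x in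
      ι δ , trans f (cong (c (pt (+ 0))) (sym (resid-ι δ))) ,
      trans g (trans (c-D δ (pt w)) (D-cong (≈-- (pt-≈ w) (≈-refl (ι δ)))))

    -- The converse of `c'-split`: there the intermediate point is given and its difference is
    -- found.
    c'-fill : ∀ {a b w} → c' a b ≡ D w → ∀ s → ∃ λ x → (c' a x ≡ D s) × (c' x b ≡ D (w - s))
    c'-fill {a} {b} {w} e s = let x , f , g = triangle joint false true (pt (+ 0)) (pt w) a b (sym e) (pt s) in
      x , sym f , trans (sym g) (c-pt s w)

    IsGroup : ℕ → Set
    IsGroup d = (+ d ∣ + n) × (∀ {x y} → D x ≡ D y → + d ∣ x → + d ∣ y)

    -- The relation of Ω' that corresponds to e(H_d).
    record E' (d : ℕ) (a b : Fin n') : Set where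
      constructor in-class
      field
        factor : ℤ
        colour : c' a b ≡ D (+ d * factor)

    E'? : ∀ d a b → Dec (E' d a b)
    E'? d a b = map′ (λ { (z , e) → in-class (ι z) e }) (λ { (in-class z e) → pt z , trans e (D-cong (≈-*ˡ (+ d) (≈-sym (pt-≈ z)))) })
      (Finₚ.any? λ (z : Fin n) → c' a b ≟ D (+ d * ι z))

    E'-intro : ∀ {d a b w} → c' a b ≡ D w → + d ∣ w → E' d a b
    E'-intro {d} e (divides q f) = in-class q (trans e (cong D (trans f (ℤₚ.*-comm q (+ d)))))

    module _ {d : ℕ} (grp : IsGroup d) where

      E'-elim : ∀ {a b w} → E' d a b → c' a b ≡ D w → + d ∣ w
      E'-elim (in-class z f) e = proj₂ grp (trans (sym f) e) (divides z (ℤₚ.*-comm (+ d) z))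

      E'-refl : ∀ a → E' d a a
      E'-refl a = E'-intro {w = + 0} (c'-diag a) (divides (+ 0) refl)

      E'-sym : ∀ {a b} → E' d a b → E' d b a
      E'-sym (in-class z e) = E'-intro {w = - (+ d * z)} (c'-neg e) (divides (- z) (-[d*z]≡-z*d (+ d) z))

      E'-trans : ∀ {a b x} → E' d a b → E' d b x → E' d a x
      E'-trans {a} {b} {x} p q =
        let w , e = c'-D a x
            s , f , g = c'-split e b in
        E'-intro {w = w} e (lin₂ (E'-elim p f) (E'-elim q g) (+ 1) (+ 1) (x≡1*y+1*[x-y] w s))

      -- Moving an endpoint inside its class changes the difference by a multiple of d.
      c'-moveʳ : ∀ {a b b' w} → c' a b ≡ D w → E' d b b' → ∃ λ t → c' a b' ≡ D (w + + d * t)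
      c'-moveʳ {a} {b} {b'} {w} e q =
        let v , f = c'-D a b'
            s , g , h = c'-split f b
            r , i , j = D-triangle (trans (sym g) e) (s - v) in
        back v s r f j (proj₂ grp i (lin₁ (E'-elim q h) (- + 1) (y-x≡-1*[x-y] v s)))
        where
        back : ∀ v s r → c' a b' ≡ D v → D (s - (s - v)) ≡ D (w - r) → + d ∣ r → ∃ λ t → c' a b' ≡ D (w + + d * t)
        back v s r f j (divides q' e') = - q' , trans f (trans (sym (cong D (s-[s-v]≡v s v))) (trans j (cong D (trans (cong (_-_ w) e') (w-q*d≡w+d*-q w q' (+ d))))))

      c'-moveˡ : ∀ {a a' b w} → c' a b ≡ D w → E' d a a' → ∃ λ t → c' a' b ≡ D (w + + d * t)
      c'-moveˡ {w = w} e q = let t , f = c'-moveʳ (c'-neg e) q in - t , trans (c'-neg f) (cong D (-[-w+d*t]≡w+d*-t w (+ d) t))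

    E'-mono : ∀ {d d' a b} → + d ∣ + d' → E' d' a b → E' d a b
    E'-mono {d} {d'} (divides q f) (in-class z e) = E'-intro {w = + d' * z} e (divides (z * q) (trans (cong (_* z) f) (q*d*z≡z*q*d q (+ d) z)))

    module SectionOf (u k : ℕ) .{{_ : NonZero u}} .{{_ : NonZero k}} (u-grp : IsGroup u) (l-grp : IsGroup (k ℕ.* u)) where

      l : ℕ
      l = k ℕ.* u

      L≡ : + l ≡ + k * + u
      L≡ = ℤₚ.pos-* k u

      u∣l : + u ∣ + l
      u∣l = divides (+ k) L≡

      mem : Fin k → Fin n → Bool
      mem = inCoset {n} {k} u

      mem⇒ : ∀ {i x} → mem i x ≡ true → + l ∣ (ι x - ι i * + u)
      mem⇒ {i} {x} = inCoset⇒∣ u i x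

      mem⇐ : ∀ {i x} → + l ∣ (ι x - ι i * + u) → mem i x ≡ true
      mem⇐ {i} {x} = ∣⇒inCoset u i x

      mem-pt : ∀ z → mem (resid k z) (pt (+ u * z)) ≡ true
      mem-pt z = mem⇐ {resid k z} {pt (+ u * z)} (lin₂ (∣-trans (proj₁ l-grp) (div (pt-≈ (+ u * z)))) scaled (+ 1) (- + 1) (p-r≡1*[p-z]+-1*[r-z] (ι (pt (+ u * z))) (+ u * z) (ι (resid k z) * + u)))
        where
        scaled : + l ∣ (ι (resid k z) * + u - + u * z)
        scaled = let mod (divides q e) = ι-resid k z in divides q (trans (r*u-u*z≡[r-z]*u (ι (resid k z)) (+ u) z) (trans (cong (_* + u) e) (trans (ℤₚ.*-assoc q (+ k) (+ u)) (cong (q *_) (sym L≡)))))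

      mem-intro : ∀ {x} → + u ∣ ι x → ∃ λ i → mem i x ≡ true
      mem-intro {x} (divides q e) = resid k q , subst (λ y → mem (resid k q) y ≡ true) (trans (cong pt (trans (ℤₚ.*-comm (+ u) q) (sym e))) (resid-ι x)) (mem-pt q)

      mem-u : ∀ {i x} → mem i x ≡ true → + u ∣ ι x
      mem-u {i} {x} m = lin₂ (∣-trans u∣l (mem⇒ {i} {x} m)) ∣-refl (+ 1) (ι i) (x≡1*[x-y]+y (ι x) (ι i * + u))

      mem-≡ : ∀ {i j x} → mem i x ≡ true → mem j x ≡ true → i ≡ j
      mem-≡ {i} {j} {x} m m' = ι-injective (mod (cancel (lin₂ (mem⇒ {i} {x} m) (mem⇒ {j} {x} m') (- + 1) (+ 1) ([i-j]*u≡-1*[x-i*u]+1*[x-j*u] (ι x) (ι i) (ι j) (+ u)))))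
        where
        cancel : ∀ {z} → + l ∣ (z * + u) → + k ∣ z
        cancel {z} (divides q e) = divides q (ℤₚ.*-cancelʳ-≡ z (q * + k) (+ u) (trans e (trans (cong (q *_) L≡) (sym (ℤₚ.*-assoc q (+ k) (+ u))))))

      cancel-u : ∀ {z} → + l ∣ (+ u * z) → + k ∣ z
      cancel-u {z} (divides q e) = divides q (ℤₚ.*-cancelʳ-≡ z (q * + k) (+ u) (trans (ℤₚ.*-comm z (+ u)) (trans e (trans (cong (q *_) L≡) (sym (ℤₚ.*-assoc q (+ k) (+ u)))))))

      mem-block : ∀ {i j x x' y y'} → mem i x ≡ true → mem j x' ≡ true → c x y ≡ c x' y' → mem i y ≡ true → mem j y' ≡ true
      mem-block {i} {j} {x} {x'} {y} {y'} mx mx' e my = mem⇐ {j} {y'} (lin₂ (proj₂ l-grp (trans (sym (c-D x y)) (trans e (c-D x' y')))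
          (lin₂ (mem⇒ {i} {y} my) (mem⇒ {i} {x} mx) (+ 1) (- + 1) (y-x≡1*[y-z]+-1*[x-z] (ι x) (ι y) (ι i * + u)))) (mem⇒ {j} {x'} mx') (+ 1) (+ 1) (y-z≡1*[y-x]+1*[x-z] (ι x') (ι y') (ι j * + u)))

      mem-support : ∀ {i j k x x' y y'} → mem i x ≡ true → mem j x' ≡ true → c x y ≡ c x' y' → mem k y ≡ true → ∃ λ k' → mem k' y' ≡ true
      mem-support {i} {j} {k} {x} {x'} {y} {y'} mx mx' e my = mem-intro (lin₂ (proj₂ u-grp (trans (sym (c-D x y)) (trans e (c-D x' y')))
          (lin₂ (mem-u {k} {y} my) (mem-u {i} {x} mx) (+ 1) (- + 1) (y-x≡1*y+-1*x (ι x) (ι y)))) (mem-u {j} {x'} mx') (+ 1) (+ 1) (y≡1*[y-x]+1*x (ι x') (ι y')))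

      selfSection : Section {⊤} (λ _ → c) (λ _ → k) (λ _ → mem)
      selfSection = record
        { inhabited = λ _ i → pt (+ u * ι i) , subst (λ j → mem j (pt (+ u * ι i)) ≡ true) (resid-ι i) (mem-pt (ι i))
        ; disjoint  = λ _ i j x → mem-≡ {i} {j} {x}
        ; block     = λ _ _ i j x x' y y' → mem-block {i} {j} {x} {x'} {y} {y'}
        ; support   = λ _ _ i j l x x' y y' → mem-support {i} {j} {l} {x} {x'} {y} {y'}
        ; meets     = λ _ _ i x m → i , x , m , refl
        }

      -- Equality of colours in X_{U/L}, for the differences u z and u z' of cosets.
      record _∼_ (z z' : ℤ) : Set where
        constructor same
        field
          shift  : ℤ
          colour : D (+ u * z) ≡ D (+ u * z' + + l * shift)

      SameQ : Fin k → Fin k → Fin k → Fin k → Set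
      SameQ i j i' j' = ∃₂ λ x y → ∃₂ λ x' y' → ((mem i x ≡ true) × (mem j y ≡ true)) × ((mem i' x' ≡ true) × (mem j' y' ≡ true)) × (c x y ≡ c x' y')

      block-diff : ∀ {i j x y} → mem i x ≡ true → mem j y ≡ true → ∃ λ t → c x y ≡ D (+ u * (ι j - ι i) + + l * t)
      block-diff {i} {j} {x} {y} mx my = let divides q e = lin₂ (mem⇒ {j} {y} my) (mem⇒ {i} {x} mx) (+ 1) (- + 1) refl in q , trans (c-D x y) (cong D (trans (y-x≡u*[j-i]+[1*[y-j*u]+-1*[x-i*u]] (ι x) (ι y) (ι i) (ι j) (+ u)) (cong (λ z → + u * (ι j - ι i) + z) (trans e (ℤₚ.*-comm q (+ l))))))

      -- A multiple of `l` changes sides through a triangle: the third vertex at a multiple of `l`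
      -- has to go to a multiple of `l`.
      ∼-shift : ∀ {x y s t} → D (x + + l * s) ≡ D (y + + l * t) → ∃ λ r → D x ≡ D (y + + l * r)
      ∼-shift {x} {y} {s} {t} e =
        let r , f , g = D-triangle e (+ l * s)
            divides q e' = proj₂ l-grp f (divides s (ℤₚ.*-comm (+ l) s)) in
        t - q , trans (cong D (x≡x+s-s x (+ l * s))) (trans g (cong D (trans (cong (λ z → y + + l * t - z) e') (y+l*t-q*l≡y+l*[t-q] y (+ l) t q))))

      from-∃ : ∀ {z z'} → (∃ λ t → D (+ u * z) ≡ D (+ u * z' + + l * t)) → z ∼ z'
      from-∃ (t , e) = same t e

      sameQ⇒∼ : ∀ {i j i' j'} → SameQ i j i' j' → (ι j - ι i) ∼ (ι j' - ι i')
      sameQ⇒∼ {i} {j} {i'} {j'} (x , y , x' , y' , (a , b) , (a' , b') , f) =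
        combined (block-diff {i} {j} {x} {y} a b) (block-diff {i'} {j'} {x'} {y'} a' b')
        where
        combined : (∃ λ s → c x y ≡ D (+ u * (ι j - ι i) + + l * s)) → (∃ λ t → c x' y' ≡ D (+ u * (ι j' - ι i') + + l * t)) → (ι j - ι i) ∼ (ι j' - ι i')
        combined (s , g) (t , h) = from-∃ (∼-shift {+ u * (ι j - ι i)} {+ u * (ι j' - ι i')} {s} {t} (trans (sym g) (trans f h)))

      ∼⇒sameQ : ∀ {i j i' j'} → (ι j - ι i) ∼ (ι j' - ι i') → SameQ i j i' j'
      ∼⇒sameQ {i} {j} {i'} {j'} (same t e) =
        P i , P j , P i' , pt (+ u * ι j' + + l * t) , (at i , at j) , (at i' , moved) ,
         trans (c-pt (+ u * ι i) (+ u * ι j)) (trans (cong D (u*j-u*i≡u*[j-i] (+ u) (ι i) (ι j)))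
           (trans e (trans (cong D (u*[j-i]+s≡u*j+s-u*i (+ u) (ι i') (ι j') (+ l * t))) (sym (c-pt (+ u * ι i') (+ u * ι j' + + l * t))))))
        where
        P : Fin k → Fin n
        P i = pt (+ u * ι i)
        at : ∀ i → mem i (P i) ≡ true
        at i = subst (λ j → mem j (P i) ≡ true) (resid-ι i) (mem-pt (ι i))
        moved : mem j' (pt (+ u * ι j' + + l * t)) ≡ true
        moved = mem⇐ {j'} {pt (+ u * ι j' + + l * t)} (lin₂ (∣-trans (proj₁ l-grp) (div (pt-≈ (+ u * ι j' + + l * t)))) (divides t (ℤₚ.*-comm (+ l) t)) (+ 1) (+ 1) (p-j*u≡1*[p-[u*j+s]]+1*s (ι (pt (+ u * ι j' + + l * t))) (+ u) (ι j') (+ l * t)))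

      ∼-refl : ∀ z → z ∼ z
      ∼-refl z = same (+ 0) (cong D (x≡x+l*0 (+ u * z) (+ l)))

      ∼-reflexive : ∀ {z z'} → z ≡ z' → z ∼ z'
      ∼-reflexive {z} refl = ∼-refl z

      ∼-sym : ∀ {z z'} → z ∼ z' → z' ∼ z
      ∼-sym {z} {z'} (same t e) = from-∃ (∼-shift {+ u * z'} {+ u * z} {t} {+ 0} (trans (sym e) (cong D (x≡x+l*0 (+ u * z) (+ l)))))

      ∼-trans : ∀ {z z' z''} → z ∼ z' → z' ∼ z'' → z ∼ z''
      ∼-trans {z} {z'} {z''} (same t e) (same s f) = compose (∼-shift {+ u * z' + + l * t} {+ u * z''} { - t} {s} (trans (cong D (x+l*t+l*-t≡x (+ u * z') (+ l) t)) f))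
        where
        compose : (∃ λ r → D (+ u * z' + + l * t) ≡ D (+ u * z'' + + l * r)) → z ∼ z''
        compose (r , g) = same r (trans e g)

      ∼-resp : ∀ {z z'} → z ≈ z' [ + k ] → z ∼ z'
      ∼-resp {z} {z'} (mod (divides q e)) = same q (cong D (trans (u*z≡u*z'+u*[z-z'] (+ u) z z') (cong (λ w → + u * z' + w) (trans (cong (+ u *_) e) (trans (u*[q*k]≡k*u*q (+ u) q (+ k)) (cong (_* q) (sym L≡)))))))

      ∼-zero : ∀ {z z'} → z ∼ z' → + k ∣ z → + k ∣ z'
      ∼-zero {z} {z'} (same t e) (divides q f) = cancel-u (lin₂ (proj₂ l-grp e (divides q (trans (cong (+ u *_) f) (trans (H*[q*p]≡q*[p*H] (+ u) q (+ k)) (cong (q *_) (sym L≡)))))) ∣-refl (+ 1) (- t) (x≡1*[x+l*t]+-t*l (+ u * z') (+ l) t))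

      ∼? : ∀ z z' → Dec (z ∼ z')
      ∼? z z' = map′ (λ { (t , e) → same (ι t) e }) (λ { (same t e) → pt t , trans e (D-cong (≈-+ (≈-refl (+ u * z')) (≈-*ˡ (+ l) (≈-sym (pt-≈ t))))) })
        (Finₚ.any? λ (t : Fin n) → D (+ u * z) ≟ D (+ u * z' + + l * ι t))

      Preserves : (ℤ → ℤ) → Set
      Preserves h = ∀ x y → (y - x) ∼ (h y - h x)

      record Auto (z z' : ℤ) : Set where
        field
          h h⁻       : ℤ → ℤ
          preserves  : Preserves h
          preserves⁻ : Preserves h⁻
          fixes      : h (+ 0) ≈ + 0 [ + k ]
          maps       : h z ≈ z' [ + k ]
          inverse    : ∀ x → h (h⁻ x) ≈ x [ + k ]

      -- Schurity and normality of the section in terms of integer maps; normality is used in the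
      -- form that automorphisms have constant increments.
      record NormalSchurian : Set where
        field
          transitive : ∀ {z z'} → z ∼ z' → ∃ λ h → Preserves h × (h (+ 0) ≈ + 0 [ + k ]) × (h z ≈ z' [ + k ])
          affine     : ∀ h → Preserves h → ∀ x y → h (x + + 1) - h x ≈ h (y + + 1) - h y [ + k ]

        respects : ∀ h → Preserves h → ∀ {x y} → x ≈ y [ + k ] → h x ≈ h y [ + k ]
        respects h pres {x} {y} (mod e) = mod (∼-zero (pres y x) e)

        linear : ∀ h → Preserves h → h (+ 0) ≈ + 0 [ + k ] → ∀ z → h z ≈ h (+ 1) * z [ + k ]
        linear h pres h0 z = ≈-trans (respects h pres (≈-sym (ι-resid k z))) (≈-trans (nat (toℕ (resid k z))) (≈-*ˡ (h (+ 1)) (ι-resid k z)))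
          where
          nat : ∀ j → h (+ j) ≈ h (+ 1) * + j [ + k ]
          nat zero    = ≈-trans h0 (≈-reflexive (sym (ℤₚ.*-zeroʳ (h (+ 1)))))
          nat (suc j) = ≈-trans (≈-reflexive (cong h (trans (ℤₚ.pos-+ 1 j) (ℤₚ.+-comm (+ 1) (+ j)))))
            (≈-trans (mod (lin₃ (div (affine h pres (+ j) (+ 0))) (div (nat j)) (div h0) (+ 1) (+ 1) (- + 1) (a-c*[j+1]≡1*[[a-b]-[c-d]]+1*[b-c*j]+-1*[d-0] (h (+ j + + 1)) (h (+ j)) (h (+ 1)) (h (+ 0)) (+ j))))
              (≈-reflexive (cong (h (+ 1) *_) (trans (ℤₚ.+-comm (+ j) (+ 1)) (sym (ℤₚ.pos-+ 1 j))))))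

        -- The multipliers of the section. By `multiplier` the colours of differences are exactly
        -- the orbits of `K`, so the section is cyclotomic.
        K : ℤ → Set
        K m = ∀ x → x ∼ (m * x)

        K? : ∀ m → Dec (K m)
        K? m = map′ (λ f x → ∼-trans (∼-resp (≈-sym (ι-resid k x))) (∼-trans (f (resid k x)) (∼-resp (≈-*ˡ m (ι-resid k x))))) (λ f x → f (ι x))
          (Finₚ.all? λ (x : Fin k) → ∼? (ι x) (m * ι x))

        multiplier : ∀ {z z'} → z ∼ z' → ∃ λ m → K m × (z' ≈ m * z [ + k ])
        multiplier {z} {z'} e = let h , pres , h0 , hz = transitive e in
          h (+ 1) ,
          (λ x → ∼-trans (∼-reflexive (s≡s-0 x)) (∼-trans (pres (+ 0) x) (∼-resp (≈-trans (≈-- (linear h pres h0 x) h0) (≈-reflexive (x-0≡x (h (+ 1) * x))))))) ,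
          ≈-trans (≈-sym hz) (linear h pres h0 z)

        multipliers : MultiplierGroup (+ k) K
        multipliers = record
          { dec  = K?
          ; resp = λ e f x → ∼-trans (f x) (∼-resp (≈-* e (≈-refl x)))
          ; one  = λ x → ∼-reflexive (sym (ℤₚ.*-identityˡ x))
          ; mul  = λ {a} {b} f g x → ∼-trans (g x) (∼-trans (f (b * x)) (∼-reflexive (sym (ℤₚ.*-assoc a b x))))
          ; inv  = λ {m} → inverse {m}
          }
          where
          -- Multiplication by `m` is injective because only 0 has the colour of 0.
          inverse : ∀ {m} → K m → ∃ λ m' → K m' × (m * m' ≈ + 1 [ + k ])
          inverse {m} f = ι m' , (λ x → ∼-sym (∼-trans (f (ι m' * x)) (∼-trans (∼-reflexive (sym (ℤₚ.*-assoc m (ι m') x))) (∼-trans (∼-resp (≈-* mm'≈1 (≈-refl x))) (∼-reflexive (ℤₚ.*-identityˡ x)))))) , mm'≈1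
            where
            g : Fin k → Fin k
            g x = resid k (m * ι x)
            g-inj : ∀ x y → g x ≡ g y → x ≡ y
            g-inj x y e = ι-injective (mod (∼-zero (∼-sym (f (ι x - ι y))) (lin₁ (div (resid-≈ k {m * ι x} {m * ι y} e)) (+ 1) (m*[x-y]≡1*[m*x-m*y] m (ι x) (ι y)))))
            hit = injective⇒surjective ℕₚ.≤-refl g g-inj (resid k (+ 1))
            m' = proj₁ hit
            mm'≈1 : m * ι m' ≈ + 1 [ + k ]
            mm'≈1 = resid-≈ k {m * ι m'} {+ 1} (proj₂ hit)

        affine-K : ∀ (f : ℤ → ℤ) → (∀ x y → ∃ λ m → K m × (f x - f y ≈ m * (x - y) [ + k ])) →
                   ∀ x y → f (x + + 1) - f x ≈ f (y + + 1) - f y [ + k ]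
        affine-K f pres = affine f λ x y → let m , Km , e = pres y x in ∼-trans (Km (y - x)) (∼-resp (≈-sym e))

      module Joined {E : Set} {w : Fin n → Fin n → E} {w' : Fin n' → Fin n' → E} (jw : Coherent₂ w w')
        (finer : ∀ i j a b a' b' → two-col w w' i a b ≡ two-col w w' j a' b' → two-col c c' i a b ≡ two-col c c' j a' b')
        (x₀ : Fin n) (x₀∈U : + u ∣ ι x₀) (b' : Fin n') (base : w x₀ x₀ ≡ w' b' b') {m' : ℕ} (ρ : Fin m' → Fin n')
        (ρ-distinct : ∀ i j → E' l (ρ i) (ρ j) → i ≡ j) (ρ-inside : ∀ i → E' u b' (ρ i))
        (ρ-cover : ∀ x → E' u b' x → ∃ λ i → E' l (ρ i) x) where

        mem' : Fin m' → Fin n' → Bool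
        mem' i x = ⌊ E'? l (ρ i) x ⌋

        mems : ∀ i → Fin (two k m' i) → Fin (two n n' i) → Bool
        mems false = mem
        mems true  = mem'

        mem'⇒ : ∀ {i x} → mem' i x ≡ true → E' l (ρ i) x
        mem'⇒ {i} {x} = ⌊⌋-sound (E'? l (ρ i) x)

        mem'⇐ : ∀ {i x} → E' l (ρ i) x → mem' i x ≡ true
        mem'⇐ {i} {x} = ⌊⌋-true (E'? l (ρ i) x)

        mem'-class : ∀ {i x} → mem' i x ≡ true → E' u b' x
        mem'-class {i} {x} m = E'-trans u-grp (ρ-inside i) (E'-mono u∣l (mem'⇒ {i} {x} m))

        -- Blocks and their support are relations of `c`, so any finer pair respects them. For
        -- `meets` a point is carried to the other side along its arc from the base point.
        joinedSection : Section (two-col w w') (two k m') mems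
        joinedSection = record { inhabited = inh ; disjoint = dis ; block = blk ; support = sup ; meets = mts }
          where
          inh : ∀ i j → ∃ λ x → mems i j x ≡ true
          inh false j = Section.inhabited selfSection tt j
          inh true  j = ρ j , mem'⇐ {j} {ρ j} (E'-refl l-grp (ρ j))
          dis : ∀ i j j' x → mems i j x ≡ true → mems i j' x ≡ true → j ≡ j'
          dis false j j' x = mem-≡ {j} {j'} {x}
          dis true  j j' x p q = ρ-distinct j j' (E'-trans l-grp (mem'⇒ {j} {x} p) (E'-sym l-grp (mem'⇒ {j'} {x} q)))
          blk : ∀ i j p p' x x' y y' → mems i p x ≡ true → mems j p' x' ≡ true →
                two-col w w' i x y ≡ two-col w w' j x' y' → mems i p y ≡ true → mems j p' y' ≡ true
          blk false false p p' x x' y y' mx mx' e = mem-block {p} {p'} {x} {x'} {y} {y'} mx mx' (finer false false x y x' y' e)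
          blk false true  p p' x x' y y' mx mx' e my = mem'⇐ {p'} {y'} (E'-trans l-grp (mem'⇒ {p'} {x'} mx')
            (E'-intro {w = ι y - ι x} (trans (sym (finer false true x y x' y' e)) (c-D x y)) (lin₂ (mem⇒ {p} {y} my) (mem⇒ {p} {x} mx) (+ 1) (- + 1) (y-x≡1*[y-z]+-1*[x-z] (ι x) (ι y) (ι p * + u)))))
          blk true  false p p' x x' y y' mx mx' e my = mem⇐ {p'} {y'} (lin₂
            (E'-elim l-grp (E'-trans l-grp (E'-sym l-grp (mem'⇒ {p} {x} mx)) (mem'⇒ {p} {y} my)) (trans (finer true false x y x' y' e) (c-D x' y')))
            (mem⇒ {p'} {x'} mx') (+ 1) (+ 1) (y-z≡1*[y-x]+1*[x-z] (ι x') (ι y') (ι p' * + u)))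
          blk true  true  p p' x x' y y' mx mx' e my =
            let in-class z f = E'-trans l-grp (E'-sym l-grp (mem'⇒ {p} {x} mx)) (mem'⇒ {p} {y} my) in
            mem'⇐ {p'} {y'} (E'-trans l-grp (mem'⇒ {p'} {x'} mx') (in-class z (trans (sym (finer true true x y x' y' e)) f)))
          sup : ∀ i j p p' r x x' y y' → mems i p x ≡ true → mems j p' x' ≡ true →
                two-col w w' i x y ≡ two-col w w' j x' y' → mems i r y ≡ true → ∃ λ r' → mems j r' y' ≡ true
          sup false false p p' r x x' y y' mx mx' e = mem-support {p} {p'} {r} {x} {x'} {y} {y'} mx mx' (finer false false x y x' y' e)
          sup false true  p p' r x x' y y' mx mx' e my =
            let i , q = ρ-cover y' (E'-trans u-grp (mem'-class {p'} {x'} mx')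
                  (E'-intro {w = ι y - ι x} (trans (sym (finer false true x y x' y' e)) (c-D x y)) (lin₂ (mem-u {r} {y} my) (mem-u {p} {x} mx) (+ 1) (- + 1) (y-x≡1*y+-1*x (ι x) (ι y))))) in
            i , mem'⇐ {i} {y'} q
          sup true  false p p' r x x' y y' mx mx' e my = mem-intro (lin₂
            (E'-elim u-grp (E'-trans u-grp (E'-sym u-grp (mem'-class {p} {x} mx)) (mem'-class {r} {y} my)) (trans (finer true false x y x' y' e) (c-D x' y')))
            (mem-u {p'} {x'} mx') (+ 1) (+ 1) (y≡1*[y-x]+1*x (ι x') (ι y')))
          sup true  true  p p' r x x' y y' mx mx' e my =
            let in-class z f = E'-trans u-grp (E'-sym u-grp (mem'-class {p} {x} mx)) (mem'-class {r} {y} my)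
                i , q = ρ-cover y' (E'-trans u-grp (mem'-class {p'} {x'} mx') (in-class z (trans (sym (finer true true x y x' y' e)) f))) in
            i , mem'⇐ {i} {y'} q
          mts : ∀ i j p x → mems i p x ≡ true → ∃₂ λ p' x' → (mems j p' x' ≡ true) × (two-col w w' i x x ≡ two-col w w' j x' x')
          mts false false p x m = p , x , m , refl
          mts true  true  p x m = p , x , m , refl
          mts false true  p x m =
            let x' , e = arc jw false true x₀ b' base x
                i , q = ρ-cover x' (E'-intro {w = ι x - ι x₀} (trans (sym (finer false true x₀ x b' x' e)) (c-D x₀ x))
                          (lin₂ (mem-u {p} {x} m) x₀∈U (+ 1) (- + 1) (y-x≡1*y+-1*x (ι x₀) (ι x)))) in
            i , x' , mem'⇐ {i} {x'} q , target jw false true x₀ x b' x' e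
          mts true  false p x m =
            let x' , e = arc jw true false b' x₀ (sym base) x
                i , q = mem-intro {x'} (lin₂ (E'-elim u-grp (mem'-class {p} {x} m) (trans (finer true false b' x x₀ x' e) (c-D x₀ x'))) x₀∈U (+ 1) (+ 1) (y≡1*[y-x]+1*x (ι x₀) (ι x'))) in
            i , x' , q , target jw true false b' x x₀ x' e

      -- Γ lists the blocks of Ω' in the order of ℤ/k, starting at the blocks of b' and a'.
      -- Colours of the extension over the arc from the generator u determine the block.
      module Rigid (ns : NormalSchurian) {b' : Fin n'} (ext : Extension c c' (pt (+ 0)) b') (Γ : ℤ → Fin n')
        (Γ-col : ∀ z z' → ∃ λ t → c' (Γ z) (Γ z') ≡ D (+ u * (z' - z) + + l * t))
        (Γ-cover : ∀ x → E' u b' x → ∃ λ z → E' l (Γ z) x)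
        (Γ-zero : E' l b' (Γ (+ 0))) (a' : Fin n') (Γ-one : E' l a' (Γ (+ 1))) where

        open NormalSchurian ns
        open Extension ext renaming (_≟_ to _≟ᴱ_; joint to joint')

        Γ-≈ : ∀ {z z'} → E' l (Γ z) (Γ z') → z' ≈ z [ + k ]
        Γ-≈ {z} {z'} q = let t , e = Γ-col z z' in
          mod (cancel-u (lin₂ (E'-elim l-grp q e) ∣-refl (+ 1) (- t) (x≡1*[x+l*t]+-t*l (+ u * (z' - z)) (+ l) t)))

        Γ-E' : ∀ {z z'} → z' ≈ z [ + k ] → E' l (Γ z) (Γ z')
        Γ-E' {z} {z'} (mod (divides q f)) = let t , e = Γ-col z z' in
          E'-intro {w = + u * (z' - z) + + l * t} e (divides (q + t) (trans (cong (λ y → + u * y + + l * t) f) (trans (cong (λ y → + u * (q * + k) + y * t) L≡) (trans (u*[q*k]+k*u*t≡[q+t]*[k*u] (+ u) q (+ k) t) (cong ((q + t) *_) (sym L≡))))))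

        ρ : Fin k → Fin n'
        ρ i = Γ (ι i)

        private
          inside : ∀ i → E' u b' (ρ i)
          inside i = let t , e = Γ-col (+ 0) (ι i) in
            E'-trans u-grp (E'-mono u∣l Γ-zero) (E'-intro {w = + u * (ι i - + 0) + + l * t} e
              (lin₂ ∣-refl u∣l (ι i) t (u*[i-0]+l*t≡i*u+t*l (+ u) (ι i) (+ l) t)))
          cover : ∀ x → E' u b' x → ∃ λ i → E' l (ρ i) x
          cover x q = let z , r = Γ-cover x q in resid k z , E'-trans l-grp (Γ-E' (≈-sym (ι-resid k z))) r

        private
          pt0∈U : + u ∣ ι (pt (+ 0))
          pt0∈U = lin₁ (∣-trans (proj₁ u-grp) (div (pt-≈ (+ 0)))) (+ 1) (x≡1*[x-0] (ι (pt (+ 0))))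

        open Joined joint' finer (pt (+ 0)) pt0∈U b' base ρ (λ i j q → ι-injective (≈-sym (Γ-≈ q))) inside cover

        open QuotientFamily _≟ᴱ_ {w = two-col w w'} joint' true joinedSection using (qcol; Q; Q-lift; Q-target; qcol⇒Q; Q⇒qcol; quotient)

        [1] : Fin k
        [1] = resid k (+ 1)

        -- Blocks are related if they look alike from the block of the generator in the extension at
        -- 0; so both 0 and 1 are distinguished.
        R : ℤ → ℤ → Set
        R y y' = qcol false [1] (resid k y) ≡ qcol true [1] (resid k y')

        private
          block-diff' : ∀ {i j x y} → mem' i x ≡ true → mem' j y ≡ true → ∃ λ t → c' x y ≡ D (+ u * (ι j - ι i) + + l * t)
          block-diff' {i} {j} {x} {y} mx my = move₁ (Γ-col (ι i) (ι j))
            where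
            v : ℤ
            v = + u * (ι j - ι i)
            move₃ : ∀ t s → (∃ λ r → c' x y ≡ D (v + + l * t + + l * s + + l * r)) → ∃ λ t → c' x y ≡ D (v + + l * t)
            move₃ t s (r , g) = t + s + r , trans g (cong D (x+l*t+l*s+l*r≡x+l*[t+s+r] v (+ l) t s r))
            move₂ : ∀ t → (∃ λ s → c' (ρ i) y ≡ D (v + + l * t + + l * s)) → ∃ λ t → c' x y ≡ D (v + + l * t)
            move₂ t (s , f) = move₃ t s (c'-moveˡ l-grp {w = v + + l * t + + l * s} f (mem'⇒ {i} {x} mx))
            move₁ : (∃ λ t → c' (ρ i) (ρ j) ≡ D (v + + l * t)) → ∃ λ t → c' x y ≡ D (v + + l * t)
            move₁ (t , e) = move₂ t (c'-moveʳ l-grp {w = v + + l * t} e (mem'⇒ {j} {y} my))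

          coloured : ∀ {i j i' j'} → qcol false i j ≡ qcol true i' j' → (ι j - ι i) ∼ (ι j' - ι i')
          coloured {i} {j} {i'} {j'} e = unpack (qcol⇒Q false true i j i' j' e)
            where
            v v' : ℤ
            v = + u * (ι j - ι i)
            v' = + u * (ι j' - ι i')
            compared : ∀ {x y x' y'} → c x y ≡ c' x' y' → (∃ λ s → c x y ≡ D (v + + l * s)) → (∃ λ t → c' x' y' ≡ D (v' + + l * t)) →
                       (ι j - ι i) ∼ (ι j' - ι i')
            compared f (s , g) (t , h) = from-∃ (∼-shift {v} {v'} {s} {t} (trans (sym g) (trans f h)))
            unpack : Q false true i j i' j' → (ι j - ι i) ∼ (ι j' - ι i')
            unpack (x , y , x' , y' , (mx , my) , (mx' , my') , f) =
              compared (finer false true x y x' y' f) (block-diff {i} {j} {x} {y} mx my) (block-diff' {i'} {j'} {x'} {y'} mx' my')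

          -- Of the two further sides of a triangle of blocks, the one at the generator is again an
          -- instance of `R`; the other has equal colours in the section, hence differences that
          -- agree up to a multiplier.
          step : ∀ {y y'} → R y y' → Σ (Fin k ↔ Fin k) λ σ → ∀ z →
                 R (ι z) (ι (to σ z)) × ∃ λ m → K m × (y' - ι (to σ z) ≈ m * (y - ι z) [ + k ])
          step {y} {y'} r = assemble (matching quotient false true [1] (resid k y) [1] (resid k y') r)
            where
            moved : ∀ (z z' : Fin k) → (∃ λ m → K m × (ι (resid k y') - ι z' ≈ m * (ι (resid k y) - ι z) [ + k ])) →
                    ∃ λ m → K m × (y' - ι z' ≈ m * (y - ι z) [ + k ])
            moved z z' (m , Km , e) = m , Km ,
              ≈-trans (≈-- (≈-sym (ι-resid k y')) (≈-refl (ι z'))) (≈-trans e (≈-*ˡ m (≈-- (ι-resid k y) (≈-refl (ι z)))))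
            related : ∀ (z z' : Fin k) → qcol false [1] z ≡ qcol true [1] z' → R (ι z) (ι z')
            related z z' e = trans (cong (qcol false [1]) (resid-ι z)) (trans e (cong (qcol true [1]) (sym (resid-ι z'))))
            assemble : (Σ (Fin k ↔ Fin k) λ σ → ∀ δ → (qcol false [1] δ ≡ qcol true [1] (to σ δ)) × (qcol false δ (resid k y) ≡ qcol true (to σ δ) (resid k y'))) →
                       Σ (Fin k ↔ Fin k) λ σ → ∀ z → R (ι z) (ι (to σ z)) × ∃ λ m → K m × (y' - ι (to σ z) ≈ m * (y - ι z) [ + k ])
            assemble (σ , mt) = σ , λ z → related z (to σ z) (proj₁ (mt z)) ,
              moved z (to σ z) (multiplier {ι (resid k y) - ι z} {ι (resid k y') - ι (to σ z)} (coloured {z} {resid k y} {to σ z} {resid k y'} (proj₂ (mt z))))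

          base-block : mem (resid k (+ 0)) (pt (+ 0)) ≡ true
          base-block = subst (λ z → mem (resid k (+ 0)) (pt z) ≡ true) (ℤₚ.*-zeroʳ (+ u)) (mem-pt (+ 0))

          -- Equally coloured arcs have equally coloured targets, and the block of 0 contains the
          -- base point, which is alone in its fiber on both sides.
          zero-single : Single (+ k) R (+ 0)
          zero-single {z} r = located (Q-lift false true o o j j (Q-target false true [1] o [1] j (qcol⇒Q false true [1] o [1] j r))
                                (pt (+ 0)) (pt (+ 0)) base-block base-block)
            where
            o = resid k (+ 0)
            j = resid k z
            located : (∃₂ λ x' y' → ((mem' j x' ≡ true) × (mem' j y' ≡ true)) × (w (pt (+ 0)) (pt (+ 0)) ≡ w' x' y')) → z ≈ + 0 [ + k ]
            located (x' , y' , (mx' , _) , e) = ≈-trans (≈-sym (ι-resid k z)) (≈-sym (Γ-≈ {ι j} {+ 0} (E'-trans l-grp (subst (E' l (ρ j)) x'≡b' (mem'⇒ {j} {x'} mx')) Γ-zero)))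
              where
              x'≡b' : x' ≡ b'
              x'≡b' = proj₁ (basic' x' y' (trans (sym e) base))

          one-single : Single (+ k) R (+ 1)
          one-single {z} r = ≈-sym (resid-≈ k {+ 1} {z} (diagonal quotient false true [1] [1] (resid k z) r))

          equitable : Equitable k K R
          equitable = record
            { step = λ {y} {y'} → step {y} {y'}
            ; resp = λ e f r → trans (cong (qcol false [1]) (resid-cong k (≈-sym e))) (trans r (cong (qcol true [1]) (resid-cong k f)))
            ; zero₁ = λ {z} → zero-single {z} ; one₁ = λ {z} → one-single {z} }

          generator-block : mem [1] (pt (+ u)) ≡ true
          generator-block = subst (λ z → mem [1] (pt z) ≡ true) (ℤₚ.*-identityʳ (+ u)) (mem-pt (+ 1))

          a'-block : E' l (ρ [1]) a'
          a'-block = E'-trans l-grp (Γ-E' (≈-sym (ι-resid k (+ 1)))) (E'-sym l-grp Γ-one)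

        determined : ∀ z x → w (pt (+ u)) (pt (+ u * z)) ≡ w' a' x → E' l (Γ z) x
        determined z x e = located (cover x in-U)
          where
          in-U : E' u b' x
          in-U = E'-trans u-grp (E'-trans u-grp (inside [1]) (E'-mono u∣l a'-block)) (E'-intro {w = + u * z - + u}
            (trans (sym (finer false true (pt (+ u)) (pt (+ u * z)) a' x e)) (c-pt (+ u) (+ u * z))) (divides (z - + 1) (u*z-u≡[z-1]*u (+ u) z)))
          located : (∃ λ j → E' l (ρ j) x) → E' l (Γ z) x
          located (j , q) = E'-trans l-grp (Γ-E' {z} {ι j} j≈z) q
            where
            r : R z (ι j)
            r = trans (Q⇒qcol false true [1] (resid k z) [1] j (pt (+ u) , pt (+ u * z) , a' , x , (generator-block , mem-pt z) , (mem'⇐ {[1]} {a'} a'-block , mem'⇐ {j} {x} q) , e))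
                  (cong (qcol true [1]) (sym (resid-ι j)))
            j≈z : ι j ≈ z [ + k ]
            j≈z = Discreteness.discrete k multipliers equitable affine-K {z} {ι j} r

-- Isomorphisms between corresponding sections.

module SectionIso where

  open import Defs
  open Matching
  open Coherence
  open Separability
  open Quotient
  open Congruence
  open CirculantPair
  open Identities
  open import Data.Nat as ℕ using (ℕ; zero; suc; NonZero)
  open import Data.Integer using (ℤ; +_; -_; _+_; _-_; _*_)
  open import Data.Integer.Divisibility.Signed using (_∣_; ∣-trans)
  open import Data.Fin using (Fin) renaming (zero to fz; suc to fs)
  import Data.Fin.Properties as Finₚ
  open import Data.Bool using (true; false)
  import Data.Bool.Properties as Boolₚ
  open import Data.Vec.Properties using () renaming (≡-dec to ≡-decᵛ)
  open import Data.Product using (Σ; ∃; ∃₂; _×_; _,_; proj₁; proj₂)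
  open import Data.Empty using (⊥-elim)
  open import Function using (_∘_)
  open import Function.Bundles using (_↔_)
  open import Relation.Binary.Definitions using (DecidableEquality)
  open import Relation.Binary.PropositionalEquality using (_≡_; refl; sym; trans; cong; subst)
  open import Relation.Nullary using (Dec; yes; no)

  record Representatives {n : ℕ} (P : Fin n → Set) (E : Fin n → Fin n → Set) : Set where
    field
      size     : ℕ
      rep      : Fin size → Fin n
      inside   : ∀ i → P (rep i)
      distinct : ∀ i j → E (rep i) (rep j) → i ≡ j
      cover    : ∀ x → P x → ∃ λ i → E (rep i) x

  module _ {n : ℕ} {P : Fin n → Set} (P? : ∀ x → Dec (P x)) {E : Fin n → Fin n → Set} (E? : ∀ x y → Dec (E x y))
    (E-refl : ∀ x → E x x) (E-sym : ∀ {x y} → E x y → E y x) where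

    private
      record Partial {j : ℕ} (f : Fin j → Fin n) : Set where
        field
          size     : ℕ
          rep      : Fin size → Fin n
          inside   : ∀ i → P (rep i)
          distinct : ∀ i j → E (rep i) (rep j) → i ≡ j
          cover    : ∀ x → P (f x) → ∃ λ i → E (rep i) (f x)

      partial : ∀ {j} (f : Fin j → Fin n) → Partial f
      partial {zero}  f = record { size = 0 ; rep = λ () ; inside = λ () ; distinct = λ () ; cover = λ () }
      partial {suc j} f = extend (partial (f ∘ fs)) (P? (f fz))
        where
        extend : Partial (f ∘ fs) → Dec (P (f fz)) → Partial f
        extend r (no ¬p) = record { size = size ; rep = rep ; inside = inside ; distinct = distinct
          ; cover = λ { fz p → ⊥-elim (¬p p) ; (fs x) p → cover x p } }
          where open Partial r
        extend r (yes p) = decide (Finₚ.any? λ i → E? (rep i) (f fz))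
          where
          open Partial r
          decide : Dec (∃ λ i → E (rep i) (f fz)) → Partial f
          decide (yes q) = record { size = size ; rep = rep ; inside = inside ; distinct = distinct
            ; cover = λ { fz _ → q ; (fs x) → cover x } }
          decide (no none) = record { size = suc size ; rep = rep' ; inside = λ { fz → p ; (fs i) → inside i }
            ; distinct = distinct'
            ; cover = λ { fz _ → fz , E-refl (f fz) ; (fs x) q → let i , e = cover x q in fs i , e } }
            where
            rep' : Fin (suc size) → Fin n
            rep' fz     = f fz
            rep' (fs i) = rep i
            distinct' : ∀ i j → E (rep' i) (rep' j) → i ≡ j
            distinct' fz     fz     e = refl
            distinct' fz     (fs j) e = ⊥-elim (none (j , E-sym e))
            distinct' (fs i) fz     e = ⊥-elim (none (i , e))
            distinct' (fs i) (fs j) e = cong fs (distinct i j e)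

    representatives : Representatives P E
    representatives = record { size = size ; rep = rep ; inside = inside ; distinct = distinct ; cover = cover }
      where open Partial (partial (λ x → x))

  module _ (n : ℕ) .{{_ : NonZero n}} {n' : ℕ} {C : Set} (_≟_ : DecidableEquality C)
    (c : Fin n → Fin n → C) (c' : Fin n' → Fin n' → C) (joint : Coherent₂ c c')
    (circulant : ∀ x y → c x y ≡ c (resid n (+ 0)) (resid n (ι y - ι x)))
    (extension : ∀ x x' → Extension c c' x x') where

    open Pair n _≟_ c c' joint circulant using (pt; D; pt-≈; c-D; c'-diag; IsGroup; E'; E'?; E'-refl; E'-sym; E'-trans; c'-moveʳ; c'-moveˡ)

    module _ (u k : ℕ) .{{_ : NonZero u}} .{{_ : NonZero k}} (u-grp : IsGroup u) (l-grp : IsGroup (k ℕ.* u)) where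

      open Pair.SectionOf n _≟_ c c' joint circulant u k u-grp l-grp using (l; mem; mem-u; mem-≡; _∼_; same; SameQ; block-diff; ∼-shift; ∼-resp)

      module _ (b' : Fin n') where

        private
          reps : Representatives (E' u b') (E' l)
          reps = representatives (E'? u b') (E'? l) (E'-refl l-grp) (E'-sym l-grp)
          open Representatives reps renaming (size to m'; rep to ρ)

          c-base : ∀ x x' → c x x ≡ c' x' x'
          c-base x x' = trans (c-D x x) (trans (cong D (x-x≡0 (ι x))) (sym (c'-diag x')))

          pt0∈U : + u ∣ ι (pt (+ 0))
          pt0∈U = lin₁ (∣-trans (proj₁ u-grp) (div (pt-≈ (+ 0)))) (+ 1) (x≡1*[x-0] (ι (pt (+ 0))))

        open Pair.SectionOf.Joined n _≟_ c c' joint circulant u k u-grp l-grp joint (λ _ _ _ _ _ _ e → e) (pt (+ 0)) pt0∈U b' (c-base (pt (+ 0)) b') ρ distinct inside cover using (mem'; mems; mem'⇒; mem'-class; joinedSection)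
        open QuotientFamily _≟_ {w = two-col c c'} joint true joinedSection using (qcol; Q; qcol⇒Q; Q⇒qcol; quotient)

        private
          _≟ᵠ_ : DecidableEquality (QCol n')
          _≟ᵠ_ = ≡-decᵛ (≡-decᵛ Boolₚ._≟_)

          -- Sesquiclosedness passes to the section: an extension at a point of a block, coarsened
          -- to blocks, is an extension at the block. The block becomes basic because its point is.
          ext : ∀ i i' → Extension (qcol false) (qcol true) i i'
          ext i i' = build (Section.inhabited joinedSection false i) (Section.inhabited joinedSection true i')
            where
            build : (∃ λ x → mem i x ≡ true) → (∃ λ x → mem' i' x ≡ true) → Extension (qcol false) (qcol true) i i'
            build (x , mx) (x' , mx') = record
              { E = QCol n' ; _≟_ = _≟ᵠ_ ; w = F.qcol false ; w' = F.qcol true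
              ; joint = recolour (λ a b p q p' q' e → trans (sym (shape a p q)) (trans e (shape b p' q'))) (λ a b p q p' q' e → trans (shape a p q) (trans e (sym (shape b p' q')))) F.quotient
              ; finer = λ a b p q p' q' e → trans (shape' a p q) (trans (coarser a b p q p' q' (trans (shape a p q) (trans e (sym (shape b p' q'))))) (sym (shape' b p' q')))
              ; base = F.Q⇒qcol false true i i i' i' (x , x , x' , x' , (mx , mx) , (mx' , mx') , base)
              ; basic = λ p q e → located p q (F.Q-lift false false i i p q (F.qcol⇒Q false false i i p q (sym e)) x x mx mx)
              ; basic' = λ p q e → located' p q (F.Q-lift true true i' i' p q (F.qcol⇒Q true true i' i' p q (sym e)) x' x' mx' mx') }
              where
              open Extension (extension x x') renaming (_≟_ to _≟ᴱ_; joint to joint')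
              x'∈U : E' u b' x'
              x'∈U = mem'-class {i'} {x'} mx'
              -- The base point is now `x'`, which lies in the class of `b'`, so the same
              -- representatives serve.
              module J = Pair.SectionOf.Joined n _≟_ c c' joint circulant u k u-grp l-grp joint' finer x (mem-u {i} {x} mx) x' base ρ distinct
                (λ j → E'-trans u-grp (E'-sym u-grp x'∈U) (inside j)) (λ y q → cover y (E'-trans u-grp x'∈U q)) using (mems; joinedSection)
              module F = QuotientFamily _≟ᴱ_ {w = two-col w w'} joint' true J.joinedSection using (qcol; Q; Q-lift; qcol⇒Q; Q⇒qcol; quotient)
              shape : ∀ a p q → F.qcol a p q ≡ two-col (F.qcol false) (F.qcol true) a p q
              shape false p q = refl
              shape true  p q = refl
              shape' : ∀ a p q → two-col (qcol false) (qcol true) a p q ≡ qcol a p q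
              shape' false p q = refl
              shape' true  p q = refl
              same-mem : ∀ a p z → J.mems a p z ≡ mems a p z
              same-mem false p z = refl
              same-mem true  p z = refl
              coarser : ∀ a b p q p' q' → F.qcol a p q ≡ F.qcol b p' q' → qcol a p q ≡ qcol b p' q'
              coarser a b p q p' q' e = unpack (F.qcol⇒Q a b p q p' q' e)
                where
                unpack : F.Q a b p q p' q' → qcol a p q ≡ qcol b p' q'
                unpack (y , z , y' , z' , (my , mz) , (my' , mz') , f) = Q⇒qcol a b p q p' q' (y , z , y' , z' ,
                  (trans (sym (same-mem a p y)) my , trans (sym (same-mem a q z)) mz) ,
                  (trans (sym (same-mem b p' y')) my' , trans (sym (same-mem b q' z')) mz') , finer a b y z y' z' f)
              located : ∀ p q → (∃₂ λ y z → ((mem p y ≡ true) × (mem q z ≡ true)) × (w x x ≡ w y z)) → (p ≡ i) × (q ≡ i)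
              located p q (y , z , (my , mz) , e) = let y≡x , z≡x = basic y z (sym e) in
                mem-≡ {p} {i} {x} (subst (λ v → mem p v ≡ true) y≡x my) mx , mem-≡ {q} {i} {x} (subst (λ v → mem q v ≡ true) z≡x mz) mx
              located' : ∀ p q → (∃₂ λ y z → ((mem' p y ≡ true) × (mem' q z ≡ true)) × (w' x' x' ≡ w' y z)) → (p ≡ i') × (q ≡ i')
              located' p q (y , z , (my , mz) , e) = let y≡x , z≡x = basic' y z (sym e) in
                Section.disjoint joinedSection true p i' x' (subst (λ v → mem' p v ≡ true) y≡x my) mx' ,
                Section.disjoint joinedSection true q i' x' (subst (λ v → mem' q v ≡ true) z≡x mz) mx'

          joint-q : Coherent₂ (qcol false) (qcol true)
          joint-q = recolour (λ a b p q p' q' e → trans (sym (shape a p q)) (trans e (shape b p' q'))) (λ a b p q p' q' e → trans (shape a p q) (trans e (sym (shape b p' q')))) quotient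
            where
            shape : ∀ a p q → qcol a p q ≡ two-col (qcol false) (qcol true) a p q
            shape false p q = refl
            shape true  p q = refl

        module _ (A : Config k) (sep : Sesquiseparable A)
          (A⇒ : ∀ i j i' j' → col A i j ≡ col A i' j' → SameQ i j i' j')
          (⇒A : ∀ i j i' j' → SameQ i j i' j' → col A i j ≡ col A i' j') where

          private
            iso : Σ (Fin k ↔ Fin m') λ f → ∀ i j → qcol true (to f i) (to f j) ≡ qcol false i j
            iso = separate A (resid k (+ 0)) sep _≟ᵠ_ (qcol false) (qcol true)
              (λ i j i' j' e → Q⇒qcol false false i j i' j' (A⇒ i j i' j' e))
              (λ i j i' j' e → ⇒A i j i' j' (qcol⇒Q false false i j i' j' e))
              joint-q (λ i i' _ → ext i i')

            f : Fin k ↔ Fin m'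
            f = proj₁ iso

          blocks : ℤ → Fin n'
          blocks z = ρ (to f (resid k z))

          blocks-cover : ∀ x → E' u b' x → ∃ λ z → E' l (blocks z) x
          blocks-cover x q = let i , e = cover x q in
            ι (from f i) , subst (λ j → E' l (ρ j) x) (sym (trans (cong (to f) (resid-ι (from f i))) (to-from f i))) e

          -- Equality of quotient colours concerns some representatives of the blocks; moving both
          -- endpoints to the chosen ones costs multiples of `l`.
          blocks-col : ∀ z z' → ∃ λ t → c' (blocks z) (blocks z') ≡ D (+ u * (z' - z) + + l * t)
          blocks-col z z' = unpack (qcol⇒Q false true i j (to f i) (to f j) (sym (proj₂ iso i j)))
            where
            i = resid k z
            j = resid k z'
            v : ℤ
            v = + u * (ι j - ι i)
            final : ∀ t s → (∃ λ r → c' (blocks z) (blocks z') ≡ D (v + + l * t + + l * s + + l * r)) → ∃ λ t → c' (blocks z) (blocks z') ≡ D (+ u * (z' - z) + + l * t)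
            final t s (r , e) = changed (∼-resp {ι j - ι i} {z' - z} (≈-- (ι-resid k z') (ι-resid k z)))
              where
              a : ℤ
              a = t + s + r
              renamed : (∃ λ b → D (v + + l * a) ≡ D (+ u * (z' - z) + + l * b)) → ∃ λ t → c' (blocks z) (blocks z') ≡ D (+ u * (z' - z) + + l * t)
              renamed (b , h) = b , trans e (trans (cong D (x+l*t+l*s+l*r≡x+l*[t+s+r] v (+ l) t s r)) h)
              changed : (ι j - ι i) ∼ (z' - z) → ∃ λ t → c' (blocks z) (blocks z') ≡ D (+ u * (z' - z) + + l * t)
              changed (same q g) = renamed (∼-shift {v + + l * a} {+ u * (z' - z)} { - a} {q} (trans (cong D (x+l*t+l*-t≡x v (+ l) a)) g))
            move₂ : ∀ {x'} t s → E' l (blocks z) x' → c' x' (blocks z') ≡ D (v + + l * t + + l * s) → ∃ λ t → c' (blocks z) (blocks z') ≡ D (+ u * (z' - z) + + l * t)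
            move₂ t s q e = final t s (c'-moveˡ l-grp {w = v + + l * t + + l * s} e (E'-sym l-grp q))
            move₁ : ∀ {x' y'} t → E' l (blocks z) x' → E' l (blocks z') y' → c' x' y' ≡ D (v + + l * t) → ∃ λ t → c' (blocks z) (blocks z') ≡ D (+ u * (z' - z) + + l * t)
            move₁ {x'} {y'} t q r e = onwards (c'-moveʳ l-grp {w = v + + l * t} e (E'-sym l-grp r))
              where
              onwards : (∃ λ s → c' x' (blocks z') ≡ D (v + + l * t + + l * s)) → ∃ λ t → c' (blocks z) (blocks z') ≡ D (+ u * (z' - z) + + l * t)
              onwards (s , g) = move₂ t s q g
            unpack : Q false true i j (to f i) (to f j) → ∃ λ t → c' (blocks z) (blocks z') ≡ D (+ u * (z' - z) + + l * t)
            unpack (x , y , x' , y' , (mx , my) , (mx' , my') , e) = start (block-diff {i} {j} {x} {y} mx my)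
              where
              start : (∃ λ t → c x y ≡ D (v + + l * t)) → ∃ λ t → c' (blocks z) (blocks z') ≡ D (+ u * (z' - z) + + l * t)
              start (t , g) = move₁ {x'} {y'} t (mem'⇒ {to f i} {x'} mx') (mem'⇒ {to f j} {y'} my') (trans (sym e) g)

          -- The isomorphism takes the form of a map on integers that picks one point per block,
          -- since only the circulant side has coordinates.
          sectionIso : ∃ λ (Γ : ℤ → Fin n') → (∀ z z' → ∃ λ t → c' (Γ z) (Γ z') ≡ D (+ u * (z' - z) + + l * t)) ×
                         (∀ x → E' u b' x → ∃ λ z → E' l (Γ z) x)
          sectionIso = blocks , blocks-col , blocks-cover

-- Lifting an isomorphism of the quotient by L over the cosets of U, and gluing the lifts.

module Wreath where

  open import Defs
  open Matching
  open Coherence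
  open Separability
  open Congruence
  open CirculantPair
  open Identities
  open import Data.Nat as ℕ using (ℕ; NonZero)
  open import Data.Integer using (ℤ; +_; -_; _+_; _-_; _*_)
  import Data.Integer.Properties as ℤₚ
  open import Data.Integer.Divisibility.Signed using (_∣_; divides; _∣?_; ∣-trans; ∣-refl)
  open import Data.Fin using (Fin)
  import Data.Fin.Properties as Finₚ
  open import Data.Bool using (true; false)
  open import Data.Product using (Σ; ∃; _×_; _,_; proj₁; proj₂)
  open import Data.Empty using (⊥-elim)
  open import Relation.Binary.Definitions using (DecidableEquality)
  open import Relation.Binary.PropositionalEquality using (_≡_; refl; sym; trans; cong; cong₂; subst)
  open import Relation.Nullary using (¬_; Dec; yes; no)

  -- U = H_u, L = H_l with l = k' u', U' = H_u', L' = H_l' with l' = k'' u.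
  module WreathPair (n : ℕ) .{{_ : NonZero n}} {n' : ℕ} {C : Set} (_≟_ : DecidableEquality C)
    (c : Fin n → Fin n → C) (c' : Fin n' → Fin n' → C) (joint : Coherent₂ c c')
    (circulant : ∀ x y → c x y ≡ c (resid n (+ 0)) (resid n (ι y - ι x)))
    (u u' k' k'' k₁ q : ℕ) .{{_ : NonZero u}} .{{_ : NonZero u'}} .{{_ : NonZero k'}} .{{_ : NonZero k''}}
    (k₁u≡n : k₁ ℕ.* u ≡ n) (u≡ : u ≡ u' ℕ.* q) where

    open Pair n _≟_ c c' joint circulant using (pt; D; D-cong; c-D; c'-neg; c'-fill; IsGroup; E'; in-class; E'-intro; E'-elim; E'-refl; E'-sym; E'-trans; E'-mono; c'-moveʳ; c'-moveˡ)

    module Groups (u-grp : IsGroup u) (u'-grp : IsGroup u') (l-grp : IsGroup (k' ℕ.* u')) (l'-grp : IsGroup (k'' ℕ.* u))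
      (u∣l : + u ∣ + (k' ℕ.* u')) (l∣l' : + (k' ℕ.* u') ∣ + (k'' ℕ.* u)) where

      -- `N` is the upper normal section U'/L and `M` the lower one, U/L'.
      module N = Pair.SectionOf n _≟_ c c' joint circulant u' k' u'-grp l-grp using (L≡; u∣l; cancel-u; _∼_; same; ∼-shift; Preserves; NormalSchurian; module NormalSchurian)
      module M = Pair.SectionOf n _≟_ c c' joint circulant u k'' u-grp l'-grp using (L≡; _∼_; same; Preserves; NormalSchurian; module NormalSchurian)

      l l' : ℕ
      l = k' ℕ.* u'
      l' = k'' ℕ.* u

      Preserves₀ : (ℤ → ℤ) → Set
      Preserves₀ h = ∀ x y → ∃ λ t → D (y - x) ≡ D ((h y - h x) + + l * t)

      record Auto₀ (z z' : ℤ) : Set where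
        field
          h h⁻        : ℤ → ℤ
          preserves   : Preserves₀ h
          preserves⁻  : Preserves₀ h⁻
          fixes       : + l ∣ h (+ 0)
          maps        : h z ≈ z' [ + l ]
          inverse     : ∀ x → h (h⁻ x) ≈ x [ + l ]

      record Auto₁ (z z' : ℤ) : Set where
        field
          h h⁻        : ℤ → ℤ
          preserves   : ∀ x y → D (+ u * (y - x)) ≡ D (+ u * (h y - h x))
          fixes       : h (+ 0) ≈ + 0 [ + k₁ ]
          maps        : h z ≈ z' [ + k₁ ]
          inverse     : ∀ x → h (h⁻ x) ≈ x [ + k₁ ]

      -- Restriction of an automorphism of X_{G/L} that fixes 0 to U'/L.
      module Restrict {z₀ z₁ : ℤ} (auto : Auto₀ z₀ z₁) where

        open Auto₀ auto using (h; preserves; fixes)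

        divisible : ∀ z → + u' ∣ h (+ u' * z)
        divisible z = located (preserves (+ 0) (+ u' * z))
          where
          located : (∃ λ t → D (+ u' * z - + 0) ≡ D ((h (+ u' * z) - h (+ 0)) + + l * t)) → + u' ∣ h (+ u' * z)
          located (t , e) = lin₃ (proj₂ u'-grp e (divides z (q*x-0≡x*q (+ u') z))) (∣-trans N.u∣l fixes) N.u∣l (+ 1) (+ 1) (- t) (a≡1*[[a-b]+l*t]+1*b+-t*l (h (+ u' * z)) (h (+ 0)) (+ l) t)

        h' : ℤ → ℤ
        h' z = _∣_.quotient (divisible z)

        h'-eq : ∀ z → h (+ u' * z) ≡ + u' * h' z
        h'-eq z = trans (_∣_.equality (divisible z)) (ℤₚ.*-comm (h' z) (+ u'))

        h'-preserves : N.Preserves h'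
        h'-preserves y z = converted (preserves (+ u' * y) (+ u' * z))
          where
          converted : (∃ λ t → D (+ u' * z - + u' * y) ≡ D ((h (+ u' * z) - h (+ u' * y)) + + l * t)) → (z - y) N.∼ (h' z - h' y)
          converted (t , e) = N.same t (trans (cong D (u*[z-y]≡u*z-u*y (+ u') y z)) (trans e (cong (λ r → D (r + + l * t)) (trans (cong₂ _-_ (h'-eq z) (h'-eq y)) (sym (u*[z-y]≡u*z-u*y (+ u') (h' y) (h' z)))))))

        h'-zero : h' (+ 0) ≈ + 0 [ + k' ]
        h'-zero = ∣⇒≈0 (N.cancel-u (subst (+ l ∣_) (trans (cong h (sym (ℤₚ.*-zeroʳ (+ u')))) (h'-eq (+ 0))) fixes))

        linear : N.NormalSchurian → ∀ z → h (+ u' * z) ≈ + u' * (h' (+ 1) * z) [ + l ]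
        linear ns z = scaled (N.NormalSchurian.linear ns h' h'-preserves h'-zero z)
          where
          scaled : h' z ≈ h' (+ 1) * z [ + k' ] → h (+ u' * z) ≈ + u' * (h' (+ 1) * z) [ + l ]
          scaled (mod (divides r e)) = ≈-trans (≈-reflexive (h'-eq z)) (mod (divides r (trans (u*a-u*b≡u*[a-b] (+ u') (h' z) (h' (+ 1) * z)) (trans (cong (+ u' *_) e) (trans (H*[q*p]≡q*[p*H] (+ u') r (+ k')) (cong (r *_) (sym N.L≡)))))))

        -- U consists of the elements `u' * (q * i)` of U', so by linearity on U'/L the value at the
        -- generator `u' * q` decides all of U modulo L.
        linear-U : N.NormalSchurian → ∀ i → h (+ u' * (+ q * i)) ≈ h (+ u' * + q) * i [ + l ]
        linear-U ns i = ≈-trans (linear ns (+ q * i)) (≈-trans (≈-reflexive (u*[m*[q*i]]≡u*[m*q]*i (+ u') (h' (+ 1)) (+ q) i)) (≈-* (≈-sym (linear ns (+ q))) (≈-refl i)))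

      -- Schurity of U'/L comes from `X_{G/L}` by restriction, and in the companion below that of
      -- U/L' comes from `X_U` by reduction.
      normalSchurian-N : (∀ {z z'} → (∃ λ t → D z ≡ D (z' + + l * t)) → Auto₀ z z') →
        (∀ h → N.Preserves h → ∀ x y → h (x + + 1) - h x ≈ h (y + + 1) - h y [ + k' ]) → N.NormalSchurian
      normalSchurian-N auto₀ affine = record { transitive = λ {z} {z'} → transitive z z' ; affine = affine }
        where
        transitive : ∀ z z' → z N.∼ z' → ∃ λ h → N.Preserves h × (h (+ 0) ≈ + 0 [ + k' ]) × (h z ≈ z' [ + k' ])
        transitive z z' (N.same t e) = restricted (auto₀ {+ u' * z} {+ u' * z'} (t , e))
          where
          restricted : Auto₀ (+ u' * z) (+ u' * z') → ∃ λ h → N.Preserves h × (h (+ 0) ≈ + 0 [ + k' ]) × (h z ≈ z' [ + k' ])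
          restricted auto = h' , h'-preserves , h'-zero ,
            mod (N.cancel-u (subst (+ l ∣_) (trans (cong (_- (+ u' * z')) (h'-eq z)) (sym (u*[a-b]≡u*a-u*b (+ u') (h' z) z'))) (div (Auto₀.maps auto))))
            where open Restrict auto

      normalSchurian-M : + k'' ∣ + k₁ → (∀ {z z'} → D (+ u * z) ≡ D (+ u * z') → Auto₁ z z') →
        (∀ h → M.Preserves h → ∀ x y → h (x + + 1) - h x ≈ h (y + + 1) - h y [ + k'' ]) → M.NormalSchurian
      normalSchurian-M k''∣k₁ auto₁ affine = record { transitive = λ {z} {z'} → transitive z z' ; affine = affine }
        where
        transitive : ∀ z z' → z M.∼ z' → ∃ λ h → M.Preserves h × (h (+ 0) ≈ + 0 [ + k'' ]) × (h z ≈ z' [ + k'' ])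
        transitive z z' (M.same t e) = converted (auto₁ {z} {z' + + k'' * t} (trans e (cong D (trans (cong (λ y → + u * z' + y * t) M.L≡) (u*z+k*u*t≡u*[z+k*t] (+ u) z' (+ k'') t)))))
          where
          converted : Auto₁ z (z' + + k'' * t) → ∃ λ h → M.Preserves h × (h (+ 0) ≈ + 0 [ + k'' ]) × (h z ≈ z' [ + k'' ])
          converted a = A.h , M-preserves , ≈-weaken k''∣k₁ A.fixes , ≈-trans (≈-weaken k''∣k₁ A.maps) (mod (divides t (z+k*t-z≡t*k z' (+ k'') t)))
            where
            module A = Auto₁ a
            M-preserves : M.Preserves A.h
            M-preserves x y = M.same (+ 0) (trans (A.preserves x y) (cong D (x≡x+l*0 (+ u * (A.h y - A.h x)) (+ l'))))

      -- A bijection from the classes of L to the classes of its counterpart, and from a coset of U to its counterpart.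
      record Iso₀ : Set where
        field
          F       : ℤ → Fin n'
          F-col   : ∀ z z' → ∃ λ t → c' (F z) (F z') ≡ D ((z' - z) + + l * t)
          F-cover : ∀ x → ∃ λ z → E' l (F z) x

        F-E' : ∀ {z z'} → z' ≈ z [ + l ] → E' l (F z) (F z')
        F-E' {z} {z'} (mod e) = located (F-col z z')
          where
          located : (∃ λ t → c' (F z) (F z') ≡ D ((z' - z) + + l * t)) → E' l (F z) (F z')
          located (t , f) = E'-intro {w = (z' - z) + + l * t} f (lin₂ e ∣-refl (+ 1) t (x+l*t≡1*x+t*l (z' - z) (+ l) t))

        F-≈ : ∀ {z z'} → E' l (F z) (F z') → z' ≈ z [ + l ]
        F-≈ {z} {z'} r = located (F-col z z')
          where
          located : (∃ λ t → c' (F z) (F z') ≡ D ((z' - z) + + l * t)) → z' ≈ z [ + l ]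
          located (t , f) = mod (lin₂ (E'-elim l-grp {w = (z' - z) + + l * t} r f) ∣-refl (+ 1) (- t) (x≡1*[x+l*t]+-t*l (z' - z) (+ l) t))

        shifted : ℤ → Iso₀
        shifted b = record
          { F = λ z → F (b + z)
          ; F-col = λ z z' → renamed (F-col (b + z) (b + z'))
          ; F-cover = λ x → found (F-cover x) }
          where
          renamed : ∀ {z z'} → (∃ λ t → c' (F (b + z)) (F (b + z')) ≡ D (((b + z') - (b + z)) + + l * t)) → ∃ λ t → c' (F (b + z)) (F (b + z')) ≡ D ((z' - z) + + l * t)
          renamed {z} {z'} (t , e) = t , trans e (cong (λ y → D (y + + l * t)) ([z+b]-[z+a]≡b-a b z z'))
          found : ∀ {x} → (∃ λ z → E' l (F z) x) → ∃ λ z → E' l (F (b + z)) x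
          found {x} (z , e) = z - b , subst (λ y → E' l (F y) x) (sym (x+[y-x]≡y b z)) e

      record Iso₁ (b' : Fin n') : Set where
        field
          g       : ℤ → Fin n'
          g-col   : ∀ z z' → c' (g z) (g z') ≡ D (+ u * (z' - z))
          g-cover : ∀ x → E' u b' x → ∃ λ z → g z ≡ x

        g-≡ : ∀ {z z'} → z ≈ z' [ + k₁ ] → g z ≡ g z'
        g-≡ {z} {z'} (mod (divides r e)) = diagonal joint false true (pt (+ 0)) (g z) (g z') (sym (trans (g-col z z') (D-cong (mod (divides (- r) vanishes)))))
          where
          vanishes : + u * (z' - z) - + 0 ≡ - r * + n
          vanishes = trans (u*[z'-z]-0≡-[u*[z-z']] (+ u) z z') (trans (cong (λ y → - (+ u * y)) e)
            (trans (-[u*[r*k]]≡-r*[k*u] (+ u) r (+ k₁)) (cong (- r *_) (trans (sym (ℤₚ.pos-* k₁ u)) (cong +_ k₁u≡n)))))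

      module Lifting (ns : N.NormalSchurian) (ms : M.NormalSchurian)
        (auto₀ : ∀ {z z'} → (∃ λ t → D z ≡ D (z' + + l * t)) → Auto₀ z z')
        (auto₁ : ∀ {z z'} → D (+ u * z) ≡ D (+ u * z') → Auto₁ z z')
        (extension : ∀ x x' → Σ (Extension c c' x x') λ ext → ∀ γ δ → c x γ ≡ c x δ → Extension.w ext γ γ ≡ Extension.w ext δ δ)
        (iso₁ : ∀ b' → Iso₁ b') where

        module At (iso₀ : Iso₀) (b' : Fin n') (Fb : E' l (Iso₀.F iso₀ (+ 0)) b') where

          open Iso₀ iso₀
          ext : Extension c c' (pt (+ 0)) b'
          ext = proj₁ (extension (pt (+ 0)) b')
          open Extension ext using (w; w'; finer; base; basic; basic') renaming (joint to jw)

          -- Agreement of colours from the base point in `c` is upgraded to agreement of fibers in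
          -- the extension. This makes every `v` with the colour of the generator admissible.
          fibre : ∀ {v z} → c' b' v ≡ D z → w (pt z) (pt z) ≡ w' v v
          fibre {v} {z} e = located (arc jw true false b' (pt (+ 0)) (sym base) v)
            where
            located : (∃ λ y → w' b' v ≡ w (pt (+ 0)) y) → w (pt z) (pt z) ≡ w' v v
            located (y , f) = trans (proj₂ (extension (pt (+ 0)) b') (pt z) y (trans (sym e) (finer true false b' v (pt (+ 0)) y f)))
              (sym (target jw true false b' v (pt (+ 0)) y f))

          -- The colour from `b'` to `F u` is that of `u` up to a multiple of `l`. Cutting the arc
          -- at difference `u` leaves just that multiple between `v` and `F u`.
          generator : ∃ λ v → (c' b' v ≡ D (+ u)) × E' l (F (+ u)) v
          generator = step₁ (F-col (+ 0) (+ u))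
            where
            V : ℤ
            V = + u - + 0
            step₃ : ∀ t s → (∃ λ x → (c' b' x ≡ D (+ u)) × (c' x (F (+ u)) ≡ D (V + + l * t + + l * s - + u))) → ∃ λ v → (c' b' v ≡ D (+ u)) × E' l (F (+ u)) v
            step₃ t s (x , e , f) = x , e , E'-sym l-grp (E'-intro {w = V + + l * t + + l * s - + u} f (divides (t + s) (u-0+l*t+l*s-u≡[t+s]*l (+ u) (+ l) t s)))
            step₂ : ∀ t → (∃ λ s → c' b' (F (+ u)) ≡ D (V + + l * t + + l * s)) → ∃ λ v → (c' b' v ≡ D (+ u)) × E' l (F (+ u)) v
            step₂ t (s , e) = step₃ t s (c'-fill {w = V + + l * t + + l * s} e (+ u))
            step₁ : (∃ λ t → c' (F (+ 0)) (F (+ u)) ≡ D (V + + l * t)) → ∃ λ v → (c' b' v ≡ D (+ u)) × E' l (F (+ u)) v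
            step₁ (t , e) = step₂ t (c'-moveˡ l-grp {w = V + + l * t} e Fb)

          module Generator (v : Fin n') (bv : c' b' v ≡ D (+ u)) (Fv : E' l (F (+ u)) v) where

            record Adjusted : Set where
              field
                g       : ℤ → Fin n'
                g-col   : ∀ z z' → c' (g z) (g z') ≡ D (+ u * (z' - z))
                g-cover : ∀ x → E' u b' x → ∃ λ z → g z ≡ x
                g-zero  : g (+ 0) ≡ b'
                g-one   : g (+ 1) ≡ v

            -- The given isomorphism takes the values `b'` and `v` at some two places. Their
            -- difference has the colour of the generator, so an automorphism of `X_U` moves 0 and 1
            -- there.
            adjusted : Adjusted
            adjusted = from-points (I.g-cover b' (E'-refl u-grp b')) (I.g-cover v (E'-intro {w = + u} bv ∣-refl))
              where
              module I = Iso₁ (iso₁ b')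
              from-points : (∃ λ z → I.g z ≡ b') → (∃ λ z → I.g z ≡ v) → Adjusted
              from-points (z₀ , e₀) (z₁ , e₁) = compose (auto₁ {+ 1} {z₁ - z₀} (trans (cong D (ℤₚ.*-identityʳ (+ u))) (trans (sym bv) (trans (cong₂ c' (sym e₀) (sym e₁)) (I.g-col z₀ z₁)))))
                where
                compose : Auto₁ (+ 1) (z₁ - z₀) → Adjusted
                compose a = record
                  { g = λ i → I.g (z₀ + A.h i)
                  ; g-col = λ i j → trans (I.g-col (z₀ + A.h i) (z₀ + A.h j)) (trans (cong (λ y → D (+ u * y)) ([z+b]-[z+a]≡b-a z₀ (A.h i) (A.h j))) (sym (A.preserves i j)))
                  ; g-cover = λ x e → located (I.g-cover x e)
                  ; g-zero = trans (I.g-≡ {z₀ + A.h (+ 0)} {z₀} (≈-trans {y = z₀ + + 0} (≈-+ (≈-refl z₀) A.fixes) (≈-reflexive (ℤₚ.+-identityʳ z₀)))) e₀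
                  ; g-one = trans (I.g-≡ {z₀ + A.h (+ 1)} {z₁} (≈-trans {y = z₀ + (z₁ - z₀)} (≈-+ (≈-refl z₀) A.maps) (≈-reflexive (x+[y-x]≡y z₀ z₁)))) e₁ }
                  where
                  module A = Auto₁ a
                  located : ∀ {x} → (∃ λ z → I.g z ≡ x) → ∃ λ z → I.g (z₀ + A.h z) ≡ x
                  located (z , e) = A.h⁻ (z - z₀) , trans (I.g-≡ {z₀ + A.h (A.h⁻ (z - z₀))} {z} (≈-trans {y = z₀ + (z - z₀)} (≈-+ (≈-refl z₀) (A.inverse (z - z₀))) (≈-reflexive (x+[y-x]≡y z₀ z)))) e

            module Coset (adj : Adjusted) where

              open Adjusted adj

              -- The lower normal section U/L' locates a point up to L' ...
              lower : ∀ i x → w (pt (+ u)) (pt (+ u * i)) ≡ w' v x → E' l' (g i) x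
              lower = Pair.SectionOf.Rigid.determined n _≟_ c c' joint circulant u k'' u-grp l'-grp ms ext g
                (λ z z' → + 0 , trans (g-col z z') (cong D (x≡x+l*0 (+ u * (z' - z)) (+ l'))))
                (λ x e → located (g-cover x e))
                (subst (λ y → E' l' b' y) (sym g-zero) (E'-refl l'-grp b')) v (subst (λ y → E' l' v y) (sym g-one) (E'-refl l'-grp v))
                where
                located : ∀ {x} → (∃ λ z → g z ≡ x) → ∃ λ z → E' l' (g z) x
                located {x} (z , e) = z , subst (λ y → E' l' y x) (sym e) (E'-refl l'-grp x)

              -- ... and the upper one, U'/L, locates its class modulo L.
              module Upper (i : ℤ) (x : Fin n') (wx : w (pt (+ u)) (pt (+ u * i)) ≡ w' v x) where

                module At' (a : Fin n') (wa : w (pt (+ u)) (pt (+ u')) ≡ w' v a) (wax : w (pt (+ u')) (pt (+ u * i)) ≡ w' a x) where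

                  -- An arc from `a` that corresponds to the one from `u'` to 0 has to end in `b'`,
                  -- the only point of its fiber.
                  ba : c' b' a ≡ D (+ u')
                  ba = located (arc jw false true (pt (+ u')) a (target jw false true (pt (+ u)) (pt (+ u')) v a wa) (pt (+ 0)))
                    where
                    located : (∃ λ y → w (pt (+ u')) (pt (+ 0)) ≡ w' a y) → c' b' a ≡ D (+ u')
                    located (y , e) = trans (cong (λ z → c' z a) (sym y≡b')) (sym (finer false true (pt (+ 0)) (pt (+ u')) y a (transpose jw false true (pt (+ u')) (pt (+ 0)) a y e)))
                      where
                      y≡b' : y ≡ b'
                      y≡b' = proj₁ (basic' y y (trans (sym (target jw false true (pt (+ u')) (pt (+ 0)) a y e)) base))

                  module With (j : ℤ) (Fj : E' l (F j) a) (auto : Auto₀ (+ u') j) where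

                    open Auto₀ auto

                    -- `F` itself need not send `u'` to the class of `a`. Composing with an
                    -- automorphism that fixes 0 and sends `u'` to the index `j` of that class
                    -- numbers the blocks as `Rigid` requires.
                    Γ : ℤ → Fin n'
                    Γ z = F (h (+ u' * z))

                    Γ-col : ∀ z z' → ∃ λ t → c' (Γ z) (Γ z') ≡ D (+ u' * (z' - z) + + l * t)
                    Γ-col z z' = combined (F-col (h (+ u' * z)) (h (+ u' * z'))) (preserves (+ u' * z) (+ u' * z'))
                      where
                      Y X : ℤ
                      Y = h (+ u' * z') - h (+ u' * z)
                      X = + u' * (z' - z)
                      result : ∀ t → c' (Γ z) (Γ z') ≡ D (Y + + l * t) → (∃ λ r → D (Y + + l * t) ≡ D (X + + l * r)) → ∃ λ t → c' (Γ z) (Γ z') ≡ D (X + + l * t)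
                      result t e (r , f) = r , trans e f
                      combined : (∃ λ t → c' (Γ z) (Γ z') ≡ D (Y + + l * t)) → (∃ λ s → D (+ u' * z' - + u' * z) ≡ D (Y + + l * s)) → ∃ λ t → c' (Γ z) (Γ z') ≡ D (X + + l * t)
                      combined (t , e) (s , f) = result t e (N.∼-shift {Y + + l * t} {X} {s - t} {+ 0}
                        (trans (cong D (Y+l*t+l*[s-t]≡Y+l*s Y (+ l) t s)) (trans (sym f) (cong D (trans (u*j-u*i≡u*[j-i] (+ u') z z') (x≡x+l*0 X (+ l)))))))

                    h⁻-zero : + l ∣ h⁻ (+ 0)
                    h⁻-zero = located (preserves (+ 0) (h⁻ (+ 0)))
                      where
                      located : (∃ λ t → D (h⁻ (+ 0) - + 0) ≡ D ((h (h⁻ (+ 0)) - h (+ 0)) + + l * t)) → + l ∣ h⁻ (+ 0)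
                      located (t , e) = lin₁ (proj₂ l-grp (sym e) (lin₃ (div (inverse (+ 0))) fixes ∣-refl (+ 1) (- + 1) t ([a-b]+l*t≡1*[a-0]+-1*b+t*l (h (h⁻ (+ 0))) (h (+ 0)) (+ l) t))) (+ 1) (x≡1*[x-0] (h⁻ (+ 0)))

                    Γ-cover : ∀ y → E' u' b' y → ∃ λ z → E' l (Γ z) y
                    Γ-cover y by = from-F (F-cover y)
                      where
                      from-F : (∃ λ z → E' l (F z) y) → ∃ λ z → E' l (Γ z) y
                      from-F (z , Fz) = quotient (u'∣h⁻ (preserves⁻ (+ 0) z))
                        where
                        u'∣z : + u' ∣ (z - + 0)
                        u'∣z = located (F-col (+ 0) z)
                          where
                          FF : E' u' (F (+ 0)) (F z)
                          FF = E'-trans u'-grp (E'-mono N.u∣l Fb) (E'-trans u'-grp by (E'-sym u'-grp (E'-mono N.u∣l Fz)))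
                          located : (∃ λ t → c' (F (+ 0)) (F z) ≡ D ((z - + 0) + + l * t)) → + u' ∣ (z - + 0)
                          located (t , e) = lin₂ (E'-elim u'-grp {w = (z - + 0) + + l * t} FF e) N.u∣l (+ 1) (- t) (x-0≡1*[x-0+l*t]+-t*l z (+ l) t)
                        u'∣h⁻ : (∃ λ t → D (z - + 0) ≡ D ((h⁻ z - h⁻ (+ 0)) + + l * t)) → + u' ∣ h⁻ z
                        u'∣h⁻ (t , e) = lin₃ (proj₂ u'-grp e u'∣z) (∣-trans N.u∣l h⁻-zero) N.u∣l (+ 1) (+ 1) (- t) (a≡1*[[a-b]+l*t]+1*b+-t*l (h⁻ z) (h⁻ (+ 0)) (+ l) t)
                        quotient : + u' ∣ h⁻ z → ∃ λ z → E' l (Γ z) y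
                        quotient (divides r e) = r , E'-trans l-grp (F-E' (≈-sym (≈-trans (≈-reflexive (cong h (trans (ℤₚ.*-comm (+ u') r) (sym e)))) (inverse z)))) Fz

                    Γ-zero : E' l b' (Γ (+ 0))
                    Γ-zero = E'-trans l-grp (E'-sym l-grp Fb) (F-E' (≈-trans (≈-reflexive (cong h (ℤₚ.*-zeroʳ (+ u')))) (∣⇒≈0 fixes)))

                    Γ-one : E' l a (Γ (+ 1))
                    Γ-one = E'-trans l-grp (E'-sym l-grp Fj) (F-E' (≈-trans (≈-reflexive (cong h (ℤₚ.*-identityʳ (+ u')))) maps))

                    determined : ∀ z y → w (pt (+ u')) (pt (+ u' * z)) ≡ w' a y → E' l (Γ z) y
                    determined = Pair.SectionOf.Rigid.determined n _≟_ c c' joint circulant u' k' u'-grp l-grp ns ext Γ Γ-col Γ-cover Γ-zero a Γ-one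

                    u-factor : + u ≡ + u' * + q
                    u-factor = trans (cong +_ u≡) (ℤₚ.pos-* u' q)

                    at-v : E' l (Γ (+ q)) v
                    at-v = determined (+ q) v (subst (λ z → w (pt (+ u')) (pt z) ≡ w' a v) u-factor (transpose jw false true (pt (+ u)) (pt (+ u')) v a wa))

                    at-x : E' l (Γ (+ q * i)) x
                    at-x = determined (+ q * i) x (subst (λ z → w (pt (+ u')) (pt z) ≡ w' a x) (trans (cong (_* i) u-factor) (ℤₚ.*-assoc (+ u') (+ q) i)) wax)

                    open Restrict auto using (linear-U)

                    -- `v` lies in the class of `F u` by choice and in that of `F (h u)` by `at-v`,
                    -- and `F` separates classes.
                    fixes-u : h (+ u' * + q) ≈ + u [ + l ]
                    fixes-u = F-≈ (E'-trans l-grp Fv (E'-sym l-grp at-v))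

                    fixes-U : h (+ u' * (+ q * i)) ≈ + u * i [ + l ]
                    fixes-U = ≈-trans (linear-U ns i) (≈-* fixes-u (≈-refl i))

                    result : E' l (F (+ u * i)) x
                    result = E'-trans l-grp (F-E' fixes-U) at-x

                  compared : ∀ j → E' l (F j) a → ∃ λ t → D (+ u') ≡ D (j + + l * t)
                  compared j Fj = step₁ (F-col (+ 0) j)
                    where
                    V : ℤ
                    V = j - + 0
                    step₃ : ∀ t s → (∃ λ r → c' b' a ≡ D (V + + l * t + + l * s + + l * r)) → ∃ λ t → D (+ u') ≡ D (j + + l * t)
                    step₃ t s (r , e) = t + s + r , trans (sym ba) (trans e (cong D (j-0+l*t+l*s+l*r≡j+l*[t+s+r] j (+ l) t s r)))
                    step₂ : ∀ t → (∃ λ s → c' (F (+ 0)) a ≡ D (V + + l * t + + l * s)) → ∃ λ t → D (+ u') ≡ D (j + + l * t)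
                    step₂ t (s , e) = step₃ t s (c'-moveˡ l-grp {w = V + + l * t + + l * s} e Fb)
                    step₁ : (∃ λ t → c' (F (+ 0)) (F j) ≡ D (V + + l * t)) → ∃ λ t → D (+ u') ≡ D (j + + l * t)
                    step₁ (t , e) = step₂ t (c'-moveʳ l-grp {w = V + + l * t} e Fj)

                  result : E' l (F (+ u * i)) x
                  result = located (F-cover a)
                    where
                    located : (∃ λ j → E' l (F j) a) → E' l (F (+ u * i)) x
                    located (j , Fj) = With.result j Fj (auto₀ (compared j Fj))

                result : E' l (F (+ u * i)) x
                result = located (triangle jw false true (pt (+ u)) (pt (+ u * i)) v x wx (pt (+ u')))
                  where
                  located : (∃ λ a → (w (pt (+ u)) (pt (+ u')) ≡ w' v a) × (w (pt (+ u')) (pt (+ u * i)) ≡ w' a x)) → E' l (F (+ u * i)) x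
                  located (a , wa , wax) = At'.result a wa wax

              -- The point `x` over `u * i`, seen from `v`, is the witness: it lies with `g i`
              -- modulo L' and with `F (u * i)` modulo L.
              agree : ∀ i → E' l (F (+ u * i)) (g i)
              agree i = located (arc jw false true (pt (+ u)) v (fibre bv) (pt (+ u * i)))
                where
                located : (∃ λ x → w (pt (+ u)) (pt (+ u * i)) ≡ w' v x) → E' l (F (+ u * i)) (g i)
                located (x , e) = E'-trans l-grp (Upper.result i x e) (E'-sym l-grp (E'-mono l∣l' (lower i x e)))

          lifted : ∃ λ g → (∀ z z' → c' (g z) (g z') ≡ D (+ u * (z' - z))) × (g (+ 0) ≡ b') × (∀ i → E' l (F (+ u * i)) (g i))
          lifted = located generator
            where
            result : ∀ v bv Fv → (adj : Generator.Adjusted v bv Fv) →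
              ∃ λ g → (∀ z z' → c' (g z) (g z') ≡ D (+ u * (z' - z))) × (g (+ 0) ≡ b') × (∀ i → E' l (F (+ u * i)) (g i))
            result v bv Fv adj = Generator.Adjusted.g adj , Generator.Adjusted.g-col adj , Generator.Adjusted.g-zero adj , Generator.Coset.agree v bv Fv adj
            located : (∃ λ v → (c' b' v ≡ D (+ u)) × E' l (F (+ u)) v) →
              ∃ λ g → (∀ z z' → c' (g z) (g z') ≡ D (+ u * (z' - z))) × (g (+ 0) ≡ b') × (∀ i → E' l (F (+ u * i)) (g i))
            located (v , bv , Fv) = result v bv Fv (Generator.adjusted v bv Fv)

      record Lift (iso₀ : Iso₀) (b : ℤ) : Set where
        field
          g     : ℤ → Fin n'
          g-col : ∀ z z' → c' (g z) (g z') ≡ D (+ u * (z' - z))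
          over  : ∀ i → E' l (Iso₀.F iso₀ (b + + u * i)) (g i)

      reparametrise : ∀ {iso₀ b b₀} i₀ → b ≡ b₀ + + u * i₀ → Lift iso₀ b → Lift iso₀ b₀
      reparametrise {iso₀} {b} {b₀} i₀ e lift = record
        { g = λ i → Lift.g lift (i - i₀)
        ; g-col = λ z z' → trans (Lift.g-col lift (z - i₀) (z' - i₀)) (cong (λ y → D (+ u * y)) ([x'-s]-[x-s]≡x'-x z z' i₀))
        ; over = λ i → subst (λ z → E' l (Iso₀.F iso₀ z) (Lift.g lift (i - i₀))) (trans (cong (_+ (+ u * (i - i₀))) e) (Y+l*t+l*[s-t]≡Y+l*s b₀ (+ u) i₀ i)) (Lift.over lift (i - i₀)) }

      coset : Fin n → Fin u
      coset x = resid u (ι x)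

      index : Fin n → ℤ
      index x = - _∣_.quotient (div (ι-resid u (ι x)))

      split : ∀ x → ι x ≡ ι (coset x) + + u * index x
      split x = trans (x≡b-[b-x] (ι x) (ι (coset x))) (trans (cong (_-_ (ι (coset x))) (_∣_.equality (div (ι-resid u (ι x))))) (w-q*d≡w+d*-q (ι (coset x)) (_∣_.quotient (div (ι-resid u (ι x)))) (+ u)))

      module Override {iso₀ : Iso₀} (lift : ∀ (b : Fin u) → Lift iso₀ (ι b)) (x : Fin n) (at-x : Lift iso₀ (ι x)) where

        private
          pick : ∀ b → Dec (b ≡ coset x) → Lift iso₀ (ι b)
          pick b (yes e) = reparametrise (index x) (trans (split x) (cong (λ y → ι y + + u * index x) (sym e))) at-x
          pick b (no _)  = lift b

          pick-at : ∀ b d → b ≡ coset x → ∀ i → Lift.g (pick b d) i ≡ Lift.g at-x (i - index x)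
          pick-at b (yes _) e i = refl
          pick-at b (no ¬e) e i = ⊥-elim (¬e e)

          pick-off : ∀ b d → ¬ b ≡ coset x → ∀ i → Lift.g (pick b d) i ≡ Lift.g (lift b) i
          pick-off b (yes e) ¬e i = ⊥-elim (¬e e)
          pick-off b (no _)  ¬e i = refl

        -- Changes the lift over a single coset. Applied twice, it prescribes values at points of
        -- two different cosets.
        override : ∀ (b : Fin u) → Lift iso₀ (ι b)
        override b = pick b (b Finₚ.≟ coset x)

        override-at : ∀ b → b ≡ coset x → ∀ i → Lift.g (override b) i ≡ Lift.g at-x (i - index x)
        override-at b = pick-at b (b Finₚ.≟ coset x)

        override-off : ∀ b → ¬ b ≡ coset x → ∀ i → Lift.g (override b) i ≡ Lift.g (lift b) i
        override-off b = pick-off b (b Finₚ.≟ coset x)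

      module Gluing (wreath : ∀ w s → ¬ (+ u ∣ w) → + l ∣ s → D (w + s) ≡ D w) (iso₀ : Iso₀)
        (lift : ∀ (b : Fin u) → Lift iso₀ (ι b)) where

        open Iso₀ iso₀

        f : Fin n → Fin n'
        f x = Lift.g (lift (coset x)) (index x)

        f-F : ∀ x → E' l (F (ι x)) (f x)
        f-F x = subst (λ z → E' l (F z) (f x)) (sym (split x)) (Lift.over (lift (coset x)) (index x))

        -- Outside e(U) colours depend only on the classes of L.
        move : ∀ {w₀ a b b₁} → ¬ (+ u ∣ w₀) → c' a b ≡ D w₀ → E' l b b₁ → c' a b₁ ≡ D w₀
        move {w₀} {a} {b} {b₁} ¬u e r = located (c'-moveʳ l-grp {w = w₀} e r)
          where
          located : (∃ λ t → c' a b₁ ≡ D (w₀ + + l * t)) → c' a b₁ ≡ D w₀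
          located (t , g) = trans g (wreath w₀ (+ l * t) ¬u (divides t (ℤₚ.*-comm (+ l) t)))

        neg∤ : ∀ {w₀} → ¬ (+ u ∣ w₀) → ¬ (+ u ∣ - w₀)
        neg∤ {w₀} ¬u d = ¬u (lin₁ d (- + 1) (a≡-1*-a w₀))

        moveˡ : ∀ {w₀ a a₁ b} → ¬ (+ u ∣ w₀) → c' a b ≡ D w₀ → E' l a a₁ → c' a₁ b ≡ D w₀
        moveˡ {w₀} ¬u e r = trans (c'-neg (move { - w₀} (neg∤ ¬u) (c'-neg e) r)) (cong D (ℤₚ.neg-involutive w₀))

        -- Within a coset the lift decides. Between cosets the colour depends only on the classes
        -- modulo L, so lifts over different cosets may be chosen independently.
        f-col : ∀ x y → c' (f x) (f y) ≡ D (ι y - ι x)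
        f-col x y = decide (+ u ∣? (ι y - ι x))
          where
          outside : ¬ (+ u ∣ (ι y - ι x)) → (∃ λ t → c' (F (ι x)) (F (ι y)) ≡ D ((ι y - ι x) + + l * t)) → c' (f x) (f y) ≡ D (ι y - ι x)
          outside ¬u (t , e) = moveˡ ¬u (move ¬u (trans e (wreath (ι y - ι x) (+ l * t) ¬u (divides t (ℤₚ.*-comm (+ l) t)))) (f-F y)) (f-F x)
          inside : coset y ≡ coset x → c' (f x) (f y) ≡ D (ι y - ι x)
          inside e = trans (cong (λ b → c' (f x) (Lift.g (lift b) (index y))) e) (trans (Lift.g-col (lift (coset x)) (index x) (index y))
            (cong D (trans (u*[j-i]≡[b+u*j]-[b+u*i] (ι (coset x)) (+ u) (index x) (index y)) (cong₂ _-_ (trans (cong (λ b → ι b + + u * index y) (sym e)) (sym (split y))) (sym (split x))))))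
          decide : Dec (+ u ∣ (ι y - ι x)) → c' (f x) (f y) ≡ D (ι y - ι x)
          decide (yes d) = inside (resid-cong u (mod d))
          decide (no ¬d) = outside ¬d (F-col (ι x) (ι y))

        glued : ∀ x y → c' (f x) (f y) ≡ c x y
        glued x y = trans (f-col x y) (sym (c-D x y))

        f-injective : ∀ x y → f x ≡ f y → x ≡ y
        f-injective x y e = diagonal joint true false (f x) x y (trans (cong (c' (f x)) e) (glued x y))

-- Radicals, quotients and normality translated to differences.

module CirculantScheme where

  open import Defs
  open Matching
  open Coherence
  open Quotient
  open Congruence
  open CirculantPair
  open Identities
  open import Data.Nat as ℕ using (ℕ; NonZero)
  import Data.Nat.Properties as ℕₚ
  import Data.Nat.Divisibility as ℕᵈ
  open import Data.Integer using (+_; -_; _+_; _-_; _*_)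
  import Data.Integer.Properties as ℤₚ
  open import Data.Integer.Divisibility.Signed using (_∣_; divides; ∣-trans; ∣-refl)
  open import Data.Fin using (Fin)
  open import Data.Bool using (false)
  open import Data.Product using (Σ; ∃; _×_; _,_; proj₁; proj₂)
  open import Data.Unit using (⊤; tt)
  open import Function using (_∘_; id)
  open import Function.Bundles using (_↔_; _⇔_; Equivalence; mk⇔)
  open import Relation.Binary using (IsEquivalence)
  open import Relation.Binary.PropositionalEquality using (_≡_; refl; sym; trans; cong; cong₂; subst)
  open import Relation.Nullary using (¬_)

  -- The radical of s identifies the points with the same s-neighbours.
  module _ {n : ℕ} (s : Fin n → Fin n → Set) where

    Twins : Fin n → Fin n → Set
    Twins x y = (∀ z → s x z ⇔ s y z) × (∀ z → s z x ⇔ s z y)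

    twins-isRad : IsRad Twins s
    twins-isRad = record
        { refl  = (λ z → mk⇔ id id) , (λ z → mk⇔ id id)
        ; sym   = λ { (p , q) → (λ z → flip (p z)) , (λ z → flip (q z)) }
        ; trans = λ { (p , q) (p' , q') → (λ z → compose (p z) (p' z)) , (λ z → compose (q z) (q' z)) } } ,
      (λ x y → mk⇔ (λ e → x , y , self x , self y , e)
         (λ { (x' , y' , (p , _) , (_ , q) , e) → bwd (q x) (bwd (p y') e) })) ,
      λ e eq rad x y exy →
        (λ z → mk⇔ (λ h → bwd (rad y z) (x , z , IsEquivalence.sym eq exy , IsEquivalence.refl eq , h))
                   (λ h → bwd (rad x z) (y , z , exy , IsEquivalence.refl eq , h))) ,
        (λ z → mk⇔ (λ h → bwd (rad z y) (z , x , IsEquivalence.refl eq , IsEquivalence.sym eq exy , h))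
                   (λ h → bwd (rad z x) (z , y , IsEquivalence.refl eq , exy , h)))
      where
      open Equivalence using () renaming (from to bwd; to to fwd)
      flip : {A B : Set} → A ⇔ B → B ⇔ A
      flip e = mk⇔ (bwd e) (fwd e)
      compose : {A B C : Set} → A ⇔ B → B ⇔ C → A ⇔ C
      compose e f = mk⇔ (fwd f ∘ fwd e) (bwd e ∘ bwd f)
      self : ∀ x → Twins x x
      self x = (λ z → mk⇔ id id) , (λ z → mk⇔ id id)

  module Circulants (n : ℕ) .{{_ : NonZero n}} (X : Config n) (scheme : IsScheme X) (circ : Circulant X) where

    X-circulant : ∀ x y → col X x y ≡ col X (resid n (+ 0)) (resid n (ι y - ι x))
    X-circulant x y = trans (cong₂ (col X) (sym (shift (+ 0) x (0+x≡x (ι x)))) (sym (shift (ι y - ι x) y (y-x+x≡y (ι x) (ι y))))) (circ (resid n (+ 0)) (resid n (ι y - ι x)) x)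
      where
      shift : ∀ z y → z + ι x ≡ ι y → resid n z ⊕ x ≡ y
      shift z y e = ι-injective (≈-trans (ι-⊕ (resid n z) x) (≈-trans (≈-+ (ι-resid n z) (≈-refl (ι x))) (≈-reflexive e)))

    module Over {n' : ℕ} (X' : Config n') (cc' : IsCC X') (φ : Col X → Col X') (iso : IsAlgIso X X' φ) where

      c : Fin n → Fin n → Col X'
      c x y = φ (col X x y)

      joint : Coherent₂ c (col X')
      joint = algIso⇒coherent X X' φ (proj₁ scheme) cc' iso

      c-circulant : ∀ x y → c x y ≡ c (resid n (+ 0)) (resid n (ι y - ι x))
      c-circulant x y = cong φ (X-circulant x y)

      open Pair n (_≟ᶜ_ X') c (col X') joint c-circulant using (pt; D; pt-≈; D-cong; c-D; IsGroup)

      group : ∀ {d} → XGroup X d → IsGroup d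
      group {d} (d∣n , closed) = ℕ∣⇒∣ d∣n , λ {x} {y} e d∣x →
        lin₂ (sameCoset⇒∣ d∣n (closed (pt (+ 0)) (pt x) (pt (+ 0)) (pt y) (IsAlgIso.inj iso (pt (+ 0)) (pt x) (pt (+ 0)) (pt y) e) (∣⇒sameCoset d∣n (near x d∣x))))
          (∣-trans (ℕ∣⇒∣ d∣n) (div (≈-- (pt-≈ y) (pt-≈ (+ 0))))) (+ 1) (- + 1) (y≡1*a+-1*[a-[y-0]] (ι (pt y) - ι (pt (+ 0))) y)
        where
        near : ∀ x → + d ∣ x → + d ∣ (ι (pt x) - ι (pt (+ 0)))
        near x d∣x = lin₂ (∣-trans (ℕ∣⇒∣ d∣n) (div (≈-- (pt-≈ x) (pt-≈ (+ 0))))) d∣x (+ 1) (+ 1) (a≡1*[a-[x-0]]+1*x (ι (pt x) - ι (pt (+ 0))) x)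

      group-1 : IsGroup 1
      group-1 = divides (+ n) (sym (ℤₚ.*-identityʳ (+ n))) , λ {_} {y} _ _ → divides y (sym (ℤₚ.*-identityʳ y))

      group-n : ∀ {m} → m ≡ n → IsGroup m
      group-n refl = ∣-refl , λ {x} {y} e d → ≈0⇒∣ (resid-≈ n {y} {+ 0} (sym (diagonal joint false false (pt (+ 0)) (pt (+ 0)) (pt y) (trans (D-cong (≈-sym (∣⇒≈0 d))) e))))

      -- `IsWreath` quantifies over whatever is the radical, and `Twins` is one. For the relation of
      -- the arc from 0 to `w`, the points `w` and `w + s` are twins and so have the same colour
      -- from 0.
      wreath : ∀ {u l} → u ℕᵈ.∣ n → l ℕᵈ.∣ n → IsGroup u → IsWreath X u l → ∀ w s → ¬ (+ u ∣ w) → + l ∣ s → D (w + s) ≡ D w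
      wreath {u} {l} u∣n l∣n u-grp wr w s ¬u l∣s = cong φ (Equivalence.to (proj₂ twin (pt (+ 0))) refl)
        where
        outside : ∀ x y → basicRel X (pt (+ 0)) (pt w) x y → ¬ SameCoset u x y
        outside x y e sc = ¬u (proj₂ u-grp (trans (sym (c-D x y)) (cong φ e)) (sameCoset⇒∣ u∣n sc))
        l∣n' : + l ∣ + n
        l∣n' = ℕ∣⇒∣ l∣n
        twin : Twins (basicRel X (pt (+ 0)) (pt w)) (pt w) (pt (w + s))
        twin = wr (pt (+ 0)) (pt w) outside _ (twins-isRad (basicRel X (pt (+ 0)) (pt w))) (pt w) (pt (w + s))
          (∣⇒sameCoset l∣n (lin₃ (∣-trans l∣n' (div (pt-≈ (w + s)))) (∣-trans l∣n' (div (pt-≈ w))) l∣s (+ 1) (- + 1) (+ 1) (b-a≡1*[b-[w+s]]+-1*[a-w]+1*s (ι (pt w)) (ι (pt (w + s))) w s)))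

      module Section' (u k : ℕ) .{{_ : NonZero u}} .{{_ : NonZero k}} (u-grp : IsGroup u) (l-grp : IsGroup (k ℕ.* u)) where

        open Pair.SectionOf n (_≟ᶜ_ X') c (col X') joint c-circulant u k u-grp l-grp using (mem; mem-block; mem-support; selfSection; _∼_; SameQ; sameQ⇒∼; ∼⇒sameQ; ∼-sym; ∼-trans; ∼-resp; ∼-zero; Preserves; Auto)

        private
          sec : Section {⊤} (λ _ → col X) (λ _ → k) (λ _ → mem)
          sec = record
            { inhabited = Section.inhabited selfSection
            ; disjoint  = Section.disjoint selfSection
            ; block     = λ _ _ i j x x' y y' mx mx' e → mem-block {i} {j} {x} {x'} {y} {y'} mx mx' (cong φ e)
            ; support   = λ _ _ i j l x x' y y' mx mx' e → mem-support {i} {j} {l} {x} {x'} {y} {y'} mx mx' (cong φ e)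
            ; meets     = λ _ _ i x m → i , x , m , refl }

          module QF = QuotientFamily (_≟ᶜ_ X) {n = λ (_ : ⊤) → n} {w = λ _ → col X} (isCC⇒coherent X (proj₁ scheme)) tt sec using (Q; qcol⇒Q; Q⇒qcol)

        quot⇒ : ∀ i j i' j' → col (Quot X u k) i j ≡ col (Quot X u k) i' j' → SameQ i j i' j'
        quot⇒ i j i' j' e = convert (QF.qcol⇒Q tt tt i j i' j' e)
          where
          convert : QF.Q tt tt i j i' j' → SameQ i j i' j'
          convert (x , y , x' , y' , a , b , f) = x , y , x' , y' , a , b , cong φ f

        quot⇐ : ∀ i j i' j' → SameQ i j i' j' → col (Quot X u k) i j ≡ col (Quot X u k) i' j'
        quot⇐ i j i' j' (x , y , x' , y' , a , b , f) = QF.Q⇒qcol tt tt i j i' j' (x , y , x' , y' , a , b , IsAlgIso.inj iso x y x' y' f)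

        schurian⇒auto : Schurian (Quot X u k) → ∀ {z z'} → z ∼ z' → Auto z z'
        schurian⇒auto sch {z} {z'} e = build (sch o (resid k z) o (resid k z') (quot⇐ o (resid k z) o (resid k z')
            (∼⇒sameQ {o} {resid k z} {o} {resid k z'} (∼-trans (∼-resp (near z)) (∼-trans e (∼-resp (≈-sym (near z'))))))))
          where
          o : Fin k
          o = resid k (+ 0)
          near : ∀ z → ι (resid k z) - ι o ≈ z [ + k ]
          near z = ≈-trans (≈-- (ι-resid k z) (ι-resid k (+ 0))) (≈-reflexive (x-0≡x z))
          build : (Σ (Fin k ↔ Fin k) λ f → IsAut (Quot X u k) f × (to f o ≡ o) × (to f (resid k z) ≡ resid k z')) → Auto z z'
          build (f , aut , f-o , f-z) = record
            { h = λ x → ι (to f (resid k x)) ; h⁻ = λ x → ι (from f (resid k x))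
            ; preserves = λ x y → ∼-trans (∼-resp (≈-sym (≈-- (ι-resid k y) (ι-resid k x)))) (moved (resid k x) (resid k y))
            ; preserves⁻ = λ x y → ∼-trans (∼-resp (≈-sym (≈-- (ι-resid k y) (ι-resid k x)))) (moved⁻ (resid k x) (resid k y))
            ; fixes = ≈-trans (≈-reflexive (cong ι f-o)) (ι-resid k (+ 0))
            ; maps = ≈-trans (≈-reflexive (cong ι f-z)) (ι-resid k z')
            ; inverse = λ x → ≈-trans (≈-reflexive (cong ι (trans (cong (to f) (resid-ι (from f (resid k x)))) (to-from f (resid k x))))) (ι-resid k x) }
            where
            moved : ∀ i j → (ι j - ι i) ∼ (ι (to f j) - ι (to f i))
            moved i j = sameQ⇒∼ {i} {j} {to f i} {to f j} (quot⇒ i j (to f i) (to f j) (sym (aut i j)))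
            moved⁻ : ∀ i j → (ι j - ι i) ∼ (ι (from f j) - ι (from f i))
            moved⁻ i j = ∼-sym (subst (λ a → (ι (from f j) - ι (from f i)) ∼ (ι a - ι i)) (to-from f j) (subst (λ a → (ι (from f j) - ι (from f i)) ∼ (ι (to f (from f j)) - ι a)) (to-from f i) (moved (from f i) (from f j))))

        -- `h` induces an automorphism of the quotient; normality turns the translation by 1 into a
        -- translation by some `g`, which is the constant increment.
        normal⇒affine : Normal (Quot X u k) → ∀ h → Preserves h → ∀ x y → h (x + + 1) - h x ≈ h (y + + 1) - h y [ + k ]
        normal⇒affine nor h pres x y = conclude (nor σ aut (resid k (+ 1)))
          where
          respects : ∀ {a b} → a ≈ b [ + k ] → h a ≈ h b [ + k ]
          respects {a} {b} (mod e) = mod (∼-zero (pres b a) e)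
          f : Fin k → Fin k
          f i = resid k (h (ι i))
          f-inj : ∀ i j → f i ≡ f j → i ≡ j
          f-inj i j e = ι-injective (mod (∼-zero (∼-sym (pres (ι j) (ι i))) (div (resid-≈ k {h (ι i)} {h (ι j)} e))))
          perm : Σ (Fin k ↔ Fin k) λ σ → ∀ i → to σ i ≡ f i
          perm = injective⇒↔ ℕₚ.≤-refl f f-inj
          σ : Fin k ↔ Fin k
          σ = proj₁ perm
          value : ∀ i → ι (to σ i) ≈ h (ι i) [ + k ]
          value i = ≈-trans (≈-reflexive (cong ι (proj₂ perm i))) (ι-resid k (h (ι i)))
          aut : IsAut (Quot X u k) σ
          aut i j = quot⇐ (to σ i) (to σ j) i j (∼⇒sameQ {to σ i} {to σ j} {i} {j} (∼-trans (∼-resp (≈-- (value j) (value i))) (∼-sym (pres (ι i) (ι j)))))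
          conclude : (∃ λ g → ∀ i → to σ (i ⊕ resid k (+ 1)) ≡ to σ i ⊕ g) → h (x + + 1) - h x ≈ h (y + + 1) - h y [ + k ]
          conclude (g , e) = ≈-trans (increment x) (≈-sym (increment y))
            where
            increment : ∀ x → h (x + + 1) - h x ≈ ι g [ + k ]
            increment x = mod (lin₃ (div moved) (div (respects (≈-sym (ι-resid k x)))) (div (value (resid k x))) (+ 1) (- + 1) (+ 1) (a-b-g≡1*[a-[c+g]]+-1*[b-d]+1*[c-d] (h (x + + 1)) (h x) (ι g) (ι (to σ (resid k x))) (h (ι (resid k x)))))
              where
              moved : h (x + + 1) ≈ ι (to σ (resid k x)) + ι g [ + k ]
              moved = ≈-trans (respects (≈-sym (≈-trans (ι-⊕ (resid k x) (resid k (+ 1))) (≈-+ (ι-resid k x) (ι-resid k (+ 1))))))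
                (≈-trans (≈-sym (value (resid k x ⊕ resid k (+ 1)))) (≈-trans (≈-reflexive (cong ι (e (resid k x)))) (ι-⊕ (to σ (resid k x)) g)))

-- Sesquiseparability and schurity of the wreath product.

module WreathProduct where

  open import Defs
  open Matching
  open Coherence
  open Separability
  open Congruence
  open CirculantPair
  open SectionIso
  open Wreath
  open CirculantScheme
  open Identities
  open import Data.Nat as ℕ using (ℕ; NonZero)
  import Data.Nat.Properties as ℕₚ
  import Data.Nat.Divisibility as ℕᵈ
  open import Data.Integer using (ℤ; +_; -_; _+_; _-_; _*_)
  import Data.Integer.Properties as ℤₚ
  open import Data.Integer.Divisibility.Signed using (_∣_; divides; _∣?_)
  open import Data.Fin using (Fin)
  import Data.Fin.Properties as Finₚ
  open import Data.Bool using (true; false)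
  open import Data.Product using (Σ; ∃; ∃₂; _×_; _,_; proj₁; proj₂)
  open import Function.Bundles using (_↔_)
  open import Relation.Binary.PropositionalEquality using (_≡_; refl; sym; trans; cong; cong₂; subst)
  open import Relation.Nullary using (¬_; Dec; yes; no)

  module Wreathed (n : ℕ) .{{_ : NonZero n}} (X : Config n) (scheme : IsScheme X) (circ : Circulant X)
    (fibres : ∀ β Y → IsOnePointExt X β Y → FibersEq X β Y)
    (u u' k' k'' k₁ q : ℕ) .{{_ : NonZero u}} .{{_ : NonZero u'}} .{{_ : NonZero k'}} .{{_ : NonZero k''}} .{{_ : NonZero k₁}} .{{_ : NonZero (k' ℕ.* u')}}
    (k₁u≡n : k₁ ℕ.* u ≡ n) (u≡ : u ≡ u' ℕ.* q)
    (gu : XGroup X u) (gu' : XGroup X u') (gl : XGroup X (k' ℕ.* u')) (gl' : XGroup X (k'' ℕ.* u))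
    (u∣l : u ℕᵈ.∣ k' ℕ.* u') (l∣l' : k' ℕ.* u' ℕᵈ.∣ k'' ℕ.* u)
    (wr : IsWreath X u (k' ℕ.* u'))
    (normalN : Normal (Quot X u' k')) (normalM : Normal (Quot X u k''))
    (schurian₀ : Schurian (Quot X 1 (k' ℕ.* u'))) (separable₀ : Sesquiseparable (Quot X 1 (k' ℕ.* u')))
    (schurian₁ : Schurian (Quot X u k₁)) (separable₁ : Sesquiseparable (Quot X u k₁)) where

    module Onto {n' : ℕ} (X' : Config n') (cc' : IsCC X') (φ : Col X → Col X') (iso : IsAlgIso X X' φ) (closed : SesquiclosedMap X X' φ) where

      private
        module O = Circulants.Over n X scheme circ X' cc' φ iso using (c; joint; c-circulant; group; group-1; group-n; wreath)

      open Pair n (_≟ᶜ_ X') O.c (col X') O.joint O.c-circulant using (pt; D; D-cong; c-D; c'-diag; c'-D; IsGroup; E'; in-class; E'-intro; E'-refl)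

      c' : Fin n' → Fin n' → Col X'
      c' = col X'

      u-grp : IsGroup u
      u-grp = O.group gu

      l-grp : IsGroup (k' ℕ.* u')
      l-grp = O.group gl

      open WreathPair.Groups n (_≟ᶜ_ X') O.c (col X') O.joint O.c-circulant u u' k' k'' k₁ q k₁u≡n u≡ u-grp (O.group gu') l-grp (O.group gl') (ℕ∣⇒∣ u∣l) (ℕ∣⇒∣ l∣l')
        using (module N; module M; l; l'; Preserves₀; Auto₀; module Auto₀; Auto₁; module Auto₁; module Restrict; normalSchurian-N; normalSchurian-M; Iso₀; module Iso₀; Iso₁; Lift; module Lift; coset; index; split; module Override)

      private
        l*1-grp : IsGroup (l ℕ.* 1)
        l*1-grp = subst IsGroup (sym (ℕₚ.*-identityʳ l)) l-grp

        n-grp : IsGroup (k₁ ℕ.* u)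
        n-grp = O.group-n k₁u≡n

        module S₀ = Circulants.Over.Section' n X scheme circ X' cc' φ iso 1 l O.group-1 l*1-grp using (quot⇒; quot⇐; schurian⇒auto)
        module S₁ = Circulants.Over.Section' n X scheme circ X' cc' φ iso u k₁ u-grp n-grp using (quot⇒; quot⇐; schurian⇒auto)
        module T₀ = Pair.SectionOf n (_≟ᶜ_ X') O.c (col X') O.joint O.c-circulant 1 l O.group-1 l*1-grp using (_∼_; same; Preserves; Auto; module Auto)
        module T₁ = Pair.SectionOf n (_≟ᶜ_ X') O.c (col X') O.joint O.c-circulant u k₁ u-grp n-grp using (_∼_; same; Auto; module Auto)

        l*1 : + (l ℕ.* 1) ≡ + l
        l*1 = cong +_ (ℕₚ.*-identityʳ l)

        -- `X_{G/L}` is treated as a section whose upper group is all of G, generated by 1; its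
        -- modulus then reads `l * 1`.
        unscale : ∀ {x y t} → D (+ 1 * x) ≡ D (+ 1 * y + + (l ℕ.* 1) * t) → D x ≡ D (y + + l * t)
        unscale {x} {y} {t} e = trans (cong D (sym (ℤₚ.*-identityˡ x))) (trans e (cong D (cong₂ _+_ (ℤₚ.*-identityˡ y) (cong (_* t) l*1))))

        scale : ∀ {x y t} → D x ≡ D (y + + l * t) → D (+ 1 * x) ≡ D (+ 1 * y + + (l ℕ.* 1) * t)
        scale {x} {y} {t} e = trans (cong D (ℤₚ.*-identityˡ x)) (trans e (cong D (cong₂ _+_ (sym (ℤₚ.*-identityˡ y)) (cong (_* t) (sym l*1)))))

        -- `X_U` is a section with trivial lower group: its modulus `k₁ * u` equals `n` and vanishes
        -- in ℤ/n.
        drop-n : ∀ x t → D (x + + (k₁ ℕ.* u) * t) ≡ D x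
        drop-n x t = D-cong (mod (divides t (trans (z+k*t-z≡t*k x (+ (k₁ ℕ.* u)) t) (cong (λ m → t * + m) k₁u≡n))))

      auto₀ : ∀ {z z'} → (∃ λ t → D z ≡ D (z' + + l * t)) → Auto₀ z z'
      auto₀ {z} {z'} (t , e) = convert (S₀.schurian⇒auto schurian₀ {z} {z'} (T₀.same t (scale {z} {z'} {t} e)))
        where
        keep : ∀ {h} → T₀.Preserves h → Preserves₀ h
        keep {h} p x y = unpack (p x y)
          where
          unpack : (y - x) T₀.∼ (h y - h x) → ∃ λ t → D (y - x) ≡ D ((h y - h x) + + l * t)
          unpack (T₀.same s f) = s , unscale {y - x} {h y - h x} {s} f
        convert : T₀.Auto z z' → Auto₀ z z'
        convert a = record { h = A.h ; h⁻ = A.h⁻ ; preserves = keep {A.h} A.preserves ; preserves⁻ = keep {A.h⁻} A.preserves⁻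
          ; fixes = ≈0⇒∣ A.fixes ; maps = A.maps ; inverse = A.inverse }
          where module A = T₀.Auto a

      auto₁ : ∀ {z z'} → D (+ u * z) ≡ D (+ u * z') → Auto₁ z z'
      auto₁ {z} {z'} e = convert (S₁.schurian⇒auto schurian₁ {z} {z'} (T₁.same (+ 0) (trans e (sym (drop-n (+ u * z') (+ 0))))))
        where
        convert : T₁.Auto z z' → Auto₁ z z'
        convert a = record { h = A.h ; h⁻ = A.h⁻ ; preserves = λ x y → unpack x y (A.preserves x y)
          ; fixes = A.fixes ; maps = A.maps ; inverse = A.inverse }
          where
          module A = T₁.Auto a
          unpack : ∀ x y → (y - x) T₁.∼ (A.h y - A.h x) → D (+ u * (y - x)) ≡ D (+ u * (A.h y - A.h x))
          unpack x y (T₁.same s f) = trans f (drop-n (+ u * (A.h y - A.h x)) s)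

      k''∣k₁ : + k'' ∣ + k₁
      k''∣k₁ = ℕ∣⇒∣ (ℕᵈ.*-cancelʳ-∣ u (subst (k'' ℕ.* u ℕᵈ.∣_) (sym k₁u≡n) (proj₁ gl')))

      ns : N.NormalSchurian
      ns = normalSchurian-N auto₀ (Circulants.Over.Section'.normal⇒affine n X scheme circ X' cc' φ iso u' k' (O.group gu') l-grp normalN)

      ms : M.NormalSchurian
      ms = normalSchurian-M k''∣k₁ auto₁ (Circulants.Over.Section'.normal⇒affine n X scheme circ X' cc' φ iso u k'' u-grp (O.group gl') normalM)

      homogeneous : ∀ x x' → O.c x x ≡ c' x' x'
      homogeneous x x' = trans (c-D x x) (trans (cong D (ℤₚ.+-inverseʳ (ι x))) (sym (c'-diag x')))

      extension : ∀ x x' → Σ (Extension O.c c' x x') λ ext → ∀ γ δ → O.c x γ ≡ O.c x δ → Extension.w ext γ γ ≡ Extension.w ext δ δ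
      extension x x' = sesquiclosed⇒extension X X' φ iso closed fibres x x' (homogeneous x x')

      iso₁ : ∀ b' → Iso₁ b'
      iso₁ b' = convert (sectionIso n (_≟ᶜ_ X') O.c c' O.joint O.c-circulant (λ x x' → proj₁ (extension x x')) u k₁ u-grp n-grp b'
          (Quot X u k₁) separable₁ S₁.quot⇒ S₁.quot⇐)
        where
        convert : (∃ λ (Γ : ℤ → Fin n') → (∀ z z' → ∃ λ t → c' (Γ z) (Γ z') ≡ D (+ u * (z' - z) + + (k₁ ℕ.* u) * t)) × (∀ x → E' u b' x → ∃ λ z → E' (k₁ ℕ.* u) (Γ z) x)) → Iso₁ b'
        convert (Γ , Γ-col , Γ-cover) = record { g = Γ ; g-col = λ z z' → flat z z' (Γ-col z z') ; g-cover = λ x e → point x (Γ-cover x e) }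
          where
          flat : ∀ z z' → (∃ λ t → c' (Γ z) (Γ z') ≡ D (+ u * (z' - z) + + (k₁ ℕ.* u) * t)) → c' (Γ z) (Γ z') ≡ D (+ u * (z' - z))
          flat z z' (t , e) = trans e (drop-n (+ u * (z' - z)) t)
          point : ∀ x → (∃ λ z → E' (k₁ ℕ.* u) (Γ z) x) → ∃ λ z → Γ z ≡ x
          point x (z , in-class t e) = z , diagonal O.joint false true (pt (+ 0)) (Γ z) x (sym (trans e (trans (cong D (sym (ℤₚ.+-identityˡ (+ (k₁ ℕ.* u) * t)))) (drop-n (+ 0) t))))

      iso₀ : Fin n' → Iso₀
      iso₀ b' = convert (sectionIso n (_≟ᶜ_ X') O.c c' O.joint O.c-circulant (λ x x' → proj₁ (extension x x')) 1 l O.group-1 l*1-grp b'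
          (Quot X 1 l) separable₀ S₀.quot⇒ S₀.quot⇐)
        where
        convert : (∃ λ (Γ : ℤ → Fin n') → (∀ z z' → ∃ λ t → c' (Γ z) (Γ z') ≡ D (+ 1 * (z' - z) + + (l ℕ.* 1) * t)) × (∀ x → E' 1 b' x → ∃ λ z → E' (l ℕ.* 1) (Γ z) x)) → Iso₀
        convert (Γ , Γ-col , Γ-cover) = record { F = Γ ; F-col = λ z z' → flat z z' (Γ-col z z') ; F-cover = λ x → reindexed (Γ-cover x (everything x (c'-D b' x))) }
          where
          flat : ∀ z z' → (∃ λ t → c' (Γ z) (Γ z') ≡ D (+ 1 * (z' - z) + + (l ℕ.* 1) * t)) → ∃ λ t → c' (Γ z) (Γ z') ≡ D ((z' - z) + + l * t)
          flat z z' (t , e) = t , trans e (cong D (cong₂ _+_ (ℤₚ.*-identityˡ (z' - z)) (cong (_* t) l*1)))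
          everything : ∀ x → (∃ λ w → c' b' x ≡ D w) → E' 1 b' x
          everything x (w , e) = E'-intro {w = w} e (divides w (sym (ℤₚ.*-identityʳ w)))
          reindexed : ∀ {x} → (∃ λ z → E' (l ℕ.* 1) (Γ z) x) → ∃ λ z → E' l (Γ z) x
          reindexed {x} (z , e) = z , subst (λ m → E' m (Γ z) x) (ℕₚ.*-identityʳ l) e

      -- Shifting `F₀` by `b` brings the coset through `b` to U itself, where `At.lifted` applies.
      liftThrough : ∀ (F₀ : Iso₀) b b'' → E' l (Iso₀.F F₀ b) b'' → Σ (Lift F₀ b) λ L → Lift.g L (+ 0) ≡ b''
      liftThrough F₀ b b'' e = convert (WreathPair.Groups.Lifting.At.lifted n (_≟ᶜ_ X') O.c (col X') O.joint O.c-circulant u u' k' k'' k₁ q k₁u≡n u≡ u-grp (O.group gu') l-grp (O.group gl') (ℕ∣⇒∣ u∣l) (ℕ∣⇒∣ l∣l')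
        ns ms auto₀ auto₁ extension iso₁ (Iso₀.shifted F₀ b) b'' (subst (λ z → E' l (Iso₀.F F₀ z) b'') (sym (ℤₚ.+-identityʳ b)) e))
        where
        convert : (∃ λ g → (∀ z z' → c' (g z) (g z') ≡ D (+ u * (z' - z))) × (g (+ 0) ≡ b'') × (∀ i → E' l (Iso₀.F F₀ (b + + u * i)) (g i))) → Σ (Lift F₀ b) λ L → Lift.g L (+ 0) ≡ b''
        convert (g , g-col , g0 , over) = record { g = g ; g-col = g-col ; over = over } , g0

      defaultLift : ∀ (F₀ : Iso₀) (b : Fin u) → Lift F₀ (ι b)
      defaultLift F₀ b = proj₁ (liftThrough F₀ (ι b) (Iso₀.F F₀ (ι b)) (E'-refl l-grp (Iso₀.F F₀ (ι b))))

      -- A matching over one loop is a bijection of the two point sets.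
      n'≤n : n' ℕ.≤ n
      n'≤n = bound (matching O.joint true false)
        where
        bound : (∀ a b x y → c' a b ≡ O.c x y → Σ (Fin n' ↔ Fin n) λ σ → ∀ δ → (c' a δ ≡ O.c x (to σ δ)) × (c' δ b ≡ O.c (to σ δ) y)) → n' ℕ.≤ n
        bound mt = cardinal (realised O.joint false true (pt (+ 0)) (pt (+ 0)))
          where
          cardinal : (∃₂ λ a b → O.c (pt (+ 0)) (pt (+ 0)) ≡ c' a b) → n' ℕ.≤ n
          cardinal (a , b , e) = Finₚ.injective⇒≤ {f = to σ} (λ {x} {y} f → trans (sym (from-to σ x)) (trans (cong (from σ) f) (from-to σ y)))
            where
            σ = proj₁ (mt a b (pt (+ 0)) (pt (+ 0)) (sym e))

      module Glued (F₀ : Iso₀) (lift : ∀ (b : Fin u) → Lift F₀ (ι b)) where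

        open WreathPair.Groups.Gluing n (_≟ᶜ_ X') O.c (col X') O.joint O.c-circulant u u' k' k'' k₁ q k₁u≡n u≡ u-grp (O.group gu') l-grp (O.group gl') (ℕ∣⇒∣ u∣l) (ℕ∣⇒∣ l∣l')
          (O.wreath (proj₁ gu) (proj₁ gl) u-grp wr) F₀ lift using (f; glued; f-injective)

        bijection : Σ (Fin n ↔ Fin n') λ σ → ∀ x → to σ x ≡ f x
        bijection = injective⇒↔ n'≤n f f-injective

        isomorphism : Iso X X' φ
        isomorphism = proj₁ bijection , λ a b → trans (cong₂ c' (proj₂ bijection a) (proj₂ bijection b)) (glued a b)

      separated : Iso X X' φ
      separated = through (IsAlgIso.into iso (resid n (+ 0)) (resid n (+ 0)))
        where
        through : (∃₂ λ a' b' → c' a' b' ≡ φ (col X (resid n (+ 0)) (resid n (+ 0)))) → Iso X X' φ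
        through (b' , _) = Glued.isomorphism (iso₀ b') (defaultLift (iso₀ b'))

      -- X' is coordinatised by P, for instance through an isomorphism from X.
      module Transitive (P : ℤ → Fin n') (P-col : ∀ x y → c' (P x) (P y) ≡ D (y - x))
        (P-cong : ∀ {x y} → x ≈ y [ + n ] → P x ≡ P y) (P-onto : ∀ x → ∃ λ y → P y ≡ x) where

        private
          scaled : ∀ {k m x y} → k ℕ.* u ≡ m → x ≈ y [ + k ] → + u * x ≈ + u * y [ + m ]
          scaled {k} {m} {x} {y} ku≡m (mod (divides r e)) = mod (divides r
            (trans (u*a-u*b≡u*[a-b] (+ u) x y) (trans (cong (+ u *_) e) (trans (H*[q*p]≡q*[p*H] (+ u) r (+ k)) (cong (r *_) (trans (sym (ℤₚ.pos-* k u)) (cong +_ ku≡m)))))))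

        module Carry (a : Fin n) (a' : ℤ) {z z' : ℤ} (auto : Auto₀ z z') where

          open Auto₀ auto

          -- The coordinates `P` composed with an automorphism of `X_{G/L}`, centred so that the
          -- class of `a` goes to that of `P a'`.
          F : ℤ → Fin n'
          F y = P (a' + h (y - ι a))

          F-at : ∀ y x → x - a' ≈ h (y - ι a) [ + l ] → E' l (F y) (P x)
          F-at y x (mod e) = E'-intro {w = x - (a' + h (y - ι a))} (P-col (a' + h (y - ι a)) x) (lin₁ e (+ 1) (x-[a+h]≡1*[x-a-h] x a' (h (y - ι a))))

          F-col : ∀ y y' → ∃ λ t → c' (F y) (F y') ≡ D ((y' - y) + + l * t)
          F-col y y' = combined (preserves (y - ι a) (y' - ι a))
            where
            Y : ℤ
            Y = h (y' - ι a) - h (y - ι a)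
            result : (∃ λ t → D Y ≡ D ((y' - y) + + l * t)) → ∃ λ t → c' (F y) (F y') ≡ D ((y' - y) + + l * t)
            result (t , e) = t , trans (P-col (a' + h (y - ι a)) (a' + h (y' - ι a))) (trans (cong D ([z+b]-[z+a]≡b-a a' (h (y - ι a)) (h (y' - ι a)))) e)
            combined : (∃ λ s → D ((y' - ι a) - (y - ι a)) ≡ D (Y + + l * s)) → ∃ λ t → c' (F y) (F y') ≡ D ((y' - y) + + l * t)
            combined (s , e) = result (N.∼-shift {Y} {y' - y} {s} {+ 0} (trans (sym e) (cong D (trans ([x'-s]-[x-s]≡x'-x y y' (ι a)) (x≡x+l*0 (y' - y) (+ l))))))

          F-cover : ∀ x → ∃ λ y → E' l (F y) x
          F-cover x = reached (P-onto x)
            where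
            reached : (∃ λ y → P y ≡ x) → ∃ λ y → E' l (F y) x
            reached (y , e) = ι a + h⁻ (y - a') , subst (E' l (F (ι a + h⁻ (y - a')))) e (F-at (ι a + h⁻ (y - a')) y
              (≈-sym (≈-trans (≈-reflexive (cong h (a+x-a≡x (ι a) (h⁻ (y - a'))))) (inverse (y - a')))))

          F₀ : Iso₀
          F₀ = record { F = F ; F-col = F-col ; F-cover = F-cover }

          F-base : E' l (F (ι a)) (P a')
          F-base = F-at (ι a) a' (≈-trans (≈-reflexive (ℤₚ.+-inverseʳ a')) (≈-sym (≈-trans (≈-reflexive (cong h (ℤₚ.+-inverseʳ (ι a)))) (∣⇒≈0 fixes))))

        Carried : Fin n → Fin n → ℤ → ℤ → Set
        Carried a b a' b' = Σ (Iso X X' φ) λ σ → (to (proj₁ σ) a ≡ P a') × (to (proj₁ σ) b ≡ P b')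

        carried : ∀ (F₀ : Iso₀) (lift : ∀ (b : Fin u) → Lift F₀ (ι b)) {a b a' b'} →
          Lift.g (lift (coset a)) (index a) ≡ P a' → Lift.g (lift (coset b)) (index b) ≡ P b' → Carried a b a' b'
        carried F₀ lift {a} {b} ea eb = G.isomorphism , trans (proj₂ G.bijection a) ea , trans (proj₂ G.bijection b) eb
          where module G = Glued F₀ lift

        module Across (a b : Fin n) (a' b' : ℤ) (auto : Auto₀ (ι b - ι a) (b' - a')) (¬d : ¬ (+ u ∣ (ι b - ι a))) where

          open Carry a a' auto

          result : Carried a b a' b'
          result = built (liftThrough F₀ (ι a) (P a') F-base)
            (liftThrough F₀ (ι b) (P b') (F-at (ι b) b' (≈-sym (Auto₀.maps auto))))
            where
            distinct : ¬ coset a ≡ coset b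
            distinct f = ¬d (div (≈-sym (resid-≈ u {ι a} {ι b} f)))
            built : (Σ (Lift F₀ (ι a)) λ L → Lift.g L (+ 0) ≡ P a') → (Σ (Lift F₀ (ι b)) λ L → Lift.g L (+ 0) ≡ P b') → Carried a b a' b'
            built (La , ea) (Lb , eb) = carried F₀ Ob.override
              (trans (Ob.override-off (coset a) distinct (index a)) (trans (Oa.override-at (coset a) refl (index a)) (trans (cong (Lift.g La) (ℤₚ.+-inverseʳ (index a))) ea)))
              (trans (Ob.override-at (coset b) refl (index b)) (trans (cong (Lift.g Lb) (ℤₚ.+-inverseʳ (index b))) eb))
              where
              module Oa = Override (defaultLift F₀) a La
              module Ob = Override Oa.override b Lb

        module Along (a b : Fin n) (a' b' : ℤ) (r : ℤ) (same-coset : coset b ≡ coset a) (r-eq : b' - a' ≡ r * + u) (auto : Auto₁ (index b - index a) r) where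

          open Auto₁ auto using () renaming (h to h₁; preserves to preserves₁; fixes to fixes₁; maps to maps₁)

          -- The slope of `h₁`. An automorphism of `X_{G/L}` sends `u` to `u * m` as well, which
          -- gives `F₀` and the lift `g` the same slope on U.
          m : ℤ
          m = h₁ (+ 1) - h₁ (+ 0)

          slope : ∃ λ t → D (+ u) ≡ D (+ u * m + + l * t)
          slope = + 0 , trans (cong D (u≡u*[1-0] (+ u))) (trans (preserves₁ (+ 0) (+ 1)) (cong D (x≡x+l*0 (+ u * m) (+ l))))

          module With (auto' : Auto₀ (+ u) (+ u * m)) where

            open Carry a a' auto'
            open Auto₀ auto' using (h; maps)

            h-U : ∀ i → h (+ u * i) ≈ + u * m * i [ + l ]
            h-U i = ≈-trans (≈-reflexive (cong h (trans (cong (_* i) u-factor) (ℤₚ.*-assoc (+ u') (+ q) i))))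
              (≈-trans (Restrict.linear-U auto' ns i) (≈-* (≈-trans (≈-reflexive (cong h (sym u-factor))) maps) (≈-refl i)))
              where
              u-factor : + u ≡ + u' * + q
              u-factor = trans (cong +_ u≡) (ℤₚ.pos-* u' q)

            -- Normality of U/L' makes `h₁` linear modulo `k''` only. After multiplication by `u`
            -- this holds modulo `l'`, hence modulo its divisor `l`.
            h₁-linear : ∀ i → + u * h₁ i ≈ + u * m * i [ + l ]
            h₁-linear i = ≈-trans (≈-weaken (ℕ∣⇒∣ l∣l') (scaled refl (≈-trans (M.NormalSchurian.linear ms h₁ preserving zero₁ i) (≈-* slope₁ (≈-refl i)))))
              (≈-reflexive (sym (ℤₚ.*-assoc (+ u) m i)))
              where
              preserving : M.Preserves h₁
              preserving x y = M.same (+ 0) (trans (preserves₁ x y) (cong D (x≡x+l*0 (+ u * (h₁ y - h₁ x)) (+ l'))))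
              zero₁ : h₁ (+ 0) ≈ + 0 [ + k'' ]
              zero₁ = ≈-weaken k''∣k₁ fixes₁
              slope₁ : h₁ (+ 1) ≈ m [ + k'' ]
              slope₁ = ≈-trans (≈-reflexive (sym (ℤₚ.+-identityʳ (h₁ (+ 1))))) (≈-- (≈-refl (h₁ (+ 1))) (≈-sym zero₁))

            g : ℤ → Fin n'
            g i = P (a' + + u * h₁ i)

            lift : Lift F₀ (ι a)
            lift = record { g = g ; g-col = g-col ; over = over }
              where
              g-col : ∀ z z' → c' (g z) (g z') ≡ D (+ u * (z' - z))
              g-col z z' = trans (P-col (a' + + u * h₁ z) (a' + + u * h₁ z')) (trans (cong D ([a+u*y]-[a+u*x]≡u*[y-x] a' (+ u) (h₁ z) (h₁ z'))) (sym (preserves₁ z z')))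
              over : ∀ i → E' l (F (ι a + + u * i)) (g i)
              over i = F-at (ι a + + u * i) (a' + + u * h₁ i)
                (≈-trans (≈-reflexive (a+x-a≡x a' (+ u * h₁ i))) (≈-trans (h₁-linear i) (≈-sym (≈-trans (≈-reflexive (cong h (a+x-a≡x (ι a) (+ u * i)))) (h-U i)))))

            g-zero : g (+ 0) ≡ P a'
            g-zero = P-cong (≈-trans (≈-+ (≈-refl (a')) (scaled k₁u≡n fixes₁)) (≈-reflexive (sym (x≡x+l*0 (a') (+ u)))))

            g-end : g (index b - index a) ≡ P b'
            g-end = P-cong (≈-trans (≈-+ (≈-refl (a')) (scaled k₁u≡n maps₁))
              (≈-reflexive (trans (cong (λ y → a' + y) (trans (ℤₚ.*-comm (+ u) r) (sym r-eq))) (x+[y-x]≡y a' (b')))))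

            result : Carried a b a' b'
            result = carried F₀ Ov.override
              (trans (Ov.override-at (coset a) refl (index a)) (trans (cong g (ℤₚ.+-inverseʳ (index a))) g-zero))
              (trans (Ov.override-at (coset b) same-coset (index b)) g-end)
              where module Ov = Override (defaultLift F₀) a lift

          result : Carried a b a' b'
          result = With.result (auto₀ {+ u} {+ u * m} slope)

        transitive : ∀ a b a' b' → D (ι b - ι a) ≡ D (b' - a') → Carried a b a' b'
        transitive a b a' b' e = decide (+ u ∣? (ι b - ι a))
          where
          inside : coset b ≡ coset a → + u ∣ (b' - a') → Carried a b a' b'
          inside f (divides r r-eq) = Along.result a b a' b' r f r-eq (auto₁ {index b - index a} {r}
            (trans (cong D (sym difference)) (trans e (cong D (trans r-eq (ℤₚ.*-comm r (+ u)))))))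
            where
            difference : ι b - ι a ≡ + u * (index b - index a)
            difference = trans (cong₂ _-_ (trans (split b) (cong (λ y → ι y + + u * index b) f)) (split a)) ([a+u*y]-[a+u*x]≡u*[y-x] (ι (coset a)) (+ u) (index a) (index b))
          decide : Dec (+ u ∣ (ι b - ι a)) → Carried a b a' b'
          decide (yes d) = inside (resid-cong u (mod d)) (proj₂ u-grp e d)
          decide (no ¬d) = Across.result a b a' b' (auto₀ {ι b - ι a} {b' - a'} (+ 0 , trans e (cong D (x≡x+l*0 (b' - a') (+ l))))) ¬d

    sesquiseparable : Sesquiseparable X
    sesquiseparable X' cc' φ iso closed = Onto.separated X' cc' φ iso closed

    identityIso : IsAlgIso X X (λ r → r)
    identityIso = record
      { into = λ a b → a , b , refl
      ; onto = λ a b → a , b , refl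
      ; inj = λ _ _ _ _ e → e
      ; preserve = λ a b a' b' e p q r s → IsCC.intersect (proj₁ scheme) a b a' b' (sym e) (col X p q) (col X r s) }

    schurian : SesquiclosedMap X X (λ r → r) → Schurian X
    schurian closed a b a' b' e = repack (Onto.Transitive.transitive X (proj₁ scheme) (λ r → r) identityIso closed (resid n)
        (Pair.c-pt n (_≟ᶜ_ X) (col X) (col X) O.joint O.c-circulant) (resid-cong n) (λ x → ι x , resid-ι x) a b (ι a') (ι b')
        (trans (sym (O.c-circulant a b)) (trans e (O.c-circulant a' b'))))
      where
      module O = Circulants.Over n X scheme circ X (proj₁ scheme) (λ r → r) identityIso using (joint; c-circulant)
      repack : (Σ (Iso X X (λ r → r)) λ σ → (to (proj₁ σ) a ≡ resid n (ι a')) × (to (proj₁ σ) b ≡ resid n (ι b'))) →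
        Σ (Fin n ↔ Fin n) λ σ → IsAut X σ × (to σ a ≡ a') × (to σ b ≡ b')
      repack ((σ , aut) , ea , eb) = σ , aut , trans ea (resid-ι a') , trans eb (resid-ι b')

-- Unpacking the hypotheses: nonzero indices and a common form of the modulus of L.

open import Defs
open import Data.Nat using (ℕ; _*_; _<_)
open import Data.Nat.Divisibility using (_∣_)
open import Data.Product using (Σ; _×_)
open import Relation.Binary.PropositionalEquality using (_≡_)

open import Data.Nat using (suc; zero; NonZero; >-nonZero)
open import Data.Nat.Divisibility using (divides; n∣m*n; 0∣⇒≡0)
open import Data.Nat.Properties using (*-comm; m*n≢0⇒m≢0)
open import Data.Product using (_,_; proj₁)
open import Relation.Binary.PropositionalEquality using (refl; sym; trans; subst)
open WreathProduct using (module Wreathed)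

divisor-nonZero : ∀ {m n} → m ∣ n → NonZero n → NonZero m
divisor-nonZero {suc m} _   _  = _
divisor-nonZero {zero}  m∣n nz = subst NonZero (0∣⇒≡0 m∣n) nz

-- The modulus of L is a variable here, so its equation with `k' * u'` can be matched away; two
-- products could not be unified directly.
assembled : ∀ {n} → 0 < n → (X : Config n) → IsScheme X → Circulant X → Sesquiclosed X →
  ∀ u l k' u' k'' k₁ → u ∣ l → k' * u' ≡ l → u' ∣ u → l ∣ k'' * u → k₁ * u ≡ n →
  XGroup X u → XGroup X u' → XGroup X l → XGroup X (k'' * u) → IsWreath X u l →
  Normal (Quot X u' k') → Normal (Quot X u k'') →
  Schurian (Quot X 1 l) → Sesquiseparable (Quot X 1 l) → Schurian (Quot X u k₁) → Sesquiseparable (Quot X u k₁) →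
  Schurian X × Sesquiseparable X
assembled {n} 0<n X scheme circ (fibres , closed) u _ k' u' k'' k₁ u∣l refl (divides q u≡) l∣l' k₁u≡n gu gu' gl gl' wr normalN normalM sch₀ sep₀ sch₁ sep₁ =
  W.schurian closed , W.sesquiseparable
  where
  n≢0 = >-nonZero 0<n
  l≢0 = divisor-nonZero (proj₁ gl) n≢0
  l'≢0 = divisor-nonZero (proj₁ gl') n≢0
  k₁u≢0 = subst NonZero (sym k₁u≡n) n≢0
  module W = Wreathed n {{n≢0}} X scheme circ fibres u u' k' k'' k₁ q
    {{divisor-nonZero (proj₁ gu) n≢0}} {{divisor-nonZero (proj₁ gu') n≢0}} {{m*n≢0⇒m≢0 k' {{l≢0}}}} {{m*n≢0⇒m≢0 k'' {{l'≢0}}}}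
    {{m*n≢0⇒m≢0 k₁ {{k₁u≢0}}}} {{l≢0}}
    k₁u≡n (trans u≡ (*-comm q u')) gu gu' gl gl' u∣l l∣l' wr normalN normalM sch₀ sep₀ sch₁ sep₁
      using (schurian; sesquiseparable)

theorem6p4 : (n : ℕ) → 0 < n → (X : Config n) →
    IsScheme X → Circulant X → Sesquiclosed X →
    (u k : ℕ) → XGroup X u → XGroup X (k * u) →
    IsWreath X u (k * u) →
    Σ ℕ (λ u' → Σ ℕ (λ k' →
    (u' ∣ u) × (k' * u' ≡ k * u) × XGroup X u' × Normal (Quot X u' k'))) →
    Σ ℕ (λ l' → Σ ℕ (λ k'' →
    ((k * u) ∣ l') × (k'' * u ≡ l') × XGroup X l' × Normal (Quot X u k''))) →
    Schurian (Quot X 1 (k * u)) → Sesquiseparable (Quot X 1 (k * u)) →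
    (k₁ : ℕ) → k₁ * u ≡ n →
    Schurian (Quot X u k₁) → Sesquiseparable (Quot X u k₁) →
    Schurian X × Sesquiseparable X
theorem6p4 n 0<n X scheme circ closed u k gu gl wr (u' , k' , u'∣u , k'u'≡l , gu' , normalN) (_ , k'' , l∣l' , refl , gl' , normalM)
  sch₀ sep₀ k₁ k₁u≡n sch₁ sep₁ =
  assembled 0<n X scheme circ closed u (k * u) k' u' k'' k₁ (n∣m*n k) k'u'≡l u'∣u l∣l' k₁u≡n gu gu' gl gl' wr normalN normalM sch₀ sep₀ sch₁ sep₁
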